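{- With $Q:=q^{13}$, the following hold: $$2q^2E(q^2)E(Q^6)U(1,39,q)U(1,39,-q)=(1,1,10)+(2,1,5)-(1,0,39)-(5,2,8),$$ $$2q^2E(q^6)E(Q^2)U(3,13,q)U(3,13,-q)=(3,0,13)+(2,1,5)-(3,3,4)-(5,2,8),$$ $$\frac{(3,0,13)-(5,2,8)}{(1,0,39)+(5,2,8)}=q^3\frac{\psi(-q)\psi(-Q^3)}{\psi(-q^3)\psi(-Q)},$$ $$\frac{(1,1,10)+(2,1,5)-(1,0,39)-(5,2,8)}{(3,0,13)+(2,1,5)-(3,3,4)-(5,2,8)}=\frac{\varphi(-q^6)\varphi(-Q^2)}{\varphi(-q^2)\varphi(-Q^6)}.$$
   Context: Let $|q|<1$, $(a;q)_\infty=\prod_{k\ge0}(1-aq^k)$, $(a;q)_n=\prod_{k=0}^{n-1}(1-aq^k)$. $G(q)=\sum_{n\ge0}\frac{q^{n^2}}{(q;q)_n}$, $H(q)=\sum_{n\ge0}\frac{q^{n(n+1)}}{(q;q)_n}$. For positive integers $r,s$, $U(r,s,q)$ is defined by $U(r,s,q)=G(q^r)G(q^s)+q^{(s+r)/5}H(q^r)H(q^s)$ if $s+r\equiv0\pmod5$ and $U(r,s,q)=H(q^r)G(q^s)-q^{(s-r)/5}G(q^r)H(q^s)$ if $s-r\equiv0\pmod5$; $U(r,s,x)$ denotes this expression with $q$ replaced by $x$ (e.g. $x=-q$). $E(q)=(q;q)_\infty$, $\varphi(q)=\sum_{n\in\mathbb Z}q^{n^2}$, $\psi(q)=\sum_{n\ge0}q^{n(n+1)/2}$.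 For integers $a,b,c$ with $a,c>0$, $b^2-4ac<0$, the symbol $(a,b,c)$ denotes the theta series $\sum_{n,m=-\infty}^{\infty}q^{an^2+bnm+cm^2}$. -}

module Defs where

open import Data.Nat as ℕ using (ℕ; zero; suc; NonZero; _∸_; _≤?_)
open import Data.Nat.DivMod using (_/_; _%_)
open import Data.Integer as ℤ using (ℤ; +_; 0ℤ; 1ℤ; _+_; _-_; _*_; -_)
open import Relation.Nullary using (yes; no)

-- Formal power series in q with integer coefficients: n ↦ [q^n] f.
PS : Set
PS = ℕ → ℤ

sumTo : ℕ → (ℕ → ℤ) → ℤ
sumTo zero    f = f 0
sumTo (suc n) f = sumTo n f + f (suc n)

infixl 6 _⊕_ _⊖_
infixl 7 _⊛_

_⊕_ : PS → PS → PS
(f ⊕ g) n = f n + g n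

_⊖_ : PS → PS → PS
(f ⊖ g) n = f n - g n

_⊛_ : PS → PS → PS
(f ⊛ g) n = sumTo n (λ i → f i * g (n ∸ i))

sc : ℤ → PS → PS
sc c f n = c * f n

one : PS
one zero    = 1ℤ
one (suc _) = 0ℤ

sh : ℕ → PS → PS
sh k f n with k ≤? n
... | yes _ = f (n ∸ k)
... | no  _ = 0ℤ

dil : (k : ℕ) → .{{_ : NonZero k}} → PS → PS
dil k f n with n % k
... | zero  = f (n / k)
... | suc _ = 0ℤ

negq : PS → PS
negq f n with n ℕ.% 2
... | zero  = f n
... | suc _ = - f n

prodTo : ℕ → (ℕ → PS) → PS
prodTo zero    F = one
prodTo (suc n) F = prodTo n F ⊛ F n

-- 1/(1-q^(j+1)) = Σ_m q^{(j+1)m}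
geomS : ℕ → PS
geomS j = dil (suc j) (λ _ → 1ℤ)

-- E(q) = (q;q)_∞ ; its q^n coefficient only depends on the factors (1-q^k), k ≤ n
E : PS
E n = prodTo n (λ j → one ⊖ sh (suc j) one) n

invPoch : ℕ → PS
invPoch n = prodTo n geomS

-- G(q) = Σ_n q^{n²}/(q;q)_n ; terms with n > N do not contribute to [q^N]
G : PS
G N = sumTo N (λ n → sh (n ℕ.* n) (invPoch n) N)

H : PS
H N = sumTo N (λ n → sh (n ℕ.* suc n) (invPoch n) N)

ind : ℤ → ℤ → ℤ
ind x y with x ℤ.≟ y
... | yes _ = 1ℤ
... | no  _ = 0ℤ

sumZ : ℕ → (ℤ → ℤ) → ℤ
sumZ B f = sumTo (B ℕ.+ B) (λ i → f (+ i - + B))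

-- theta series (a,b,c) = Σ_{n,m ∈ ℤ} q^{an²+bnm+cm²}, for a,c>0, b²<4ac.
-- [q^N] = #{(n,m) ∈ ℤ² : an²+bnm+cm² = N}; positive definiteness gives
-- n² ≤ 4cN and m² ≤ 4aN, so |n|,|m| ≤ 4(a+c)N covers all solutions.
theta : ℕ → ℕ → ℕ → PS
theta a b c N =
  sumZ (4 ℕ.* (a ℕ.+ c) ℕ.* N) λ n →
  sumZ (4 ℕ.* (a ℕ.+ c) ℕ.* N) λ m →
  ind (+ a * n * n + + b * n * m + + c * m * m) (+ N)

phi : PS
phi N = sumZ N (λ n → ind (n * n) (+ N))

-- ψ(q) = Σ_{n≥0} q^{n(n+1)/2}  ([q^N] counts n ≥ 0 with n(n+1) = 2N; such n ≤ N)
psi : PS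
psi N = sumTo N (λ n → ind (+ (n ℕ.* suc n)) (+ (2 ℕ.* N)))

-- U(1,39,q) = G(q)G(q^39) + q^{(39+1)/5} H(q)H(q^39)   (case 39+1 ≡ 0 mod 5)
U1-39 : PS
U1-39 = G ⊛ dil 39 G ⊕ sh 8 (H ⊛ dil 39 H)

-- U(3,13,q) = H(q^3)G(q^13) - q^{(13-3)/5} G(q^3)H(q^13)   (case 13-3 ≡ 0 mod 5)
U3-13 : PS
U3-13 = dil 3 H ⊛ dil 13 G ⊖ sh 2 (dil 3 G ⊛ dil 13 H)

{-# OPTIONS --safe #-}

-- Write x⁻ and xₖ for x(-q) and x(q^k). A theta series Σ q^P(n,m) over ℤ², P a positive definite quadratic polynomial,
-- is unchanged by splitting ℤ² into cosets of a sublattice and by affine automorphisms of ℤ², and the product of two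
-- one-variable theta series is such a series. These rules prove every identity below between products of two theta
-- functions whose quadratic forms belong to the same imaginary quadratic field, once both sides are expressed by the
-- Rogers–Ramanujan identities E G = f₂ := f(-q²,-q³), E H = f₁ := f(-q,-q⁴). In particular
-- E E₃₉ U(1,39) = E₃ E₁₃ U(3,13).
--
-- Jacobi's triple product gives E₂ G G⁻ = Σ q^(5n²+n), E₂ H H⁻ = Σ q^(5n²+3n), E₂ G H₄ = Σ q^(5n²+4n),
-- E₂ H G₄ = Σ q^(5n²+2n), E E⁻ = E₂ φ(-q²) and E E₄ = E₂ ψ(-q). The sum of Z = E₂ G H⁻ and W = E₂ H G⁻ is
-- 2ψ(q²) and their product is E₂ G G⁻ E₂ H H⁻, so that Z - W = 2q ψ(q¹⁰); likewise E₂ G G₄ ± q E₂ H H₄ are φ(q) and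
-- φ(q⁵). Multiplying out, E₂ E₇₈ U U⁻ and E₂ E₇₈ U U₄, where U = U(1,39), become sums of products of two theta
-- functions, hence combinations of the forms (a,b,c); similarly for U(3,13). The first two identities are the
-- results for U U⁻; the fourth follows from them and the third from those for U U₄, because replacing
-- E E₃₉ U(1,39) by E₃ E₁₃ U(3,13) (at q and at -q, or at q and at q⁴) turns one side into the other.

module Submission where

open import Defs
open import Data.Nat as ℕ using (ℕ; zero; suc; NonZero; z≤n; s≤s; _≤?_)
import Data.Nat.Properties as ℕ
import Data.Nat.Tactic.RingSolver as ℕ-Solver
open import Data.Nat.DivMod using (_/_; _%_; m≡m%n+[m/n]*n; m*n%n≡0; m*n/n≡m; [m+kn]%n≡m%n)
open import Data.Nat.Divisibility using (m%n≡0⇒n∣m; n∣m⇒m%n≡0; *-cancelʳ-∣; 1∣_)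
open import Data.Integer as ℤ using (ℤ; +_; 0ℤ; 1ℤ; -1ℤ; _+_; _-_; _*_; -_; ∣_∣)
import Data.Integer.Properties as ℤ
open import Data.Integer.DivMod using (_/ℕ_; a≡a%ℕn+[a/ℕn]*n; n%ℕd<d)
open import Data.Integer.Tactic.RingSolver using (solve-∀)
open import Data.Fin as Fin using (Fin; zero; suc; toℕ; fromℕ<)
import Data.Fin.Properties as Fin
open import Data.List using (List; []; _∷_; _++_; map; filter; foldr; downFrom; cartesianProduct; concatMap; tabulate; length; lookup)
open import Data.List.Membership.Propositional using (_∈_)
open import Data.List.Membership.Propositional.Properties using (∈-filter⁺; ∈-filter⁻; ∈-map⁺; ∈-map⁻; ∈-++⁺ˡ; ∈-++⁺ʳ; ∈-downFrom⁺; ∈-cartesianProduct⁺)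
open import Data.List.Membership.Propositional.Properties.WithK using (unique∧set⇒bag)
open import Data.List.Relation.Unary.All as All using (All; []; _∷_)
open import Data.List.Relation.Unary.AllPairs using ([]; _∷_)
open import Data.List.Relation.Unary.Unique.Propositional using (Unique)
import Data.List.Relation.Unary.Unique.Propositional.Properties as Unique
open import Data.List.Relation.Binary.BagAndSetEquality using (∼bag⇒↭)
open import Data.List.Relation.Binary.Permutation.Propositional as Perm using (_↭_)
open import Data.Maybe using (Maybe; just; nothing)
open import Data.Product using (_×_; _,_; proj₁; proj₂)
open import Data.Sum using (inj₁; inj₂)
open import Data.Empty using (⊥-elim)
open import Data.Unit using (⊤; tt)
open import Function using (_∘_; mk⇔)
open import Level using (0ℓ)
open import Algebra.Bundles using (CommutativeRing)
open import Algebra.Structures using (IsCommutativeRing)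
open import Algebra.Properties.AbelianGroup ℤ.+-0-abelianGroup using () renaming (∙-cancelʳ to +-cancelʳ-≡)
open import Algebra.Solver.Ring.AlmostCommutativeRing using (fromCommutativeRing; _-Raw-AlmostCommutative⟶_)
import Algebra.Solver.Ring as RingSolver
open import Relation.Nullary using (yes; no; ¬_; ¬?)
open import Relation.Nullary.Decidable using (True; Dec; toWitness; _×-dec_; map′)
open import Relation.Binary.Definitions using (tri<; tri≈; tri>)
open import Relation.Binary.PropositionalEquality
import Relation.Binary.Reasoning.Setoid as SetoidReasoning

-- Coset splittings and isometries never leave the imaginary quadratic field of a form, and this
-- shapes the proof. In f₂f₂(q⁴) ± q f₁f₁(q⁴) and in f₂f₁(-q) ± f₁f₂(-q) all forms belong to ℚ(i).
-- The value expected of the first sum, φ(q)ψ(-q), lies over ℚ(√-2); it is rewritten as ψ(q)φ(-q²),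
-- over ℚ(i), before the two sides are compared, and the second sum is treated in the same way at
-- q². The differences are ψ(-q)φ(q⁵) and 2q φ(-q²)ψ(q¹⁰), over ℚ(√-10), and these rules cannot
-- reach them. After common factors are cancelled, however, the squares of the differences become
-- φ(q⁵)² and 4q²ψ(q¹⁰)², again over ℚ(i); since power series form an integral domain, a single
-- coefficient then selects the root. The relation between U(1,39) and U(3,13) and all identities
-- for the forms (a,b,c) belong to ℚ(√-39).
--
-- Series are never divided: quotients appear cross-multiplied, and common factors are cancelled by
-- means of their leading coefficients.

sumTo-cong≤ : ∀ n {f g : ℕ → ℤ} → (∀ i → i ℕ.≤ n → f i ≡ g i) → sumTo n f ≡ sumTo n g
sumTo-cong≤ zero    e = e 0 z≤n
sumTo-cong≤ (suc n) e = cong₂ _+_ (sumTo-cong≤ n (λ i i≤n → e i (ℕ.m≤n⇒m≤1+n i≤n))) (e (suc n) ℕ.≤-refl)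

sumTo-cong : ∀ n {f g : ℕ → ℤ} → f ≗ g → sumTo n f ≡ sumTo n g
sumTo-cong n e = sumTo-cong≤ n (λ i _ → e i)

sumTo-zero≤ : ∀ n {f : ℕ → ℤ} → (∀ i → i ℕ.≤ n → f i ≡ 0ℤ) → sumTo n f ≡ 0ℤ
sumTo-zero≤ zero    e = e 0 z≤n
sumTo-zero≤ (suc n) e = cong₂ _+_ (sumTo-zero≤ n (λ i i≤n → e i (ℕ.m≤n⇒m≤1+n i≤n))) (e (suc n) ℕ.≤-refl)

sumTo-+ : ∀ n (f g : ℕ → ℤ) → sumTo n (λ i → f i + g i) ≡ sumTo n f + sumTo n g
sumTo-+ zero    f g = refl
sumTo-+ (suc n) f g = trans (cong (_+ (f (suc n) + g (suc n))) (sumTo-+ n f g)) (lem (sumTo n f) (sumTo n g) (f (suc n)) (g (suc n)))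
  where
  lem : ∀ a b c d → (a + b) + (c + d) ≡ (a + c) + (b + d)
  lem = solve-∀

sumTo-*ˡ : ∀ n c (f : ℕ → ℤ) → sumTo n (λ i → c * f i) ≡ c * sumTo n f
sumTo-*ˡ zero    c f = refl
sumTo-*ˡ (suc n) c f = trans (cong (_+ c * f (suc n)) (sumTo-*ˡ n c f)) (sym (ℤ.*-distribˡ-+ c _ _))

sumTo-first : ∀ n (f : ℕ → ℤ) → sumTo (suc n) f ≡ f 0 + sumTo n (f ∘ suc)
sumTo-first zero    f = refl
sumTo-first (suc n) f = trans (cong (_+ f (suc (suc n))) (sumTo-first n f)) (ℤ.+-assoc (f 0) _ _)

sumTo-swap : ∀ n m (f : ℕ → ℕ → ℤ) →
  sumTo n (λ i → sumTo m (λ j → f i j)) ≡ sumTo m (λ j → sumTo n (λ i → f i j))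
sumTo-swap zero    m f = refl
sumTo-swap (suc n) m f =
  trans (cong (_+ sumTo m (f (suc n))) (sumTo-swap n m f)) (sym (sumTo-+ m _ _))

sumTo-extend : ∀ r n (f : ℕ → ℤ) → (∀ i → n ℕ.< i → i ℕ.≤ r ℕ.+ n → f i ≡ 0ℤ) →
  sumTo (r ℕ.+ n) f ≡ sumTo n f
sumTo-extend zero    n f z = refl
sumTo-extend (suc r) n f z =
  trans (cong₂ _+_ (sumTo-extend r n f (λ i l u → z i l (ℕ.m≤n⇒m≤1+n u)))
                   (z (suc (r ℕ.+ n)) (s≤s (ℕ.m≤n+m n r)) ℕ.≤-refl))
        (ℤ.+-identityʳ _)

sumTo-extend′ : ∀ {m n} (f : ℕ → ℤ) → n ℕ.≤ m → (∀ i → n ℕ.< i → f i ≡ 0ℤ) → sumTo m f ≡ sumTo n f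
sumTo-extend′ {m} {n} f n≤m z =
  subst (λ k → sumTo k f ≡ sumTo n f) (ℕ.m∸n+n≡m n≤m) (sumTo-extend (m ℕ.∸ n) n f (λ i l _ → z i l))

-- The ring of formal power series

infix 8 ⊝_
⊝_ : PS → PS
(⊝ f) n = - f n

𝟘 : PS
𝟘 _ = 0ℤ

tl : PS → PS
tl f n = f (suc n)

-- Splitting off the first summand removes the truncated subtraction from the convolution, so that
-- the ring laws follow by induction on the coefficient, generalized over the series.
⊛-suc : ∀ f g n → (f ⊛ g) (suc n) ≡ f 0 * g (suc n) + (tl f ⊛ g) n
⊛-suc f g n = sumTo-first n (λ i → f i * g (suc n ℕ.∸ i))

⊛-cong≤ : ∀ n {f f′ g g′ : PS} → (∀ i → i ℕ.≤ n → f i ≡ f′ i) → (∀ i → i ℕ.≤ n → g i ≡ g′ i) →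
  (f ⊛ g) n ≡ (f′ ⊛ g′) n
⊛-cong≤ n ef eg = sumTo-cong≤ n (λ i i≤n → cong₂ _*_ (ef i i≤n) (eg (n ℕ.∸ i) (ℕ.m∸n≤m n i)))

⊛-cong′ : ∀ {f f′ g g′ : PS} → f ≗ f′ → g ≗ g′ → f ⊛ g ≗ f′ ⊛ g′
⊛-cong′ ef eg n = ⊛-cong≤ n (λ i _ → ef i) (λ i _ → eg i)

⊛-sucʳ : ∀ f g n → (f ⊛ g) (suc n) ≡ f (suc n) * g 0 + (f ⊛ tl g) n
⊛-sucʳ f g zero = ℤ.+-comm (f 0 * g 1) (f 1 * g 0)
⊛-sucʳ f g (suc n) = begin
  (f ⊛ g) (suc (suc n))  ≡⟨ ⊛-suc f g (suc n) ⟩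
  f 0 * g (suc (suc n)) + (tl f ⊛ g) (suc n)  ≡⟨ cong (_+_ (f 0 * g (suc (suc n)))) (⊛-sucʳ (tl f) g n) ⟩
  f 0 * g (suc (suc n)) + (f (suc (suc n)) * g 0 + (tl f ⊛ tl g) n)
                                                              ≡⟨ lem (f 0 * g (suc (suc n))) (f (suc (suc n)) * g 0) ((tl f ⊛ tl g) n) ⟩
  f (suc (suc n)) * g 0 + (f 0 * g (suc (suc n)) + (tl f ⊛ tl g) n)
                                                              ≡⟨ cong (_+_ (f (suc (suc n)) * g 0)) (sym (⊛-suc f (tl g) n)) ⟩
  f (suc (suc n)) * g 0 + (f ⊛ tl g) (suc n)  ∎
  where
  open ≡-Reasoning
  lem : ∀ a b c → a + (b + c) ≡ b + (a + c)
  lem = solve-∀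

⊛-comm′ : ∀ f g → f ⊛ g ≗ g ⊛ f
⊛-comm′ f g zero    = ℤ.*-comm (f 0) (g 0)
⊛-comm′ f g (suc n) = trans (⊛-suc f g n) (trans
  (cong₂ _+_ (ℤ.*-comm (f 0) (g (suc n))) (⊛-comm′ (tl f) g n)) (sym (⊛-sucʳ g f n)))

⊛-distribʳ′ : ∀ h f g → (f ⊕ g) ⊛ h ≗ f ⊛ h ⊕ g ⊛ h
⊛-distribʳ′ h f g n = trans (sumTo-cong n (λ i → ℤ.*-distribʳ-+ (h (n ℕ.∸ i)) (f i) (g i))) (sumTo-+ n _ _)

sc-⊛′ : ∀ c f g → sc c f ⊛ g ≗ sc c (f ⊛ g)
sc-⊛′ c f g n = trans (sumTo-cong n (λ i → ℤ.*-assoc c (f i) (g (n ℕ.∸ i)))) (sumTo-*ˡ n c _)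

⊛-assoc′ : ∀ f g h → (f ⊛ g) ⊛ h ≗ f ⊛ (g ⊛ h)
⊛-assoc′ f g h zero = ℤ.*-assoc (f 0) (g 0) (h 0)
⊛-assoc′ f g h (suc n) = begin
  ((f ⊛ g) ⊛ h) (suc n)  ≡⟨ ⊛-suc (f ⊛ g) h n ⟩
  f 0 * g 0 * h (suc n) + (tl (f ⊛ g) ⊛ h) n  ≡⟨ cong (_+_ (f 0 * g 0 * h (suc n))) (⊛-cong′ {g = h} (⊛-suc f g) (λ _ → refl) n) ⟩
  f 0 * g 0 * h (suc n) + ((sc (f 0) (tl g) ⊕ tl f ⊛ g) ⊛ h) n ≡⟨ cong (_+_ (f 0 * g 0 * h (suc n))) (⊛-distribʳ′ h (sc (f 0) (tl g)) (tl f ⊛ g) n) ⟩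
  f 0 * g 0 * h (suc n) + ((sc (f 0) (tl g) ⊛ h) n + ((tl f ⊛ g) ⊛ h) n)
    ≡⟨ cong (_+_ (f 0 * g 0 * h (suc n))) (cong₂ _+_ (sc-⊛′ (f 0) (tl g) h n) (⊛-assoc′ (tl f) g h n)) ⟩
  f 0 * g 0 * h (suc n) + (f 0 * (tl g ⊛ h) n + (tl f ⊛ (g ⊛ h)) n) ≡⟨ lem (f 0) (g 0) (h (suc n)) ((tl g ⊛ h) n) ((tl f ⊛ (g ⊛ h)) n) ⟩
  f 0 * (g 0 * h (suc n) + (tl g ⊛ h) n) + (tl f ⊛ (g ⊛ h)) n  ≡⟨ cong (λ z → f 0 * z + (tl f ⊛ (g ⊛ h)) n) (sym (⊛-suc g h n)) ⟩
  f 0 * (g ⊛ h) (suc n) + (tl f ⊛ (g ⊛ h)) n  ≡⟨ sym (⊛-suc f (g ⊛ h) n) ⟩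
  (f ⊛ (g ⊛ h)) (suc n)  ∎
  where
  open ≡-Reasoning
  lem : ∀ a b c d e → a * b * c + (a * d + e) ≡ a * (b * c + d) + e
  lem = solve-∀

𝟘-⊛ : ∀ g → 𝟘 ⊛ g ≗ 𝟘
𝟘-⊛ g n = sumTo-zero≤ n (λ i _ → ℤ.*-zeroˡ (g (n ℕ.∸ i)))

⊛-identityˡ′ : ∀ f → one ⊛ f ≗ f
⊛-identityˡ′ f zero    = ℤ.*-identityˡ (f 0)
⊛-identityˡ′ f (suc n) = trans (⊛-suc one f n) (trans
  (cong₂ _+_ (ℤ.*-identityˡ (f (suc n))) (𝟘-⊛ f n)) (ℤ.+-identityʳ _))

-- Unlike _≗_, this record lets the two series be inferred from the type of an equation.
infix 4 _≋_
record _≋_ (f g : PS) : Set where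
  constructor pw
  field at : f ≗ g
open _≋_ public

-- Products are compared as atoms from here on; unfolding them makes conversion checking exponential.
infixl 7 _✶_
opaque
  _✶_ : PS → PS → PS
  f ✶ g = f ⊛ g

  ⊛≋✶ : ∀ f g → f ⊛ g ≋ f ✶ g
  ⊛≋✶ f g .at n = refl

opaque
  unfolding _✶_
  isPSRing : IsCommutativeRing _≋_ _⊕_ _✶_ ⊝_ 𝟘 one
  isPSRing = record
    { isRing = record
      { +-isAbelianGroup = record
        { isGroup = record
          { isMonoid = record
            { isSemigroup = record
              { isMagma = record
                { isEquivalence = record { refl = pw λ _ → refl ; sym = λ e → pw λ n → sym (at e n) ; trans = λ e e′ → pw λ n → trans (at e n) (at e′ n) }
                ; ∙-cong = λ e e′ → pw λ n → cong₂ _+_ (at e n) (at e′ n) }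
              ; assoc = λ f g h → pw λ n → ℤ.+-assoc (f n) (g n) (h n) }
            ; identity = (λ f → pw λ n → ℤ.+-identityˡ (f n)) , (λ f → pw λ n → ℤ.+-identityʳ (f n)) }
          ; inverse = (λ f → pw λ n → ℤ.+-inverseˡ (f n)) , (λ f → pw λ n → ℤ.+-inverseʳ (f n))
          ; ⁻¹-cong = λ e → pw λ n → cong -_ (at e n) }
        ; comm = λ f g → pw λ n → ℤ.+-comm (f n) (g n) }
      ; *-cong = λ e e′ → pw (⊛-cong′ (at e) (at e′))
      ; *-assoc = λ f g h → pw (⊛-assoc′ f g h)
      ; *-identity = (λ f → pw (⊛-identityˡ′ f)) , (λ f → pw λ n → trans (⊛-comm′ f one n) (⊛-identityˡ′ f n))
      ; distrib = (λ h f g → pw λ n → trans (⊛-comm′ h (f ⊕ g) n) (trans (⊛-distribʳ′ h f g n) (cong₂ _+_ (⊛-comm′ f h n) (⊛-comm′ g h n))))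
                , (λ h f g → pw (⊛-distribʳ′ h f g)) }
    ; *-comm = λ f g → pw (⊛-comm′ f g) }

psRing : CommutativeRing 0ℓ 0ℓ
psRing = record { isCommutativeRing = isPSRing }

module R = CommutativeRing psRing

✶-cong : ∀ {f f′ g g′} → f ≋ f′ → g ≋ g′ → f ✶ g ≋ f′ ✶ g′
✶-cong = R.*-cong

opaque
  unfolding _✶_
  ✶-at-0 : ∀ f g → (f ✶ g) 0 ≡ f 0 * g 0
  ✶-at-0 f g = refl

⊖-cong : ∀ {f f′ g g′} → f ≋ f′ → g ≋ g′ → f ⊖ g ≋ f′ ⊖ g′
⊖-cong e e′ = pw λ n → cong₂ _-_ (at e n) (at e′ n)

sc-cong : ∀ a {f g} → f ≋ g → sc a f ≋ sc a g
sc-cong a e = pw λ n → cong (a *_) (at e n)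

opaque
  unfolding _✶_
  sc-✶ : ∀ c f g → sc c f ✶ g ≋ sc c (f ✶ g)
  sc-✶ c f g = pw (sc-⊛′ c f g)

-- Shifts, monomials and cancellation

sh-≤ : ∀ k f {n} → k ℕ.≤ n → sh k f n ≡ f (n ℕ.∸ k)
sh-≤ k f {n} k≤n with k ≤? n
... | yes _ = refl
... | no ¬p = ⊥-elim (¬p k≤n)

sh-> : ∀ k f {n} → n ℕ.< k → sh k f n ≡ 0ℤ
sh-> k f {n} n<k with k ≤? n
... | yes p = ⊥-elim (ℕ.<⇒≱ n<k p)
... | no _  = refl

sh-suc : ∀ k f n → sh (suc k) f (suc n) ≡ sh k f n
sh-suc k f n with k ≤? n
... | yes p = sh-≤ (suc k) f (s≤s p)
... | no ¬p = sh-> (suc k) f (s≤s (ℕ.≰⇒> ¬p))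

sh-0 : ∀ f → sh 0 f ≋ f
sh-0 f = pw λ n → sh-≤ 0 f z≤n

sh-cong : ∀ k {f g} → f ≋ g → sh k f ≋ sh k g
sh-cong k {f} {g} e = pw eq
  where
  eq : sh k f ≗ sh k g
  eq n with k ≤? n
  ... | yes _ = at e _
  ... | no  _ = refl

qp : ℕ → PS
qp k = sh k one

opaque
  unfolding _✶_
  -- As multiplication by the monomial q^k, a shift becomes an expression of the ring and thus
  -- accessible to algebraic normalization.
  sh-qp : ∀ k f → sh k f ≋ qp k ✶ f
  sh-qp k f = pw (eq k)
    where
    open ≡-Reasoning
    eq : ∀ k → sh k f ≗ qp k ✶ f
    eq zero    n       = at (R.trans (sh-0 f) (R.sym (R.trans (R.*-congʳ {f} (sh-0 one)) (R.*-identityˡ f)))) n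
    eq (suc k) zero    = sym (trans (cong (_* f 0) (sh-> (suc k) one {0} (s≤s z≤n))) (trans (ℤ.*-zeroˡ (f 0)) (sym (sh-> (suc k) f (s≤s z≤n)))))
    eq (suc k) (suc n) = begin
      sh (suc k) f (suc n)  ≡⟨ sh-suc k f n ⟩
      sh k f n  ≡⟨ eq k n ⟩
      (qp k ✶ f) n  ≡⟨ at (R.*-congʳ {f} (pw λ i → sym (sh-suc k one i))) n ⟩
      (tl (qp (suc k)) ✶ f) n  ≡⟨ sym (ℤ.+-identityˡ _) ⟩
      0ℤ + (tl (qp (suc k)) ✶ f) n  ≡⟨ cong (_+ (tl (qp (suc k)) ✶ f) n) (sym (trans (cong (_* f (suc n)) (sh-> (suc k) one {0} (s≤s z≤n))) (ℤ.*-zeroˡ (f (suc n))))) ⟩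
      qp (suc k) 0 * f (suc n) + (tl (qp (suc k)) ✶ f) n  ≡⟨ sym (⊛-suc (qp (suc k)) f n) ⟩
      (qp (suc k) ✶ f) (suc n)  ∎

sh-sh : ∀ j k f → sh j (sh k f) ≋ sh (j ℕ.+ k) f
sh-sh j k f = pw (eq j)
  where
  eq : ∀ j → sh j (sh k f) ≗ sh (j ℕ.+ k) f
  eq zero    n       = at (sh-0 (sh k f)) n
  eq (suc j) zero    = trans (sh-> (suc j) (sh k f) {0} (s≤s z≤n)) (sym (sh-> (suc j ℕ.+ k) f (s≤s z≤n)))
  eq (suc j) (suc n) = trans (sh-suc j (sh k f) n) (trans (eq j n) (sym (sh-suc (j ℕ.+ k) f n)))

qp-+ : ∀ j k → qp (j ℕ.+ k) ≋ qp j ✶ qp k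
qp-+ j k = R.trans (R.sym (sh-sh j k one)) (sh-qp j (qp k))

qp-0 : qp 0 ≋ one
qp-0 = sh-0 one

opaque
  unfolding _✶_
  -- Once the coefficients of g below n vanish, the n-th coefficient of the product is `f 0` times
  -- that of g; as ℤ has no zero divisors, a nonzero `f 0` suffices.
  ✶-cancel-0 : ∀ f {g} → f 0 ≢ 0ℤ → f ✶ g ≋ 𝟘 → g ≋ 𝟘
  ✶-cancel-0 f {g} f0 e = pw λ n → below (suc n) n ℕ.≤-refl
    where
    below : ∀ n i → i ℕ.< n → g i ≡ 0ℤ
    below (suc n) i (s≤s i≤n) with ℕ.m≤n⇒m<n∨m≡n i≤n
    ... | inj₁ i<n = below n i i<n
    ... | inj₂ refl with ℤ.i*j≡0⇒i≡0∨j≡0 (f 0) (trans (sym (head i (below i))) (at e i))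
      where
      head : ∀ n → (∀ i → i ℕ.< n → g i ≡ 0ℤ) → (f ✶ g) n ≡ f 0 * g n
      head zero    z = refl
      head (suc n) z = trans (⊛-suc f g n) (trans (cong (_+_ (f 0 * g (suc n)))
        (sumTo-zero≤ n (λ i i≤n → trans (cong (f (suc i) *_) (z (n ℕ.∸ i) (s≤s (ℕ.m∸n≤m n i)))) (ℤ.*-zeroʳ (f (suc i))))))
        (ℤ.+-identityʳ _))
    ...   | inj₁ p = ⊥-elim (f0 p)
    ...   | inj₂ p = p

⊖-zero : ∀ {f g} → f ⊖ g ≋ 𝟘 → f ≋ g
⊖-zero {f} {g} e = pw λ n → ℤ.i-j≡0⇒i≡j (f n) (g n) (at e n)

zero-⊖ : ∀ {f g} → f ≋ g → f ⊖ g ≋ 𝟘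
zero-⊖ {f} {g} e = R.trans (⊖-cong e R.refl) (R.-‿inverseʳ g)

✶-cancelˡ : ∀ f {g h} → f 0 ≢ 0ℤ → f ✶ g ≋ f ✶ h → g ≋ h
✶-cancelˡ f {g} {h} f0 e = ⊖-zero (✶-cancel-0 f f0 (R.trans (R.distribˡ f g (⊝ h))
  (R.trans (R.+-congˡ {f ✶ g} (R.sym (-‿distribʳ-* f h))) (zero-⊖ e))))
  where open import Algebra.Properties.Ring R.ring using (-‿distribʳ-*)

sh-cancel : ∀ k {f g} → sh k f ≋ sh k g → f ≋ g
sh-cancel k {f} {g} e = pw λ n → trans (sym (unsh f n)) (trans (at e (k ℕ.+ n)) (unsh g n))
  where
  unsh : ∀ h n → sh k h (k ℕ.+ n) ≡ h n
  unsh h n = trans (sh-≤ k h (ℕ.m≤m+n k n)) (cong h (ℕ.m+n∸m≡n k n))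

sc-cancel : ∀ c {f g} → c ≢ 0ℤ → sc c f ≋ sc c g → f ≋ g
sc-cancel c {f} {g} c0 e = pw λ n → ℤ.*-cancelˡ-≡ c (f n) (g n) {{ℤ.≢-nonZero c0}} (at e n)

-- The substitutions q ↦ -q and q ↦ q^k

sgn : ℕ → ℤ
sgn zero    = 1ℤ
sgn (suc n) = - sgn n

sgn-+ : ∀ m n → sgn (m ℕ.+ n) ≡ sgn m * sgn n
sgn-+ zero    n = sym (ℤ.*-identityˡ (sgn n))
sgn-+ (suc m) n = trans (cong -_ (sgn-+ m n)) (ℤ.neg-distribˡ-* (sgn m) (sgn n))

sgn-even : ∀ n → n % 2 ≡ 0 → sgn n ≡ 1ℤ
sgn-even zero          _ = refl
sgn-even (suc (suc n)) e = trans (ℤ.neg-involutive (sgn n)) (sgn-even n e)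

sgn-odd : ∀ n {r} → n % 2 ≡ suc r → sgn n ≡ - 1ℤ
sgn-odd (suc zero)    _ = refl
sgn-odd (suc (suc n)) e = trans (ℤ.neg-involutive (sgn n)) (sgn-odd n e)

-- The factor `sgn n` is multiplicative in n, unlike the parity test in the definition of `negq`;
-- the homomorphism laws rest on this form.
negq≗ : ∀ f n → negq f n ≡ sgn n * f n
negq≗ f n with n % 2 in e
... | zero  = sym (trans (cong (_* f n) (sgn-even n e)) (ℤ.*-identityˡ (f n)))
... | suc _ = sym (trans (cong (_* f n) (sgn-odd n e)) (ℤ.-1*i≡-i (f n)))

negq-cong : ∀ {f g} → f ≋ g → negq f ≋ negq g
negq-cong {f} {g} e .at n = trans (negq≗ f n) (trans (cong (sgn n *_) (at e n)) (sym (negq≗ g n)))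

opaque
  unfolding _✶_
  negq-✶ : ∀ f g → negq (f ✶ g) ≋ negq f ✶ negq g
  negq-✶ f g .at n = trans (negq≗ (f ✶ g) n) (trans (sym (sumTo-*ˡ n (sgn n) _)) (sumTo-cong≤ n term))
    where
    term : ∀ i → i ℕ.≤ n → sgn n * (f i * g (n ℕ.∸ i)) ≡ negq f i * negq g (n ℕ.∸ i)
    term i i≤n = begin
      sgn n * (f i * g (n ℕ.∸ i))  ≡⟨ cong (λ m → sgn m * (f i * g (n ℕ.∸ i))) (sym (ℕ.m+[n∸m]≡n i≤n)) ⟩
      sgn (i ℕ.+ (n ℕ.∸ i)) * (f i * g (n ℕ.∸ i))  ≡⟨ cong (_* (f i * g (n ℕ.∸ i))) (sgn-+ i (n ℕ.∸ i)) ⟩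
      sgn i * sgn (n ℕ.∸ i) * (f i * g (n ℕ.∸ i))  ≡⟨ lem (sgn i) (sgn (n ℕ.∸ i)) (f i) (g (n ℕ.∸ i)) ⟩
      sgn i * f i * (sgn (n ℕ.∸ i) * g (n ℕ.∸ i))  ≡⟨ sym (cong₂ _*_ (negq≗ f i) (negq≗ g (n ℕ.∸ i))) ⟩
      negq f i * negq g (n ℕ.∸ i)  ∎
      where
      open ≡-Reasoning
      lem : ∀ a b c d → a * b * (c * d) ≡ a * c * (b * d)
      lem = solve-∀

negq-⊕ : ∀ f g → negq (f ⊕ g) ≋ negq f ⊕ negq g
negq-⊕ f g .at n = trans (negq≗ (f ⊕ g) n) (trans (ℤ.*-distribˡ-+ (sgn n) (f n) (g n)) (sym (cong₂ _+_ (negq≗ f n) (negq≗ g n))))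

negq-sc : ∀ c f → negq (sc c f) ≋ sc c (negq f)
negq-sc c f .at n = trans (negq≗ (sc c f) n) (trans (lem (sgn n) c (f n)) (sym (cong (c *_) (negq≗ f n))))
  where
  lem : ∀ a b d → a * (b * d) ≡ b * (a * d)
  lem = solve-∀

negq-⊖ : ∀ f g → negq (f ⊖ g) ≋ negq f ⊖ negq g
negq-⊖ f g .at n = trans (negq≗ (f ⊖ g) n) (trans (lem (sgn n) (f n) (g n)) (sym (cong₂ _-_ (negq≗ f n) (negq≗ g n))))
  where
  lem : ∀ a b d → a * (b - d) ≡ a * b - a * d
  lem = solve-∀

negq-one : negq one ≋ one
negq-one .at zero    = refl
negq-one .at (suc n) = trans (negq≗ one (suc n)) (ℤ.*-zeroʳ (sgn (suc n)))

dil-mult : ∀ k .{{_ : NonZero k}} f m → dil k f (m ℕ.* k) ≡ f m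
dil-mult k f m with (m ℕ.* k) % k in e
... | zero  = cong f (m*n/n≡m m k)
... | suc _ = ⊥-elim (ℕ.1+n≢0 (trans (sym e) (m*n%n≡0 m k)))

dil-other : ∀ k .{{_ : NonZero k}} f n → n % k ≢ 0 → dil k f n ≡ 0ℤ
dil-other k f n ne with n % k
... | zero  = ⊥-elim (ne refl)
... | suc _ = refl

data Mult (k : ℕ) .{{_ : NonZero k}} : ℕ → Set where
  multiple : ∀ m → Mult k (m ℕ.* k)
  other    : ∀ {n} → n % k ≢ 0 → Mult k n

mult? : ∀ k .{{_ : NonZero k}} n → Mult k n
mult? k n with n % k in e
... | suc r = other (λ p → ℕ.1+n≢0 (trans (sym e) p))
... | zero  = subst (Mult k) (sym (trans (m≡m%n+[m/n]*n n k) (cong (ℕ._+ n / k ℕ.* k) e))) (multiple (n / k))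

dil-cong : ∀ k .{{_ : NonZero k}} {f g} → f ≋ g → dil k f ≋ dil k g
dil-cong k e .at n with n % k
... | zero  = at e _
... | suc _ = refl

-- Testing at multiples of k and at the remaining exponents avoids the division in the definition of
-- `dil`; the multiplicative laws of dilation are proved through it.
dil-pointwise : ∀ k .{{_ : NonZero k}} {f g} → (∀ m → g (m ℕ.* k) ≡ f m) → (∀ n → n % k ≢ 0 → g n ≡ 0ℤ) → dil k f ≋ g
dil-pointwise k {f} {g} em eo .at n with mult? k n
... | multiple m = trans (dil-mult k f m) (sym (em m))
... | other ne   = trans (dil-other k f n ne) (sym (eo n ne))

sumTo-mult : ∀ k .{{_ : NonZero k}} m (h : ℕ → ℤ) → (∀ i → i % k ≢ 0 → h i ≡ 0ℤ) →
  sumTo (m ℕ.* k) h ≡ sumTo m (λ j → h (j ℕ.* k))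
sumTo-mult k       zero    h z = refl
sumTo-mult (suc k) (suc m) h z = cong (_+ h (suc (k ℕ.+ m ℕ.* suc k)))
  (trans (sumTo-extend k (m ℕ.* suc k) h gap) (sumTo-mult (suc k) m h z))
  where
  gap : ∀ i → m ℕ.* suc k ℕ.< i → i ℕ.≤ k ℕ.+ m ℕ.* suc k → h i ≡ 0ℤ
  gap i l u with mult? (suc k) i
  ... | other ne   = z i ne
  -- A multiple of k + 1 beyond m(k + 1) is at least (m + 1)(k + 1), which lies past the end of the
  -- gap.
  ... | multiple j = ⊥-elim (ℕ.<⇒≱ (ℕ.*-cancelʳ-< (suc k) m j l)
          (ℕ.≤-pred (ℕ.*-cancelʳ-< (suc k) j (suc m) (s≤s u))))

opaque
  unfolding _✶_
  -- The indices i and n - i of a summand are both multiples of k only if n is; otherwise one of the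
  -- two factors vanishes.
  dil-✶ : ∀ k .{{_ : NonZero k}} f g → dil k (f ✶ g) ≋ dil k f ✶ dil k g
  dil-✶ k f g = dil-pointwise k em eo
    where
    em : ∀ m → (dil k f ✶ dil k g) (m ℕ.* k) ≡ (f ✶ g) m
    em m = trans (sumTo-mult k m _ (λ i ne → trans (cong (_* dil k g (m ℕ.* k ℕ.∸ i)) (dil-other k f i ne)) (ℤ.*-zeroˡ (dil k g (m ℕ.* k ℕ.∸ i)))))
      (sumTo-cong m (λ j → cong₂ _*_ (dil-mult k f j)
        (trans (cong (dil k g) (sym (ℕ.*-distribʳ-∸ k m j))) (dil-mult k g (m ℕ.∸ j)))))
    eo : ∀ n → n % k ≢ 0 → (dil k f ✶ dil k g) n ≡ 0ℤ
    eo n ne = sumTo-zero≤ n term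
      where
      term : ∀ i → i ℕ.≤ n → dil k f i * dil k g (n ℕ.∸ i) ≡ 0ℤ
      term i i≤n with mult? k i
      ... | other ne′  = trans (cong (_* dil k g (n ℕ.∸ i)) (dil-other k f i ne′)) (ℤ.*-zeroˡ (dil k g (n ℕ.∸ i)))
      ... | multiple j = trans (cong (dil k f (j ℕ.* k) *_) (dil-other k g _ ne″)) (ℤ.*-zeroʳ (dil k f (j ℕ.* k)))
        where
        ne″ : (n ℕ.∸ j ℕ.* k) % k ≢ 0
        ne″ p = ne (trans (cong (_% k) (sym (ℕ.m∸n+n≡m i≤n))) (trans ([m+kn]%n≡m%n (n ℕ.∸ j ℕ.* k) j k) p))

dil-⊕ : ∀ k .{{_ : NonZero k}} f g → dil k (f ⊕ g) ≋ dil k f ⊕ dil k g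
dil-⊕ k f g .at n with n % k
... | zero  = refl
... | suc _ = refl

dil-⊖ : ∀ k .{{_ : NonZero k}} f g → dil k (f ⊖ g) ≋ dil k f ⊖ dil k g
dil-⊖ k f g .at n with n % k
... | zero  = refl
... | suc _ = refl

dil-sc : ∀ k .{{_ : NonZero k}} c f → dil k (sc c f) ≋ sc c (dil k f)
dil-sc k c f .at n with n % k
... | zero  = refl
... | suc _ = sym (ℤ.*-zeroʳ c)

dil-one : ∀ k .{{_ : NonZero k}} → dil k one ≋ one
dil-one k {{nz}} = dil-pointwise k {one} {one} em eo
  where
  em : ∀ m → one (m ℕ.* k) ≡ one m
  em zero = refl
  em (suc m) = go k {{nz}} 
    where
    go : ∀ k .{{_ : NonZero k}} → one (k ℕ.+ m ℕ.* k) ≡ 0ℤ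
    go (suc k) = refl
  eo : ∀ n → n % k ≢ 0 → one n ≡ 0ℤ
  eo zero    ne = ⊥-elim (ne (m*n%n≡0 0 k))
  eo (suc n) ne = refl

qp-self : ∀ k → qp k k ≡ 1ℤ
qp-self k = trans (sh-≤ k one ℕ.≤-refl) (cong one (ℕ.n∸n≡0 k))

qp-other : ∀ k n → n ≢ k → qp k n ≡ 0ℤ
qp-other k n ne with ℕ.<-cmp n k
... | tri< n<k _ _ = sh-> k one n<k
... | tri≈ _ e _ = ⊥-elim (ne e)
... | tri> _ _ k<n = trans (sh-≤ k one (ℕ.<⇒≤ k<n)) (pos (n ℕ.∸ k) (ℕ.m<n⇒0<n∸m k<n))
  where
  pos : ∀ m → 0 ℕ.< m → one m ≡ 0ℤ
  pos (suc m) _ = refl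

dil-qp : ∀ k .{{_ : NonZero k}} e → dil k (qp e) ≋ qp (e ℕ.* k)
dil-qp k e = dil-pointwise k em eo
  where
  em : ∀ m → qp (e ℕ.* k) (m ℕ.* k) ≡ qp e m
  em m with m ℕ.≟ e
  ... | yes refl = trans (qp-self (e ℕ.* k)) (sym (qp-self e))
  ... | no ne    = trans (qp-other (e ℕ.* k) (m ℕ.* k) (λ p → ne (ℕ.*-cancelʳ-≡ m e k p))) (sym (qp-other e m ne))
  eo : ∀ n → n % k ≢ 0 → qp (e ℕ.* k) n ≡ 0ℤ
  eo n ne = qp-other (e ℕ.* k) n (λ p → ne (trans (cong (_% k) p) (m*n%n≡0 e k)))

negq-qp : ∀ k → negq (qp k) ≋ sc (sgn k) (qp k)
negq-qp k .at n with n ℕ.≟ k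
... | yes refl = negq≗ (qp k) n
... | no ne    = trans (negq≗ (qp k) n) (trans (cong (sgn n *_) (qp-other k n ne)) (trans (ℤ.*-zeroʳ (sgn n))
      (sym (trans (cong (sgn k *_) (qp-other k n ne)) (ℤ.*-zeroʳ (sgn k))))))

-- Integer constants and polynomial identities in the ring

sc≋ : ∀ c f → sc c one ✶ f ≋ sc c f
sc≋ c f = R.trans (sc-✶ c one f) (sc-cong c (R.*-identityˡ f))

-- 0 and 1 are sent to `𝟘` and `one` themselves rather than to multiples of `one`, so that constants
-- in solver equations agree definitionally with the terms of the goals.
cst : ℤ → PS
cst (+ 0) = 𝟘
cst (+ 1) = one
cst c     = sc c one

cst≋ : ∀ c → cst c ≋ sc c one
cst≋ (+ 0)             = pw λ n → sym (ℤ.*-zeroˡ (one n))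
cst≋ (+ 1)             = pw λ n → sym (ℤ.*-identityˡ (one n))
cst≋ (+ suc (suc _))   = R.refl
cst≋ ℤ.-[1+ _ ]        = R.refl

constants : CommutativeRing.rawRing ℤ.+-*-commutativeRing -Raw-AlmostCommutative⟶ fromCommutativeRing psRing
constants = record
  { ⟦_⟧ = cst
  ; +-homo = λ a b → R.trans (cst≋ (a + b)) (R.trans (pw λ n → ℤ.*-distribʳ-+ (one n) a b) (R.sym (R.+-cong (cst≋ a) (cst≋ b))))
  ; *-homo = λ a b → R.trans (cst≋ (a * b)) (R.trans (pw λ n → ℤ.*-assoc a b (one n))
      (R.trans (R.sym (sc≋ a (sc b one))) (R.sym (R.*-cong (cst≋ a) (cst≋ b)))))
  ; -‿homo = λ a → R.trans (cst≋ (- a)) (R.trans (pw λ n → sym (ℤ.neg-distribˡ-* a (one n))) (R.-‿cong (R.sym (cst≋ a))))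
  ; 0-homo = R.refl
  ; 1-homo = R.refl
  }

coeff≟ : ∀ a b → Maybe (cst a ≋ cst b)
coeff≟ a b with a ℤ.≟ b
... | yes refl = just R.refl
... | no  _    = nothing

module Solver = RingSolver _ (fromCommutativeRing psRing) constants coeff≟
open Solver using (solve; _:+_; _:*_; _:-_; :-_; _:=_; con)
module ≋-Reasoning = SetoidReasoning R.setoid

open import Algebra.Solver.CommutativeMonoid R.*-commutativeMonoid using () renaming (solve to ×-solve; id to ε; _⊕_ to infixl 7 _·_; _⊜_ to infix 4 _:≈_)
open import Algebra.Properties.Ring R.ring using (-‿distribˡ-*)

-- Congruences modulo powers of q and infinite products

infix 4 _≡[_]_
_≡[_]_ : PS → ℕ → PS → Set
f ≡[ n ] g = ∀ i → i ℕ.≤ n → f i ≡ g i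

≡[]-trans : ∀ {n f g h} → f ≡[ n ] g → g ≡[ n ] h → f ≡[ n ] h
≡[]-trans p q i i≤n = trans (p i i≤n) (q i i≤n)

≡[]-sym : ∀ {n f g} → f ≡[ n ] g → g ≡[ n ] f
≡[]-sym p i i≤n = sym (p i i≤n)

≡[]-mono : ∀ {m n f g} → m ℕ.≤ n → f ≡[ n ] g → f ≡[ m ] g
≡[]-mono m≤n p i i≤m = p i (ℕ.≤-trans i≤m m≤n)

opaque
  unfolding _✶_
  ≡[]-✶ : ∀ {n f f′ g g′} → f ≡[ n ] f′ → g ≡[ n ] g′ → f ✶ g ≡[ n ] f′ ✶ g′
  ≡[]-✶ p q i i≤n = ⊛-cong≤ i (≡[]-mono i≤n p) (≡[]-mono i≤n q)

≡[]-✶-one : ∀ {n f g} → g ≡[ n ] one → f ✶ g ≡[ n ] f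
≡[]-✶-one {n} {f} q = ≡[]-trans (≡[]-✶ {n} {f} (λ _ _ → refl) q) (λ i _ → at (R.*-identityʳ f) i)

≋⇒≡[] : ∀ {n f g} → f ≋ g → f ≡[ n ] g
≋⇒≡[] e i _ = at e i

Ord : ℕ → PS → Set
Ord k f = ∀ i → i ℕ.< k → f i ≡ 0ℤ

Ord-sh : ∀ k f → Ord k (sh k f)
Ord-sh k f i i<k = sh-> k f i<k

Ord-mono : ∀ {j k f} → j ℕ.≤ k → Ord k f → Ord j f
Ord-mono j≤k o i i<j = o i (ℕ.<-≤-trans i<j j≤k)

Ord-≋ : ∀ {k f g} → f ≋ g → Ord k f → Ord k g
Ord-≋ e o i i<k = trans (sym (at e i)) (o i i<k)

opaque
  unfolding _✶_
  Ord-✶ : ∀ {k} f g → Ord k f → Ord k (f ✶ g)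
  Ord-✶ f g o i i<k = sumTo-zero≤ i (λ j j≤i →
    trans (cong (_* g (i ℕ.∸ j)) (o j (ℕ.≤-<-trans j≤i i<k))) (ℤ.*-zeroˡ (g (i ℕ.∸ j))))

Ord-⊖ : ∀ {k f g} → Ord k f → Ord k g → Ord k (f ⊖ g)
Ord-⊖ o p i i<k = cong₂ _-_ (o i i<k) (p i i<k)

opaque
  unfolding _✶_
  -- Precisions add: the error of g lies beyond q^m and is multiplied by h, which starts at q^k or
  -- later. The outer terms of the triple product depend on this gain.
  Ord-absorb : ∀ {k m h g} → Ord k h → g ≡[ m ] one → h ✶ g ≡[ k ℕ.+ m ] h
  Ord-absorb {k} {m} {h} {g} o e i i≤ = trans (sumTo-cong≤ i term) (at (R.*-identityʳ h) i)
    where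
    term : ∀ j → j ℕ.≤ i → h j * g (i ℕ.∸ j) ≡ h j * one (i ℕ.∸ j)
    term j j≤i with ℕ.<-≤-connex j k
    ... | inj₁ j<k = trans (cong (_* g (i ℕ.∸ j)) (o j j<k)) (sym (cong (_* one (i ℕ.∸ j)) (o j j<k)))
    ... | inj₂ k≤j = cong (h j *_) (e (i ℕ.∸ j) (ℕ.≤-trans (ℕ.∸-mono i≤ k≤j) (ℕ.≤-reflexive (ℕ.m+n∸m≡n k m))))

-- The convergence condition for `∏`: factors of index n and above are 1 through q^n, so the first n
-- factors already determine coefficient n.
NearOne : (ℕ → PS) → Set
NearOne F = ∀ k → F k ≡[ k ] one

∏ : (ℕ → PS) → PS
∏ F n = prodTo n F n

opaque
  unfolding _✶_
  prodTo-cong : ∀ n {F F′ : ℕ → PS} → (∀ k → F k ≋ F′ k) → prodTo n F ≋ prodTo n F′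
  prodTo-cong zero    e = R.refl
  prodTo-cong (suc n) e = R.*-cong (prodTo-cong n e) (e n)

opaque
  unfolding _✶_
  prodTo-✶ : ∀ n (F F′ : ℕ → PS) → prodTo n (λ k → F k ✶ F′ k) ≋ prodTo n F ✶ prodTo n F′
  prodTo-✶ zero    F F′ = R.sym (R.*-identityˡ one)
  prodTo-✶ (suc n) F F′ = R.trans (R.*-congʳ {F n ✶ F′ n} (prodTo-✶ n F F′))
    (solve 4 (λ a b c d → (a :* b) :* (c :* d) := (a :* c) :* (b :* d)) R.refl (prodTo n F) (prodTo n F′) (F n) (F′ n))

opaque
  unfolding _✶_
  prodTo-+ : ∀ m n (F : ℕ → PS) → prodTo (n ℕ.+ m) F ≋ prodTo m F ✶ prodTo n (λ k → F (k ℕ.+ m))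
  prodTo-+ m zero    F = R.sym (R.*-identityʳ _)
  prodTo-+ m (suc n) F = R.trans (R.*-congʳ {F (n ℕ.+ m)} (prodTo-+ m n F)) (R.*-assoc (prodTo m F) (prodTo n (λ k → F (k ℕ.+ m))) (F (n ℕ.+ m)))

prodTo-suc : ∀ n (F : ℕ → PS) → prodTo (suc n) F ≋ prodTo n F ✶ F n
prodTo-suc n F = ⊛≋✶ (prodTo n F) (F n)

prodTo-1 : ∀ (F : ℕ → PS) → prodTo 1 F ≋ F 0
prodTo-1 F = R.trans (prodTo-suc 0 F) (R.*-identityˡ (F 0))

prodTo-2 : ∀ (F : ℕ → PS) → prodTo 2 F ≋ F 0 ✶ F 1
prodTo-2 F = R.trans (prodTo-suc 1 F) (✶-cong (prodTo-1 F) R.refl)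

prodTo-5 : ∀ (F : ℕ → PS) → prodTo 5 F ≋ F 0 ✶ F 1 ✶ F 2 ✶ F 3 ✶ F 4
prodTo-5 F = R.trans (prodTo-suc 4 F) (✶-cong (R.trans (prodTo-suc 3 F) (✶-cong (R.trans (prodTo-suc 2 F) (✶-cong (prodTo-2 F) R.refl)) R.refl)) R.refl)

prodTo-* : ∀ s n (F : ℕ → PS) → prodTo (n ℕ.* s) F ≋ prodTo n (λ k → prodTo s (λ r → F (r ℕ.+ k ℕ.* s)))
prodTo-* s zero    F = R.refl
prodTo-* s (suc n) F = R.trans (prodTo-+ (n ℕ.* s) s F) (R.trans (R.*-congʳ {prodTo s (λ r → F (r ℕ.+ n ℕ.* s))} (prodTo-* s n F)) (R.sym (prodTo-suc n _)))

opaque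
  unfolding _✶_
  prodTo-stable : ∀ {F n} → NearOne F → ∀ m → prodTo (m ℕ.+ n) F ≡[ n ] prodTo n F
  prodTo-stable N zero    = λ _ _ → refl
  prodTo-stable {F} {n} N (suc m) = ≡[]-trans (≡[]-✶-one {g = F (m ℕ.+ n)} (≡[]-mono (ℕ.m≤n+m n m) (N (m ℕ.+ n)))) (prodTo-stable N m)

∏-prodTo : ∀ {F m} → NearOne F → prodTo m F ≡[ m ] ∏ F
∏-prodTo {F} {m} N i i≤m = subst (λ k → prodTo k F i ≡ prodTo i F i) (ℕ.m∸n+n≡m i≤m)
  (prodTo-stable N (m ℕ.∸ i) i ℕ.≤-refl)

∏-cong : ∀ {F F′ : ℕ → PS} → (∀ k → F k ≋ F′ k) → ∏ F ≋ ∏ F′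
∏-cong e .at n = at (prodTo-cong n e) n

∏-✶ : ∀ {F F′} → NearOne F → NearOne F′ → ∏ (λ k → F k ✶ F′ k) ≋ ∏ F ✶ ∏ F′
∏-✶ {F} {F′} N N′ .at n = trans (at (prodTo-✶ n F F′) n) (≡[]-✶ (∏-prodTo N) (∏-prodTo N′) n ℕ.≤-refl)

-- For exponents in arithmetic progression, the position r in a block is the residue class of the
-- index modulo s; regrouping thus separates residue classes.
∏-regroup : ∀ {F} s .{{_ : NonZero s}} → NearOne F → ∏ F ≋ ∏ (λ k → prodTo s (λ r → F (r ℕ.+ k ℕ.* s)))
∏-regroup {F} s N .at n = trans (sym (∏-prodTo N n (ℕ.m≤m*n n s))) (at (prodTo-* s n F) n)

opaque
  unfolding _✶_
  ∏-negq : ∀ F → negq (∏ F) ≋ ∏ (λ k → negq (F k))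
  ∏-negq F .at n = trans (negq≗ (∏ F) n) (trans (sym (negq≗ (prodTo n F) n)) (at (hom n) n))
    where
    hom : ∀ m → negq (prodTo m F) ≋ prodTo m (λ k → negq (F k))
    hom zero    = negq-one
    hom (suc m) = R.trans (negq-✶ (prodTo m F) (F m)) (R.*-congʳ {negq (F m)} (hom m))

opaque
  unfolding _✶_
  ∏-dil : ∀ {F} k .{{_ : NonZero k}} → NearOne F → dil k (∏ F) ≋ ∏ (λ j → dil k (F j))
  ∏-dil {F} k N = dil-pointwise k
    (λ m → trans (sym (at (hom (m ℕ.* k)) (m ℕ.* k))) (trans (dil-mult k (prodTo (m ℕ.* k) F) m) (∏-prodTo N m (ℕ.m≤m*n m k))))
    (λ n ne → trans (sym (at (hom n) n)) (dil-other k (prodTo n F) n ne))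
    where
    hom : ∀ m → dil k (prodTo m F) ≋ prodTo m (λ j → dil k (F j))
    hom zero    = dil-one k
    hom (suc m) = R.trans (dil-✶ k (prodTo m F) (F m)) (R.*-congʳ {dil k (F m)} (hom m))

-- Infinite products and Jacobi's triple product

fac : ℤ → ℕ → PS
fac s e = one ⊕ sc s (qp e)

fac-≡one : ∀ s e n → n ℕ.< e → fac s e ≡[ n ] one
fac-≡one s e n n<e i i≤n = trans (cong (λ z → one i + s * z) (sh-> e one (ℕ.≤-<-trans i≤n n<e)))
  (trans (cong (_+_ (one i)) (ℤ.*-zeroʳ s)) (ℤ.+-identityʳ (one i)))

-- In the notation of q-series this is (-s q^i; q^m)_∞, hence (q^i; q^m)_∞ for s = -1.
br : ℤ → ℕ → ℕ → PS
br s i m = ∏ (λ k → fac s (i ℕ.+ k ℕ.* m))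

near : ∀ s i m .{{_ : NonZero i}} .{{_ : NonZero m}} → NearOne (λ k → fac s (i ℕ.+ k ℕ.* m))
near s i m k = fac-≡one s (i ℕ.+ k ℕ.* m) k (ℕ.+-mono-≤ (ℕ.>-nonZero⁻¹ i) (ℕ.m≤m*n k m))

br-split : ∀ s i m .{{_ : NonZero i}} .{{_ : NonZero m}} → br s i m ≋ br s i (2 ℕ.* m) ✶ br s (i ℕ.+ m) (2 ℕ.* m)
br-split s (suc i) m@(suc _) = R.trans (∏-regroup 2 (near s (suc i) m)) (R.trans (∏-cong step)
  (∏-✶ (near s (suc i) (2 ℕ.* m)) (near s (suc i ℕ.+ m) (2 ℕ.* m))))
  where
  e₀ : ∀ k m i → i ℕ.+ (k ℕ.* 2) ℕ.* m ≡ i ℕ.+ k ℕ.* (2 ℕ.* m)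
  e₀ = ℕ-Solver.solve-∀
  e₁ : ∀ k m i → i ℕ.+ (m ℕ.+ (k ℕ.* 2) ℕ.* m) ≡ i ℕ.+ m ℕ.+ k ℕ.* (2 ℕ.* m)
  e₁ = ℕ-Solver.solve-∀
  step : ∀ k → prodTo 2 (λ r → fac s (suc i ℕ.+ (r ℕ.+ k ℕ.* 2) ℕ.* m))
             ≋ fac s (suc i ℕ.+ k ℕ.* (2 ℕ.* m)) ✶ fac s (suc i ℕ.+ m ℕ.+ k ℕ.* (2 ℕ.* m))
  step k = R.trans (prodTo-2 (λ r → fac s (suc i ℕ.+ (r ℕ.+ k ℕ.* 2) ℕ.* m)))
    (✶-cong (R.reflexive (cong (fac s) (e₀ k m (suc i)))) (R.reflexive (cong (fac s) (e₁ k m (suc i)))))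

opaque
  unfolding _✶_
  sc-✶-sc : ∀ a b f g → sc a f ✶ sc b g ≋ sc (a * b) (f ✶ g)
  sc-✶-sc a b f g .at n = trans (sumTo-cong n (λ i → lem a b (f i) (g (n ℕ.∸ i)))) (sumTo-*ˡ n (a * b) _)
    where
    lem : ∀ a b x y → (a * x) * (b * y) ≡ (a * b) * (x * y)
    lem = solve-∀

sc-1 : ∀ f → sc -1ℤ f ≋ ⊝ f
sc-1 f .at n = ℤ.-1*i≡-i (f n)

sc1 : ∀ f → sc 1ℤ f ≋ f
sc1 f .at n = ℤ.*-identityˡ (f n)

qp-double : ∀ e → qp e ✶ qp e ≋ qp (2 ℕ.* e)
qp-double e = R.trans (R.sym (qp-+ e e)) (R.reflexive (cong (λ k → qp (e ℕ.+ k)) (sym (ℕ.+-identityʳ e))))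

fac-± : ∀ e → fac -1ℤ e ✶ fac 1ℤ e ≋ fac -1ℤ (2 ℕ.* e)
fac-± e = begin
  fac -1ℤ e ✶ fac 1ℤ e  ≈⟨ R.*-cong (R.+-congˡ {one} (sc-1 (qp e))) (R.+-congˡ {one} (sc1 (qp e))) ⟩
  (one ⊖ qp e) ✶ (one ⊕ qp e)  ≈⟨ solve 2 (λ o x → (o :- x) :* (o :+ x) := o :* o :- x :* x) R.refl one (qp e) ⟩
  one ✶ one ⊖ qp e ✶ qp e  ≈⟨ R.+-cong (R.*-identityˡ one) (R.-‿cong (qp-double e)) ⟩
  one ⊖ qp (2 ℕ.* e)  ≈⟨ R.+-congˡ {one} (R.sym (sc-1 (qp (2 ℕ.* e)))) ⟩
  fac -1ℤ (2 ℕ.* e)  ∎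
  where open ≋-Reasoning

br-± : ∀ i m .{{_ : NonZero i}} .{{_ : NonZero m}} → br -1ℤ i m ✶ br 1ℤ i m ≋ br -1ℤ (2 ℕ.* i) (2 ℕ.* m)
br-± i m = R.trans (R.sym (∏-✶ (near -1ℤ i m) (near 1ℤ i m))) (∏-cong (λ k →
  R.trans (fac-± (i ℕ.+ k ℕ.* m)) (R.reflexive (cong (fac -1ℤ) (e k m i)))))
  where
  e : ∀ k m i → 2 ℕ.* (i ℕ.+ k ℕ.* m) ≡ 2 ℕ.* i ℕ.+ k ℕ.* (2 ℕ.* m)
  e = ℕ-Solver.solve-∀

-- The modulus is even, so all exponents have the parity of i and q ↦ -q changes every factor by the
-- same sign.
br-negq : ∀ s i m → br (sgn i * s) i (2 ℕ.* m) ≋ negq (br s i (2 ℕ.* m))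
br-negq s i m = R.sym (R.trans (∏-negq (λ k → fac s (i ℕ.+ k ℕ.* (2 ℕ.* m)))) (∏-cong step))
  where
  sgn-2* : ∀ n → sgn (2 ℕ.* n) ≡ 1ℤ
  sgn-2* n = sgn-even (2 ℕ.* n) (trans (cong (_% 2) (ℕ.*-comm 2 n)) (m*n%n≡0 n 2))
  e : ∀ k m → k ℕ.* (2 ℕ.* m) ≡ 2 ℕ.* (k ℕ.* m)
  e = ℕ-Solver.solve-∀
  lem : ∀ a b c → a * (b * c) ≡ b * a * c
  lem = solve-∀
  step : ∀ k → negq (fac s (i ℕ.+ k ℕ.* (2 ℕ.* m))) ≋ fac (sgn i * s) (i ℕ.+ k ℕ.* (2 ℕ.* m))
  step k = R.trans (negq-⊕ one (sc s (qp x))) (R.+-cong negq-one (R.trans (negq-sc s (qp x)) (R.trans (sc-cong s (negq-qp x))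
    (pw λ n → trans (cong (λ z → s * (z * qp x n)) sg) (lem s (sgn i) (qp x n))))))
    where
    x = i ℕ.+ k ℕ.* (2 ℕ.* m)
    sg : sgn x ≡ sgn i
    sg = trans (sgn-+ i (k ℕ.* (2 ℕ.* m))) (trans (cong (sgn i *_) (trans (cong sgn (e k m)) (sgn-2* (k ℕ.* m)))) (ℤ.*-identityʳ (sgn i)))

br-dil : ∀ k s i m .{{_ : NonZero k}} .{{_ : NonZero i}} .{{_ : NonZero m}} → dil k (br s i m) ≋ br s (i ℕ.* k) (m ℕ.* k)
br-dil k s i m = R.trans (∏-dil k (near s i m)) (∏-cong step)
  where
  e : ∀ i j m k → (i ℕ.+ j ℕ.* m) ℕ.* k ≡ i ℕ.* k ℕ.+ j ℕ.* (m ℕ.* k)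
  e = ℕ-Solver.solve-∀
  step : ∀ j → dil k (fac s (i ℕ.+ j ℕ.* m)) ≋ fac s (i ℕ.* k ℕ.+ j ℕ.* (m ℕ.* k))
  step j = R.trans (dil-⊕ k one _) (R.+-cong (dil-one k) (R.trans (dil-sc k s _) (sc-cong s
    (R.trans (dil-qp k (i ℕ.+ j ℕ.* m)) (R.reflexive (cong qp (e i j m k)))))))

E≋br : E ≋ br -1ℤ 1 1
E≋br = ∏-cong (λ j → R.trans (R.+-congˡ {one} (R.sym (sc-1 (qp (suc j))))) (R.reflexive (cong (λ k → fac -1ℤ (suc k)) (sym (ℕ.*-identityʳ j)))))

-- Gaussian binomial coefficients and the finite triple product

pow : PS → ℕ → PS
pow p zero    = one
pow p (suc n) = pow p n ✶ p

-- The sum over all pairs with j + d = n. Carrying both indices keeps the binomial coefficient of j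
-- + d over j free of subtraction.
adsum : ℕ → (ℕ → ℕ → PS) → PS
adsum zero    F = F 0 0
adsum (suc n) F = F 0 (suc n) ⊕ adsum n (λ j d → F (suc j) d)

adsum-cong : ∀ n {F F′ : ℕ → ℕ → PS} → (∀ j d → j ℕ.+ d ≡ n → F j d ≋ F′ j d) → adsum n F ≋ adsum n F′
adsum-cong zero    e = e 0 0 refl
adsum-cong (suc n) e = R.+-cong (e 0 (suc n) refl) (adsum-cong n (λ j d p → e (suc j) d (cong suc p)))

adsum-⊕ : ∀ n (F F′ : ℕ → ℕ → PS) → adsum n (λ j d → F j d ⊕ F′ j d) ≋ adsum n F ⊕ adsum n F′
adsum-⊕ zero    F F′ = R.refl
adsum-⊕ (suc n) F F′ = R.trans (R.+-congˡ {F 0 (suc n) ⊕ F′ 0 (suc n)} (adsum-⊕ n (λ j d → F (suc j) d) (λ j d → F′ (suc j) d)))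
  (solve 4 (λ a b c d → (a :+ b) :+ (c :+ d) := (a :+ c) :+ (b :+ d)) R.refl
    (F 0 (suc n)) (F′ 0 (suc n)) (adsum n (λ j d → F (suc j) d)) (adsum n (λ j d → F′ (suc j) d)))

adsum-✶ : ∀ n g (F : ℕ → ℕ → PS) → g ✶ adsum n F ≋ adsum n (λ j d → g ✶ F j d)
adsum-✶ zero    g F = R.refl
adsum-✶ (suc n) g F = R.trans (R.distribˡ g (F 0 (suc n)) (adsum n (λ j d → F (suc j) d)))
  (R.+-congˡ {g ✶ F 0 (suc n)} (adsum-✶ n g (λ j d → F (suc j) d)))

adsum-last : ∀ n (F : ℕ → ℕ → PS) → adsum (suc n) F ≋ adsum n (λ j d → F j (suc d)) ⊕ F (suc n) 0
adsum-last zero    F = R.refl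
adsum-last (suc n) F = R.trans (R.+-congˡ {F 0 (suc (suc n))} (adsum-last n (λ j d → F (suc j) d)))
  (R.sym (R.+-assoc (F 0 (suc (suc n))) (adsum n (λ j d → F (suc j) (suc d))) (F (suc (suc n)) 0)))

adsum-≡[] : ∀ {N} n {F F′ : ℕ → ℕ → PS} → (∀ j d → j ℕ.+ d ≡ n → F j d ≡[ N ] F′ j d) → adsum n F ≡[ N ] adsum n F′
adsum-≡[] zero    e = e 0 0 refl
adsum-≡[] (suc n) e i i≤ = cong₂ _+_ (e 0 (suc n) refl i i≤) (adsum-≡[] n (λ j d p → e (suc j) d (cong suc p)) i i≤)

adsum-sumTo : ∀ n (F : ℕ → PS) i → adsum n (λ j _ → F j) i ≡ sumTo n (λ j → F j i)
adsum-sumTo zero    F i = refl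
adsum-sumTo (suc n) F i = trans (cong (_+_ (F 0 i)) (adsum-sumTo n (λ j → F (suc j)) i)) (sym (sumTo-first n (λ j → F j i)))

-- gauss j d is the Gaussian binomial coefficient of j+d over j in base p.
module Gauss (p : PS) where
  gauss : ℕ → ℕ → PS
  gauss zero    d       = one
  gauss (suc j) zero    = one
  gauss (suc j) (suc d) = gauss j (suc d) ⊕ pow p (suc j) ✶ gauss (suc j) d

  -- The definition is one q-Pascal rule and this is its mirror image, obtained by induction in
  -- place of the symmetry of the coefficients.
  gauss-sym : ∀ j d → gauss (suc j) (suc d) ≋ gauss (suc j) d ⊕ pow p (suc d) ✶ gauss j (suc d)
  gauss-sym zero    zero    = R.refl
  gauss-sym zero    (suc d) = R.trans (R.+-congˡ {one} (R.*-congˡ {one ✶ p} (gauss-sym zero d)))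
    (solve 3 (λ p g x → con 1ℤ :+ (con 1ℤ :* p) :* (g :+ x :* p :* con 1ℤ)
                     := (con 1ℤ :+ (con 1ℤ :* p) :* g) :+ x :* p :* p :* con 1ℤ) R.refl p (gauss 1 d) (pow p d))
  gauss-sym (suc j) zero    = R.trans (R.+-congʳ {pow p (suc (suc j)) ✶ one} (gauss-sym j zero))
    (solve 3 (λ p g y → (con 1ℤ :+ (con 1ℤ :* p) :* g) :+ y :* p :* p :* con 1ℤ
                     := con 1ℤ :+ (con 1ℤ :* p) :* (g :+ y :* p :* con 1ℤ)) R.refl p (gauss j 1) (pow p j))
  gauss-sym (suc j) (suc d) = R.trans (R.+-cong (gauss-sym j (suc d)) (R.*-congˡ {pow p (suc (suc j))} (gauss-sym (suc j) d)))
    (solve 6 (λ p x y A B C → (A :+ x :* p :* p :* B) :+ y :* p :* p :* (C :+ x :* p :* A)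
                            := (A :+ y :* p :* p :* C) :+ x :* p :* p :* (B :+ y :* p :* A)) R.refl
      p (pow p d) (pow p j) (gauss (suc j) (suc d)) (gauss j (suc (suc d))) (gauss (suc (suc j)) d))

  -- Both Pascal rules compute the same coefficient. Equating them yields the ratio of neighbouring
  -- coefficients, so that quotients of q-factorials never have to be formed.
  gauss-absorb : ∀ j d → (one ⊖ pow p (suc j)) ✶ gauss (suc j) d ≋ (one ⊖ pow p (suc d)) ✶ gauss j (suc d)
  gauss-absorb j d = R.trans (solve 4 (λ A B x y → (con 1ℤ :- x) :* A := (A :+ y :* B) :- (x :* A :+ y :* B)) R.refl
      (gauss (suc j) d) (gauss j (suc d)) (pow p (suc j)) (pow p (suc d)))
    (R.trans (⊖-cong (R.sym (gauss-sym j d)) R.refl)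
    (solve 4 (λ A B x y → (B :+ x :* A) :- (x :* A :+ y :* B) := (con 1ℤ :- y) :* B) R.refl
      (gauss (suc j) d) (gauss j (suc d)) (pow p (suc j)) (pow p (suc d))))

  module _ (small : ∀ n → Ord (suc n) (pow p (suc n))) where
    1-p : ℕ → PS
    1-p k = one ⊖ pow p (suc k)

    1-p-near : NearOne 1-p
    1-p-near k i i≤k = trans (cong (λ z → one i - z) (small k i (s≤s i≤k))) (ℤ.+-identityʳ (one i))

    -- Repeated absorption turns the product into (1 - p^(d+1))⋯(1 - p^(d+j)), each factor of which
    -- is 1 through q^d.
    poch-gauss : ∀ j d → prodTo j 1-p ✶ gauss j d ≡[ d ] one
    poch-gauss zero    d = ≋⇒≡[] (R.*-identityˡ one)
    poch-gauss (suc j) d = ≡[]-trans (≋⇒≡[] (R.trans (R.trans (✶-cong (prodTo-suc j 1-p) R.refl) (R.*-assoc (prodTo j 1-p) (1-p j) (gauss (suc j) d)))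
        (R.trans (R.*-congˡ {prodTo j 1-p} (gauss-absorb j d))
        (solve 3 (λ a b c → a :* (b :* c) := (a :* c) :* b) R.refl (prodTo j 1-p) (1-p d) (gauss j (suc d))))))
      (≡[]-trans (≡[]-✶-one {g = 1-p d} (1-p-near d)) (≡[]-mono (ℕ.n≤1+n d) (poch-gauss j (suc d))))

    ∏-gauss : ∀ {m} j d → m ℕ.≤ j → m ℕ.≤ d → ∏ 1-p ✶ gauss j d ≡[ m ] one
    ∏-gauss {m} j d m≤j m≤d = ≡[]-trans (≡[]-✶ {m} {g = gauss j d} (≡[]-mono m≤j (≡[]-sym (∏-prodTo 1-p-near))) (λ _ _ → refl))
      (≡[]-mono m≤d (poch-gauss j d))

-- Here a and b are z and p/z of Jacobi's identity: two series with product p replace a variable and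
-- its inverse, and negative powers are avoided.
module TripleProduct (a b p : PS) (ab≋p : a ✶ b ≋ p) where
  open Gauss p public

  -- half a n = a^n p^(n(n-1)/2)
  half : PS → ℕ → PS
  half c zero    = one
  half c (suc n) = half c n ✶ (c ✶ pow p n)

  -- full L j is the term of index j - L of the bilateral series.
  full : ℕ → ℕ → PS
  full zero    j       = half a j
  full (suc L) zero    = half b (suc L)
  full (suc L) (suc j) = full L j

  -- The terms of index j - L and j - L - 1 have ratio a p^(j-L-1); multiplied by b p^L this becomes
  -- p^j because ab = p.
  full-step : ∀ L j → (b ✶ pow p L) ✶ full L j ≋ pow p j ✶ full (suc L) j
  full-step zero zero = solve 1 (λ b → (b :* con 1ℤ) :* con 1ℤ := con 1ℤ :* (con 1ℤ :* (b :* con 1ℤ))) R.refl b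
  full-step zero (suc j) = R.trans (solve 4 (λ a b h x → (b :* con 1ℤ) :* (h :* (a :* x)) := (x :* (a :* b)) :* h) R.refl a b (half a j) (pow p j))
    (R.*-congʳ {half a j} (R.*-congˡ {pow p j} ab≋p))
  full-step (suc L) zero = R.trans (R.*-comm (b ✶ pow p (suc L)) (half b (suc L))) (R.sym (R.*-identityˡ (half b (suc (suc L)))))
  full-step (suc L) (suc j) = R.trans (solve 4 (λ b x p f → (b :* (x :* p)) :* f := p :* ((b :* x) :* f)) R.refl b (pow p L) p (full L j))
    (R.trans (R.*-congˡ {p} (full-step L j)) (solve 3 (λ p x f → p :* (x :* f) := (x :* p) :* f) R.refl p (pow p j) (full (suc L) j)))

  fa fb : ℕ → PS
  fa k = one ⊕ a ✶ pow p k
  fb k = one ⊕ b ✶ pow p k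

  pow-+ : ∀ m n → pow p (m ℕ.+ n) ≋ pow p m ✶ pow p n
  pow-+ zero    n = R.sym (R.*-identityˡ (pow p n))
  pow-+ (suc m) n = R.trans (R.*-congʳ {p} (pow-+ m n)) (solve 3 (λ x y p → (x :* y) :* p := (x :* p) :* y) R.refl (pow p m) (pow p n) p)

  private
    left right : (ℕ → ℕ → PS) → ℕ → ℕ → PS
    left  F zero    d       = 𝟘
    left  F (suc j) d       = F j d
    right F j       zero    = 𝟘
    right F j       (suc d) = F j d

    adsum-left : ∀ n F → adsum (suc n) (left F) ≋ adsum n F
    adsum-left n F = R.+-identityˡ (adsum n F)

    adsum-right : ∀ n F → adsum (suc n) (right F) ≋ adsum n F
    adsum-right n F = R.trans (adsum-last n (right F)) (R.+-identityʳ (adsum n F))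

  -- Cauchy's q-binomial theorem, by induction on M: the new factor 1 + a p^M produces the two terms
  -- of the Pascal rule `gauss-sym`.
  one-sided : ∀ M → prodTo M fa ≋ adsum M (λ j d → gauss j d ✶ half a j)
  one-sided zero    = R.sym (R.*-identityˡ one)
  one-sided (suc M) = begin
    prodTo (suc M) fa  ≈⟨ prodTo-suc M fa ⟩
    prodTo M fa ✶ fa M  ≈⟨ R.*-congʳ {fa M} (one-sided M) ⟩
    S ✶ (one ⊕ a ✶ pow p M)  ≈⟨ solve 2 (λ s x → s :* (con 1ℤ :+ x) := s :+ x :* s) R.refl S (a ✶ pow p M) ⟩
    S ⊕ (a ✶ pow p M) ✶ S  ≈⟨ R.+-congˡ {S} (R.trans (adsum-✶ M (a ✶ pow p M) T) (adsum-cong M shift)) ⟩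
    S ⊕ adsum M T′  ≈⟨ R.+-cong (R.sym (adsum-right M T)) (R.sym (adsum-left M T′)) ⟩
    adsum (suc M) (right T) ⊕ adsum (suc M) (left T′)  ≈⟨ R.sym (adsum-⊕ (suc M) (right T) (left T′)) ⟩
    adsum (suc M) (λ j d → right T j d ⊕ left T′ j d)  ≈⟨ adsum-cong (suc M) pascal ⟩
    adsum (suc M) T  ∎
    where
    open ≋-Reasoning
    T T′ : ℕ → ℕ → PS
    T j d  = gauss j d ✶ half a j
    T′ j d = pow p d ✶ gauss j d ✶ half a (suc j)
    S = adsum M T
    shift : ∀ j d → j ℕ.+ d ≡ M → (a ✶ pow p M) ✶ T j d ≋ T′ j d
    shift j d refl = R.trans (R.*-congʳ {T j d} (R.*-congˡ {a} (pow-+ j d)))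
      (solve 5 (λ a x y g h → (a :* (x :* y)) :* (g :* h) := y :* g :* (h :* (a :* x))) R.refl a (pow p j) (pow p d) (gauss j d) (half a j))
    pascal : ∀ j d → j ℕ.+ d ≡ suc M → right T j d ⊕ left T′ j d ≋ T j d
    pascal zero    (suc d) _ = R.+-identityʳ (one ✶ one)
    pascal (suc j) zero    _ = solve 2 (λ g h → con 0ℤ :+ con 1ℤ :* g :* h := g :* h) R.refl (gauss j 0) (half a (suc j)) ⟫ g0 j
      where
      _⟫_ = R.trans
      g0 : ∀ j → gauss j 0 ✶ half a (suc j) ≋ one ✶ half a (suc j)
      g0 zero    = R.refl
      g0 (suc j) = R.refl
    pascal (suc j) (suc d) _ = R.trans (solve 4 (λ g h x k → g :* h :+ x :* k :* h := (g :+ x :* k) :* h) R.refl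
        (gauss (suc j) d) (half a (suc j)) (pow p (suc d)) (gauss j (suc d)))
      (R.*-congʳ {half a (suc j)} (R.sym (gauss-sym j d)))

  -- The finite form of the triple product. A new factor 1 + b p^L moves the series by one index
  -- through `full-step`, and the two sums recombine by the defining Pascal rule.
  two-sided : ∀ M L → prodTo M fa ✶ prodTo L fb ≋ adsum (L ℕ.+ M) (λ j d → gauss j d ✶ full L j)
  two-sided M zero    = R.trans (R.*-identityʳ (prodTo M fa)) (one-sided M)
  two-sided M (suc L) = begin
    prodTo M fa ✶ prodTo (suc L) fb  ≈⟨ ✶-cong (R.refl {prodTo M fa}) (prodTo-suc L fb) ⟩
    prodTo M fa ✶ (prodTo L fb ✶ fb L)  ≈⟨ R.sym (R.*-assoc (prodTo M fa) (prodTo L fb) (fb L)) ⟩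
    (prodTo M fa ✶ prodTo L fb) ✶ fb L  ≈⟨ R.*-congʳ {fb L} (two-sided M L) ⟩
    S ✶ (one ⊕ b ✶ pow p L)  ≈⟨ solve 2 (λ s x → s :* (con 1ℤ :+ x) := s :+ x :* s) R.refl S (b ✶ pow p L) ⟩
    S ⊕ (b ✶ pow p L) ✶ S  ≈⟨ R.+-congˡ {S} (R.trans (adsum-✶ K (b ✶ pow p L) T) (adsum-cong K shift)) ⟩
    S ⊕ adsum K T′  ≈⟨ R.+-cong (R.sym (adsum-left K T)) (R.sym (adsum-right K T′)) ⟩
    adsum (suc K) (left T) ⊕ adsum (suc K) (right T′)  ≈⟨ R.sym (adsum-⊕ (suc K) (left T) (right T′)) ⟩
    adsum (suc K) (λ j d → left T j d ⊕ right T′ j d)  ≈⟨ adsum-cong (suc K) pascal ⟩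
    adsum (suc K) T″  ∎
    where
    open ≋-Reasoning
    K = L ℕ.+ M
    T T′ T″ : ℕ → ℕ → PS
    T j d  = gauss j d ✶ full L j
    T′ j d = pow p j ✶ gauss j d ✶ full (suc L) j
    T″ j d = gauss j d ✶ full (suc L) j
    S = adsum K T
    shift : ∀ j d → j ℕ.+ d ≡ K → (b ✶ pow p L) ✶ T j d ≋ T′ j d
    shift j d _ = R.trans (solve 3 (λ x g h → x :* (g :* h) := g :* (x :* h)) R.refl (b ✶ pow p L) (gauss j d) (full L j))
      (R.trans (R.*-congˡ {gauss j d} (full-step L j))
      (solve 3 (λ x g h → g :* (x :* h) := x :* g :* h) R.refl (pow p j) (gauss j d) (full (suc L) j)))
    pascal : ∀ j d → j ℕ.+ d ≡ suc K → left T j d ⊕ right T′ j d ≋ T″ j d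
    pascal zero    (suc d) _ = solve 1 (λ h → con 0ℤ :+ con 1ℤ :* con 1ℤ :* h := con 1ℤ :* h) R.refl (full (suc L) 0)
    pascal (suc j) zero    _ = R.trans (R.+-identityʳ (gauss j 0 ✶ full L j)) (g0 j)
      where
      g0 : ∀ j → gauss j 0 ✶ full L j ≋ one ✶ full L j
      g0 zero    = R.refl
      g0 (suc j) = R.refl
    pascal (suc j) (suc d) _ = solve 4 (λ g h x k → g :* h :+ x :* k :* h := (g :+ x :* k) :* h) R.refl
        (gauss j (suc d)) (full L j) (pow p (suc j)) (gauss (suc j) d)

  module _ (small : ∀ n → Ord (suc n) (pow p (suc n))) (a-near : NearOne fa) (b-near : NearOne fb)
           (a-ord : ∀ n → Ord n (half a n)) (b-ord : ∀ n → Ord n (half b n)) where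

    full-ordʳ : ∀ L j → Ord (j ℕ.∸ L) (full L j)
    full-ordʳ zero    j       = a-ord j
    full-ordʳ (suc L) zero    i ()
    full-ordʳ (suc L) (suc j) = full-ordʳ L j

    full-ordˡ : ∀ L j → Ord (L ℕ.∸ j) (full L j)
    full-ordˡ zero    zero    i ()
    full-ordˡ zero    (suc j) i ()
    full-ordˡ (suc L) zero    = b-ord (suc L)
    full-ordˡ (suc L) (suc j) = full-ordˡ L j

    -- In the finite form with N factors of each kind, multiplication by (p;p)_∞ turns the
    -- coefficient of j + d = 2N over j into 1, but only through q^min(j,d). The missing precision
    -- |j - N| is supplied by the order of the term itself.
    triple-product : ∀ N → ∏ fa ✶ ∏ fb ✶ ∏ (1-p small) ≡[ N ] adsum (N ℕ.+ N) (λ j _ → full N j)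
    triple-product N = ≡[]-trans (≡[]-✶ {g = Π} (≡[]-✶ (≡[]-sym (∏-prodTo a-near)) (≡[]-sym (∏-prodTo b-near))) (λ _ _ → refl))
      (≡[]-trans (≋⇒≡[] (R.trans (R.*-congʳ {Π} (two-sided N N)) (R.trans (R.*-comm (adsum (N ℕ.+ N) (λ j d → gauss j d ✶ full N j)) Π)
        (adsum-✶ (N ℕ.+ N) Π (λ j d → gauss j d ✶ full N j)))))
      (adsum-≡[] (N ℕ.+ N) term))
      where
      Π = ∏ (1-p small)
      term : ∀ j d → j ℕ.+ d ≡ N ℕ.+ N → Π ✶ (gauss j d ✶ full N j) ≡[ N ] full N j
      term j d e = ≡[]-trans (≋⇒≡[] (solve 3 (λ x g f → x :* (g :* f) := f :* (x :* g)) R.refl Π (gauss j d) (full N j))) main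
        where
        main : full N j ✶ (Π ✶ gauss j d) ≡[ N ] full N j
        main with ℕ.≤-total j N
        ... | inj₁ j≤N = subst (full N j ✶ (Π ✶ gauss j d) ≡[_] full N j) (ℕ.m∸n+n≡m j≤N)
              (Ord-absorb (full-ordˡ N j) (∏-gauss small j d ℕ.≤-refl j≤d))
          where
          j≤d : j ℕ.≤ d
          j≤d = ℕ.+-cancelˡ-≤ j j d (ℕ.≤-trans (ℕ.+-mono-≤ j≤N j≤N) (ℕ.≤-reflexive (sym e)))
        ... | inj₂ N≤j = subst (full N j ✶ (Π ✶ gauss j d) ≡[_] full N j) j-N+d
              (Ord-absorb (full-ordʳ N j) (∏-gauss small j d d≤j ℕ.≤-refl))
          where
          d≤j : d ℕ.≤ j
          d≤j = ℕ.+-cancelˡ-≤ j d j (ℕ.≤-trans (ℕ.≤-reflexive e) (ℕ.+-mono-≤ N≤j N≤j))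
          j-N+d : j ℕ.∸ N ℕ.+ d ≡ N
          j-N+d = trans (sym (ℕ.+-∸-comm d N≤j)) (trans (cong (ℕ._∸ N) e) (ℕ.m+n∸n≡m N N))

-- The Rogers–Ramanujan identities

-- Meant for families with `Ord n (F n)`, in which terms of index beyond i have no coefficient at
-- q^i.
ΣP : (ℕ → PS) → PS
ΣP F i = sumTo i (λ n → F n i)

ΣP-cong : ∀ {F F′ : ℕ → PS} → (∀ n → F n ≋ F′ n) → ΣP F ≋ ΣP F′
ΣP-cong e .at i = sumTo-cong i (λ n → at (e n) i)

ΣP-⊕ : ∀ (F F′ : ℕ → PS) → ΣP (λ n → F n ⊕ F′ n) ≋ ΣP F ⊕ ΣP F′
ΣP-⊕ F F′ .at i = sumTo-+ i _ _

ΣP-shift : ∀ (F : ℕ → PS) → (∀ n → Ord n (F n)) → ΣP F ≋ F 0 ⊕ ΣP (λ n → F (suc n))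
ΣP-shift F o .at i = trans (sym (trans (cong (_+_ (ΣP F i)) (o (suc i) i ℕ.≤-refl)) (ℤ.+-identityʳ (ΣP F i))))
  (sumTo-first i (λ n → F n i))

opaque
  unfolding _✶_
  ΣP-✶ : ∀ g (F : ℕ → PS) → (∀ n → Ord n (F n)) → g ✶ ΣP F ≋ ΣP (λ n → g ✶ F n)
  ΣP-✶ g F o .at i = begin
    sumTo i (λ j → g j * sumTo (i ℕ.∸ j) (λ n → F n (i ℕ.∸ j)))  ≡⟨ sumTo-cong i (λ j → cong (g j *_) (sym (sumTo-extend′ _ (ℕ.m∸n≤m i j) (λ n l → o n (i ℕ.∸ j) l)))) ⟩
    sumTo i (λ j → g j * sumTo i (λ n → F n (i ℕ.∸ j)))  ≡⟨ sumTo-cong i (λ j → sym (sumTo-*ˡ i (g j) _)) ⟩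
    sumTo i (λ j → sumTo i (λ n → g j * F n (i ℕ.∸ j)))  ≡⟨ sumTo-swap i i (λ j n → g j * F n (i ℕ.∸ j)) ⟩
    sumTo i (λ n → (g ✶ F n) i)  ∎
    where open ≡-Reasoning

q : PS
q = qp 1

pow-q : ∀ n → pow q n ≋ qp n
pow-q zero    = R.sym qp-0
pow-q (suc n) = R.trans (R.*-congʳ {q} (pow-q n)) (R.trans (R.*-comm (qp n) q) (R.sym (qp-+ 1 n)))

Ord-qp : ∀ n → Ord n (qp n)
Ord-qp n = Ord-sh n one

Ord-pow : ∀ n → Ord n (pow q n)
Ord-pow n = Ord-≋ (R.sym (pow-q n)) (Ord-qp n)

Ord-qp✶ : ∀ {k f} e → Ord k f → Ord (e ℕ.+ k) (qp e ✶ f)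
Ord-qp✶ {k} {f} e o i i< = trans (sym (at (sh-qp e f) i)) (go i i<)
  where
  go : Ord (e ℕ.+ k) (sh e f)
  go i i< with ℕ.<-≤-connex i e
  ... | inj₁ i<e = sh-> e f i<e
  ... | inj₂ e≤i = trans (sh-≤ e f e≤i) (o (i ℕ.∸ e) (ℕ.+-cancelˡ-< e (i ℕ.∸ e) k (subst (ℕ._< e ℕ.+ k) (sym (ℕ.m+[n∸m]≡n e≤i)) i<)))

Ord-⊝ : ∀ {k f} → Ord k f → Ord k (⊝ f)
Ord-⊝ o i i<k = cong -_ (o i i<k)

1-q^ : ℕ → PS
1-q^ k = one ⊖ pow q k

-- qpoch k n = (1 - q^(n+1)) ⋯ (1 - q^(n+k))
qpoch : ℕ → ℕ → PS
qpoch k n = prodTo k (λ i → 1-q^ (suc (i ℕ.+ n)))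

-- Both sides are the product of 1 - q^m over n < m ≤ n + k + 1.
qpoch-shift : ∀ k n → qpoch k (suc n) ✶ 1-q^ (suc n) ≋ qpoch k n ✶ 1-q^ (suc (k ℕ.+ n))
qpoch-shift zero    n = R.refl
qpoch-shift (suc k) n = begin
  qpoch (suc k) (suc n) ✶ 1-q^ (suc n)  ≈⟨ ✶-cong (prodTo-suc k _) R.refl ⟩
  qpoch k (suc n) ✶ 1-q^ (suc (k ℕ.+ suc n)) ✶ 1-q^ (suc n)  ≈⟨ solve 3 (λ a b c → a :* b :* c := a :* c :* b) R.refl (qpoch k (suc n)) (1-q^ (suc (k ℕ.+ suc n))) (1-q^ (suc n)) ⟩
  qpoch k (suc n) ✶ 1-q^ (suc n) ✶ 1-q^ (suc (k ℕ.+ suc n))  ≈⟨ R.*-cong (qpoch-shift k n) (R.reflexive (cong (λ m → 1-q^ (suc m)) (ℕ.+-suc k n))) ⟩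
  qpoch k n ✶ 1-q^ (suc (k ℕ.+ n)) ✶ 1-q^ (suc (suc k ℕ.+ n)) ≈⟨ ✶-cong (R.sym (prodTo-suc k _)) R.refl ⟩
  qpoch (suc k) n ✶ 1-q^ (suc (suc k ℕ.+ n))  ∎
  where open ≋-Reasoning

pow-q-+ : ∀ m n → pow q (m ℕ.+ n) ≋ pow q m ✶ pow q n
pow-q-+ zero    n = R.sym (R.*-identityˡ (pow q n))
pow-q-+ (suc m) n = R.trans (R.*-congʳ {q} (pow-q-+ m n)) (solve 3 (λ x y p → (x :* y) :* p := (x :* p) :* y) R.refl (pow q m) (pow q n) q)

-- The signed monomial in `w`, built from the ratio -x⁵y²q of consecutive terms, where x = q^n and y
-- = q^(k+1). In this way n(5n+1) is never halved and x, y, q can serve as independent letters for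
-- the solvers.
mono : ℕ → ℕ → PS
mono k zero    = one
mono k (suc n) = ⊝ (mono k n ✶ (x ✶ x ✶ x ✶ x ✶ x ✶ y ✶ y ✶ q))
  where
  x = pow q n
  y = pow q (suc k)

-- w k n = (-1)^n q^(2kn + n(5n+1)/2) (1 - q^(n+1)) ⋯ (1 - q^(n+k))
w : ℕ → ℕ → PS
w k n = mono k n ✶ qpoch k n

w-sucˡ : ∀ k n → w (suc k) n ≋ w k n ✶ (pow q n ✶ pow q n) ✶ (one ⊖ pow q n ✶ pow q (suc k))
w-sucˡ k n = R.trans (✶-cong (mono-sucˡ n) (R.trans (prodTo-suc k _) (R.*-congˡ {qpoch k n} (⊖-cong (R.refl {one}) e))))
  (solve 4 (λ m x p z → (m :* (x :* x)) :* (p :* z) := m :* p :* (x :* x) :* z) R.refl (mono k n) (pow q n) (qpoch k n) (one ⊖ pow q n ✶ pow q (suc k)))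
  where
  e : pow q (suc (k ℕ.+ n)) ≋ pow q n ✶ pow q (suc k)
  e = R.trans (R.reflexive (cong (pow q) (ℕ.+-comm (suc k) n))) (pow-q-+ n (suc k))
  mono-sucˡ : ∀ n → mono (suc k) n ≋ mono k n ✶ (pow q n ✶ pow q n)
  mono-sucˡ zero    = solve 0 (con 1ℤ := con 1ℤ :* (con 1ℤ :* con 1ℤ)) R.refl
  mono-sucˡ (suc n) = R.trans (R.-‿cong (R.trans
      (R.*-congʳ {let x = pow q n ; y = pow q (suc (suc k)) in x ✶ x ✶ x ✶ x ✶ x ✶ y ✶ y ✶ q} (mono-sucˡ n))
      (×-solve 4 (λ m x y q → (m · (x · x)) · (x · x · x · x · x · (y · q) · (y · q) · q)
         :≈ (m · (x · x · x · x · x · y · y · q)) · ((x · q) · (x · q))) R.refl (mono k n) (pow q n) (pow q (suc k)) q)))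
    (-‿distribˡ-* (mono k n ✶ (let x = pow q n ; y = pow q (suc k) in x ✶ x ✶ x ✶ x ✶ x ✶ y ✶ y ✶ q)) (pow q (suc n) ✶ pow q (suc n)))

-- The factor 1 - q^(n+1) is present because `qpoch k (suc n)` starts one factor later than
-- `qpoch k n`.
w-sucʳ : ∀ k n → w k (suc n) ✶ 1-q^ (suc n)
  ≋ (let x = pow q n ; y = pow q (suc k) in ⊝ (w k n ✶ (x ✶ x ✶ x ✶ x ✶ x ✶ y ✶ y ✶ q) ✶ (one ⊖ x ✶ y)))
w-sucʳ k n = R.trans (R.*-assoc (mono k (suc n)) (qpoch k (suc n)) (1-q^ (suc n)))
  (R.trans (R.*-congˡ {mono k (suc n)} (R.trans (qpoch-shift k n) (R.*-congˡ {qpoch k n} (⊖-cong (R.refl {one}) e))))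
  (solve 4 (λ m z p u → (:- (m :* z)) :* (p :* u) := :- (m :* p :* z :* u)) R.refl (mono k n) (let x = pow q n ; y = pow q (suc k) in x ✶ x ✶ x ✶ x ✶ x ✶ y ✶ y ✶ q) (qpoch k n) (one ⊖ pow q n ✶ pow q (suc k))))
  where
  e : pow q (suc (k ℕ.+ n)) ≋ pow q n ✶ pow q (suc k)
  e = R.trans (R.reflexive (cong (pow q) (ℕ.+-comm (suc k) n))) (pow-q-+ n (suc k))

mono-ord : ∀ k n → Ord n (mono k n)
mono-ord k zero    i ()
mono-ord k (suc n) = Ord-⊝ (Ord-≋ (×-solve 4 (λ m x y q → q · (m · (x · x · x · x · x · y · y)) :≈ m · (x · x · x · x · x · y · y · q)) R.refl
    (mono k n) (pow q n) (pow q (suc k)) q)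
  (Ord-qp✶ 1 (Ord-✶ (mono k n) (let x = pow q n ; y = pow q (suc k) in x ✶ x ✶ x ✶ x ✶ x ✶ y ✶ y) (mono-ord k n))))

mono-ord′ : ∀ k n → Ord (suc k) (mono k (suc n))
mono-ord′ k n = Ord-⊝ (Ord-≋ (×-solve 4 (λ m x y q → y · (m · (x · x · x · x · x · y · q)) :≈ m · (x · x · x · x · x · y · y · q)) R.refl
    (mono k n) (pow q n) (pow q (suc k)) q)
  (Ord-✶ (pow q (suc k)) (let x = pow q n ; y = pow q (suc k) in mono k n ✶ (x ✶ x ✶ x ✶ x ✶ x ✶ y ✶ q)) (Ord-pow (suc k))))

w-ord : ∀ k n → Ord n (w k n)
w-ord k n = Ord-✶ (mono k n) (qpoch k n) (mono-ord k n)

module _ (k : ℕ) where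
  private
    x : ℕ → PS
    x n = pow q n
    y = pow q (suc k)
    z : ℕ → PS
    z n = w k n ✶ (x n ✶ x n ✶ x n ✶ x n ✶ x n ✶ y ✶ y ✶ q) ✶ (one ⊖ x n ✶ y)

  -- The factor 1 - q^n removes the term n = 0, and in the term n + 1 it is the factor with which
  -- `w-sucʳ` steps back to n.
  w-telescope : ∀ (g : ℕ → PS) → ΣP (λ n → w k n ✶ 1-q^ n ✶ g n) ≋ ΣP (λ n → ⊝ z n ✶ g (suc n))
  w-telescope g = begin
    ΣP F  ≈⟨ ΣP-shift F (λ n → Ord-✶ (w k n ✶ 1-q^ n) (g n) (Ord-✶ (w k n) (1-q^ n) (w-ord k n))) ⟩
    F 0 ⊕ ΣP (λ n → F (suc n))  ≈⟨ R.+-cong (solve 2 (λ a b → a :* (con 1ℤ :- con 1ℤ) :* b := con 0ℤ) R.refl (w k 0) (g 0))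
                                          (ΣP-cong (λ n → R.*-congʳ {g (suc n)} (w-sucʳ k n))) ⟩
    𝟘 ⊕ ΣP (λ n → ⊝ z n ✶ g (suc n)) ≈⟨ R.+-identityˡ (ΣP (λ n → ⊝ z n ✶ g (suc n))) ⟩
    ΣP (λ n → ⊝ z n ✶ g (suc n))  ∎
    where
    open ≋-Reasoning
    F : ℕ → PS
    F n = w k n ✶ 1-q^ n ✶ g n

  -- Two forms of E(q) Σ q^(n²+(k+1)n)/(q;q)_n and E(q) Σ q^(n²+kn)/(q;q)_n: the shift w-telescope turns rr-theta₁ k into
  -- rr-theta₂ (suc k), and rr-theta₂ k into the right-hand side of the recurrence satisfied by the two sums.
  rr-theta₁ rr-theta₂ : PS
  rr-theta₁ = ΣP (λ n → w k n ✶ (x n ✶ (one ⊖ x n ✶ x n ✶ y)))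
  rr-theta₂ = ΣP (λ n → w k n ✶ (one ⊖ x n ✶ x n ✶ x n ✶ x n ✶ y ✶ y))

-- With x = q^n and y = q^(k+1), the bracket x(1 - x²y) equals (1 - x)x + x²(1 - xy). The first part
-- telescopes; the second carries x²(1 - xy), the ratio of `w (suc k) n` to `w k n`, and after the
-- shift the first part contains it too.
R1≋R2 : ∀ k → rr-theta₁ k ≋ rr-theta₂ (suc k)
R1≋R2 k = begin
  rr-theta₁ k  ≈⟨ ΣP-cong (λ n → solve 3 (λ w x y → w :* (x :* (con 1ℤ :- x :* x :* y))
                                                      := w :* (con 1ℤ :- x) :* x :+ w :* (x :* x) :* (con 1ℤ :- x :* y)) R.refl (w k n) (pow q n) y) ⟩
  ΣP (λ n → w k n ✶ 1-q^ n ✶ pow q n ⊕ A n)  ≈⟨ ΣP-⊕ (λ n → w k n ✶ 1-q^ n ✶ pow q n) A ⟩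
  ΣP (λ n → w k n ✶ 1-q^ n ✶ pow q n) ⊕ ΣP A  ≈⟨ R.+-congʳ {ΣP A} (w-telescope k (pow q)) ⟩
  ΣP B ⊕ ΣP A  ≈⟨ R.sym (ΣP-⊕ B A) ⟩
  ΣP (λ n → B n ⊕ A n)  ≈⟨ ΣP-cong merge ⟩
  rr-theta₂ (suc k)  ∎
  where
  open ≋-Reasoning
  y = pow q (suc k)
  X : ℕ → PS
  X n = let x = pow q n in x ✶ x ✶ x ✶ x ✶ x ✶ y ✶ y ✶ q
  A B : ℕ → PS
  A n = w k n ✶ (pow q n ✶ pow q n) ✶ (one ⊖ pow q n ✶ y)
  B n = ⊝ (w k n ✶ X n ✶ (one ⊖ pow q n ✶ y)) ✶ pow q (suc n)
  merge : ∀ n → B n ⊕ A n ≋ w (suc k) n ✶ (let x = pow q n ; y = pow q (suc (suc k)) in one ⊖ x ✶ x ✶ x ✶ x ✶ y ✶ y)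
  merge n = begin
    B n ⊕ A n  ≈⟨ solve 5 (λ w X v p x² → (:- (w :* X :* v)) :* p :+ w :* x² :* v := w :* v :* (x² :- X :* p)) R.refl
                                                               (w k n) (X n) v (pow q (suc n)) (x ✶ x) ⟩
    w k n ✶ v ✶ (x ✶ x ⊖ X n ✶ pow q (suc n))  ≈⟨ R.*-congˡ {w k n ✶ v} (⊖-cong (R.refl {x ✶ x}) (×-solve 3 (λ x y q → (x · x · x · x · x · y · y · q) · (x · q)
                                                               :≈ (x · x) · (x · x · x · x · (y · q) · (y · q))) R.refl x y q)) ⟩
    w k n ✶ v ✶ (x ✶ x ⊖ (x ✶ x) ✶ t)  ≈⟨ solve 4 (λ w v x² t → w :* v :* (x² :- x² :* t) := w :* x² :* v :* (con 1ℤ :- t)) R.refl (w k n) v (x ✶ x) t ⟩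
    w k n ✶ (x ✶ x) ✶ v ✶ (one ⊖ t)  ≈⟨ R.*-congʳ {one ⊖ t} (R.sym (w-sucˡ k n)) ⟩
    w (suc k) n ✶ (one ⊖ t)  ∎
    where
    x = pow q n
    v = one ⊖ x ✶ y
    t = x ✶ x ✶ x ✶ x ✶ pow q (suc (suc k)) ✶ pow q (suc (suc k))

-- Here 1 - x⁴y² = x(1 - x²y) + (1 - x) + x³y(1 - xy). The first part gives `rr-theta₁ k`; the
-- second telescopes and joins the third to form y times the terms of `rr-theta₁ (suc k)`.
R2-rec : ∀ k → rr-theta₂ k ≋ rr-theta₁ k ⊕ pow q (suc k) ✶ rr-theta₁ (suc k)
R2-rec k = begin
  rr-theta₂ k  ≈⟨ ΣP-cong (λ n → solve 3 (λ w x y → w :* (con 1ℤ :- x :* x :* x :* x :* y :* y)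
                                               := w :* (x :* (con 1ℤ :- x :* x :* y)) :+ (w :* (con 1ℤ :- x) :* con 1ℤ :+ w :* (x :* x :* x :* y) :* (con 1ℤ :- x :* y))) R.refl (w k n) (pow q n) y) ⟩
  ΣP (λ n → C n ⊕ (D n ⊕ A n))  ≈⟨ R.trans (ΣP-⊕ C (λ n → D n ⊕ A n)) (R.+-congˡ {rr-theta₁ k} (ΣP-⊕ D A)) ⟩
  rr-theta₁ k ⊕ (ΣP D ⊕ ΣP A)  ≈⟨ R.+-congˡ {rr-theta₁ k} (R.+-congʳ {ΣP A} (w-telescope k (λ _ → one))) ⟩
  rr-theta₁ k ⊕ (ΣP B ⊕ ΣP A)  ≈⟨ R.+-congˡ {rr-theta₁ k} (R.sym (ΣP-⊕ B A)) ⟩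
  rr-theta₁ k ⊕ ΣP (λ n → B n ⊕ A n)  ≈⟨ R.+-congˡ {rr-theta₁ k} (ΣP-cong merge) ⟩
  rr-theta₁ k ⊕ ΣP (λ n → y ✶ F n)  ≈⟨ R.+-congˡ {rr-theta₁ k} (R.sym (ΣP-✶ y F (λ n → Ord-✶ (w (suc k) n) (pow q n ✶ (one ⊖ pow q n ✶ pow q n ✶ pow q (suc (suc k)))) (w-ord (suc k) n)))) ⟩
  rr-theta₁ k ⊕ y ✶ rr-theta₁ (suc k)  ∎
  where
  open ≋-Reasoning
  y = pow q (suc k)
  X : ℕ → PS
  X n = let x = pow q n in x ✶ x ✶ x ✶ x ✶ x ✶ y ✶ y ✶ q
  A B C D F : ℕ → PS
  A n = let x = pow q n in w k n ✶ (x ✶ x ✶ x ✶ y) ✶ (one ⊖ x ✶ y)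
  B n = ⊝ (w k n ✶ X n ✶ (one ⊖ pow q n ✶ y)) ✶ one
  C n = let x = pow q n in w k n ✶ (x ✶ (one ⊖ x ✶ x ✶ y))
  D n = w k n ✶ 1-q^ n ✶ one
  F n = let x = pow q n in w (suc k) n ✶ (x ✶ (one ⊖ x ✶ x ✶ pow q (suc (suc k))))
  merge : ∀ n → B n ⊕ A n ≋ y ✶ F n
  merge n = begin
    B n ⊕ A n  ≈⟨ solve 4 (λ w X v c → (:- (w :* X :* v)) :* con 1ℤ :+ w :* c :* v := w :* v :* (c :- X)) R.refl (w k n) (X n) v (x ✶ x ✶ x ✶ y) ⟩
    w k n ✶ v ✶ (x ✶ x ✶ x ✶ y ⊖ X n)  ≈⟨ R.*-congˡ {w k n ✶ v} (⊖-cong (R.refl {x ✶ x ✶ x ✶ y}) (×-solve 3 (λ x y q → x · x · x · x · x · y · y · q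
                                                                      :≈ (x · x · x · y) · (x · x · (y · q))) R.refl x y q)) ⟩
    w k n ✶ v ✶ (x ✶ x ✶ x ✶ y ⊖ (x ✶ x ✶ x ✶ y) ✶ t)  ≈⟨ solve 5 (λ w v x y t → w :* v :* (x :* x :* x :* y :- (x :* x :* x :* y) :* t) := y :* (w :* (x :* x) :* v :* (x :* (con 1ℤ :- t)))) R.refl (w k n) v x y t ⟩
    y ✶ (w k n ✶ (x ✶ x) ✶ v ✶ (x ✶ (one ⊖ t)))  ≈⟨ R.*-congˡ {y} (R.*-congʳ {x ✶ (one ⊖ t)} (R.sym (w-sucˡ k n))) ⟩
    y ✶ F n  ∎
    where
    x = pow q n
    v = one ⊖ x ✶ y
    t = x ✶ x ✶ pow q (suc (suc k))

-- For 1/(1 - q) the product is a telescoping difference; dilation by j + 1 yields the other cases.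
geomS-inverse : ∀ j → geomS j ✶ 1-q^ (suc j) ≋ one
geomS-inverse j = R.trans (R.*-congˡ {geomS j} e) (R.trans (R.sym (dil-✶ (suc j) (λ _ → 1ℤ) (one ⊖ qp 1)))
  (R.trans (dil-cong (suc j) ones) (dil-one (suc j))))
  where
  e : 1-q^ (suc j) ≋ dil (suc j) (one ⊖ qp 1)
  e = R.sym (R.trans (dil-⊖ (suc j) one (qp 1)) (⊖-cong (dil-one (suc j))
    (R.trans (dil-qp (suc j) 1) (R.trans (R.reflexive (cong qp (ℕ.*-identityˡ (suc j)))) (R.sym (pow-q (suc j)))))))
  ones : (λ _ → 1ℤ) ✶ (one ⊖ qp 1) ≋ one
  ones = R.trans (R.*-comm (λ _ → 1ℤ) (one ⊖ qp 1)) (R.trans (solve 2 (λ x f → (con 1ℤ :- x) :* f := f :- x :* f) R.refl (qp 1) (λ _ → 1ℤ))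
    (R.trans (⊖-cong (R.refl {λ _ → 1ℤ}) (R.sym (sh-qp 1 (λ _ → 1ℤ)))) (pw go)))
    where
    go : (λ _ → 1ℤ) ⊖ sh 1 (λ _ → 1ℤ) ≗ one
    go zero    = refl
    go (suc n) = cong (λ z → 1ℤ - z) (sh-≤ 1 (λ _ → 1ℤ) {suc n} (s≤s z≤n))

Gterm : ℕ → ℕ → PS
Gterm k n = sh (n ℕ.* n ℕ.+ k ℕ.* n) (invPoch n)

Gk : ℕ → PS
Gk k = ΣP (Gterm k)

n≤n*n : ∀ n → n ℕ.≤ n ℕ.* n
n≤n*n zero    = z≤n
n≤n*n (suc n) = ℕ.m≤m*n (suc n) (suc n)

Gterm-ord : ∀ k n → Ord n (Gterm k n)
Gterm-ord k n = Ord-mono (ℕ.≤-trans (n≤n*n n) (ℕ.m≤m+n (n ℕ.* n) (k ℕ.* n))) (Ord-sh (n ℕ.* n ℕ.+ k ℕ.* n) (invPoch n))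

-- `Gk k` is Σ q^(n²+kn)/(q;q)_n. Subtracting the terms for k + 1 brings in 1 - q^n, which cancels
-- the last factor of (q;q)_n; then n is shifted by one.
Gk-rec : ∀ k → Gk k ≋ Gk (suc k) ⊕ pow q (suc k) ✶ Gk (suc (suc k))
Gk-rec k = begin
  Gk k  ≈⟨ ΣP-cong (λ n → solve 2 (λ x y → x := y :+ (x :- y)) R.refl (Gterm k n) (Gterm (suc k) n)) ⟩
  ΣP (λ n → Gterm (suc k) n ⊕ D n)  ≈⟨ ΣP-⊕ (Gterm (suc k)) D ⟩
  Gk (suc k) ⊕ ΣP D  ≈⟨ R.+-congˡ {Gk (suc k)} (ΣP-shift D (λ n → Ord-⊖ {n} {Gterm k n} {Gterm (suc k) n} (Gterm-ord k n) (Gterm-ord (suc k) n))) ⟩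
  Gk (suc k) ⊕ (D 0 ⊕ ΣP (λ n → D (suc n)))  ≈⟨ R.+-congˡ {Gk (suc k)} (R.+-cong D0 (ΣP-cong Dsuc)) ⟩
  Gk (suc k) ⊕ (𝟘 ⊕ ΣP (λ n → y ✶ Gterm (suc (suc k)) n)) ≈⟨ R.+-congˡ {Gk (suc k)} (R.+-identityˡ (ΣP (λ n → y ✶ Gterm (suc (suc k)) n))) ⟩
  Gk (suc k) ⊕ ΣP (λ n → y ✶ Gterm (suc (suc k)) n)  ≈⟨ R.+-congˡ {Gk (suc k)} (R.sym (ΣP-✶ y (Gterm (suc (suc k))) (Gterm-ord (suc (suc k))))) ⟩
  Gk (suc k) ⊕ y ✶ Gk (suc (suc k))  ∎
  where
  open ≋-Reasoning
  y = pow q (suc k)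
  D : ℕ → PS
  D n = Gterm k n ⊖ Gterm (suc k) n
  D0 : D 0 ≋ 𝟘
  D0 = zero-⊖ (R.reflexive (cong (λ e → sh e one) (trans (ℕ.*-zeroʳ k) (sym (ℕ.*-zeroʳ (suc k))))))
  e₁ : ∀ k n → suc n ℕ.* suc n ℕ.+ suc k ℕ.* suc n ≡ (suc n ℕ.* suc n ℕ.+ k ℕ.* suc n) ℕ.+ suc n
  e₁ = ℕ-Solver.solve-∀
  e₂ : ∀ k n → suc n ℕ.* suc n ℕ.+ k ℕ.* suc n ≡ suc k ℕ.+ (n ℕ.* n ℕ.+ suc (suc k) ℕ.* n)
  e₂ = ℕ-Solver.solve-∀
  Dsuc : ∀ n → D (suc n) ≋ y ✶ Gterm (suc (suc k)) n
  Dsuc n = R.trans (⊖-cong (R.trans (sh-qp a (invPoch (suc n))) (✶-cong R.refl (prodTo-suc n geomS))) (R.trans (R.reflexive (cong (λ e → sh e (invPoch (suc n))) (e₁ k n)))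
      (R.trans (sh-qp (a ℕ.+ suc n) (invPoch (suc n))) (✶-cong (qp-+ a (suc n)) (prodTo-suc n geomS)))))
    (R.trans (solve 4 (λ A B P g → A :* (P :* g) :- (A :* B) :* (P :* g) := A :* P :* (g :* (con 1ℤ :- B))) R.refl (qp a) (qp (suc n)) (invPoch n) (geomS n))
    (R.trans (R.*-congˡ {qp a ✶ invPoch n} (R.trans (R.*-congˡ {geomS n} (⊖-cong (R.refl {one}) (R.sym (pow-q (suc n))))) (geomS-inverse n)))
    (R.trans (R.*-identityʳ (qp a ✶ invPoch n))
    (R.trans (R.*-congʳ {invPoch n} (R.trans (R.reflexive (cong qp (e₂ k n))) (qp-+ (suc k) b)))
    (R.trans (R.*-assoc (qp (suc k)) (qp b) (invPoch n)) (R.*-cong (R.sym (pow-q (suc k))) (R.sym (sh-qp b (invPoch n)))))))))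
    where
    a = suc n ℕ.* suc n ℕ.+ k ℕ.* suc n
    b = n ℕ.* n ℕ.+ suc (suc k) ℕ.* n

rr-theta : ℕ → PS
rr-theta zero    = rr-theta₂ 0
rr-theta (suc k) = rr-theta₁ k

T-rec : ∀ k → rr-theta k ≋ rr-theta (suc k) ⊕ pow q (suc k) ✶ rr-theta (suc (suc k))
T-rec zero    = R2-rec 0
T-rec (suc k) = R.trans (R1≋R2 k) (R2-rec (suc k))

ΣP-≡[] : ∀ {k} (F : ℕ → PS) → (∀ n → Ord (suc k) (F (suc n))) → ΣP F ≡[ k ] F 0
ΣP-≡[] {k} F o i i≤k = sumTo-extend′ {i} {0} (λ n → F n i) z≤n (λ { (suc n) _ → o n i (s≤s i≤k) })

E-near : ∀ k → prodTo k (λ j → one ⊖ sh (suc j) one) ≡[ k ] E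
E-near k = ∏-prodTo (λ j i i≤j → trans (cong (λ z → one i - z) (sh-> (suc j) one (s≤s i≤j))) (ℤ.+-identityʳ (one i)))

-- For n ≥ 1 the order of `mono k n` exceeds k, so only the term n = 0 is left: (q;q)_k times 1 -
-- q^(k+1).
T-limit : ∀ k → rr-theta (suc k) ≡[ k ] E
T-limit k = ≡[]-trans (ΣP-≡[] (λ n → w k n ✶ c n) (λ n → Ord-✶ (w k (suc n)) (c (suc n)) (Ord-✶ (mono k (suc n)) (qpoch k (suc n)) (mono-ord′ k n))))
  (≡[]-trans (≡[]-✶ (≋⇒≡[] {k} {w k 0} (R.*-identityˡ (qpoch k 0))) c≡one) (≡[]-trans (≋⇒≡[] (R.*-identityʳ (qpoch k 0)))
  (≡[]-trans (≋⇒≡[] (prodTo-cong k (λ i → ⊖-cong (R.refl {one}) (R.trans (R.reflexive (cong (λ m → pow q (suc m)) (ℕ.+-identityʳ i))) (pow-q (suc i)))))) (E-near k))))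
  where
  c : ℕ → PS
  c n = let x = pow q n in x ✶ (one ⊖ x ✶ x ✶ pow q (suc k))
  c≡one : c 0 ≡[ k ] one
  c≡one = ≡[]-trans (≋⇒≡[] (solve 1 (λ y → con 1ℤ :* (con 1ℤ :- con 1ℤ :* con 1ℤ :* y) := con 1ℤ :- y) R.refl (pow q (suc k))))
    (λ i i≤k → trans (cong (λ z → one i - z) (Ord-pow (suc k) i (s≤s i≤k))) (ℤ.+-identityʳ (one i)))

EG-limit : ∀ k → E ✶ Gk (suc k) ≡[ k ] E
EG-limit k = ≡[]-✶-one {k} {E} {Gk (suc k)} (≡[]-trans (ΣP-≡[] (Gterm (suc k)) ord) (≋⇒≡[] (R.trans (R.reflexive (cong (λ e → sh e one) (ℕ.*-zeroʳ (suc k)))) (sh-0 one))))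
  where
  ord : ∀ n → Ord (suc k) (Gterm (suc k) (suc n))
  ord n = Ord-mono (ℕ.≤-trans (ℕ.m≤m*n (suc k) (suc n)) (ℕ.m≤n+m (suc k ℕ.* suc n) (suc n ℕ.* suc n))) (Ord-sh (suc n ℕ.* suc n ℕ.+ suc k ℕ.* suc n) (invPoch (suc n)))

-- The difference of the two sides satisfies D k = D (k+1) + q^(k+1) D (k+2). By strong induction on
-- i, for all k at once, the last term contributes nothing at q^i. So this coefficient is the same
-- for all k, and it vanishes for large k since both sides tend to `E`.
rogers-ramanujan : ∀ k → E ✶ Gk k ≋ rr-theta k
rogers-ramanujan k = ⊖-zero (pw λ i → below (suc i) i ℕ.≤-refl k)
  where
  D : ℕ → PS
  D k = E ✶ Gk k ⊖ rr-theta k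
  D-rec : ∀ k → D k ≋ D (suc k) ⊕ sh (suc k) (D (suc (suc k)))
  D-rec k = R.trans (⊖-cong (R.*-congˡ {E} (Gk-rec k)) (T-rec k)) (R.trans
    (solve 6 (λ e a y b c d → e :* (a :+ y :* b) :- (c :+ y :* d) := (e :* a :- c) :+ y :* (e :* b :- d)) R.refl
      E (Gk (suc k)) (pow q (suc k)) (Gk (suc (suc k))) (rr-theta (suc k)) (rr-theta (suc (suc k))))
    (R.+-congˡ {D (suc k)} (R.trans (R.*-congʳ {D (suc (suc k))} (pow-q (suc k))) (R.sym (sh-qp (suc k) (D (suc (suc k))))))))
  D-limit : ∀ k → Ord (suc k) (D (suc k))
  D-limit k i (s≤s i≤k) = trans (cong₂ _-_ (EG-limit k i i≤k) (T-limit k i i≤k)) (ℤ.+-inverseʳ (E i))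
  below : ∀ n i → i ℕ.< n → ∀ k → D k i ≡ 0ℤ
  below (suc n) i (s≤s i≤n) k = up k
    where
    step : ∀ k → D k i ≡ D (suc k) i
    step k = trans (at (D-rec k) i) (trans (cong (_+_ (D (suc k) i)) small) (ℤ.+-identityʳ (D (suc k) i)))
      where
      small : sh (suc k) (D (suc (suc k))) i ≡ 0ℤ
      small with ℕ.<-≤-connex i (suc k)
      ... | inj₁ l = sh-> (suc k) (D (suc (suc k))) l
      ... | inj₂ l = trans (sh-≤ (suc k) (D (suc (suc k))) l) (below n (i ℕ.∸ suc k) (ℕ.<-≤-trans (ℕ.∸-monoʳ-< {i} {suc k} {0} (s≤s z≤n) l) i≤n) (suc (suc k)))
    up : ∀ k → D k i ≡ 0ℤ
    up k = trans (go (suc i)) (D-limit (i ℕ.+ k) i (s≤s (ℕ.m≤m+n i k)))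
      where
      go : ∀ d → D k i ≡ D (d ℕ.+ k) i
      go zero    = refl
      go (suc d) = trans (go d) (step (d ℕ.+ k))

Gk-0 : Gk 0 ≋ G
Gk-0 = ΣP-cong (λ n → R.reflexive (cong (λ e → sh e (invPoch n)) (ℕ.+-identityʳ (n ℕ.* n))))

Gk-1 : Gk 1 ≋ H
Gk-1 = ΣP-cong (λ n → R.reflexive (cong (λ e → sh e (invPoch n)) (lem n)))
  where
  lem : ∀ n → n ℕ.* n ℕ.+ 1 ℕ.* n ≡ n ℕ.* suc n
  lem = ℕ-Solver.solve-∀

-- Ramanujan's theta functions f(sq^i, sq^j) with s = ±1

module Theta (s : ℤ) (s² : s * s ≡ 1ℤ) (i j : ℕ) .{{_ : NonZero i}} .{{_ : NonZero j}} where
  private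
    a b p : PS
    a = sc s (qp i)
    b = sc s (qp j)
    p = qp (i ℕ.+ j)
    ab≋p : a ✶ b ≋ p
    ab≋p = R.trans (sc-✶-sc s s (qp i) (qp j)) (R.trans (pw λ n → trans (cong (_* (qp i ✶ qp j) n) s²) (ℤ.*-identityˡ ((qp i ✶ qp j) n))) (R.sym (qp-+ i j)))
    pow-p : ∀ n → pow p n ≋ qp (n ℕ.* (i ℕ.+ j))
    pow-p zero    = R.sym qp-0
    pow-p (suc n) = R.trans (R.*-congʳ {p} (pow-p n)) (R.trans (R.*-comm (qp (n ℕ.* (i ℕ.+ j))) p) (R.sym (qp-+ (i ℕ.+ j) (n ℕ.* (i ℕ.+ j)))))

  open TripleProduct a b p ab≋p public using (half; full)
  open TripleProduct a b p ab≋p hiding (half; full)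

  -- The value is cn + (i + j)n(n - 1)/2, accumulated stepwise to avoid halving.
  ex : ℕ → ℕ → ℕ
  ex c zero    = 0
  ex c (suc n) = ex c n ℕ.+ (c ℕ.+ n ℕ.* (i ℕ.+ j))

  sg : ℕ → ℤ
  sg zero    = 1ℤ
  sg (suc n) = sg n * s

  half-mono : ∀ c n → half (sc s (qp c)) n ≋ sc (sg n) (qp (ex c n))
  half-mono c zero    = R.sym (R.trans (sc1 (qp 0)) qp-0)
  half-mono c (suc n) = R.trans (R.*-cong (half-mono c n) (R.trans (sc-✶ s (qp c) (pow p n)) (sc-cong s
      (R.trans (R.*-congˡ {qp c} (pow-p n)) (R.sym (qp-+ c (n ℕ.* (i ℕ.+ j))))))))
    (R.trans (sc-✶-sc (sg n) s (qp (ex c n)) (qp (c ℕ.+ n ℕ.* (i ℕ.+ j))))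
    (sc-cong (sg n * s) (R.sym (qp-+ (ex c n) (c ℕ.+ n ℕ.* (i ℕ.+ j))))))

  Ord-sc : ∀ {k f} c → Ord k f → Ord k (sc c f)
  Ord-sc c o i i<k = trans (cong (c *_) (o i i<k)) (ℤ.*-zeroʳ c)

  n≤ex : ∀ c .{{_ : NonZero c}} n → n ℕ.≤ ex c n
  n≤ex c zero    = z≤n
  n≤ex c (suc n) = ℕ.≤-trans (ℕ.≤-reflexive (ℕ.+-comm 1 n)) (ℕ.+-mono-≤ (n≤ex c n) (ℕ.≤-trans (ℕ.>-nonZero⁻¹ c) (ℕ.m≤m+n c (n ℕ.* (i ℕ.+ j)))))

  half-ord : ∀ c .{{_ : NonZero c}} n → Ord n (half (sc s (qp c)) n)
  half-ord c n = Ord-≋ (R.sym (half-mono c n)) (Ord-sc (sg n) (Ord-mono (n≤ex c n) (Ord-qp (ex c n))))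

  private
    m≢0 : NonZero (i ℕ.+ j)
    m≢0 = ℕ.>-nonZero (ℕ.≤-trans (ℕ.>-nonZero⁻¹ i) (ℕ.m≤m+n i j))
    small : ∀ n → Ord (suc n) (pow p (suc n))
    small n = Ord-≋ (R.sym (pow-p (suc n))) (Ord-mono (ℕ.m≤m*n (suc n) (i ℕ.+ j) {{m≢0}}) (Ord-qp (suc n ℕ.* (i ℕ.+ j))))
    fac-form : ∀ c k → one ⊕ sc s (qp c) ✶ pow p k ≋ fac s (c ℕ.+ k ℕ.* (i ℕ.+ j))
    fac-form c k = R.+-congˡ {one} (R.trans (sc-✶ s (qp c) (pow p k)) (sc-cong s (R.trans (R.*-congˡ {qp c} (pow-p k)) (R.sym (qp-+ c (k ℕ.* (i ℕ.+ j)))))))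
    near-form : ∀ c .{{_ : NonZero c}} → NearOne (λ k → one ⊕ sc s (qp c) ✶ pow p k)
    near-form c {{nz}} k = ≡[]-trans (≋⇒≡[] (fac-form c k)) (near s c (i ℕ.+ j) {{nz}} {{m≢0}} k)

  -- Coefficient n is read off the window of indices from -n to n, which suffices because the term
  -- of index k has order at least |k|.
  bil : PS
  bil n = adsum (n ℕ.+ n) (λ j _ → full n j) n

  jacobi : br s i (i ℕ.+ j) ✶ br s j (i ℕ.+ j) ✶ br -1ℤ (i ℕ.+ j) (i ℕ.+ j) ≋ bil
  jacobi = R.trans (R.sym (R.*-cong (R.*-cong (∏-cong (fac-form i)) (∏-cong (fac-form j)))
      (∏-cong (λ k → R.trans (⊖-cong (R.refl {one}) (pow-p (suc k))) (R.+-congˡ {one} (R.sym (sc-1 (qp (suc k ℕ.* (i ℕ.+ j))))))))))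
    (pw λ N → triple-product small (near-form i) (near-form j) (half-ord i) (half-ord j) N N ℕ.≤-refl)

  bil-halves : bil ≋ ΣP (half a) ⊕ ΣP (λ n → half b (suc n))
  bil-halves .at N = trans (go N) (cong (_+_ (ΣP (half a) N)) last)
    where
    usum : ℕ → ℤ
    usum zero    = 0ℤ
    usum (suc L) = usum L + half b (suc L) N
    lem : ∀ x y z → x + (y + z) ≡ y + (z + x)
    lem = solve-∀
    go : ∀ L → adsum (L ℕ.+ N) (λ j _ → full L j) N ≡ ΣP (half a) N + usum L
    go zero    = trans (adsum-sumTo N (half a) N) (sym (ℤ.+-identityʳ (ΣP (half a) N)))
    go (suc L) = trans (cong (_+_ (half b (suc L) N)) (go L)) (lem (half b (suc L) N) (ΣP (half a) N) (usum L))
    sums : ∀ L → usum (suc L) ≡ sumTo L (λ n → half b (suc n) N)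
    sums zero    = ℤ.+-identityˡ (half b 1 N)
    sums (suc L) = cong (_+ half b (suc (suc L)) N) (sums L)
    last : usum N ≡ sumTo N (λ n → half b (suc n) N)
    last = trans (sym (trans (cong (_+_ (usum N)) (half-ord j (suc N) N ℕ.≤-refl)) (ℤ.+-identityʳ (usum N)))) (sums N)

-- f₂ = f(-q²,-q³) and f₁ = f(-q,-q⁴) in Ramanujan's notation.
module f₂ = Theta -1ℤ refl 3 2
module f₁ = Theta -1ℤ refl 4 1

pow-q⁵ : ∀ n → pow (qp 5) n ≋ (let x = pow q n in x ✶ x ✶ x ✶ x ✶ x)
pow-q⁵ zero    = ×-solve 0 (ε :≈ ε · ε · ε · ε · ε) R.refl
pow-q⁵ (suc n) = R.trans (R.*-cong (pow-q⁵ n) (R.sym (pow-q 5)))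
  (×-solve 2 (λ x q → x · x · x · x · x · (ε · q · q · q · q · q) :≈ x · q · (x · q) · (x · q) · (x · q) · (x · q)) R.refl (pow q n) q)

-q^ : ℕ → PS
-q^ c = sc -1ℤ (qp c)

private
  -q^≋ : ∀ c → -q^ c ≋ ⊝ pow q c
  -q^≋ c = R.trans (sc-1 (qp c)) (R.-‿cong (R.sym (pow-q c)))

  step : ∀ c n → -q^ c ✶ pow (qp 5) n ≋ (let x = pow q n in ⊝ pow q c ✶ (x ✶ x ✶ x ✶ x ✶ x))
  step c n = R.*-cong (-q^≋ c) (pow-q⁵ n)

  pull : ∀ m c z → m ✶ (⊝ c ✶ z) ≋ ⊝ (m ✶ (c ✶ z))
  pull = solve 3 (λ m c z → m :* ((:- c) :* z) := :- (m :* (c :* z))) R.refl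

  pull₂ : ∀ m c z → ⊝ m ✶ (⊝ c ✶ z) ≋ m ✶ (c ✶ z)
  pull₂ = solve 3 (λ m c z → (:- m) :* ((:- c) :* z) := m :* (c :* z)) R.refl

  push₂ : ∀ m z → m ✶ z ≋ ⊝ (⊝ m ✶ z)
  push₂ = solve 2 (λ m z → m :* z := :- ((:- m) :* z)) R.refl

-- The two terms of w(1 - x⁴y²) at k = 0 are the terms of index n and -(n + 1) of the bilateral
-- series; for `H` the two terms of wx(1 - x²y) play the same parts.
EG≋f₂ : E ✶ G ≋ f₂.bil
EG≋f₂ = R.trans (R.*-congˡ {E} (R.sym Gk-0)) (R.trans (rogers-ramanujan 0) (R.trans (ΣP-cong term)
  (R.trans (ΣP-⊕ (f₂.half (-q^ 3)) (λ n → f₂.half (-q^ 2) (suc n))) (R.sym f₂.bil-halves))))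
  where
  y = pow q 1
  x⁵ : ℕ → PS
  x⁵ n = let x = pow q n in x ✶ x ✶ x ✶ x ✶ x
  pos : ∀ n → f₂.half (-q^ 3) n ≋ mono 0 n
  pos zero    = R.refl
  pos (suc n) = R.trans (R.*-cong (pos n) (step 3 n)) (R.trans (pull (mono 0 n) (pow q 3) (x⁵ n)) (R.-‿cong
    (×-solve 3 (λ m x q → m · ((ε · q · q · q) · (x · x · x · x · x)) :≈ m · (x · x · x · x · x · (ε · q) · (ε · q) · q)) R.refl (mono 0 n) (pow q n) q)))
  neg : ∀ n → f₂.half (-q^ 2) (suc n) ≋ (let x = pow q n in ⊝ (mono 0 n ✶ (x ✶ x ✶ x ✶ x ✶ y ✶ y)))
  neg zero    = R.trans (R.*-congˡ {one} (step 2 0)) (R.trans (pull one (pow q 2) (x⁵ 0)) (R.-‿cong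
    (×-solve 1 (λ q → ε · ((ε · q · q) · (ε · ε · ε · ε · ε)) :≈ ε · (ε · ε · ε · ε · (ε · q) · (ε · q))) R.refl q)))
  neg (suc n) = R.trans (R.*-cong (neg n) (step 2 (suc n))) (R.trans (pull₂ (mono 0 n ✶ (x ✶ x ✶ x ✶ x ✶ y ✶ y)) (pow q 2) (x⁵ (suc n)))
    (R.trans (×-solve 3 (λ m x q → m · (x · x · x · x · (ε · q) · (ε · q)) · ((ε · q · q) · (x · q · (x · q) · (x · q) · (x · q) · (x · q)))
       :≈ m · (x · x · x · x · x · (ε · q) · (ε · q) · q) · (x · q · (x · q) · (x · q) · (x · q) · (ε · q) · (ε · q))) R.refl (mono 0 n) x q)
    (push₂ (mono 0 n ✶ (x⁵ n ✶ y ✶ y ✶ q)) (let x = pow q (suc n) in x ✶ x ✶ x ✶ x ✶ y ✶ y))))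
    where x = pow q n
  term : ∀ n → w 0 n ✶ (let x = pow q n in one ⊖ x ✶ x ✶ x ✶ x ✶ y ✶ y) ≋ f₂.half (-q^ 3) n ⊕ f₂.half (-q^ 2) (suc n)
  term n = R.trans (solve 2 (λ m z → m :* con 1ℤ :* (con 1ℤ :- z) := m :+ (:- (m :* z))) R.refl (mono 0 n) (let x = pow q n in x ✶ x ✶ x ✶ x ✶ y ✶ y))
    (R.sym (R.+-cong (pos n) (neg n)))

EH≋f₁ : E ✶ H ≋ f₁.bil
EH≋f₁ = R.trans (R.*-congˡ {E} (R.sym Gk-1)) (R.trans (rogers-ramanujan 1) (R.trans (ΣP-cong term)
  (R.trans (ΣP-⊕ (f₁.half (-q^ 4)) (λ n → f₁.half (-q^ 1) (suc n))) (R.sym f₁.bil-halves))))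
  where
  y = pow q 1
  x⁵ : ℕ → PS
  x⁵ n = let x = pow q n in x ✶ x ✶ x ✶ x ✶ x
  pos : ∀ n → f₁.half (-q^ 4) n ≋ mono 0 n ✶ pow q n
  pos zero    = R.sym (R.*-identityˡ one)
  pos (suc n) = R.trans (R.*-cong (pos n) (step 4 n)) (R.trans (pull (mono 0 n ✶ pow q n) (pow q 4) (x⁵ n)) (R.trans (R.-‿cong
    (×-solve 3 (λ m x q → m · x · ((ε · q · q · q · q) · (x · x · x · x · x)) :≈ m · (x · x · x · x · x · (ε · q) · (ε · q) · q) · (x · q)) R.refl (mono 0 n) (pow q n) q))
    (solve 2 (λ a b → :- (a :* b) := (:- a) :* b) R.refl (mono 0 n ✶ (x⁵ n ✶ y ✶ y ✶ q)) (pow q (suc n)))))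
  neg : ∀ n → f₁.half (-q^ 1) (suc n) ≋ (let x = pow q n in ⊝ (mono 0 n ✶ (x ✶ (x ✶ x ✶ y))))
  neg zero    = R.trans (R.*-congˡ {one} (step 1 0)) (R.trans (pull one y (x⁵ 0)) (R.-‿cong
    (×-solve 1 (λ y → ε · (y · (ε · ε · ε · ε · ε)) :≈ ε · (ε · (ε · ε · y))) R.refl y)))
  neg (suc n) = R.trans (R.*-cong (neg n) (step 1 (suc n))) (R.trans (pull₂ (mono 0 n ✶ (x ✶ (x ✶ x ✶ y))) y (x⁵ (suc n)))
    (R.trans (×-solve 3 (λ m x q → m · (x · (x · x · (ε · q))) · ((ε · q) · (x · q · (x · q) · (x · q) · (x · q) · (x · q)))
       :≈ m · (x · x · x · x · x · (ε · q) · (ε · q) · q) · (x · q · (x · q · (x · q) · (ε · q)))) R.refl (mono 0 n) x q)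
    (push₂ (mono 0 n ✶ (x⁵ n ✶ y ✶ y ✶ q)) (let x = pow q (suc n) in x ✶ (x ✶ x ✶ y)))))
    where x = pow q n
  term : ∀ n → w 0 n ✶ (let x = pow q n in x ✶ (one ⊖ x ✶ x ✶ y)) ≋ f₁.half (-q^ 4) n ⊕ f₁.half (-q^ 1) (suc n)
  term n = R.trans (solve 3 (λ m x z → m :* con 1ℤ :* (x :* (con 1ℤ :- z)) := m :* x :+ (:- (m :* (x :* z)))) R.refl (mono 0 n) (pow q n) (pow q n ✶ pow q n ✶ y))
    (R.sym (R.+-cong (pos n) (neg n)))

-- Product formulas by sorting residue classes modulo 10 and 20

br-split5 : ∀ s i m .{{_ : NonZero i}} .{{_ : NonZero m}} → br s i m ≋
  br s i (5 ℕ.* m) ✶ br s (i ℕ.+ m) (5 ℕ.* m) ✶ br s (i ℕ.+ 2 ℕ.* m) (5 ℕ.* m) ✶ br s (i ℕ.+ 3 ℕ.* m) (5 ℕ.* m) ✶ br s (i ℕ.+ 4 ℕ.* m) (5 ℕ.* m)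
br-split5 s i@(suc _) m@(suc _) = R.trans (∏-regroup 5 (near s i m)) (R.trans (∏-cong stp)
  (R.trans (∏-✶ N₀₁₂₃ (near s (i ℕ.+ 4 ℕ.* m) (5 ℕ.* m))) (R.*-congʳ {br s (i ℕ.+ 4 ℕ.* m) (5 ℕ.* m)}
  (R.trans (∏-✶ N₀₁₂ (near s (i ℕ.+ 3 ℕ.* m) (5 ℕ.* m))) (R.*-congʳ {br s (i ℕ.+ 3 ℕ.* m) (5 ℕ.* m)}
  (R.trans (∏-✶ N₀₁ (near s (i ℕ.+ 2 ℕ.* m) (5 ℕ.* m))) (R.*-congʳ {br s (i ℕ.+ 2 ℕ.* m) (5 ℕ.* m)}
  (∏-✶ (near s i (5 ℕ.* m)) (near s (i ℕ.+ m) (5 ℕ.* m))))))))))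
  where
  F : ℕ → ℕ → PS
  F c k = fac s (c ℕ.+ k ℕ.* (5 ℕ.* m))
  near-✶ : ∀ {A B} → NearOne A → NearOne B → NearOne (λ k → A k ✶ B k)
  near-✶ {A} {B} a b k = ≡[]-trans (≡[]-✶ (a k) (b k)) (≋⇒≡[] (R.*-identityˡ one))
  N₀₁ : NearOne (λ k → F i k ✶ F (i ℕ.+ m) k)
  N₀₁ = near-✶ (near s i (5 ℕ.* m)) (near s (i ℕ.+ m) (5 ℕ.* m))
  N₀₁₂ : NearOne (λ k → F i k ✶ F (i ℕ.+ m) k ✶ F (i ℕ.+ 2 ℕ.* m) k)
  N₀₁₂ = near-✶ N₀₁ (near s (i ℕ.+ 2 ℕ.* m) (5 ℕ.* m))
  N₀₁₂₃ : NearOne (λ k → F i k ✶ F (i ℕ.+ m) k ✶ F (i ℕ.+ 2 ℕ.* m) k ✶ F (i ℕ.+ 3 ℕ.* m) k)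
  N₀₁₂₃ = near-✶ N₀₁₂ (near s (i ℕ.+ 3 ℕ.* m) (5 ℕ.* m))
  e₀ : ∀ k m i → i ℕ.+ (k ℕ.* 5) ℕ.* m ≡ i ℕ.+ k ℕ.* (5 ℕ.* m)
  e₀ = ℕ-Solver.solve-∀
  e : ∀ r k m i → i ℕ.+ (r ℕ.+ k ℕ.* 5) ℕ.* m ≡ i ℕ.+ r ℕ.* m ℕ.+ k ℕ.* (5 ℕ.* m)
  e = ℕ-Solver.solve-∀
  f : ∀ r k → fac s (i ℕ.+ (r ℕ.+ k ℕ.* 5) ℕ.* m) ≋ F (i ℕ.+ r ℕ.* m) k
  f r k = R.reflexive (cong (fac s) (e r k m i))
  e₁ : ∀ k → fac s (i ℕ.+ (1 ℕ.+ k ℕ.* 5) ℕ.* m) ≋ F (i ℕ.+ m) k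
  e₁ k = R.trans (f 1 k) (R.reflexive (cong (λ z → F (i ℕ.+ z) k) (ℕ.*-identityˡ m)))
  stp : ∀ k → prodTo 5 (λ r → fac s (i ℕ.+ (r ℕ.+ k ℕ.* 5) ℕ.* m))
            ≋ F i k ✶ F (i ℕ.+ m) k ✶ F (i ℕ.+ 2 ℕ.* m) k ✶ F (i ℕ.+ 3 ℕ.* m) k ✶ F (i ℕ.+ 4 ℕ.* m) k
  stp k = R.trans (prodTo-5 (λ r → fac s (i ℕ.+ (r ℕ.+ k ℕ.* 5) ℕ.* m)))
    (✶-cong (✶-cong (✶-cong (✶-cong (R.reflexive (cong (fac s) (e₀ k m i))) (e₁ k)) (f 2 k)) (f 3 k)) (f 4 k))

-- φ(q), ψ(q) and Σ q^(5n²+bn) for b = 1, 2, 3, 4.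
module θ₀  = Theta 1ℤ refl 1 1
module θ₂  = Theta 1ℤ refl 3 1
module θ₅₁ = Theta 1ℤ refl 6 4
module θ₅₂ = Theta 1ℤ refl 7 3
module θ₅₃ = Theta 1ℤ refl 8 2
module θ₅₄ = Theta 1ℤ refl 9 1

[_∶_] [_∶_]⁺ : ℕ → ℕ → PS
[ i ∶ m ]  = br -1ℤ i m
[ i ∶ m ]⁺ = br 1ℤ i m

E-dil : ∀ k .{{_ : NonZero k}} → dil k E ≋ [ k ∶ k ]
E-dil k = R.trans (dil-cong k E≋br) (R.trans (br-dil k -1ℤ 1 1) (R.reflexive (cong₂ [_∶_] (ℕ.*-identityˡ k) (ℕ.*-identityˡ k))))

E-split : E ≋ [ 1 ∶ 2 ] ✶ [ 2 ∶ 2 ]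
E-split = R.trans E≋br (br-split -1ℤ 1 1)

negE : negq E ≋ [ 1 ∶ 2 ]⁺ ✶ [ 2 ∶ 2 ]
negE = R.trans (negq-cong E-split) (R.trans (negq-✶ [ 1 ∶ 2 ] [ 2 ∶ 2 ]) (R.*-cong (R.sym (br-negq -1ℤ 1 1)) (R.sym (br-negq -1ℤ 2 1))))

-- Gauss's φ(q) = E(-q)²/E(q²). Together with ψ(q) = E(q²)²/E(q) and E(-q)E(q)E(q⁴) = E(q²)³ it
-- yields every eta quotient used later.
φE₂≋E⁻² : θ₀.bil ✶ dil 2 E ≋ negq E ✶ negq E
φE₂≋E⁻² = R.trans (R.*-cong (R.sym θ₀.jacobi) (E-dil 2)) (R.trans
  (×-solve 2 (λ a b → a · a · b · b :≈ (a · b) · (a · b)) R.refl [ 1 ∶ 2 ]⁺ [ 2 ∶ 2 ])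
  (R.sym (R.*-cong negE negE)))

ψE≋E₂² : θ₂.bil ✶ E ≋ dil 2 E ✶ dil 2 E
ψE≋E₂² = begin
  θ₂.bil ✶ E  ≈⟨ R.*-cong (R.sym θ₂.jacobi) E-split ⟩
  [ 3 ∶ 4 ]⁺ ✶ [ 1 ∶ 4 ]⁺ ✶ [ 4 ∶ 4 ] ✶ ([ 1 ∶ 2 ] ✶ [ 2 ∶ 2 ])  ≈⟨ ×-solve 5 (λ a b c d e → a · b · c · (d · e) :≈ (d · (b · a)) · c · e) R.refl [ 3 ∶ 4 ]⁺ [ 1 ∶ 4 ]⁺ [ 4 ∶ 4 ] [ 1 ∶ 2 ] [ 2 ∶ 2 ] ⟩
  [ 1 ∶ 2 ] ✶ ([ 1 ∶ 4 ]⁺ ✶ [ 3 ∶ 4 ]⁺) ✶ [ 4 ∶ 4 ] ✶ [ 2 ∶ 2 ]  ≈⟨ R.*-congʳ {[ 2 ∶ 2 ]} (R.*-congʳ {[ 4 ∶ 4 ]} (R.trans (R.*-congˡ {[ 1 ∶ 2 ]} (R.sym (br-split 1ℤ 1 2))) (br-± 1 2))) ⟩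
  [ 2 ∶ 4 ] ✶ [ 4 ∶ 4 ] ✶ [ 2 ∶ 2 ]  ≈⟨ R.*-congʳ {[ 2 ∶ 2 ]} (R.sym (br-split -1ℤ 2 2)) ⟩
  [ 2 ∶ 2 ] ✶ [ 2 ∶ 2 ]  ≈⟨ R.sym (R.*-cong (E-dil 2) (E-dil 2)) ⟩
  dil 2 E ✶ dil 2 E  ∎
  where open ≋-Reasoning

E⁻EE₄≋E₂³ : negq E ✶ E ✶ dil 4 E ≋ dil 2 E ✶ dil 2 E ✶ dil 2 E
E⁻EE₄≋E₂³ = begin
  negq E ✶ E ✶ dil 4 E  ≈⟨ R.*-cong (R.*-cong negE E-split) (E-dil 4) ⟩
  [ 1 ∶ 2 ]⁺ ✶ [ 2 ∶ 2 ] ✶ ([ 1 ∶ 2 ] ✶ [ 2 ∶ 2 ]) ✶ [ 4 ∶ 4 ]  ≈⟨ ×-solve 4 (λ a b c d → a · b · (c · b) · d :≈ (c · a) · d · b · b) R.refl [ 1 ∶ 2 ]⁺ [ 2 ∶ 2 ] [ 1 ∶ 2 ] [ 4 ∶ 4 ] ⟩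
  [ 1 ∶ 2 ] ✶ [ 1 ∶ 2 ]⁺ ✶ [ 4 ∶ 4 ] ✶ [ 2 ∶ 2 ] ✶ [ 2 ∶ 2 ]  ≈⟨ R.*-congʳ {[ 2 ∶ 2 ]} (R.*-congʳ {[ 2 ∶ 2 ]} (R.trans (R.*-congʳ {[ 4 ∶ 4 ]} (br-± 1 2)) (R.sym (br-split -1ℤ 2 2)))) ⟩
  [ 2 ∶ 2 ] ✶ [ 2 ∶ 2 ] ✶ [ 2 ∶ 2 ]  ≈⟨ R.sym (R.*-cong (R.*-cong (E-dil 2) (E-dil 2)) (E-dil 2)) ⟩
  dil 2 E ✶ dil 2 E ✶ dil 2 E  ∎
  where open ≋-Reasoning

br-✶-0 : ∀ i m i′ m′ → ([ i ∶ m ] ✶ [ i′ ∶ m′ ]) 0 ≢ 0ℤ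
br-✶-0 i m i′ m′ e with trans (sym (✶-at-0 [ i ∶ m ] [ i′ ∶ m′ ])) e
... | ()

f₂-mod10 : f₂.bil ≋ [ 3 ∶ 10 ] ✶ [ 8 ∶ 10 ] ✶ ([ 2 ∶ 10 ] ✶ [ 7 ∶ 10 ]) ✶ ([ 5 ∶ 10 ] ✶ [ 10 ∶ 10 ])
f₂-mod10 = R.trans (R.sym f₂.jacobi) (✶-cong (✶-cong (br-split -1ℤ 3 5) (br-split -1ℤ 2 5)) (br-split -1ℤ 5 5))

f₁-mod10 : f₁.bil ≋ [ 4 ∶ 10 ] ✶ [ 9 ∶ 10 ] ✶ ([ 1 ∶ 10 ] ✶ [ 6 ∶ 10 ]) ✶ ([ 5 ∶ 10 ] ✶ [ 10 ∶ 10 ])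
f₁-mod10 = R.trans (R.sym f₁.jacobi) (✶-cong (✶-cong (br-split -1ℤ 4 5) (br-split -1ℤ 1 5)) (br-split -1ℤ 5 5))

negq-✶₂ : ∀ {a b a′ b′} → negq a ≋ a′ → negq b ≋ b′ → negq (a ✶ b) ≋ a′ ✶ b′
negq-✶₂ {a} {b} p q = R.trans (negq-✶ a b) (✶-cong p q)

dil-✶₂ : ∀ k .{{_ : NonZero k}} {a b a′ b′} → dil k a ≋ a′ → dil k b ≋ b′ → dil k (a ✶ b) ≋ a′ ✶ b′
dil-✶₂ k {a} {b} p q = R.trans (dil-✶ k a b) (✶-cong p q)

neg-mod10 : ∀ i → negq [ i ∶ 10 ] ≋ br (sgn i * -1ℤ) i 10
neg-mod10 i = R.sym (br-negq -1ℤ i 5)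

negf₂ : negq f₂.bil ≋ [ 3 ∶ 10 ]⁺ ✶ [ 8 ∶ 10 ] ✶ ([ 2 ∶ 10 ] ✶ [ 7 ∶ 10 ]⁺) ✶ ([ 5 ∶ 10 ]⁺ ✶ [ 10 ∶ 10 ])
negf₂ = R.trans (negq-cong f₂-mod10) (negq-✶₂ (negq-✶₂ (negq-✶₂ (neg-mod10 3) (neg-mod10 8)) (negq-✶₂ (neg-mod10 2) (neg-mod10 7))) (negq-✶₂ (neg-mod10 5) (neg-mod10 10)))

negf₁ : negq f₁.bil ≋ [ 4 ∶ 10 ] ✶ [ 9 ∶ 10 ]⁺ ✶ ([ 1 ∶ 10 ]⁺ ✶ [ 6 ∶ 10 ]) ✶ ([ 5 ∶ 10 ]⁺ ✶ [ 10 ∶ 10 ])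
negf₁ = R.trans (negq-cong f₁-mod10) (negq-✶₂ (negq-✶₂ (negq-✶₂ (neg-mod10 4) (neg-mod10 9)) (negq-✶₂ (neg-mod10 1) (neg-mod10 6))) (negq-✶₂ (neg-mod10 5) (neg-mod10 10)))

φ-q² : PS
φ-q² = dil 2 (negq θ₀.bil)

-- φ(-q²) is (q²;q⁴)² (q⁴;q⁴), and each of these products is spread over five residue classes modulo
-- 20.
φ-q²-mod20 : φ-q² ≋ [ 2 ∶ 20 ] ✶ [ 6 ∶ 20 ] ✶ [ 10 ∶ 20 ] ✶ [ 14 ∶ 20 ] ✶ [ 18 ∶ 20 ] ✶ ([ 2 ∶ 20 ] ✶ [ 6 ∶ 20 ] ✶ [ 10 ∶ 20 ] ✶ [ 14 ∶ 20 ] ✶ [ 18 ∶ 20 ])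
                    ✶ ([ 4 ∶ 20 ] ✶ [ 8 ∶ 20 ] ✶ [ 12 ∶ 20 ] ✶ [ 16 ∶ 20 ] ✶ [ 20 ∶ 20 ])
φ-q²-mod20 = R.trans (dil-cong 2 (R.trans (negq-cong (R.sym θ₀.jacobi)) (negq-✶₂ (negq-✶₂ (R.sym (br-negq 1ℤ 1 1)) (R.sym (br-negq 1ℤ 1 1))) (R.sym (br-negq -1ℤ 2 1)))))
  (R.trans (dil-✶₂ 2 (dil-✶₂ 2 (br-dil 2 -1ℤ 1 2) (br-dil 2 -1ℤ 1 2)) (br-dil 2 -1ℤ 2 2))
  (✶-cong (✶-cong (br-split5 -1ℤ 2 4) (br-split5 -1ℤ 2 4)) (br-split5 -1ℤ 4 4)))

ψ-q : PS
ψ-q = negq θ₂.bil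

ψ-q-mod20 : ψ-q ≋ [ 1 ∶ 10 ] ✶ [ 3 ∶ 10 ] ✶ [ 5 ∶ 10 ] ✶ [ 7 ∶ 10 ] ✶ [ 9 ∶ 10 ] ✶ ([ 4 ∶ 20 ] ✶ [ 8 ∶ 20 ] ✶ [ 12 ∶ 20 ] ✶ [ 16 ∶ 20 ] ✶ [ 20 ∶ 20 ])
ψ-q-mod20 = R.trans (negq-cong (R.sym θ₂.jacobi)) (R.trans (negq-✶₂ (negq-✶₂ (R.sym (br-negq 1ℤ 3 2)) (R.sym (br-negq 1ℤ 1 2))) (R.sym (br-negq -1ℤ 4 2)))
  (✶-cong (R.trans (R.*-comm [ 3 ∶ 4 ] [ 1 ∶ 4 ]) (R.trans (R.sym (br-split -1ℤ 1 2)) (br-split5 -1ℤ 1 2))) (br-split5 -1ℤ 4 4)))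

-- The right side contains [6 ∶ 10]⁺ and [4 ∶ 10]⁺. Multiplying by the brackets with minus sign
-- turns them into brackets modulo 20 by `br-±`; both sides then consist of brackets modulo 20 and
-- one [10 ∶ 10], and are compared by sorting.
f₂f₂⁻ : f₂.bil ✶ negq f₂.bil ≋ φ-q² ✶ θ₅₁.bil
f₂f₂⁻ = ✶-cancelˡ ([ 6 ∶ 10 ] ✶ [ 4 ∶ 10 ]) (br-✶-0 6 10 4 10) (begin
  [ 6 ∶ 10 ] ✶ [ 4 ∶ 10 ] ✶ (f₂.bil ✶ negq f₂.bil)
    ≈⟨ R.*-congˡ {[ 6 ∶ 10 ] ✶ [ 4 ∶ 10 ]} (✶-cong f₂-mod10 negf₂) ⟩
  [ 6 ∶ 10 ] ✶ [ 4 ∶ 10 ] ✶ (([ 3 ∶ 10 ] ✶ [ 8 ∶ 10 ] ✶ ([ 2 ∶ 10 ] ✶ [ 7 ∶ 10 ]) ✶ ([ 5 ∶ 10 ] ✶ [ 10 ∶ 10 ])) ✶ ([ 3 ∶ 10 ]⁺ ✶ [ 8 ∶ 10 ] ✶ ([ 2 ∶ 10 ] ✶ [ 7 ∶ 10 ]⁺) ✶ ([ 5 ∶ 10 ]⁺ ✶ [ 10 ∶ 10 ])))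
    ≈⟨ ×-solve 11 (λ c6 c4 c3 c8 c2 c7 c5 c10 p3 p7 p5 → c6 · c4 · ((c3 · c8 · (c2 · c7) · (c5 · c10)) · (p3 · c8 · (c2 · p7) · (p5 · c10)))
         :≈ (c3 · p3) · (c7 · p7) · (c5 · p5) · c6 · c4 · c8 · c8 · c2 · c2 · c10 · c10) R.refl
         [ 6 ∶ 10 ] [ 4 ∶ 10 ] [ 3 ∶ 10 ] [ 8 ∶ 10 ] [ 2 ∶ 10 ] [ 7 ∶ 10 ] [ 5 ∶ 10 ] [ 10 ∶ 10 ] [ 3 ∶ 10 ]⁺ [ 7 ∶ 10 ]⁺ [ 5 ∶ 10 ]⁺ ⟩
  ([ 3 ∶ 10 ] ✶ [ 3 ∶ 10 ]⁺) ✶ ([ 7 ∶ 10 ] ✶ [ 7 ∶ 10 ]⁺) ✶ ([ 5 ∶ 10 ] ✶ [ 5 ∶ 10 ]⁺) ✶ [ 6 ∶ 10 ] ✶ [ 4 ∶ 10 ] ✶ [ 8 ∶ 10 ] ✶ [ 8 ∶ 10 ] ✶ [ 2 ∶ 10 ] ✶ [ 2 ∶ 10 ] ✶ [ 10 ∶ 10 ] ✶ [ 10 ∶ 10 ]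
    ≈⟨ R.*-congʳ {[ 10 ∶ 10 ]} (✶-cong (✶-cong (✶-cong (✶-cong (✶-cong (✶-cong (✶-cong (✶-cong (✶-cong (br-± 3 10) (br-± 7 10)) (br-± 5 10)) (br-split -1ℤ 6 10)) (br-split -1ℤ 4 10))
         (br-split -1ℤ 8 10)) (br-split -1ℤ 8 10)) (br-split -1ℤ 2 10)) (br-split -1ℤ 2 10)) (br-split -1ℤ 10 10)) ⟩
  [ 6 ∶ 20 ] ✶ [ 14 ∶ 20 ] ✶ [ 10 ∶ 20 ] ✶ ([ 6 ∶ 20 ] ✶ [ 16 ∶ 20 ]) ✶ ([ 4 ∶ 20 ] ✶ [ 14 ∶ 20 ]) ✶ ([ 8 ∶ 20 ] ✶ [ 18 ∶ 20 ]) ✶ ([ 8 ∶ 20 ] ✶ [ 18 ∶ 20 ]) ✶ ([ 2 ∶ 20 ] ✶ [ 12 ∶ 20 ]) ✶ ([ 2 ∶ 20 ] ✶ [ 12 ∶ 20 ]) ✶ ([ 10 ∶ 20 ] ✶ [ 20 ∶ 20 ]) ✶ [ 10 ∶ 10 ]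
    -- The letters b2, `f₁f₂₄`, b6, ... stand for the brackets of residues 2, 4, 6, ... modulo 20.
    -- The two factors in front recover [6 ∶ 10][6 ∶ 10]⁺ and [4 ∶ 10][4 ∶ 10]⁺.
    ≈⟨ ×-solve 11 (λ b2 f₁f₂₄ b6 b8 b10 b12 b14 b16 b18 b20 c → b6 · b14 · b10 · (b6 · b16) · (f₁f₂₄ · b14) · (b8 · b18) · (b8 · b18) · (b2 · b12) · (b2 · b12) · (b10 · b20) · c
         :≈ b12 · b8 · (b2 · b6 · b10 · b14 · b18 · (b2 · b6 · b10 · b14 · b18) · (f₁f₂₄ · b8 · b12 · b16 · b20) · c)) R.refl
         [ 2 ∶ 20 ] [ 4 ∶ 20 ] [ 6 ∶ 20 ] [ 8 ∶ 20 ] [ 10 ∶ 20 ] [ 12 ∶ 20 ] [ 14 ∶ 20 ] [ 16 ∶ 20 ] [ 18 ∶ 20 ] [ 20 ∶ 20 ] [ 10 ∶ 10 ] ⟩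
  _ ≈⟨ ✶-cong (R.sym (✶-cong (br-± 6 10) (br-± 4 10))) (R.*-congʳ {[ 10 ∶ 10 ]} (R.sym φ-q²-mod20)) ⟩
  ([ 6 ∶ 10 ] ✶ [ 6 ∶ 10 ]⁺) ✶ ([ 4 ∶ 10 ] ✶ [ 4 ∶ 10 ]⁺) ✶ (φ-q² ✶ [ 10 ∶ 10 ])
    ≈⟨ ×-solve 6 (λ a b c d φ t → (a · b) · (c · d) · (φ · t) :≈ a · c · (φ · (b · d · t))) R.refl [ 6 ∶ 10 ] [ 6 ∶ 10 ]⁺ [ 4 ∶ 10 ] [ 4 ∶ 10 ]⁺ φ-q² [ 10 ∶ 10 ] ⟩
  [ 6 ∶ 10 ] ✶ [ 4 ∶ 10 ] ✶ (φ-q² ✶ ([ 6 ∶ 10 ]⁺ ✶ [ 4 ∶ 10 ]⁺ ✶ [ 10 ∶ 10 ]))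
    ≈⟨ R.*-congˡ {[ 6 ∶ 10 ] ✶ [ 4 ∶ 10 ]} (R.*-congˡ {φ-q²} θ₅₁.jacobi) ⟩
  [ 6 ∶ 10 ] ✶ [ 4 ∶ 10 ] ✶ (φ-q² ✶ θ₅₁.bil) ∎)
  where open ≋-Reasoning

f₁f₁⁻ : f₁.bil ✶ negq f₁.bil ≋ φ-q² ✶ θ₅₃.bil
f₁f₁⁻ = ✶-cancelˡ ([ 8 ∶ 10 ] ✶ [ 2 ∶ 10 ]) (br-✶-0 8 10 2 10) (begin
  [ 8 ∶ 10 ] ✶ [ 2 ∶ 10 ] ✶ (f₁.bil ✶ negq f₁.bil)
    ≈⟨ R.*-congˡ {[ 8 ∶ 10 ] ✶ [ 2 ∶ 10 ]} (✶-cong f₁-mod10 negf₁) ⟩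
  [ 8 ∶ 10 ] ✶ [ 2 ∶ 10 ] ✶ (([ 4 ∶ 10 ] ✶ [ 9 ∶ 10 ] ✶ ([ 1 ∶ 10 ] ✶ [ 6 ∶ 10 ]) ✶ ([ 5 ∶ 10 ] ✶ [ 10 ∶ 10 ])) ✶ ([ 4 ∶ 10 ] ✶ [ 9 ∶ 10 ]⁺ ✶ ([ 1 ∶ 10 ]⁺ ✶ [ 6 ∶ 10 ]) ✶ ([ 5 ∶ 10 ]⁺ ✶ [ 10 ∶ 10 ])))
    ≈⟨ ×-solve 11 (λ c8 c2 c4 c9 c1 c6 c5 c10 p9 p1 p5 → c8 · c2 · ((c4 · c9 · (c1 · c6) · (c5 · c10)) · (c4 · p9 · (p1 · c6) · (p5 · c10)))
         :≈ (c9 · p9) · (c1 · p1) · (c5 · p5) · c8 · c2 · c4 · c4 · c6 · c6 · c10 · c10) R.refl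
         [ 8 ∶ 10 ] [ 2 ∶ 10 ] [ 4 ∶ 10 ] [ 9 ∶ 10 ] [ 1 ∶ 10 ] [ 6 ∶ 10 ] [ 5 ∶ 10 ] [ 10 ∶ 10 ] [ 9 ∶ 10 ]⁺ [ 1 ∶ 10 ]⁺ [ 5 ∶ 10 ]⁺ ⟩
  ([ 9 ∶ 10 ] ✶ [ 9 ∶ 10 ]⁺) ✶ ([ 1 ∶ 10 ] ✶ [ 1 ∶ 10 ]⁺) ✶ ([ 5 ∶ 10 ] ✶ [ 5 ∶ 10 ]⁺) ✶ [ 8 ∶ 10 ] ✶ [ 2 ∶ 10 ] ✶ [ 4 ∶ 10 ] ✶ [ 4 ∶ 10 ] ✶ [ 6 ∶ 10 ] ✶ [ 6 ∶ 10 ] ✶ [ 10 ∶ 10 ] ✶ [ 10 ∶ 10 ]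
    ≈⟨ R.*-congʳ {[ 10 ∶ 10 ]} (✶-cong (✶-cong (✶-cong (✶-cong (✶-cong (✶-cong (✶-cong (✶-cong (✶-cong (br-± 9 10) (br-± 1 10)) (br-± 5 10)) (br-split -1ℤ 8 10)) (br-split -1ℤ 2 10))
         (br-split -1ℤ 4 10)) (br-split -1ℤ 4 10)) (br-split -1ℤ 6 10)) (br-split -1ℤ 6 10)) (br-split -1ℤ 10 10)) ⟩
  [ 18 ∶ 20 ] ✶ [ 2 ∶ 20 ] ✶ [ 10 ∶ 20 ] ✶ ([ 8 ∶ 20 ] ✶ [ 18 ∶ 20 ]) ✶ ([ 2 ∶ 20 ] ✶ [ 12 ∶ 20 ]) ✶ ([ 4 ∶ 20 ] ✶ [ 14 ∶ 20 ]) ✶ ([ 4 ∶ 20 ] ✶ [ 14 ∶ 20 ]) ✶ ([ 6 ∶ 20 ] ✶ [ 16 ∶ 20 ]) ✶ ([ 6 ∶ 20 ] ✶ [ 16 ∶ 20 ]) ✶ ([ 10 ∶ 20 ] ✶ [ 20 ∶ 20 ]) ✶ [ 10 ∶ 10 ]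
    ≈⟨ ×-solve 11 (λ b2 f₁f₂₄ b6 b8 b10 b12 b14 b16 b18 b20 c → b18 · b2 · b10 · (b8 · b18) · (b2 · b12) · (f₁f₂₄ · b14) · (f₁f₂₄ · b14) · (b6 · b16) · (b6 · b16) · (b10 · b20) · c
         :≈ b16 · f₁f₂₄ · (b2 · b6 · b10 · b14 · b18 · (b2 · b6 · b10 · b14 · b18) · (f₁f₂₄ · b8 · b12 · b16 · b20) · c)) R.refl
         [ 2 ∶ 20 ] [ 4 ∶ 20 ] [ 6 ∶ 20 ] [ 8 ∶ 20 ] [ 10 ∶ 20 ] [ 12 ∶ 20 ] [ 14 ∶ 20 ] [ 16 ∶ 20 ] [ 18 ∶ 20 ] [ 20 ∶ 20 ] [ 10 ∶ 10 ] ⟩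
  _ ≈⟨ ✶-cong (R.sym (✶-cong (br-± 8 10) (br-± 2 10))) (R.*-congʳ {[ 10 ∶ 10 ]} (R.sym φ-q²-mod20)) ⟩
  ([ 8 ∶ 10 ] ✶ [ 8 ∶ 10 ]⁺) ✶ ([ 2 ∶ 10 ] ✶ [ 2 ∶ 10 ]⁺) ✶ (φ-q² ✶ [ 10 ∶ 10 ])
    ≈⟨ ×-solve 6 (λ a b c d φ t → (a · b) · (c · d) · (φ · t) :≈ a · c · (φ · (b · d · t))) R.refl [ 8 ∶ 10 ] [ 8 ∶ 10 ]⁺ [ 2 ∶ 10 ] [ 2 ∶ 10 ]⁺ φ-q² [ 10 ∶ 10 ] ⟩
  [ 8 ∶ 10 ] ✶ [ 2 ∶ 10 ] ✶ (φ-q² ✶ ([ 8 ∶ 10 ]⁺ ✶ [ 2 ∶ 10 ]⁺ ✶ [ 10 ∶ 10 ]))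
    ≈⟨ R.*-congˡ {[ 8 ∶ 10 ] ✶ [ 2 ∶ 10 ]} (R.*-congˡ {φ-q²} θ₅₃.jacobi) ⟩
  [ 8 ∶ 10 ] ✶ [ 2 ∶ 10 ] ✶ (φ-q² ✶ θ₅₃.bil) ∎)
  where open ≋-Reasoning

-- The odd residues make up those of ψ(-q) once the auxiliary brackets for 9 and 1 are added, and
-- they stay modulo 10; the even residues other than 10 are refined to modulo 20.
f₂f₁₄ : f₂.bil ✶ dil 4 f₁.bil ≋ ψ-q ✶ θ₅₄.bil
f₂f₁₄ = ✶-cancelˡ ([ 9 ∶ 10 ] ✶ [ 1 ∶ 10 ]) (br-✶-0 9 10 1 10) (begin
  [ 9 ∶ 10 ] ✶ [ 1 ∶ 10 ] ✶ (f₂.bil ✶ dil 4 f₁.bil)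
    ≈⟨ R.*-congˡ {[ 9 ∶ 10 ] ✶ [ 1 ∶ 10 ]} (✶-cong (R.trans f₂-mod10 (R.*-congʳ {[ 5 ∶ 10 ] ✶ [ 10 ∶ 10 ]} (✶-cong (R.*-congˡ {[ 3 ∶ 10 ]} (br-split -1ℤ 8 10)) (R.*-congʳ {[ 7 ∶ 10 ]} (br-split -1ℤ 2 10)))))
         (R.trans (dil-cong 4 (R.sym f₁.jacobi)) (dil-✶₂ 4 (dil-✶₂ 4 (br-dil 4 -1ℤ 4 5) (br-dil 4 -1ℤ 1 5)) (br-dil 4 -1ℤ 5 5)))) ⟩
  [ 9 ∶ 10 ] ✶ [ 1 ∶ 10 ] ✶ (([ 3 ∶ 10 ] ✶ ([ 8 ∶ 20 ] ✶ [ 18 ∶ 20 ]) ✶ (([ 2 ∶ 20 ] ✶ [ 12 ∶ 20 ]) ✶ [ 7 ∶ 10 ]) ✶ ([ 5 ∶ 10 ] ✶ [ 10 ∶ 10 ])) ✶ ([ 16 ∶ 20 ] ✶ [ 4 ∶ 20 ] ✶ [ 20 ∶ 20 ]))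
    ≈⟨ ×-solve 13 (λ c9 c1 c3 b8 b18 b2 b12 c7 c5 c10 b16 f₁f₂₄ b20 → c9 · c1 · ((c3 · (b8 · b18) · ((b2 · b12) · c7) · (c5 · c10)) · (b16 · f₁f₂₄ · b20))
         :≈ b18 · b2 · (c1 · c3 · c5 · c7 · c9 · (f₁f₂₄ · b8 · b12 · b16 · b20) · c10)) R.refl
         [ 9 ∶ 10 ] [ 1 ∶ 10 ] [ 3 ∶ 10 ] [ 8 ∶ 20 ] [ 18 ∶ 20 ] [ 2 ∶ 20 ] [ 12 ∶ 20 ] [ 7 ∶ 10 ] [ 5 ∶ 10 ] [ 10 ∶ 10 ] [ 16 ∶ 20 ] [ 4 ∶ 20 ] [ 20 ∶ 20 ] ⟩
  _ ≈⟨ ✶-cong (R.sym (✶-cong (br-± 9 10) (br-± 1 10))) (R.*-congʳ {[ 10 ∶ 10 ]} (R.sym ψ-q-mod20)) ⟩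
  ([ 9 ∶ 10 ] ✶ [ 9 ∶ 10 ]⁺) ✶ ([ 1 ∶ 10 ] ✶ [ 1 ∶ 10 ]⁺) ✶ (ψ-q ✶ [ 10 ∶ 10 ])
    ≈⟨ ×-solve 6 (λ a b c d φ t → (a · b) · (c · d) · (φ · t) :≈ a · c · (φ · (b · d · t))) R.refl [ 9 ∶ 10 ] [ 9 ∶ 10 ]⁺ [ 1 ∶ 10 ] [ 1 ∶ 10 ]⁺ ψ-q [ 10 ∶ 10 ] ⟩
  [ 9 ∶ 10 ] ✶ [ 1 ∶ 10 ] ✶ (ψ-q ✶ ([ 9 ∶ 10 ]⁺ ✶ [ 1 ∶ 10 ]⁺ ✶ [ 10 ∶ 10 ]))
    ≈⟨ R.*-congˡ {[ 9 ∶ 10 ] ✶ [ 1 ∶ 10 ]} (R.*-congˡ {ψ-q} θ₅₄.jacobi) ⟩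
  [ 9 ∶ 10 ] ✶ [ 1 ∶ 10 ] ✶ (ψ-q ✶ θ₅₄.bil) ∎)
  where open ≋-Reasoning

f₁f₂₄ : f₁.bil ✶ dil 4 f₂.bil ≋ ψ-q ✶ θ₅₂.bil
f₁f₂₄ = ✶-cancelˡ ([ 7 ∶ 10 ] ✶ [ 3 ∶ 10 ]) (br-✶-0 7 10 3 10) (begin
  [ 7 ∶ 10 ] ✶ [ 3 ∶ 10 ] ✶ (f₁.bil ✶ dil 4 f₂.bil)
    ≈⟨ R.*-congˡ {[ 7 ∶ 10 ] ✶ [ 3 ∶ 10 ]} (✶-cong (R.trans f₁-mod10 (R.*-congʳ {[ 5 ∶ 10 ] ✶ [ 10 ∶ 10 ]} (✶-cong (R.*-congʳ {[ 9 ∶ 10 ]} (br-split -1ℤ 4 10)) (R.*-congˡ {[ 1 ∶ 10 ]} (br-split -1ℤ 6 10)))))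
         (R.trans (dil-cong 4 (R.sym f₂.jacobi)) (dil-✶₂ 4 (dil-✶₂ 4 (br-dil 4 -1ℤ 3 5) (br-dil 4 -1ℤ 2 5)) (br-dil 4 -1ℤ 5 5)))) ⟩
  [ 7 ∶ 10 ] ✶ [ 3 ∶ 10 ] ✶ ((([ 4 ∶ 20 ] ✶ [ 14 ∶ 20 ]) ✶ [ 9 ∶ 10 ] ✶ ([ 1 ∶ 10 ] ✶ ([ 6 ∶ 20 ] ✶ [ 16 ∶ 20 ])) ✶ ([ 5 ∶ 10 ] ✶ [ 10 ∶ 10 ])) ✶ ([ 12 ∶ 20 ] ✶ [ 8 ∶ 20 ] ✶ [ 20 ∶ 20 ]))
    ≈⟨ ×-solve 13 (λ c7 c3 f₁f₂₄ b14 c9 c1 b6 b16 c5 c10 b12 b8 b20 → c7 · c3 · (((f₁f₂₄ · b14) · c9 · (c1 · (b6 · b16)) · (c5 · c10)) · (b12 · b8 · b20))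
         :≈ b14 · b6 · (c1 · c3 · c5 · c7 · c9 · (f₁f₂₄ · b8 · b12 · b16 · b20) · c10)) R.refl
         [ 7 ∶ 10 ] [ 3 ∶ 10 ] [ 4 ∶ 20 ] [ 14 ∶ 20 ] [ 9 ∶ 10 ] [ 1 ∶ 10 ] [ 6 ∶ 20 ] [ 16 ∶ 20 ] [ 5 ∶ 10 ] [ 10 ∶ 10 ] [ 12 ∶ 20 ] [ 8 ∶ 20 ] [ 20 ∶ 20 ] ⟩
  _ ≈⟨ ✶-cong (R.sym (✶-cong (br-± 7 10) (br-± 3 10))) (R.*-congʳ {[ 10 ∶ 10 ]} (R.sym ψ-q-mod20)) ⟩
  ([ 7 ∶ 10 ] ✶ [ 7 ∶ 10 ]⁺) ✶ ([ 3 ∶ 10 ] ✶ [ 3 ∶ 10 ]⁺) ✶ (ψ-q ✶ [ 10 ∶ 10 ])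
    ≈⟨ ×-solve 6 (λ a b c d φ t → (a · b) · (c · d) · (φ · t) :≈ a · c · (φ · (b · d · t))) R.refl [ 7 ∶ 10 ] [ 7 ∶ 10 ]⁺ [ 3 ∶ 10 ] [ 3 ∶ 10 ]⁺ ψ-q [ 10 ∶ 10 ] ⟩
  [ 7 ∶ 10 ] ✶ [ 3 ∶ 10 ] ✶ (ψ-q ✶ ([ 7 ∶ 10 ]⁺ ✶ [ 3 ∶ 10 ]⁺ ✶ [ 10 ∶ 10 ]))
    ≈⟨ R.*-congˡ {[ 7 ∶ 10 ] ✶ [ 3 ∶ 10 ]} (R.*-congˡ {ψ-q} θ₅₂.jacobi) ⟩
  [ 7 ∶ 10 ] ✶ [ 3 ∶ 10 ] ✶ (ψ-q ✶ θ₅₂.bil) ∎)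
  where open ≋-Reasoning

-- Theta series of binary quadratic polynomials

private variable
  I₁ I₂ I₃ : Set

sumL : (I₁ → ℤ) → List I₁ → ℤ
sumL f []       = 0ℤ
sumL f (x ∷ xs) = f x + sumL f xs

sumL-cong : ∀ {f g : I₁ → ℤ} → f ≗ g → ∀ xs → sumL f xs ≡ sumL g xs
sumL-cong e []       = refl
sumL-cong e (x ∷ xs) = cong₂ _+_ (e x) (sumL-cong e xs)

sumL-map : ∀ (f : I₂ → ℤ) (h : I₁ → I₂) xs → sumL f (map h xs) ≡ sumL (f ∘ h) xs
sumL-map f h []       = refl
sumL-map f h (x ∷ xs) = cong (_+_ (f (h x))) (sumL-map f h xs)

sumL-++ : ∀ (f : I₁ → ℤ) xs ys → sumL f (xs ++ ys) ≡ sumL f xs + sumL f ys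
sumL-++ f []       ys = sym (ℤ.+-identityˡ (sumL f ys))
sumL-++ f (x ∷ xs) ys = trans (cong (_+_ (f x)) (sumL-++ f xs ys)) (sym (ℤ.+-assoc (f x) (sumL f xs) (sumL f ys)))

sumL-↭ : ∀ (f : I₁ → ℤ) {xs ys} → xs ↭ ys → sumL f xs ≡ sumL f ys
sumL-↭ f Perm.refl          = refl
sumL-↭ f (Perm.prep x p)    = cong (_+_ (f x)) (sumL-↭ f p)
sumL-↭ f (Perm.swap {xs} {ys} x y p) = trans (cong (λ z → f x + (f y + z)) (sumL-↭ f p)) (lem (f x) (f y) (sumL f ys))
  where
  lem : ∀ a b c → a + (b + c) ≡ b + (a + c)
  lem = solve-∀
sumL-↭ f (Perm.trans p p′)  = trans (sumL-↭ f p) (sumL-↭ f p′)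

sumL-cartesian : ∀ (f : I₁ × I₂ → ℤ) xs ys → sumL f (cartesianProduct xs ys) ≡ sumL (λ x → sumL (λ y → f (x , y)) ys) xs
sumL-cartesian f []       ys = refl
sumL-cartesian f (x ∷ xs) ys = trans (sumL-++ f (map (x ,_) ys) (cartesianProduct xs ys))
  (cong₂ _+_ (sumL-map f (x ,_) ys) (sumL-cartesian f xs ys))

sumL-downFrom : ∀ n (f : ℕ → ℤ) → sumL f (downFrom (suc n)) ≡ sumTo n f
sumL-downFrom zero    f = ℤ.+-identityʳ (f 0)
sumL-downFrom (suc n) f = trans (cong (_+_ (f (suc n))) (sumL-downFrom n f)) (ℤ.+-comm (f (suc n)) (sumTo n f))

-- A sum over an infinite index set, witnessed by any duplicate-free list that contains the support.
-- Sums over different boxes can then be compared and reindexed without matching their ranges.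
record HasSum (f : I₁ → ℤ) (s : ℤ) : Set where
  constructor hasSum
  field
    supp    : List I₁
    uniq    : Unique supp
    support : ∀ i → f i ≢ 0ℤ → i ∈ supp
    total   : sumL f supp ≡ s

-- After the indices with value 0 are dropped, both lists enumerate the support without repetition,
-- so they are permutations of each other.
HasSum-unique : ∀ {f : I₁ → ℤ} {s s′} → HasSum f s → HasSum f s′ → s ≡ s′
HasSum-unique {f = f} (hasSum xs ux cx tx) (hasSum ys uy cy ty) =
  trans (sym tx) (trans (sym (drop xs)) (trans (sumL-↭ f perm) (trans (drop ys) ty)))
  where
  nz? : ∀ i → _
  nz? i = ¬? (f i ℤ.≟ 0ℤ)
  drop : ∀ xs → sumL f (filter nz? xs) ≡ sumL f xs
  drop []       = refl
  drop (x ∷ xs) with f x ℤ.≟ 0ℤ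
  ... | yes e = trans (drop xs) (sym (trans (cong (_+ sumL f xs) e) (ℤ.+-identityˡ (sumL f xs))))
  ... | no  _ = cong (_+_ (f x)) (drop xs)
  perm : filter nz? xs ↭ filter nz? ys
  perm = ∼bag⇒↭ (unique∧set⇒bag (Unique.filter⁺ nz? ux) (Unique.filter⁺ nz? uy)
    (mk⇔ (λ p → ∈-filter⁺ nz? (cy _ (proj₂ (∈-filter⁻ nz? {xs = xs} p))) (proj₂ (∈-filter⁻ nz? {xs = xs} p)))
         (λ p → ∈-filter⁺ nz? (cx _ (proj₂ (∈-filter⁻ nz? {xs = ys} p))) (proj₂ (∈-filter⁻ nz? {xs = ys} p)))))

HasSum-cong : ∀ {f g : I₁ → ℤ} {s} → f ≗ g → HasSum f s → HasSum g s
HasSum-cong e (hasSum xs u c t) = hasSum xs u (λ i ne → c i (λ z → ne (trans (sym (e i)) z))) (trans (sym (sumL-cong e xs)) t)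

HasSum-*ˡ : ∀ {f : I₁ → ℤ} {s} c → HasSum f s → HasSum (λ i → c * f i) (c * s)
HasSum-*ˡ {f = f} c (hasSum xs u o t) = hasSum xs u (λ i ne → o i (λ z → ne (trans (cong (c *_) z) (ℤ.*-zeroʳ c))))
  (trans (go xs) (cong (c *_) t))
  where
  go : ∀ xs → sumL (λ i → c * f i) xs ≡ c * sumL f xs
  go []       = sym (ℤ.*-zeroʳ c)
  go (x ∷ xs) = trans (cong (_+_ (c * f x)) (go xs)) (sym (ℤ.*-distribˡ-+ c (f x) (sumL f xs)))

HasSum-bij : ∀ {f : I₂ → ℤ} {s} (φ : I₁ → I₂) (φ⁻ : I₂ → I₁) → (∀ j → φ (φ⁻ j) ≡ j) → (∀ {i i′} → φ i ≡ φ i′ → i ≡ i′) →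
  HasSum f s → HasSum (f ∘ φ) s
HasSum-bij {f = f} φ φ⁻ sec inj (hasSum xs u c t) = hasSum (map φ⁻ xs)
  (Unique.map⁺ (λ {x} {y} e → trans (sym (sec x)) (trans (cong φ e) (sec y))) u)
  (λ i ne → subst (_∈ map φ⁻ xs) (inj (sec (φ i))) (∈-map⁺ φ⁻ (c (φ i) ne)))
  (trans (sumL-map (f ∘ φ) φ⁻ xs) (trans (sumL-cong (λ j → cong f (sec j)) xs) t))

sumFin : ∀ {p} → (Fin p → ℤ) → ℤ
sumFin {zero}  s = 0ℤ
sumFin {suc p} s = s zero + sumFin (s ∘ suc)

HasSum-Fin : ∀ {p} {f : Fin p × I₁ → ℤ} {s : Fin p → ℤ} → (∀ k → HasSum (λ x → f (k , x)) (s k)) → HasSum f (sumFin s)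
HasSum-Fin {p = zero}  h = hasSum [] [] (λ { (() , _) }) refl
HasSum-Fin {I₁ = I₁} {p = suc p} {f} {s} h = hasSum (map first (supp (h zero)) ++ map later (supp rest))
  (Unique.++⁺ (Unique.map⁺ (cong proj₂) (uniq (h zero))) (Unique.map⁺ later-inj (uniq rest)) disjoint)
  covered
  (trans (sumL-++ f (map first (supp (h zero))) (map later (supp rest)))
    (cong₂ _+_ (trans (sumL-map f first (supp (h zero))) (total (h zero))) (trans (sumL-map f later (supp rest)) (total rest))))
  where
  open HasSum
  first : I₁ → Fin (suc p) × I₁
  first x = zero , x
  later : Fin p × I₁ → Fin (suc p) × I₁
  later (k , x) = suc k , x
  later-inj : ∀ {x y} → later x ≡ later y → x ≡ y
  later-inj refl = refl
  rest : HasSum (f ∘ later) (sumFin (s ∘ suc))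
  rest = HasSum-Fin (λ k → h (suc k))
  disjoint : ∀ {v} → ¬ (v ∈ map first (supp (h zero)) × v ∈ map later (supp rest))
  disjoint (a , b) with ∈-map⁻ first a | ∈-map⁻ later b
  ... | _ , _ , refl | _ , _ , ()
  covered : ∀ i → f i ≢ 0ℤ → i ∈ map first (supp (h zero)) ++ map later (supp rest)
  covered (zero  , x) ne = ∈-++⁺ˡ (∈-map⁺ first (support (h zero) x ne))
  covered (suc k , x) ne = ∈-++⁺ʳ (map first (supp (h zero))) (∈-map⁺ later (support rest (k , x) ne))

module _ (p : ℕ) .{{_ : NonZero p}} where
  -- Division with remainder as a bijection. The inert component y is the second coordinate of a
  -- lattice point, or trivial when a one-variable sum is split.
  unsplit : Fin p × ℤ × I₃ → ℤ × I₃
  unsplit (k , n , y) = + toℕ k + n * + p , y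

  private
    split′ : ℤ × I₃ → Fin p × ℤ × I₃
    split′ (n , y) = fromℕ< (n%ℕd<d n p) , n /ℕ p , y

    unsplit-split : ∀ (j : ℤ × I₃) → unsplit (split′ j) ≡ j
    unsplit-split (n , y) = cong (_, y) (trans (cong (λ r → + r + n /ℕ p * + p) (Fin.toℕ-fromℕ< (n%ℕd<d n p))) (sym (a≡a%ℕn+[a/ℕn]*n n p)))

    strict : ∀ (k k′ : Fin p) n n′ → n ℤ.< n′ → + toℕ k + n * + p ≢ + toℕ k′ + n′ * + p
    strict k k′ n n′ lt e = ℤ.<-irrefl e (begin-strict
      + toℕ k + n * + p  <⟨ ℤ.+-monoˡ-< (n * + p) (ℤ.+<+ (Fin.toℕ<n k)) ⟩
      + p + n * + p  ≡⟨ sym (ℤ.suc-* n (+ p)) ⟩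
      ℤ.suc n * + p  ≤⟨ ℤ.*-monoʳ-≤-nonNeg (+ p) (ℤ.i<j⇒suc[i]≤j lt) ⟩
      n′ * + p  ≤⟨ ℤ.i≤j+i (n′ * + p) (+ toℕ k′) ⟩
      + toℕ k′ + n′ * + p  ∎)
      where open ℤ.≤-Reasoning

    unsplit-inj : ∀ {i i′ : Fin p × ℤ × I₃} → unsplit i ≡ unsplit i′ → i ≡ i′
    unsplit-inj {i = k , n , y} {i′ = k′ , n′ , y′} e with cong proj₂ e | ℤ.<-cmp n n′
    ... | refl | tri< lt _ _ = ⊥-elim (strict k k′ n n′ lt (cong proj₁ e))
    ... | refl | tri> _ _ gt = ⊥-elim (strict k′ k n′ n gt (sym (cong proj₁ e)))
    ... | refl | tri≈ _ refl _ = cong (λ k → k , n , y) (Fin.toℕ-injective (ℤ.+-injective (+-cancelʳ-≡ (n * + p) (+ toℕ k) (+ toℕ k′) (cong proj₁ e))))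

  HasSum-split : ∀ {f : ℤ × I₃ → ℤ} {s} {t : Fin p → ℤ} → HasSum f s →
    (∀ k → HasSum (λ { (n , y) → f (+ toℕ k + n * + p , y) }) (t k)) → s ≡ sumFin t
  HasSum-split h hs = HasSum-unique (HasSum-bij unsplit split′ unsplit-split unsplit-inj h) (HasSum-Fin hs)

range : ℕ → List ℤ
range B = map (λ i → + i - + B) (downFrom (suc (B ℕ.+ B)))

sumL-range : ∀ B f → sumL f (range B) ≡ sumZ B f
sumL-range B f = trans (sumL-map f (λ i → + i - + B) (downFrom (suc (B ℕ.+ B)))) (sumL-downFrom (B ℕ.+ B) (λ i → f (+ i - + B)))

range-unique : ∀ B → Unique (range B)
range-unique B = Unique.map⁺ (λ {x} {y} e → ℤ.+-injective (+-cancelʳ-≡ (- + B) (+ x) (+ y) e)) (Unique.downFrom⁺ (suc (B ℕ.+ B)))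

∈-range : ∀ {B} n → ∣ n ∣ ℕ.≤ B → n ∈ range B
∈-range {B} n n≤B = subst (_∈ range B) eq (∈-map⁺ (λ i → + i - + B) (∈-downFrom⁺ {i = ∣ n + + B ∣} (s≤s bound)))
  where
  nonneg : ∀ n → ∣ n ∣ ℕ.≤ B → 0ℤ ℤ.≤ n + + B
  nonneg (+ n)        _ = ℤ.+≤+ z≤n
  nonneg ℤ.-[1+ n ] l = subst (0ℤ ℤ.≤_) (sym (ℤ.⊖-≥ l)) (ℤ.+≤+ z≤n)
  bound : ∣ n + + B ∣ ℕ.≤ B ℕ.+ B
  bound = ℕ.≤-trans (ℤ.∣i+j∣≤∣i∣+∣j∣ n (+ B)) (ℕ.+-monoˡ-≤ B n≤B)
  lem : ∀ a b → a + b - b ≡ a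
  lem = solve-∀
  eq : + ∣ n + + B ∣ - + B ≡ n
  eq = trans (cong (_- + B) (ℤ.0≤i⇒+∣i∣≡i (nonneg n n≤B))) (lem n (+ B))

HasSum-ℤ : ∀ {f : ℤ → ℤ} B → (∀ n → f n ≢ 0ℤ → ∣ n ∣ ℕ.≤ B) → HasSum f (sumZ B f)
HasSum-ℤ {f} B h = hasSum (range B) (range-unique B) (λ n ne → ∈-range n (h n ne)) (sumL-range B f)

HasSum-ℤ² : ∀ {f : ℤ × ℤ → ℤ} B → (∀ n m → f (n , m) ≢ 0ℤ → ∣ n ∣ ℕ.≤ B × ∣ m ∣ ℕ.≤ B) →
  HasSum f (sumZ B (λ n → sumZ B (λ m → f (n , m))))
HasSum-ℤ² {f} B h = hasSum (cartesianProduct (range B) (range B)) (Unique.cartesianProduct⁺ (range-unique B) (range-unique B))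
  (λ { (n , m) ne → ∈-cartesianProduct⁺ (∈-range n (proj₁ (h n m ne))) (∈-range m (proj₂ (h n m ne))) })
  (trans (sumL-cartesian f (range B) (range B)) (trans (sumL-cong (λ n → sumL-range B (λ m → f (n , m))) (range B))
    (sumL-range B (λ n → sumZ B (λ m → f (n , m))))))

ind-≢0 : ∀ {x y} → ind x y ≢ 0ℤ → x ≡ y
ind-≢0 {x} {y} ne with x ℤ.≟ y
... | yes e = e
... | no  _ = ⊥-elim (ne refl)

ind-⇔ : ∀ {x y x′ y′} → (x ≡ y → x′ ≡ y′) → (x′ ≡ y′ → x ≡ y) → ind x y ≡ ind x′ y′
ind-⇔ {x} {y} {x′} {y′} to from with x ℤ.≟ y | x′ ℤ.≟ y′
... | yes _ | yes _ = refl
... | no  _ | no  _ = refl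
... | yes e | no ne = ⊥-elim (ne (to e))
... | no ne | yes e = ⊥-elim (ne (from e))

ind-≢ : ∀ {x y} → x ≢ y → ind x y ≡ 0ℤ
ind-≢ {x} {y} ne with x ℤ.≟ y
... | yes e = ⊥-elim (ne e)
... | no  _ = refl

ind-qp : ∀ a i → ind (+ a) (+ i) ≡ qp a i
ind-qp a i with + a ℤ.≟ + i
... | yes e = sym (trans (cong (qp a) (sym (ℤ.+-injective e))) (qp-self a))
... | no ne = sym (qp-other a i (λ e → ne (cong +_ (sym e))))

square : ∀ i → i * i ≡ + (∣ i ∣ ℕ.* ∣ i ∣)
square (+ n)      = sym (ℤ.pos-* n n)
square ℤ.-[1+ n ] = refl

0≤i*i : ∀ i → 0ℤ ℤ.≤ i * i
0≤i*i i = subst (0ℤ ℤ.≤_) (sym (square i)) (ℤ.+≤+ z≤n)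

-- If M > K + S, then M² ≥ (K + S + 1)M > KM + S.
ℕ-quad-bound : ∀ M S K → M ℕ.* M ℕ.≤ S ℕ.+ K ℕ.* M → M ℕ.≤ K ℕ.+ S
ℕ-quad-bound zero    S K _ = z≤n
ℕ-quad-bound (suc M) S K h with ℕ.≤-<-connex (suc M) (K ℕ.+ S)
... | inj₁ l = l
... | inj₂ l = ⊥-elim (ℕ.<-irrefl refl (begin-strict
  S ℕ.+ K ℕ.* suc M  <⟨ ℕ.m<n+m _ {suc M} (s≤s z≤n) ⟩
  suc M ℕ.+ (S ℕ.+ K ℕ.* suc M)  ≤⟨ ℕ.+-monoʳ-≤ (suc M) (ℕ.+-monoˡ-≤ (K ℕ.* suc M) (ℕ.m≤m*n S (suc M))) ⟩
  suc M ℕ.+ (S ℕ.* suc M ℕ.+ K ℕ.* suc M)  ≡⟨ cong (suc M ℕ.+_) (trans (ℕ.+-comm (S ℕ.* suc M) (K ℕ.* suc M)) (sym (ℕ.*-distribʳ-+ (suc M) K S))) ⟩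
  suc (K ℕ.+ S) ℕ.* suc M  ≤⟨ ℕ.*-monoˡ-≤ (suc M) l ⟩
  suc M ℕ.* suc M  ≤⟨ h ⟩
  S ℕ.+ K ℕ.* suc M  ∎))
  where open ℕ.≤-Reasoning

quad-bound : ∀ D k l r m → 1ℤ ℤ.≤ D → D * m * m + k * m + l ℤ.≤ r → ∣ m ∣ ℕ.≤ ∣ k ∣ ℕ.+ ∣ l ∣ ℕ.+ ∣ r ∣
quad-bound D k l r m 1≤D h = subst (∣ m ∣ ℕ.≤_) (sym (ℕ.+-assoc (∣ k ∣) (∣ l ∣) (∣ r ∣))) (ℕ-quad-bound (∣ m ∣) (∣ l ∣ ℕ.+ ∣ r ∣) (∣ k ∣) (ℤ.drop‿+≤+ (begin
  + (∣ m ∣ ℕ.* ∣ m ∣)  ≡⟨ sym (square m) ⟩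
  m * m  ≡⟨ sym (ℤ.*-identityˡ (m * m)) ⟩
  1ℤ * (m * m)  ≤⟨ ℤ.*-monoʳ-≤-nonNeg (m * m) {{ℤ.nonNegative (0≤i*i m)}} 1≤D ⟩
  D * (m * m)  ≡⟨ e₁ D k l m ⟩
  (D * m * m + k * m + l) - (l + k * m)  ≤⟨ ℤ.+-monoˡ-≤ (- (l + k * m)) h ⟩
  r - (l + k * m)  ≤⟨ i≤∣i∣ (r - (l + k * m)) ⟩
  + ∣ r - (l + k * m) ∣  ≤⟨ ℤ.+≤+ tri ⟩
  + (∣ l ∣ ℕ.+ ∣ r ∣ ℕ.+ ∣ k ∣ ℕ.* ∣ m ∣)  ∎)))
  where
  open ℤ.≤-Reasoning
  i≤∣i∣ : ∀ i → i ℤ.≤ + ∣ i ∣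
  i≤∣i∣ (+ n)      = ℤ.≤-refl
  i≤∣i∣ ℤ.-[1+ n ] = ℤ.-≤+
  e₁ : ∀ D k l m → D * (m * m) ≡ (D * m * m + k * m + l) - (l + k * m)
  e₁ = solve-∀
  tri : ∣ r - (l + k * m) ∣ ℕ.≤ ∣ l ∣ ℕ.+ ∣ r ∣ ℕ.+ ∣ k ∣ ℕ.* ∣ m ∣
  tri = ℕ.≤-trans (ℤ.∣i-j∣≤∣i∣+∣j∣ r (l + k * m)) (ℕ.≤-trans (ℕ.+-monoʳ-≤ (∣ r ∣) (ℕ.≤-trans (ℤ.∣i+j∣≤∣i∣+∣j∣ l (k * m))
    (ℕ.+-monoʳ-≤ (∣ l ∣) (ℕ.≤-reflexive (ℤ.abs-* k m))))) (ℕ.≤-reflexive (trans (sym (ℕ.+-assoc (∣ r ∣) (∣ l ∣) _)) (cong (ℕ._+ ∣ k ∣ ℕ.* ∣ m ∣) (ℕ.+-comm (∣ r ∣) (∣ l ∣))))))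

-- Quadratic polynomials in one and two variables

record Quad₁ : Set where
  constructor q₁
  field α β γ : ℤ

ev₁ : Quad₁ → ℤ → ℤ
ev₁ (q₁ a b c) n = a * n * n + b * n + c

bound₁ : Quad₁ → ℕ → ℕ
bound₁ (q₁ a b c) N = ∣ b ∣ ℕ.+ ∣ c ∣ ℕ.+ N

θ₁ : Quad₁ → PS
θ₁ p N = sumZ (bound₁ p N) (λ n → ind (ev₁ p n) (+ N))

-- The values must be nonnegative, or a product of two series would lose terms. As n² ≥ |n| for
-- integers, |β| ≤ α and γ ≥ 0 ensure this.
record Valid₁ (p : Quad₁) : Set where
  constructor valid₁
  open Quad₁ p
  field
    1≤α : 1ℤ ℤ.≤ α
    β≤α : + ∣ β ∣ ℤ.≤ α
    0≤γ : 0ℤ ℤ.≤ γ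

ev₁-bound : ∀ {p N n} → Valid₁ p → ev₁ p n ≡ + N → ∣ n ∣ ℕ.≤ bound₁ p N
ev₁-bound {q₁ a b c} {N} {n} v e = quad-bound a b c (+ N) n (Valid₁.1≤α v) (ℤ.≤-reflexive e)

θ₁-HasSum : ∀ {p} → Valid₁ p → ∀ N → HasSum (λ n → ind (ev₁ p n) (+ N)) (θ₁ p N)
θ₁-HasSum {p} v N = HasSum-ℤ (bound₁ p N) (λ n ne → ev₁-bound v (ind-≢0 ne))

-∣i∣≤i : ∀ i → - + ∣ i ∣ ℤ.≤ i
-∣i∣≤i (+ zero)     = ℤ.≤-refl
-∣i∣≤i (+ suc n)    = ℤ.-≤+
-∣i∣≤i ℤ.-[1+ n ]   = ℤ.≤-refl

ev₁-nonneg : ∀ {p} → Valid₁ p → ∀ n → 0ℤ ℤ.≤ ev₁ p n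
ev₁-nonneg {q₁ a b c} (valid₁ 1≤a b≤a 0≤c) n = begin
  0ℤ  ≤⟨ 0≤c ⟩
  c  ≡⟨ e₁ (+ ∣ b ∣ * + ∣ n ∣) c ⟩
  + ∣ b ∣ * + ∣ n ∣ + - (+ ∣ b ∣ * + ∣ n ∣) + c  ≤⟨ ℤ.+-monoˡ-≤ c (ℤ.+-mono-≤ quad lin) ⟩
  a * n * n + b * n + c  ∎
  where
  open ℤ.≤-Reasoning
  e₁ : ∀ x c → c ≡ x + - x + c
  e₁ = solve-∀
  instance
    _ : ℤ.NonNegative a
    _ = ℤ.nonNegative (ℤ.≤-trans (ℤ.+≤+ z≤n) 1≤a)
  lin : - (+ ∣ b ∣ * + ∣ n ∣) ℤ.≤ b * n
  lin = ℤ.≤-trans (ℤ.≤-reflexive (cong -_ (trans (sym (ℤ.pos-* (∣ b ∣) (∣ n ∣))) (cong +_ (sym (ℤ.abs-* b n)))))) (-∣i∣≤i (b * n))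
  quad : + ∣ b ∣ * + ∣ n ∣ ℤ.≤ a * n * n
  quad = begin
    + ∣ b ∣ * + ∣ n ∣  ≤⟨ ℤ.*-monoʳ-≤-nonNeg (+ ∣ n ∣) b≤a ⟩
    a * + ∣ n ∣  ≤⟨ ℤ.*-monoˡ-≤-nonNeg a (ℤ.+≤+ (sq (∣ n ∣))) ⟩
    a * + (∣ n ∣ ℕ.* ∣ n ∣)  ≡⟨ cong (a *_) (sym (square n)) ⟩
    a * (n * n)  ≡⟨ sym (ℤ.*-assoc a n n) ⟩
    a * n * n  ∎
    where
    sq : ∀ m → m ℕ.≤ m ℕ.* m
    sq zero    = z≤n
    sq (suc m) = ℕ.m≤m*n (suc m) (suc m)

record Quad : Set where
  constructor quad
  field a b c d e f : ℤ

ev : Quad → ℤ × ℤ → ℤ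
ev (quad a b c d e f) (n , m) = a * n * n + b * n * m + c * m * m + d * n + e * m + f

disc : Quad → ℤ
disc (quad a b c d e f) = + 4 * a * c - b * b

boundˡ boundʳ bound : Quad → ℕ → ℕ
boundʳ (quad a b c d e f) N = ∣ + 4 * a * e - + 2 * b * d ∣ ℕ.+ ∣ + 4 * a * f - d * d ∣ ℕ.+ ∣ + 4 * a * + N ∣
boundˡ (quad a b c d e f) N = ∣ + 4 * c * d - + 2 * b * e ∣ ℕ.+ ∣ + 4 * c * f - e * e ∣ ℕ.+ ∣ + 4 * c * + N ∣
bound P N = boundʳ P N ℕ.+ boundˡ P N

Θ : Quad → PS
Θ P N = sumZ (bound P N) (λ n → sumZ (bound P N) (λ m → ind (ev P (n , m)) (+ N)))

-- Completing the square: 4aP = (2an + bm + d)² + disc·m² + ⋯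
ev-boundʳ : ∀ a b c d e f {n m r} → 1ℤ ℤ.≤ disc (quad a b c d e f) → ev (quad a b c d e f) (n , m) ≡ r →
  ∣ m ∣ ℕ.≤ ∣ + 4 * a * e - + 2 * b * d ∣ ℕ.+ ∣ + 4 * a * f - d * d ∣ ℕ.+ ∣ + 4 * a * r ∣
ev-boundʳ a b c d e f {n} {m} {r} D h = quad-bound (disc (quad a b c d e f)) (+ 4 * a * e - + 2 * b * d) (+ 4 * a * f - d * d) (+ 4 * a * r) m D (begin
  (+ 4 * a * c - b * b) * m * m + (+ 4 * a * e - + 2 * b * d) * m + (+ 4 * a * f - d * d)  ≡⟨ sym (ℤ.+-identityˡ _) ⟩
  0ℤ + ((+ 4 * a * c - b * b) * m * m + (+ 4 * a * e - + 2 * b * d) * m + (+ 4 * a * f - d * d)) ≤⟨ ℤ.+-monoˡ-≤ _ (0≤i*i (+ 2 * a * n + b * m + d)) ⟩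
  (+ 2 * a * n + b * m + d) * (+ 2 * a * n + b * m + d) + ((+ 4 * a * c - b * b) * m * m + (+ 4 * a * e - + 2 * b * d) * m + (+ 4 * a * f - d * d)) ≡⟨ lem a b c d e f n m ⟩
  + 4 * a * ev (quad a b c d e f) (n , m)  ≡⟨ cong (+ 4 * a *_) h ⟩
  + 4 * a * r  ∎)
  where
  open ℤ.≤-Reasoning
  lem : ∀ a b c d e f n m → (+ 2 * a * n + b * m + d) * (+ 2 * a * n + b * m + d) + ((+ 4 * a * c - b * b) * m * m + (+ 4 * a * e - + 2 * b * d) * m + (+ 4 * a * f - d * d))
    ≡ + 4 * a * (a * n * n + b * n * m + c * m * m + d * n + e * m + f)
  lem = solve-∀

ev-boundˡ : ∀ a b c d e f {n m r} → 1ℤ ℤ.≤ disc (quad a b c d e f) → ev (quad a b c d e f) (n , m) ≡ r →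
  ∣ n ∣ ℕ.≤ ∣ + 4 * c * d - + 2 * b * e ∣ ℕ.+ ∣ + 4 * c * f - e * e ∣ ℕ.+ ∣ + 4 * c * r ∣
ev-boundˡ a b c d e f {n} {m} D h = ev-boundʳ c b a e d f {m} {n} (subst (1ℤ ℤ.≤_) (lem₁ a b c) D) (trans (lem₂ a b c d e f n m) h)
  where
  lem₁ : ∀ a b c → + 4 * a * c - b * b ≡ + 4 * c * a - b * b
  lem₁ = solve-∀
  lem₂ : ∀ a b c d e f n m → c * m * m + b * m * n + a * n * n + e * m + d * n + f ≡ a * n * n + b * n * m + c * m * m + d * n + e * m + f
  lem₂ = solve-∀

Θ-HasSum : ∀ {P} → 1ℤ ℤ.≤ disc P → ∀ N → HasSum (λ x → ind (ev P x) (+ N)) (Θ P N)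
Θ-HasSum {quad a b c d e f} D N = HasSum-ℤ² (bound (quad a b c d e f) N) (λ n m ne →
  ℕ.≤-trans (ev-boundˡ a b c d e f {n} {m} D (ind-≢0 ne)) (ℕ.m≤n+m (boundˡ (quad a b c d e f) N) (boundʳ (quad a b c d e f) N)) , ℕ.≤-trans (ev-boundʳ a b c d e f {n} {m} D (ind-≢0 ne)) (ℕ.m≤m+n (boundʳ (quad a b c d e f) N) (boundˡ (quad a b c d e f) N)))

-- The two definitions sum over different boxes, each containing all solutions: for a homogeneous
-- form the general bounds reduce to 4aN and 4cN.
theta≋Θ : ∀ a b c → 1ℤ ℤ.≤ disc (quad (+ a) (+ b) (+ c) 0ℤ 0ℤ 0ℤ) → theta a b c ≋ Θ (quad (+ a) (+ b) (+ c) 0ℤ 0ℤ 0ℤ)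
theta≋Θ a b c D .at N = HasSum-unique (HasSum-cong (λ x → cong (λ z → ind z (+ N)) (lem (+ a) (+ b) (+ c) (proj₁ x) (proj₂ x)))
    (HasSum-ℤ² {λ x → ind (+ a * proj₁ x * proj₁ x + + b * proj₁ x * proj₂ x + + c * proj₂ x * proj₂ x) (+ N)} (4 ℕ.* (a ℕ.+ c) ℕ.* N) cover))
  (Θ-HasSum {quad (+ a) (+ b) (+ c) 0ℤ 0ℤ 0ℤ} D N)
  where
  lem : ∀ a b c n m → a * n * n + b * n * m + c * m * m ≡ a * n * n + b * n * m + c * m * m + 0ℤ * n + 0ℤ * m + 0ℤ
  lem = solve-∀
  z₁ : ∀ a b → + 4 * a * 0ℤ - + 2 * b * 0ℤ ≡ 0ℤ
  z₁ = solve-∀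
  z₂ : ∀ a → + 4 * a * 0ℤ - 0ℤ * 0ℤ ≡ 0ℤ
  z₂ = solve-∀
  z₃ : ∀ a → ∣ + 4 * + a * + N ∣ ≡ 4 ℕ.* a ℕ.* N
  z₃ a = trans (ℤ.abs-* (+ 4 * + a) (+ N)) (cong (ℕ._* N) (ℤ.abs-* (+ 4) (+ a)))
  z : ∀ a b → ∣ + 4 * + a * 0ℤ - + 2 * b * 0ℤ ∣ ℕ.+ ∣ + 4 * + a * 0ℤ - 0ℤ * 0ℤ ∣ ℕ.+ ∣ + 4 * + a * + N ∣ ≡ 4 ℕ.* a ℕ.* N
  z a b = cong₂ ℕ._+_ (cong₂ (λ x y → ∣ x ∣ ℕ.+ ∣ y ∣) (z₁ (+ a) b) (z₂ (+ a))) (z₃ a)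
  cover : ∀ n m → ind (+ a * n * n + + b * n * m + + c * m * m) (+ N) ≢ 0ℤ → ∣ n ∣ ℕ.≤ 4 ℕ.* (a ℕ.+ c) ℕ.* N × ∣ m ∣ ℕ.≤ 4 ℕ.* (a ℕ.+ c) ℕ.* N
  cover n m ne = ℕ.≤-trans (ℕ.≤-trans (ev-boundˡ (+ a) (+ b) (+ c) 0ℤ 0ℤ 0ℤ {n} {m} D h) (ℕ.≤-reflexive (z c (+ b)))) (ℕ.*-monoˡ-≤ N (ℕ.*-monoʳ-≤ 4 (ℕ.m≤n+m c a)))
               , ℕ.≤-trans (ℕ.≤-trans (ev-boundʳ (+ a) (+ b) (+ c) 0ℤ 0ℤ 0ℤ {n} {m} D h) (ℕ.≤-reflexive (z a (+ b)))) (ℕ.*-monoˡ-≤ N (ℕ.*-monoʳ-≤ 4 (ℕ.m≤m+n a c)))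
    where
    h : ev (quad (+ a) (+ b) (+ c) 0ℤ 0ℤ 0ℤ) (n , m) ≡ + N
    h = trans (sym (lem (+ a) (+ b) (+ c) n m)) (ind-≢0 ne)

infixl 6 _⊞_
_⊞_ : Quad₁ → Quad₁ → Quad
q₁ a b c ⊞ q₁ a′ b′ c′ = quad a 0ℤ a′ b b′ (c + c′)

ev-⊞ : ∀ p r n m → ev (p ⊞ r) (n , m) ≡ ev₁ p n + ev₁ r m
ev-⊞ (q₁ a b c) (q₁ a′ b′ c′) n m = lem a b c a′ b′ c′ n m
  where
  lem : ∀ a b c a′ b′ c′ n m → a * n * n + 0ℤ * n * m + a′ * m * m + b * n + b′ * m + (c + c′) ≡ a * n * n + b * n + c + (a′ * m * m + b′ * m + c′)
  lem = solve-∀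

disc-⊞ : ∀ {p r} → Valid₁ p → Valid₁ r → 1ℤ ℤ.≤ disc (p ⊞ r)
disc-⊞ {q₁ (+ suc a) _ _} {q₁ (+ suc a′) _ _} (valid₁ (ℤ.+≤+ (s≤s _)) _ _) (valid₁ (ℤ.+≤+ (s≤s _)) _ _) = ℤ.+≤+ (s≤s z≤n)

opaque
  unfolding _✶_
  -- Both windows are enlarged to a common one and the sums exchanged; what remains is q^x q^y =
  -- q^(x+y) for the values x and y, which are natural numbers by `Valid₁`.
  θ₁-✶ : ∀ {p r} → Valid₁ p → Valid₁ r → θ₁ p ✶ θ₁ r ≋ Θ (p ⊞ r)
  θ₁-✶ {p} {r} v u .at N = begin
    sumTo N (λ i → θ₁ p i * θ₁ r (N ℕ.∸ i))  ≡⟨ sumTo-cong≤ N (λ i i≤N → cong₂ _*_ (widen v (ℕ.m≤m+n (bound₁ p N) (bound₁ r N)) i≤N) (widen u (ℕ.m≤n+m (bound₁ r N) (bound₁ p N)) (ℕ.m∸n≤m N i))) ⟩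
    sumTo N (λ i → sumZ B (λ n → ind (ev₁ p n) (+ i)) * sumZ B (λ m → ind (ev₁ r m) (+ (N ℕ.∸ i))))
                                                                        ≡⟨ sumTo-cong N (λ i → sumZ-* (λ n → ind (ev₁ p n) (+ i)) (λ m → ind (ev₁ r m) (+ (N ℕ.∸ i)))) ⟩
    sumTo N (λ i → sumZ B (λ n → sumZ B (λ m → ind (ev₁ p n) (+ i) * ind (ev₁ r m) (+ (N ℕ.∸ i)))))
                                                                        ≡⟨ trans (sumTo-swap N (B ℕ.+ B) _) (sumTo-cong (B ℕ.+ B) (λ _ → sumTo-swap N (B ℕ.+ B) _)) ⟩
    sumZ B (λ n → sumZ B (λ m → sumTo N (λ i → ind (ev₁ p n) (+ i) * ind (ev₁ r m) (+ (N ℕ.∸ i)))))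
                                                                        ≡⟨ sumTo-cong (B ℕ.+ B) (λ j → sumTo-cong (B ℕ.+ B) (λ k → conv (+ j - + B) (+ k - + B))) ⟩
    sumZ B (λ n → sumZ B (λ m → ind (ev (p ⊞ r) (n , m)) (+ N)))  ≡⟨ HasSum-unique (HasSum-ℤ² B cover) (Θ-HasSum {p ⊞ r} (disc-⊞ v u) N) ⟩
    Θ (p ⊞ r) N  ∎
    where
    open ≡-Reasoning
    B : ℕ
    B = bound₁ p N ℕ.+ bound₁ r N
    widen : ∀ {p i} → Valid₁ p → bound₁ p N ℕ.≤ B → i ℕ.≤ N → θ₁ p i ≡ sumZ B (λ n → ind (ev₁ p n) (+ i))
    widen {p} {i} v l i≤N = HasSum-unique (θ₁-HasSum v i) (HasSum-ℤ B (λ n ne →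
      ℕ.≤-trans (ev₁-bound v (ind-≢0 ne)) (ℕ.≤-trans (ℕ.+-monoʳ-≤ (∣ Quad₁.β p ∣ ℕ.+ ∣ Quad₁.γ p ∣) i≤N) l)))
    sumZ-* : ∀ f g → sumZ B f * sumZ B g ≡ sumZ B (λ n → sumZ B (λ m → f n * g m))
    sumZ-* f g = trans (ℤ.*-comm (sumZ B f) (sumZ B g)) (trans (sym (sumTo-*ˡ (B ℕ.+ B) (sumZ B g) (λ i → f (+ i - + B))))
      (sumTo-cong (B ℕ.+ B) (λ i → trans (ℤ.*-comm (sumZ B g) (f (+ i - + B))) (sym (sumTo-*ˡ (B ℕ.+ B) (f (+ i - + B)) (λ j → g (+ j - + B)))))))
    qp-sum : ∀ x y → sumTo N (λ i → ind (+ x) (+ i) * ind (+ y) (+ (N ℕ.∸ i))) ≡ ind (+ x + + y) (+ N)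
    qp-sum x y = trans (sumTo-cong N (λ i → cong₂ _*_ (ind-qp x i) (ind-qp y (N ℕ.∸ i)))) (trans (sym (at (qp-+ x y) N)) (sym (ind-qp (x ℕ.+ y) N)))
    conv : ∀ n m → sumTo N (λ i → ind (ev₁ p n) (+ i) * ind (ev₁ r m) (+ (N ℕ.∸ i))) ≡ ind (ev (p ⊞ r) (n , m)) (+ N)
    conv n m = trans (subst₂ (λ x y → sumTo N (λ i → ind x (+ i) * ind y (+ (N ℕ.∸ i))) ≡ ind (x + y) (+ N))
        (ℤ.0≤i⇒+∣i∣≡i (ev₁-nonneg v n)) (ℤ.0≤i⇒+∣i∣≡i (ev₁-nonneg u m)) (qp-sum (∣ ev₁ p n ∣) (∣ ev₁ r m ∣)))
      (cong (λ z → ind z (+ N)) (sym (ev-⊞ p r n m)))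
    part : ∀ {x y} → 0ℤ ℤ.≤ x → 0ℤ ℤ.≤ y → x + y ≡ + N → ∣ x ∣ ℕ.≤ N
    part {+ x} {+ y} _ _ e = subst (x ℕ.≤_) (ℤ.+-injective e) (ℕ.m≤m+n x y)
    term : ∀ {p n} → Valid₁ p → bound₁ p N ℕ.≤ B → ∣ ev₁ p n ∣ ℕ.≤ N → ∣ n ∣ ℕ.≤ B
    term {p} {n} v l h = ℕ.≤-trans (ev₁-bound v (sym (ℤ.0≤i⇒+∣i∣≡i (ev₁-nonneg v n)))) (ℕ.≤-trans (ℕ.+-monoʳ-≤ (∣ Quad₁.β p ∣ ℕ.+ ∣ Quad₁.γ p ∣) h) l)
    cover : ∀ n m → ind (ev (p ⊞ r) (n , m)) (+ N) ≢ 0ℤ → ∣ n ∣ ℕ.≤ B × ∣ m ∣ ℕ.≤ B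
    cover n m ne = term v (ℕ.m≤m+n (bound₁ p N) (bound₁ r N)) (part (ev₁-nonneg v n) (ev₁-nonneg u m) h)
                 , term u (ℕ.m≤n+m (bound₁ r N) (bound₁ p N)) (part (ev₁-nonneg u m) (ev₁-nonneg v n) (trans (ℤ.+-comm (ev₁ r m) (ev₁ p n)) h))
      where
      h : ev₁ p n + ev₁ r m ≡ + N
      h = trans (sym (ev-⊞ p r n m)) (ind-≢0 ne)

-- Substitutions in one-variable theta series

scale₁ : ℤ → Quad₁ → Quad₁
scale₁ k (q₁ a b c) = q₁ (k * a) (k * b) (k * c)

shift₁ : ℕ → Quad₁ → Quad₁
shift₁ e (q₁ a b c) = q₁ a b (c + + e)

-- Odd indices are written 2n - 1 for b ≥ 0 and 2n + 1 for b < 0, so that the new linear coefficient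
-- stays within 4a in absolute value, as `Valid₁` requires.
even₁ odd₁ : Quad₁ → Quad₁
even₁ (q₁ a b c) = q₁ (+ 4 * a) (+ 2 * b) c
odd₁ (q₁ a b@(+ _) c)      = q₁ (+ 4 * a) (+ 2 * b - + 4 * a) (a - b + c)
odd₁ (q₁ a b@(ℤ.-[1+ _ ]) c) = q₁ (+ 4 * a) (+ 2 * b + + 4 * a) (a + b + c)

dil-θ₁ : ∀ k .{{_ : NonZero k}} {p} → Valid₁ p → Valid₁ (scale₁ (+ k) p) → dil k (θ₁ p) ≋ θ₁ (scale₁ (+ k) p)
dil-θ₁ k {p@(q₁ a b c)} v v′ = dil-pointwise k
  (λ m → HasSum-unique (θ₁-HasSum v′ (m ℕ.* k)) (HasSum-cong (λ n → ind-⇔ (to m n) (from m n)) (θ₁-HasSum v m)))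
  (λ N ne → sumTo-zero≤ (bound₁ (scale₁ (+ k) p) N ℕ.+ bound₁ (scale₁ (+ k) p) N) (λ i _ → ind-≢ (λ e → ne (divisible N (+ i - + bound₁ (scale₁ (+ k) p) N) e))))
  where
  ev-scale : ∀ k a b c n → (k * a) * n * n + (k * b) * n + k * c ≡ (a * n * n + b * n + c) * k
  ev-scale = solve-∀
  to : ∀ m n → ev₁ p n ≡ + m → ev₁ (scale₁ (+ k) p) n ≡ + (m ℕ.* k)
  to m n e = trans (ev-scale (+ k) a b c n) (trans (cong (_* + k) e) (sym (ℤ.pos-* m k)))
  from : ∀ m n → ev₁ (scale₁ (+ k) p) n ≡ + (m ℕ.* k) → ev₁ p n ≡ + m
  from m n e = ℤ.*-cancelʳ-≡ (ev₁ p n) (+ m) (+ k) (trans (sym (ev-scale (+ k) a b c n)) (trans e (ℤ.pos-* m k)))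
  divisible : ∀ N n → ev₁ (scale₁ (+ k) p) n ≡ + N → N % k ≡ 0
  divisible N n e = trans (cong (_% k) (ℤ.+-injective (trans (sym e) (trans (ev-scale (+ k) a b c n)
    (trans (cong (_* + k) (sym (ℤ.0≤i⇒+∣i∣≡i (ev₁-nonneg v n)))) (sym (ℤ.pos-* (∣ ev₁ p n ∣) k))))))) (m*n%n≡0 (∣ ev₁ p n ∣) k)

sh-θ₁ : ∀ e {p} → Valid₁ p → Valid₁ (shift₁ e p) → sh e (θ₁ p) ≋ θ₁ (shift₁ e p)
sh-θ₁ e {p@(q₁ a b c)} v v′ .at N with e ≤? N
... | yes e≤N = HasSum-unique (HasSum-cong (λ n → ind-⇔ (to n) (from n)) (θ₁-HasSum v (N ℕ.∸ e))) (θ₁-HasSum v′ N)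
  where
  lem : ∀ x c e → x + (c + e) ≡ x + c + e
  lem = solve-∀
  to : ∀ n → ev₁ p n ≡ + (N ℕ.∸ e) → ev₁ (shift₁ e p) n ≡ + N
  to n h = trans (lem (a * n * n + b * n) c (+ e)) (trans (cong (_+ + e) h) (cong +_ (ℕ.m∸n+n≡m e≤N)))
  from : ∀ n → ev₁ (shift₁ e p) n ≡ + N → ev₁ p n ≡ + (N ℕ.∸ e)
  from n h = +-cancelʳ-≡ (+ e) (ev₁ p n) (+ (N ℕ.∸ e)) (trans (sym (lem (a * n * n + b * n) c (+ e))) (trans h (cong +_ (sym (ℕ.m∸n+n≡m e≤N)))))
... | no e≰N = sym (sumTo-zero≤ (bound₁ (shift₁ e p) N ℕ.+ bound₁ (shift₁ e p) N) (λ i _ → ind-≢ (λ h → e≰N (small (+ i - + bound₁ (shift₁ e p) N) h))))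
  where
  lem : ∀ x c e → x + (c + e) ≡ x + c + e
  lem = solve-∀
  small : ∀ n → ev₁ (shift₁ e p) n ≡ + N → e ℕ.≤ N
  small n h = ℤ.drop‿+≤+ (subst (+ e ℤ.≤_) h (ℤ.≤-trans (ℤ.i≤j+i (+ e) (ev₁ p n) {{ℤ.nonNegative (ev₁-nonneg v n)}}) (ℤ.≤-reflexive (sym (lem (a * n * n + b * n) c (+ e))))))

σ : ℤ → ℤ
σ i = sgn ∣ i ∣

σ-suc : ∀ i → σ (ℤ.suc i) ≡ - σ i
σ-suc (+ n)            = refl
σ-suc ℤ.-[1+ zero ]    = refl
σ-suc ℤ.-[1+ suc n ]   = sym (ℤ.neg-involutive (sgn (suc n)))

σ-even : ∀ c y → σ (c + + 2 * y) ≡ σ c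
σ-even c (+ n) = up c n
  where
  lem : ∀ c n → c + + 2 * (1ℤ + n) ≡ 1ℤ + (1ℤ + (c + + 2 * n))
  lem = solve-∀
  up : ∀ c n → σ (c + + 2 * + n) ≡ σ c
  up c zero    = cong σ (ℤ.+-identityʳ c)
  up c (suc n) = trans (cong σ (lem c (+ n))) (trans (σ-suc (ℤ.suc (c + + 2 * + n))) (trans (cong -_ (σ-suc (c + + 2 * + n))) (trans (ℤ.neg-involutive (σ (c + + 2 * + n))) (up c n))))
σ-even c y@(ℤ.-[1+ n ]) = sym (trans (cong σ (lem c (+ suc n))) (σ-even (c + + 2 * y) (+ suc n)))
  where
  lem : ∀ c m → c ≡ (c + + 2 * (- m)) + + 2 * m
  lem = solve-∀

θ₁-sign : ∀ p s → (∀ n → σ (ev₁ p n) ≡ s) → ∀ N → sgn N * θ₁ p N ≡ s * θ₁ p N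
θ₁-sign p s h N = trans (sym (sumTo-*ˡ (B ℕ.+ B) (sgn N) F)) (trans (sumTo-cong (B ℕ.+ B) (λ i → term (+ i - + B))) (sumTo-*ˡ (B ℕ.+ B) s F))
  where
  B = bound₁ p N
  F : ℕ → ℤ
  F i = ind (ev₁ p (+ i - + B)) (+ N)
  term : ∀ n → sgn N * ind (ev₁ p n) (+ N) ≡ s * ind (ev₁ p n) (+ N)
  term n with ev₁ p n ℤ.≟ + N
  ... | yes e = cong (_* 1ℤ) (trans (cong σ (sym e)) (h n))
  ... | no  _ = trans (ℤ.*-zeroʳ (sgn N)) (sym (ℤ.*-zeroʳ s))

×⊤ : ∀ {f : ℤ → ℤ} {s} → HasSum f s → HasSum {ℤ × ⊤} (λ x → f (proj₁ x)) s
×⊤ = HasSum-bij proj₁ (λ n → n , tt) (λ _ → refl) (λ { {_ , tt} {_ , tt} refl → refl })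

HasSum-parity : ∀ {f : ℤ → ℤ} {s s₀ s₁} → HasSum f s → HasSum (λ n → f (n * + 2)) s₀ → HasSum (λ n → f (1ℤ + n * + 2)) s₁ → s ≡ s₀ + s₁
HasSum-parity {f} {s} {s₀} {s₁} h h₀ h₁ = trans (HasSum-split 2 {t = t} (×⊤ h) slices) (cong (_+_ s₀) (ℤ.+-identityʳ s₁))
  where
  t : Fin 2 → ℤ
  t zero    = s₀
  t (suc _) = s₁
  slices : ∀ k → HasSum (λ { (n , y) → f (+ toℕ k + n * + 2) }) (t k)
  slices zero       = HasSum-cong (λ { (n , _) → cong f (sym (ℤ.+-identityˡ (n * + 2))) }) (×⊤ h₀)
  slices (suc zero) = HasSum-cong (λ _ → refl) (×⊤ h₁)

HasSum-pred : ∀ {f : ℤ → ℤ} {s} → HasSum f s → HasSum (λ n → f (n + 1ℤ)) s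
HasSum-pred = HasSum-bij (_+ 1ℤ) (_- 1ℤ) lem (λ {i} {j} → +-cancelʳ-≡ 1ℤ i j)
  where
  lem : ∀ n → n - 1ℤ + 1ℤ ≡ n
  lem = solve-∀

θ₁-parity : ∀ {p} → Valid₁ p → Valid₁ (even₁ p) → Valid₁ (odd₁ p) → ∀ N → θ₁ p N ≡ θ₁ (even₁ p) N + θ₁ (odd₁ p) N
θ₁-parity {p@(q₁ a b c)} v v₀ v₁ N = HasSum-parity (θ₁-HasSum v N)
  (HasSum-cong (λ n → cong (λ z → ind z (+ N)) (e₀ a b c n)) (θ₁-HasSum v₀ N)) (odd b refl v₁)
  where
  e₀ : ∀ a b c n → + 4 * a * n * n + + 2 * b * n + c ≡ a * (n * + 2) * (n * + 2) + b * (n * + 2) + c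
  e₀ = solve-∀
  e₊ : ∀ a b c n → + 4 * a * (n + 1ℤ) * (n + 1ℤ) + (+ 2 * b - + 4 * a) * (n + 1ℤ) + (a - b + c) ≡ a * (1ℤ + n * + 2) * (1ℤ + n * + 2) + b * (1ℤ + n * + 2) + c
  e₊ = solve-∀
  e₋ : ∀ a b c n → + 4 * a * n * n + (+ 2 * b + + 4 * a) * n + (a + b + c) ≡ a * (1ℤ + n * + 2) * (1ℤ + n * + 2) + b * (1ℤ + n * + 2) + c
  e₋ = solve-∀
  odd : ∀ b′ → b′ ≡ b → Valid₁ (odd₁ (q₁ a b′ c)) → HasSum (λ n → ind (ev₁ p (1ℤ + n * + 2)) (+ N)) (θ₁ (odd₁ (q₁ a b′ c)) N)
  odd (+ k)      refl v₁ = HasSum-cong (λ n → cong (λ z → ind z (+ N)) (e₊ a (+ k) c n)) (HasSum-pred (θ₁-HasSum v₁ N))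
  odd ℤ.-[1+ k ] refl v₁ = HasSum-cong (λ n → cong (λ z → ind z (+ N)) (e₋ a (ℤ.-[1+ k ]) c n)) (θ₁-HasSum v₁ N)

-- On each parity class of n the quadratic and linear coefficients are even, so all exponents have
-- the parity of the constant term and q ↦ -q acts as one sign.
negq-θ₁ : ∀ {p} → Valid₁ p → Valid₁ (even₁ p) → Valid₁ (odd₁ p) →
  negq (θ₁ p) ≋ sc (σ (Quad₁.γ (even₁ p))) (θ₁ (even₁ p)) ⊕ sc (σ (Quad₁.γ (odd₁ p))) (θ₁ (odd₁ p))
negq-θ₁ {p@(q₁ a b c)} v v₀ v₁ .at N = trans (negq≗ (θ₁ p) N) (trans (cong (sgn N *_) (θ₁-parity v v₀ v₁ N))
  (trans (ℤ.*-distribˡ-+ (sgn N) (θ₁ (even₁ p) N) (θ₁ (odd₁ p) N))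
  (cong₂ _+_ (θ₁-sign (even₁ p) (σ c) (λ n → trans (cong σ (s₀ a b c n)) (σ-even c (+ 2 * a * n * n + b * n))) N) (θ₁-sign (odd₁ p) (σ (Quad₁.γ (odd₁ p))) (odd b) N))))
  where
  s₀ : ∀ a b c n → + 4 * a * n * n + + 2 * b * n + c ≡ c + + 2 * (+ 2 * a * n * n + b * n)
  s₀ = solve-∀
  s₊ : ∀ a b c n → + 4 * a * n * n + (+ 2 * b - + 4 * a) * n + c ≡ c + + 2 * (+ 2 * a * n * n + (b - + 2 * a) * n)
  s₊ = solve-∀
  s₋ : ∀ a b c n → + 4 * a * n * n + (+ 2 * b + + 4 * a) * n + c ≡ c + + 2 * (+ 2 * a * n * n + (b + + 2 * a) * n)
  s₋ = solve-∀
  odd : ∀ b n → σ (ev₁ (odd₁ (q₁ a b c)) n) ≡ σ (Quad₁.γ (odd₁ (q₁ a b c)))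
  odd b@(+ _)      n = trans (cong σ (s₊ a b (a - b + c) n)) (σ-even (a - b + c) (+ 2 * a * n * n + (b - + 2 * a) * n))
  odd b@(ℤ.-[1+ _ ]) n = trans (cong σ (s₋ a b (a + b + c) n)) (σ-even (a + b + c) (+ 2 * a * n * n + (b + + 2 * a) * n))

-- Affine substitutions and coset splittings of ℤ²

record Aff : Set where
  constructor aff
  field m₁₁ m₁₂ v₁ m₂₁ m₂₂ v₂ : ℤ

app : Aff → ℤ × ℤ → ℤ × ℤ
app (aff p q s r t u) (n , m) = p * n + q * m + s , r * n + t * m + u

comp : Quad → Aff → Quad
comp (quad a b c d e f) (aff p q s r t u) = quad
  (a * p * p + b * p * r + c * r * r)
  (+ 2 * a * p * q + b * (p * t + q * r) + + 2 * c * r * t)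
  (a * q * q + b * q * t + c * t * t)
  (+ 2 * a * p * s + b * (p * u + s * r) + + 2 * c * r * u + d * p + e * r)
  (+ 2 * a * q * s + b * (q * u + s * t) + + 2 * c * t * u + d * q + e * t)
  (a * s * s + b * s * u + c * u * u + d * s + e * u + f)

ev-comp : ∀ P g x → ev (comp P g) x ≡ ev P (app g x)
ev-comp (quad a b c d e f) (aff p q s r t u) (n , m) = lem a b c d e f p q s r t u n m
  where
  lem : ∀ a b c d e f p q s r t u n m →
    (a * p * p + b * p * r + c * r * r) * n * n + (+ 2 * a * p * q + b * (p * t + q * r) + + 2 * c * r * t) * n * m
    + (a * q * q + b * q * t + c * t * t) * m * m + (+ 2 * a * p * s + b * (p * u + s * r) + + 2 * c * r * u + d * p + e * r) * n
    + (+ 2 * a * q * s + b * (q * u + s * t) + + 2 * c * t * u + d * q + e * t) * m + (a * s * s + b * s * u + c * u * u + d * s + e * u + f)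
    ≡ a * (p * n + q * m + s) * (p * n + q * m + s) + b * (p * n + q * m + s) * (r * n + t * m + u) + c * (r * n + t * m + u) * (r * n + t * m + u)
      + d * (p * n + q * m + s) + e * (r * n + t * m + u) + f
  lem = solve-∀

det : Aff → ℤ
det (aff p q s r t u) = p * t - q * r

Pos : Quad → Set
Pos P = 1ℤ ℤ.≤ disc P

-- With determinant δ = ±1, the inverse is δ times the adjugate matrix, applied after the
-- translation is undone.
Θ-iso : ∀ {P g} → det g * det g ≡ 1ℤ → Pos P → Pos (comp P g) → Θ P ≋ Θ (comp P g)
Θ-iso {P} {g@(aff p q s r t u)} δ² D D′ .at N = HasSum-unique
  (HasSum-bij (app g) inv (λ { (n , m) → cong₂ _,_ (l₁ n m) (l₂ n m) }) inj (Θ-HasSum {P} D N))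
  (HasSum-cong (λ x → cong (λ z → ind z (+ N)) (ev-comp P g x)) (Θ-HasSum {comp P g} D′ N))
  where
  δ = det g
  inv : ℤ × ℤ → ℤ × ℤ
  inv (n , m) = δ * (t * (n - s) - q * (m - u)) , δ * (p * (m - u) - r * (n - s))
  e₁ : ∀ p q s r t u n m → p * ((p * t - q * r) * (t * (n - s) - q * (m - u))) + q * ((p * t - q * r) * (p * (m - u) - r * (n - s))) + s
     ≡ ((p * t - q * r) * (p * t - q * r)) * (n - s) + s
  e₁ = solve-∀
  e₂ : ∀ p q s r t u n m → r * ((p * t - q * r) * (t * (n - s) - q * (m - u))) + t * ((p * t - q * r) * (p * (m - u) - r * (n - s))) + u
     ≡ ((p * t - q * r) * (p * t - q * r)) * (m - u) + u
  e₂ = solve-∀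
  e₃ : ∀ n s → 1ℤ * (n - s) + s ≡ n
  e₃ = solve-∀
  l₁ : ∀ n m → p * proj₁ (inv (n , m)) + q * proj₂ (inv (n , m)) + s ≡ n
  l₁ n m = trans (e₁ p q s r t u n m) (trans (cong (λ z → z * (n - s) + s) δ²) (e₃ n s))
  l₂ : ∀ n m → r * proj₁ (inv (n , m)) + t * proj₂ (inv (n , m)) + u ≡ m
  l₂ n m = trans (e₂ p q s r t u n m) (trans (cong (λ z → z * (m - u) + u) δ²) (e₃ m u))
  e₄ : ∀ p q s r t u x y → (p * t - q * r) * (t * (p * x + q * y + s - s) - q * (r * x + t * y + u - u)) ≡ (p * t - q * r) * (p * t - q * r) * x
  e₄ = solve-∀
  e₅ : ∀ p q s r t u x y → (p * t - q * r) * (p * (r * x + t * y + u - u) - r * (p * x + q * y + s - s)) ≡ (p * t - q * r) * (p * t - q * r) * y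
  e₅ = solve-∀
  retract : ∀ x → inv (app g x) ≡ x
  retract (x , y) = cong₂ _,_ (trans (e₄ p q s r t u x y) (trans (cong (_* x) δ²) (ℤ.*-identityˡ x)))
                              (trans (e₅ p q s r t u x y) (trans (cong (_* y) δ²) (ℤ.*-identityˡ y)))
  inj : ∀ {x y} → app g x ≡ app g y → x ≡ y
  inj {x} {y} e = trans (sym (retract x)) (trans (cong inv e) (retract y))

-- Only cosets of pℤ × ℤ are needed here: an affine automorphism applied beforehand (`pre` below)
-- moves other sublattices with cyclic quotient into this position.
slice : ℕ → ℕ → Aff
slice p k = aff (+ p) 0ℤ (+ k) 0ℤ 1ℤ 0ℤ

Θ-split : ∀ {P} p .{{_ : NonZero p}} → Pos P → (∀ (k : Fin p) → Pos (comp P (slice p (toℕ k)))) →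
  ∀ N → Θ P N ≡ sumFin {p} (λ k → Θ (comp P (slice p (toℕ k))) N)
Θ-split {P} p D Ds N = HasSum-split p (Θ-HasSum {P} D N) (λ k → HasSum-cong (λ { (n , m) → cong (λ z → ind z (+ N))
    (trans (ev-comp P (slice p (toℕ k)) (n , m)) (cong (ev P) (cong₂ _,_ (l₁ (+ p) (+ toℕ k) n m) (l₂ n m)))) }) (Θ-HasSum {comp P (slice p (toℕ k))} (Ds k) N))
  where
  l₁ : ∀ p k n m → p * n + 0ℤ * m + k ≡ k + n * p
  l₁ = solve-∀
  l₂ : ∀ n m → 0ℤ * n + 1ℤ * m + 0ℤ ≡ m
  l₂ = solve-∀

-- Formal combinations of theta series and their relations

infixr 8 _∙_
_∙_ : ∀ {A : Set} → ℤ → List (ℤ × A) → List (ℤ × A)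
k ∙ L = map (λ { (c , x) → k * c , x }) L

module Combination {A : Set} (sem : A → PS) where
  opaque
    ⟦_⟧ : List (ℤ × A) → PS
    ⟦ [] ⟧          = 𝟘
    ⟦ (c , x) ∷ L ⟧ = sc c (sem x) ⊕ ⟦ L ⟧

    ⟦⟧-[] : ⟦ [] ⟧ ≋ 𝟘
    ⟦⟧-[] = R.refl

    ⟦⟧-∷ : ∀ c x L → ⟦ (c , x) ∷ L ⟧ ≋ sc c (sem x) ⊕ ⟦ L ⟧
    ⟦⟧-∷ c x L = R.refl

    ⟦⟧-++ : ∀ L M → ⟦ L ++ M ⟧ ≋ ⟦ L ⟧ ⊕ ⟦ M ⟧
    ⟦⟧-++ []            M = R.sym (R.+-identityˡ ⟦ M ⟧)
    ⟦⟧-++ ((c , x) ∷ L) M = R.trans (R.+-congˡ {sc c (sem x)} (⟦⟧-++ L M)) (R.sym (R.+-assoc (sc c (sem x)) ⟦ L ⟧ ⟦ M ⟧))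

    ⟦⟧-scale : ∀ k L → ⟦ k ∙ L ⟧ ≋ sc k ⟦ L ⟧
    ⟦⟧-scale k []            .at n = sym (ℤ.*-zeroʳ k)
    ⟦⟧-scale k ((c , x) ∷ L) .at n = trans (cong₂ _+_ (ℤ.*-assoc k c (sem x n)) (at (⟦⟧-scale k L) n)) (sym (ℤ.*-distribˡ-+ k (c * sem x n) (⟦ L ⟧ n)))

open Combination θ₁ public using () renaming (⟦_⟧ to ⟦_⟧₁; ⟦⟧-[] to ⟦⟧₁-[]; ⟦⟧-∷ to ⟦⟧₁-∷)
open Combination Θ public using () renaming (⟦_⟧ to ⟦_⟧₂; ⟦⟧-++ to ⟦⟧₂-++; ⟦⟧-scale to ⟦⟧₂-scale; ⟦⟧-[] to ⟦⟧₂-[]; ⟦⟧-∷ to ⟦⟧₂-∷)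

record Rel : Set where
  constructor rel
  field
    coef : ℤ
    poly : Quad
    pre  : Aff
    post : List Aff

-- A relation stands for  coef (Θ poly - Σ_k Θ (poly ∘ pre ∘ slice k ∘ post_k)) = 0.
module _ (r : Rel) where
  open Rel r
  private
    Q = comp poly pre
    p = length post
    S : Fin p → Quad
    S k = comp Q (slice p (toℕ k))

  expand : List (ℤ × Quad)
  expand = (coef , poly) ∷ tabulate (λ k → - coef , comp (S k) (lookup post k))

  Valid : Set
  Valid = NonZero p × (Pos poly × det pre * det pre ≡ 1ℤ × Pos Q)
        × (∀ k → Pos (S k) × det (lookup post k) * det (lookup post k) ≡ 1ℤ × Pos (comp (S k) (lookup post k)))

  valid? : Dec Valid
  valid? = ℕ.nonZero? p ×-dec ((1ℤ ℤ.≤? disc poly) ×-dec (det pre * det pre ℤ.≟ 1ℤ) ×-dec (1ℤ ℤ.≤? disc Q))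
    ×-dec Fin.all? (λ k → (1ℤ ℤ.≤? disc (S k)) ×-dec (det (lookup post k) * det (lookup post k) ℤ.≟ 1ℤ) ×-dec (1ℤ ℤ.≤? disc (comp (S k) (lookup post k))))

  opaque
    unfolding Combination.⟦_⟧
    expand≋𝟘 : Valid → ⟦ expand ⟧₂ ≋ 𝟘
    expand≋𝟘 (nz , (D , δ , D′) , h) .at N = begin
      coef * Θ poly N + ⟦ tabulate (λ k → - coef , comp (S k) (lookup post k)) ⟧₂ N  ≡⟨ cong (_+_ (coef * Θ poly N)) (tab (λ k → comp (S k) (lookup post k))) ⟩
      coef * Θ poly N + - coef * sumFin (λ k → Θ (comp (S k) (lookup post k)) N)  ≡⟨ cong (λ z → coef * Θ poly N + - coef * z) (sym same) ⟩
      coef * Θ poly N + - coef * Θ poly N  ≡⟨ lem coef (Θ poly N) ⟩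
      0ℤ  ∎
      where
      open ≡-Reasoning
      lem : ∀ c x → c * x + - c * x ≡ 0ℤ
      lem = solve-∀
      tab : ∀ {n} (X : Fin n → Quad) → ⟦ tabulate (λ k → - coef , X k) ⟧₂ N ≡ - coef * sumFin (λ k → Θ (X k) N)
      tab {zero}  X = sym (ℤ.*-zeroʳ (- coef))
      tab {suc n} X = trans (cong (_+_ (- coef * Θ (X zero) N)) (tab (λ k → X (suc k)))) (sym (ℤ.*-distribˡ-+ (- coef) (Θ (X zero) N) (sumFin (λ k → Θ (X (suc k)) N))))
      sumFin-cong : ∀ {n} {s t : Fin n → ℤ} → (∀ k → s k ≡ t k) → sumFin s ≡ sumFin t
      sumFin-cong {zero}  e = refl
      sumFin-cong {suc n} e = cong₂ _+_ (e zero) (sumFin-cong (λ k → e (suc k)))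
      same : Θ poly N ≡ sumFin (λ k → Θ (comp (S k) (lookup post k)) N)
      same = trans (at (Θ-iso {poly} {pre} δ D D′) N) (trans (Θ-split {Q} p {{nz}} D′ (λ k → proj₁ (h k)) N)
        (sumFin-cong (λ k → at (Θ-iso {S k} {lookup post k} (proj₁ (proj₂ (h k))) (proj₁ (h k)) (proj₂ (proj₂ (h k)))) N)))

same? : ∀ (P P′ : Quad) → Maybe (P ≡ P′)
same? (quad a b c d e f) (quad a′ b′ c′ d′ e′ f′) with a ℤ.≟ a′
... | no _ = nothing
... | yes refl with f ℤ.≟ f′
...   | no _ = nothing
...   | yes refl with b ℤ.≟ b′ | c ℤ.≟ c′ | d ℤ.≟ d′ | e ℤ.≟ e′
...     | yes refl | yes refl | yes refl | yes refl = just refl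
...     | _ | _ | _ | _ = nothing

insert : ℤ × Quad → List (ℤ × Quad) → List (ℤ × Quad)
insert x [] = x ∷ []
insert (c , P) ((d , P′) ∷ L) with same? P P′
... | just _  = (c + d , P′) ∷ L
... | nothing = (d , P′) ∷ insert (c , P) L

opaque
  unfolding Combination.⟦_⟧
  ⟦⟧-insert : ∀ c P L → ⟦ insert (c , P) L ⟧₂ ≋ sc c (Θ P) ⊕ ⟦ L ⟧₂
  ⟦⟧-insert c P [] = R.refl
  ⟦⟧-insert c P ((d , P′) ∷ L) .at N with same? P P′
  ... | just refl = trans (cong (_+ ⟦ L ⟧₂ N) (ℤ.*-distribʳ-+ (Θ P N) c d)) (ℤ.+-assoc (c * Θ P N) (d * Θ P N) (⟦ L ⟧₂ N))
  ... | nothing   = trans (cong (_+_ (d * Θ P′ N)) (at (⟦⟧-insert c P L) N)) (lem (d * Θ P′ N) (c * Θ P N) (⟦ L ⟧₂ N))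
    where
    lem : ∀ x y z → x + (y + z) ≡ y + (x + z)
    lem = solve-∀

collect : List (ℤ × Quad) → List (ℤ × Quad)
collect = foldr insert []

opaque
  unfolding Combination.⟦_⟧
  ⟦⟧-collect : ∀ L → ⟦ collect L ⟧₂ ≋ ⟦ L ⟧₂
  ⟦⟧-collect []            = R.refl
  ⟦⟧-collect ((c , P) ∷ L) = R.trans (⟦⟧-insert c P (collect L)) (R.+-congˡ {sc c (Θ P)} (⟦⟧-collect L))

Null : List (ℤ × Quad) → Set
Null L = All (λ x → proj₁ x ≡ 0ℤ) L

null? : ∀ L → Dec (Null L)
null? = All.all? (λ x → proj₁ x ℤ.≟ 0ℤ)

opaque
  unfolding Combination.⟦_⟧
  ⟦⟧-null : ∀ {L} → Null L → ⟦ L ⟧₂ ≋ 𝟘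
  ⟦⟧-null []                          = R.refl
  ⟦⟧-null {(_ , P) ∷ L} (refl ∷ z) .at N = trans (cong₂ _+_ (ℤ.*-zeroˡ (Θ P N)) (at (⟦⟧-null z) N)) refl

opaque
  unfolding Combination.⟦_⟧
  -- Every relation is zero, so adding relations does not change the series; L vanishes once all
  -- like terms cancel. Both the validity of the relations and the cancellation are decided by
  -- evaluation.
  certify : ∀ L rs {_ : True (All.all? valid? rs)} {_ : True (null? (collect (L ++ concatMap expand rs)))} → ⟦ L ⟧₂ ≋ 𝟘
  certify L rs {v} {z} = begin
    ⟦ L ⟧₂  ≈⟨ R.sym (R.+-identityʳ ⟦ L ⟧₂) ⟩
    ⟦ L ⟧₂ ⊕ 𝟘  ≈⟨ R.+-congˡ {⟦ L ⟧₂} (R.sym (relations rs (toWitness v))) ⟩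
    ⟦ L ⟧₂ ⊕ ⟦ concatMap expand rs ⟧₂  ≈⟨ R.sym (⟦⟧₂-++ L (concatMap expand rs)) ⟩
    ⟦ L ++ concatMap expand rs ⟧₂  ≈⟨ R.sym (⟦⟧-collect (L ++ concatMap expand rs)) ⟩
    ⟦ collect (L ++ concatMap expand rs) ⟧₂  ≈⟨ ⟦⟧-null (toWitness z) ⟩
    𝟘  ∎
    where
    open ≋-Reasoning
    relations : ∀ rs → All Valid rs → ⟦ concatMap expand rs ⟧₂ ≋ 𝟘
    relations []       []       = R.refl
    relations (r ∷ rs) (v ∷ vs) = R.trans (⟦⟧₂-++ (expand r) (concatMap expand rs))
      (R.trans (R.+-cong (expand≋𝟘 r v) (relations rs vs)) (R.+-identityˡ 𝟘))

-- Symbolic dilation, shift, sign change and multiplication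

valid₁? : ∀ p → Dec (Valid₁ p)
valid₁? (q₁ a b c) = map′ (λ { (x , y , z) → valid₁ x y z }) (λ { (valid₁ x y z) → x , y , z }) ((1ℤ ℤ.≤? a) ×-dec (+ ∣ b ∣ ℤ.≤? a) ×-dec (0ℤ ℤ.≤? c))

Valids : List (ℤ × Quad₁) → Set
Valids = All (λ x → Valid₁ (proj₂ x))

valids? : ∀ L → Dec (Valids L)
valids? = All.all? (λ x → valid₁? (proj₂ x))

dilL : ℕ → List (ℤ × Quad₁) → List (ℤ × Quad₁)
dilL k = map (λ { (c , p) → c , scale₁ (+ k) p })

shL : ℕ → List (ℤ × Quad₁) → List (ℤ × Quad₁)
shL e = map (λ { (c , p) → c , shift₁ e p })

negL : List (ℤ × Quad₁) → List (ℤ × Quad₁)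
negL []            = []
negL ((c , p) ∷ L) = (c * σ (Quad₁.γ (even₁ p)) , even₁ p) ∷ (c * σ (Quad₁.γ (odd₁ p)) , odd₁ p) ∷ negL L

infixl 7 _⊗_
_⊗_ : List (ℤ × Quad₁) → List (ℤ × Quad₁) → List (ℤ × Quad)
L ⊗ M = concatMap (λ { (c , p) → map (λ { (d , r) → c * d , p ⊞ r }) M }) L

opaque
  unfolding Combination.⟦_⟧
  ⟦⟧-dil : ∀ k .{{_ : NonZero k}} L {_ : True (valids? L)} {_ : True (valids? (dilL k L))} → dil k ⟦ L ⟧₁ ≋ ⟦ dilL k L ⟧₁
  ⟦⟧-dil k L {v} {v′} = go L (toWitness v) (toWitness v′)
    where
    go : ∀ L → Valids L → Valids (dilL k L) → dil k ⟦ L ⟧₁ ≋ ⟦ dilL k L ⟧₁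
    go []            _        _          = dil-pointwise k (λ _ → refl) (λ _ _ → refl)
    go ((c , p) ∷ L) (v ∷ vs) (v′ ∷ vs′) = R.trans (dil-⊕ k (sc c (θ₁ p)) ⟦ L ⟧₁)
      (R.+-cong (R.trans (dil-sc k c (θ₁ p)) (sc-cong c (dil-θ₁ k v v′))) (go L vs vs′))

opaque
  unfolding Combination.⟦_⟧
  ⟦⟧-sh : ∀ e L {_ : True (valids? L)} {_ : True (valids? (shL e L))} → sh e ⟦ L ⟧₁ ≋ ⟦ shL e L ⟧₁
  ⟦⟧-sh e L {v} {v′} = go L (toWitness v) (toWitness v′)
    where
    sh-⊕ : ∀ f g → sh e (f ⊕ g) ≋ sh e f ⊕ sh e g
    sh-⊕ f g = R.trans (sh-qp e (f ⊕ g)) (R.trans (R.distribˡ (qp e) f g) (R.sym (R.+-cong (sh-qp e f) (sh-qp e g))))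
    sh-sc : ∀ c f → sh e (sc c f) ≋ sc c (sh e f)
    sh-sc c f .at n with e ≤? n
    ... | yes _ = refl
    ... | no  _ = sym (ℤ.*-zeroʳ c)
    sh-𝟘 : sh e 𝟘 ≋ 𝟘
    sh-𝟘 .at n with e ≤? n
    ... | yes _ = refl
    ... | no  _ = refl
    go : ∀ L → Valids L → Valids (shL e L) → sh e ⟦ L ⟧₁ ≋ ⟦ shL e L ⟧₁
    go []            _        _          = sh-𝟘
    go ((c , p) ∷ L) (v ∷ vs) (v′ ∷ vs′) = R.trans (sh-⊕ (sc c (θ₁ p)) ⟦ L ⟧₁)
      (R.+-cong (R.trans (sh-sc c (θ₁ p)) (sc-cong c (sh-θ₁ e v v′))) (go L vs vs′))

opaque
  unfolding Combination.⟦_⟧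
  ⟦⟧-neg : ∀ L {_ : True (valids? L)} {_ : True (valids? (negL L))} → negq ⟦ L ⟧₁ ≋ ⟦ negL L ⟧₁
  ⟦⟧-neg L {v} {v′} = go L (toWitness v) (toWitness v′)
    where
    lem : ∀ c a x b y z → c * (a * x + b * y) + z ≡ c * a * x + (c * b * y + z)
    lem = solve-∀
    go : ∀ L → Valids L → Valids (negL L) → negq ⟦ L ⟧₁ ≋ ⟦ negL L ⟧₁
    go []            _        _                = pw λ n → trans (negq≗ 𝟘 n) (ℤ.*-zeroʳ (sgn n))
    go ((c , p) ∷ L) (v ∷ vs) (v₀ ∷ v₁ ∷ vs′) = R.trans (negq-⊕ (sc c (θ₁ p)) ⟦ L ⟧₁)
      (R.trans (R.+-cong (R.trans (negq-sc c (θ₁ p)) (sc-cong c (negq-θ₁ v v₀ v₁))) (go L vs vs′))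
      (pw λ n → lem c (σ (Quad₁.γ (even₁ p))) (θ₁ (even₁ p) n) (σ (Quad₁.γ (odd₁ p))) (θ₁ (odd₁ p) n) (⟦ negL L ⟧₁ n)))

opaque
  unfolding Combination.⟦_⟧
  ⟦⟧-⊗ : ∀ L M {_ : True (valids? L)} {_ : True (valids? M)} → ⟦ L ⟧₁ ✶ ⟦ M ⟧₁ ≋ ⟦ L ⊗ M ⟧₂
  ⟦⟧-⊗ L M {v} {u} = go L (toWitness v)
    where
    row : ∀ c p → Valid₁ p → ∀ M → Valids M → sc c (θ₁ p) ✶ ⟦ M ⟧₁ ≋ ⟦ map (λ { (d , r) → c * d , p ⊞ r }) M ⟧₂
    row c p v []            _        = R.zeroʳ (sc c (θ₁ p))
    row c p v ((d , r) ∷ M) (u ∷ us) = R.trans (R.distribˡ (sc c (θ₁ p)) (sc d (θ₁ r)) ⟦ M ⟧₁)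
      (R.+-cong (R.trans (sc-✶-sc c d (θ₁ p) (θ₁ r)) (sc-cong (c * d) (θ₁-✶ v u))) (row c p v M us))
    go : ∀ L → Valids L → ⟦ L ⟧₁ ✶ ⟦ M ⟧₁ ≋ ⟦ L ⊗ M ⟧₂
    go []            _        = R.zeroˡ ⟦ M ⟧₁
    go ((c , p) ∷ L) (v ∷ vs) = R.trans (R.distribʳ ⟦ M ⟧₁ (sc c (θ₁ p)) ⟦ L ⟧₁)
      (R.trans (R.+-cong (row c p v M (toWitness u)) (go L vs)) (R.sym (⟦⟧₂-++ (map (λ { (d , r) → c * d , p ⊞ r }) M) (L ⊗ M))))

-- Each certificate lists splittings into cosets (pre, then n ↦ pn + k) and isometries (post) under which the
-- combination of theta series it is used with cancels term by term; they were found by linear algebra.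
module Certificates where
  open import Agda.Builtin.FromNat using (Number; fromNat)
  open import Agda.Builtin.FromNeg using (Negative; fromNeg)
  import Data.Integer.Literals as ℤ-Literals

  instance
    ℤ-number : Number ℤ
    ℤ-number = ℤ-Literals.number
    ℤ-negative : Negative ℤ
    ℤ-negative = ℤ-Literals.negative

  ι : Aff
  ι = aff 1 0 0 0 1 0

  -- Splitting by the parity of the index absorbs the signs and the halves in the exponents: with
  -- index 2n or 2n - 1, the exponents k(5k+1)/2 become 10n² + n and 10n² - 9n + 2, and k(5k+3)/2
  -- becomes 10n² + 3n and 10n² - 7n + 1.
  f₂L f₁L φL ψL : List (ℤ × Quad₁)
  f₂L = (1 , q₁ 10 1 0) ∷ (-1 , q₁ 10 -9 2) ∷ []
  f₁L = (1 , q₁ 10 3 0) ∷ (-1 , q₁ 10 -7 1) ∷ []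
  φL  = (1 , q₁ 1 0 0) ∷ []
  ψL  = (1 , q₁ 2 1 0) ∷ []

  t₅ : ℤ → List (ℤ × Quad₁)
  t₅ b = (1 , q₁ 5 b 0) ∷ []

  form : ℤ → ℤ → ℤ → List (ℤ × Quad)
  form a b c = (1 , quad a b c 0 0 0) ∷ []

  -- In all certificates `post` has length 1, 2 or 5. Length 1 is a mere change of variables,
  -- bringing a polynomial into a common normal form; the others split modulo 2 or 5.
  cert-f₂f₂₄ : List Rel
  cert-f₂f₂₄ =
    rel -1 (quad 10 0 40 1 4 0) ι (aff 1 0 -1 0 1 -1 ∷ []) ∷
    rel 1 (quad 10 0 40 1 -36 8) ι (aff 1 0 -1 0 -1 1 ∷ []) ∷
    rel 1 (quad 10 0 40 -9 4 2) ι (aff -1 0 1 0 1 -1 ∷ []) ∷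
    rel -1 (quad 10 0 40 -9 -36 10) ι (aff -1 0 1 0 -1 1 ∷ []) ∷
    rel -1 (quad 10 0 40 3 12 1) ι (aff 1 0 -1 0 1 -1 ∷ []) ∷
    rel 1 (quad 10 0 40 3 -28 5) ι (aff 1 0 -1 0 -1 1 ∷ []) ∷
    rel 1 (quad 10 0 40 -7 12 2) ι (aff -1 0 1 0 1 -1 ∷ []) ∷
    rel -1 (quad 10 0 40 -7 -28 6) ι (aff -1 0 1 0 -1 1 ∷ []) ∷
    rel 1 (quad 2 0 8 1 0 0) ι (aff 1 0 -1 0 -1 0 ∷ []) ∷
    rel -1 (quad 2 0 8 1 -8 2) ι (aff 1 0 -1 0 -1 1 ∷ []) ∷
    -- The shear `pre` makes the splitting one by n - m modulo 5, and the quadratic part 2n² + 8m²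
    -- is divisible by 5 on the sublattice n ≡ m.
    rel 1 (quad 2 0 8 -3 0 1) (aff 1 1 0 0 1 0) (aff 0 -1 1 -1 1 0 ∷ aff 0 1 -1 1 -1 0 ∷ aff 0 1 -1 1 -1 0 ∷ aff 0 1 -1 1 -1 0 ∷ aff 0 -1 0 -1 1 0 ∷ []) ∷
    rel -1 (quad 2 0 8 -3 -8 3) (aff 1 1 0 0 1 0) (aff 0 -1 1 1 1 -1 ∷ aff 0 1 -1 -1 -1 2 ∷ aff 0 1 -1 -1 -1 2 ∷ aff 0 -1 0 1 1 -1 ∷ aff 0 -1 0 1 1 -1 ∷ []) ∷
    []

  cert-φ² : List Rel
  cert-φ² =
    rel 4 (quad 5 0 5 4 2 1) ι (aff 0 1 -1 1 0 -1 ∷ []) ∷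
    rel -1 (quad 1 0 1 0 0 0) (aff 1 2 0 0 1 0) (aff 0 -1 0 -1 2 0 ∷ aff 1 0 -1 -2 1 1 ∷ aff 0 1 -1 -1 -2 2 ∷ aff 0 -1 0 1 2 -2 ∷ aff -1 0 0 2 -1 -1 ∷ []) ∷
    []

  cert-f₂f₁⁻ : List Rel
  cert-f₂f₁⁻ =
    rel -1 (quad 10 0 40 1 6 0) ι (aff 1 0 -1 0 1 -1 ∷ []) ∷
    rel 1 (quad 10 0 40 1 -34 7) ι (aff 1 0 -1 0 -1 1 ∷ []) ∷
    rel -1 (quad 10 0 40 1 -14 1) ι (aff 1 0 -1 0 -1 1 ∷ []) ∷
    rel 1 (quad 10 0 40 1 26 4) ι (aff 1 0 -1 0 1 -1 ∷ []) ∷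
    rel 1 (quad 10 0 40 -9 6 2) ι (aff -1 0 1 0 1 -1 ∷ []) ∷
    rel -1 (quad 10 0 40 -9 -34 9) ι (aff -1 0 1 0 -1 1 ∷ []) ∷
    rel 1 (quad 10 0 40 -9 -14 3) ι (aff -1 0 1 0 -1 1 ∷ []) ∷
    rel -1 (quad 10 0 40 -9 26 6) ι (aff -1 0 1 0 1 -1 ∷ []) ∷
    rel -1 (quad 10 0 40 3 2 0) ι (aff 1 0 -1 0 1 -1 ∷ []) ∷
    rel 1 (quad 10 0 40 3 -38 9) ι (aff 1 0 -1 0 -1 1 ∷ []) ∷
    rel 1 (quad 10 0 40 3 -18 2) ι (aff 1 0 -1 0 -1 1 ∷ []) ∷
    rel -1 (quad 10 0 40 3 22 3) ι (aff 1 0 -1 0 1 -1 ∷ []) ∷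
    rel 1 (quad 10 0 40 -7 2 1) ι (aff -1 0 1 0 1 -1 ∷ []) ∷
    rel -1 (quad 10 0 40 -7 -38 10) ι (aff -1 0 1 0 -1 1 ∷ []) ∷
    rel -1 (quad 10 0 40 -7 -18 3) ι (aff -1 0 1 0 -1 1 ∷ []) ∷
    rel 1 (quad 10 0 40 -7 22 4) ι (aff -1 0 1 0 1 -1 ∷ []) ∷
    rel 2 (quad 16 0 16 4 0 0) ι (aff 1 0 -1 0 -1 0 ∷ []) ∷
    rel -2 (quad 16 0 16 4 -16 4) ι (aff 1 0 -1 0 -1 1 ∷ []) ∷
    rel -2 (quad 16 0 16 -12 0 2) ι (aff -1 0 1 0 -1 0 ∷ []) ∷
    rel 2 (quad 16 0 16 -12 -16 6) ι (aff -1 0 1 0 -1 1 ∷ []) ∷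
    rel -1 (quad 10 0 40 -17 -58 28) ι (aff 0 -1 1 1 0 0 ∷ aff 1 0 -1 0 1 0 ∷ []) ∷
    rel -1 (quad 10 0 40 -11 -46 16) ι (aff -1 0 1 0 1 0 ∷ aff 1 0 -1 0 1 0 ∷ []) ∷
    rel 1 (quad 10 0 40 -17 -62 31) ι (aff 0 -1 1 1 0 0 ∷ aff 1 0 -1 0 1 0 ∷ []) ∷
    rel 1 (quad 10 0 40 -11 -74 37) ι (aff 0 -1 1 1 0 0 ∷ aff 0 1 -1 1 0 0 ∷ []) ∷
    rel 1 (quad 10 0 40 -13 -58 25) ι (aff 0 -1 1 1 0 0 ∷ aff 1 0 -1 0 1 0 ∷ []) ∷
    rel -1 (quad 10 0 40 -11 -54 21) ι (aff -1 0 1 0 1 0 ∷ aff 1 0 -1 0 1 0 ∷ []) ∷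
    rel -1 (quad 10 0 40 -13 -62 28) ι (aff 0 -1 1 1 0 0 ∷ aff 1 0 -1 0 1 0 ∷ []) ∷
    rel 1 (quad 10 0 40 -11 -66 30) ι (aff 0 -1 1 1 0 0 ∷ aff 0 1 -1 1 0 0 ∷ []) ∷
    rel -2 (quad 40 0 40 -62 -54 42) (aff 1 1 0 0 1 0) (aff -1 0 1 1 1 -1 ∷ aff 0 1 -1 -1 -1 2 ∷ []) ∷
    rel 2 (quad 40 0 40 -74 -62 58) (aff 1 1 0 0 1 0) (aff -1 0 1 1 1 -1 ∷ aff 0 1 -1 -1 -1 2 ∷ []) ∷
    rel -2 (quad 16 0 16 -28 -16 16) (aff 1 2 0 0 1 0) (aff 1 0 -1 -2 -1 3 ∷ aff 0 1 -1 -1 -2 3 ∷ aff 0 1 -1 1 -2 1 ∷ aff 0 -1 0 -1 2 0 ∷ aff 0 -1 0 1 2 -2 ∷ []) ∷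
    rel 2 (quad 16 0 16 -28 0 12) (aff 1 2 0 0 1 0) (aff -1 0 1 2 -1 -1 ∷ aff 1 0 -1 -2 1 1 ∷ aff 1 0 -1 -2 1 1 ∷ aff 0 1 -1 -1 -2 2 ∷ aff 0 -1 0 1 2 -2 ∷ []) ∷
    rel -2 (quad 40 0 40 -66 -42 38) (aff 1 1 0 0 1 0) (aff -1 0 1 1 1 -1 ∷ aff 0 1 -1 -1 -1 2 ∷ []) ∷
    rel -2 (quad 40 0 40 -58 -46 34) (aff 1 1 0 0 1 0) (aff -1 0 1 1 1 -1 ∷ aff 0 1 -1 -1 -1 2 ∷ []) ∷
    rel -2 (quad 40 0 40 -78 -74 72) (aff 1 1 0 0 1 0) (aff -1 0 1 1 1 -1 ∷ aff 0 1 -1 -1 -1 2 ∷ []) ∷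
    rel 2 (quad 16 0 16 -20 -16 10) (aff 1 2 0 0 1 0) (aff 1 0 -1 -2 -1 3 ∷ aff 0 1 -1 1 -2 1 ∷ aff 0 1 -1 1 -2 1 ∷ aff 0 -1 0 -1 2 0 ∷ aff -1 0 0 2 1 -2 ∷ []) ∷
    rel 2 (quad 40 0 40 -66 -58 48) (aff 1 1 0 0 1 0) (aff -1 0 1 1 1 -1 ∷ aff 0 1 -1 -1 -1 2 ∷ []) ∷
    rel 2 (quad 40 0 40 -78 -54 56) (aff 1 1 0 0 1 0) (aff -1 0 1 1 1 -1 ∷ aff 0 1 -1 -1 -1 2 ∷ []) ∷
    rel -2 (quad 16 0 16 -20 0 6) (aff 1 2 0 0 1 0) (aff -1 0 1 2 -1 -1 ∷ aff 1 0 -1 -2 1 1 ∷ aff 1 0 -1 -2 -1 2 ∷ aff 0 1 -1 -1 -2 2 ∷ aff -1 0 0 2 1 -2 ∷ []) ∷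
    rel 2 (quad 40 0 40 -46 -42 24) (aff 1 1 0 0 1 0) (aff -1 0 1 1 1 -1 ∷ aff 0 1 -1 -1 -1 2 ∷ []) ∷
    rel 1 (quad 10 0 40 -19 -46 22) ι (aff 0 -1 1 1 0 0 ∷ aff 1 0 -1 0 1 0 ∷ []) ∷
    rel -1 (quad 10 0 40 -19 -66 36) ι (aff 0 -1 1 1 0 0 ∷ aff 1 0 -1 0 1 0 ∷ []) ∷
    rel -1 (quad 10 0 40 -17 -78 45) ι (aff 0 -1 1 1 0 0 ∷ aff 0 1 -1 1 0 0 ∷ []) ∷
    rel 1 (quad 10 0 40 -13 -78 42) ι (aff 0 -1 1 1 0 0 ∷ aff 0 1 -1 1 0 0 ∷ []) ∷
    rel -1 (quad 10 0 40 -13 -42 15) ι (aff -1 0 1 0 1 0 ∷ aff 1 0 -1 0 1 0 ∷ []) ∷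
    rel 1 (quad 10 0 40 -19 -54 27) ι (aff 0 -1 1 1 0 0 ∷ aff 1 0 -1 0 1 0 ∷ []) ∷
    rel 1 (quad 10 0 40 -17 -42 18) ι (aff -1 0 1 0 1 0 ∷ aff 1 0 -1 0 1 0 ∷ []) ∷
    rel -1 (quad 10 0 40 -19 -74 43) ι (aff 0 -1 1 1 0 0 ∷ aff 1 0 -1 0 1 0 ∷ []) ∷
    []

  cert-ψ₂² : List Rel
  cert-ψ₂² =
    rel -1 (quad 4 0 4 2 2 0) ι (aff 0 1 -1 1 0 -1 ∷ []) ∷
    rel 1 (quad 20 0 20 10 10 2) ι (aff 0 1 -1 1 0 -1 ∷ []) ∷
    rel 1 (quad 5 0 5 1 3 0) ι (aff 1 0 -1 0 1 -1 ∷ []) ∷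
    rel 1 (quad 5 0 20 -7 -22 8) ι (aff -1 0 1 0 1 0 ∷ aff 1 0 -1 0 1 0 ∷ []) ∷
    rel -1 (quad 4 0 4 -6 -6 4) (aff 1 2 0 0 1 0) (aff 1 0 -1 -2 -1 3 ∷ aff 0 1 -1 -1 -2 3 ∷ aff 0 -1 0 1 2 -1 ∷ aff 0 -1 0 -1 2 0 ∷ aff -1 0 0 2 1 -2 ∷ []) ∷
    rel 1 (quad 5 0 20 -7 -38 20) ι (aff 0 -1 1 1 0 0 ∷ aff 0 1 -1 1 0 0 ∷ []) ∷
    rel 1 (quad 5 0 5 -9 -7 6) ι (aff 0 -1 1 1 0 0 ∷ aff 0 1 -1 1 0 0 ∷ []) ∷
    []

  cert-EU : List Rel
  cert-EU =
    rel -2 (quad 10 0 390 1 39 0) ι (aff 1 0 -1 0 1 -1 ∷ []) ∷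
    rel 2 (quad 10 0 390 1 -351 78) ι (aff 1 0 -1 0 -1 1 ∷ []) ∷
    rel 2 (quad 10 0 390 -9 39 2) ι (aff -1 0 1 0 1 -1 ∷ []) ∷
    rel -2 (quad 10 0 390 -9 -351 80) ι (aff -1 0 1 0 -1 1 ∷ []) ∷
    rel -2 (quad 10 0 390 3 117 8) ι (aff 1 0 -1 0 1 -1 ∷ []) ∷
    rel 2 (quad 10 0 390 3 -273 47) ι (aff 1 0 -1 0 -1 1 ∷ []) ∷
    rel 2 (quad 10 0 390 -7 117 9) ι (aff -1 0 1 0 1 -1 ∷ []) ∷
    rel -2 (quad 10 0 390 -7 -273 48) ι (aff -1 0 1 0 -1 1 ∷ []) ∷
    rel 2 (quad 30 0 130 9 13 0) ι (aff 1 0 -1 0 1 -1 ∷ []) ∷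
    rel -2 (quad 30 0 130 9 -117 26) ι (aff 1 0 -1 0 -1 1 ∷ []) ∷
    rel -2 (quad 30 0 130 -21 13 3) ι (aff -1 0 1 0 1 -1 ∷ []) ∷
    rel 2 (quad 30 0 130 -21 -117 29) ι (aff -1 0 1 0 -1 1 ∷ []) ∷
    rel -2 (quad 30 0 130 3 39 2) ι (aff 1 0 -1 0 1 -1 ∷ []) ∷
    rel 2 (quad 30 0 130 3 -91 15) ι (aff 1 0 -1 0 -1 1 ∷ []) ∷
    rel 2 (quad 30 0 130 -27 39 8) ι (aff -1 0 1 0 1 -1 ∷ []) ∷
    rel -2 (quad 30 0 130 -27 -91 21) ι (aff -1 0 1 0 -1 1 ∷ []) ∷
    rel 2 (quad 30 30 40 -63 -51 35) (aff 0 1 0 1 0 0) (aff 0 -1 1 -1 1 1 ∷ aff 0 1 -1 1 -1 1 ∷ []) ∷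
    rel -2 (quad 30 30 40 -63 -77 48) (aff 0 1 0 1 0 0) (aff 0 -1 1 -1 1 1 ∷ aff 0 1 -1 1 -1 1 ∷ []) ∷
    rel -2 (quad 30 30 40 -81 -99 80) (aff 0 1 0 1 0 0) (aff 0 -1 1 -1 1 1 ∷ aff 0 1 -1 1 -1 1 ∷ []) ∷
    rel 2 (quad 30 30 40 -69 -93 65) (aff 0 1 0 1 0 0) (aff 0 -1 1 -1 1 1 ∷ aff 0 1 -1 1 -1 1 ∷ []) ∷
    rel 2 (quad 10 10 100 -19 -29 9) (aff 0 1 0 1 0 0) (aff 0 -1 1 1 1 -1 ∷ aff 0 1 -1 -1 -1 2 ∷ []) ∷
    rel -2 (quad 10 10 100 -21 -186 89) (aff 0 1 0 1 0 0) (aff 0 -1 1 -1 1 1 ∷ aff 0 1 -1 1 -1 1 ∷ []) ∷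
    rel 2 (quad 10 10 100 -17 -67 15) (aff 0 1 0 1 0 0) (aff 0 -1 1 1 1 -1 ∷ aff 0 1 -1 -1 -1 2 ∷ []) ∷
    rel -2 (quad 10 10 100 -23 -148 60) (aff 0 1 0 1 0 0) (aff 0 -1 1 -1 1 1 ∷ aff 0 1 -1 1 -1 1 ∷ []) ∷
    rel 1 (quad 4 2 10 -5 -11 3) (aff 1 2 0 0 1 0) (aff 0 1 -1 -1 -2 3 ∷ aff 0 -1 0 1 2 -1 ∷ aff 0 1 -1 -1 -2 2 ∷ aff 0 1 -1 -1 -2 2 ∷ aff 0 -1 0 1 2 -2 ∷ []) ∷
    rel -1 (quad 4 2 10 -4 -1 0) (aff 1 2 0 0 1 0) (aff 0 -1 1 -1 1 0 ∷ aff 0 1 -1 1 -1 0 ∷ aff 0 1 -1 1 -1 0 ∷ aff 0 -1 0 -1 1 0 ∷ aff 0 -1 0 -1 1 0 ∷ []) ∷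
    rel -1 (quad 4 2 10 -5 -11 3) ι (aff 0 -1 1 1 1 -1 ∷ aff 0 1 -1 -1 -1 2 ∷ aff 0 1 -1 -1 -1 2 ∷ aff 0 -1 0 -1 0 1 ∷ aff 0 -1 0 1 1 -1 ∷ []) ∷
    rel 1 (quad 4 2 10 -4 -1 0) ι (aff 0 1 0 -1 -1 1 ∷ aff 0 -1 0 1 1 -1 ∷ aff 0 -1 0 1 1 -1 ∷ aff 0 1 -1 -1 -1 1 ∷ aff 0 1 -1 -1 -1 1 ∷ []) ∷
    []

  cert₁ : List Rel
  cert₁ =
    rel -2 (quad 5 0 195 1 39 2) ι (aff 1 0 -1 0 1 -1 ∷ []) ∷
    rel -2 (quad 5 0 195 3 117 18) ι (aff 1 0 -1 0 1 -1 ∷ []) ∷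
    rel -4 (quad 4 0 156 2 78 10) ι (aff 1 0 -1 0 1 -1 ∷ []) ∷
    rel -4 (quad 20 0 780 10 390 50) ι (aff 1 0 -1 0 1 -1 ∷ []) ∷
    rel 1 (quad 5 0 195 -5 -195 50) ι (aff -1 0 1 0 -1 1 ∷ aff 1 0 -1 0 -1 1 ∷ []) ∷
    rel 2 (quad 20 0 195 -30 -195 60) (aff 0 1 0 1 0 0) (aff 0 -1 1 1 0 0 ∷ aff 0 1 -1 1 0 0 ∷ []) ∷
    rel 1 (quad 5 2 8 -1 -8 2) (aff 0 1 0 1 0 0) (aff 0 -1 1 -1 1 0 ∷ aff 0 1 -1 1 -1 0 ∷ aff 0 1 -1 1 -1 0 ∷ aff 0 -1 0 -1 1 0 ∷ aff 0 -1 0 -1 1 0 ∷ []) ∷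
    rel -1 (quad 1 0 39 0 0 0) (aff 1 1 0 0 1 0) (aff -1 -1 0 0 1 0 ∷ aff -1 -1 0 0 1 0 ∷ []) ∷
    rel 1 (quad 4 2 10 -4 -1 1) ι (aff 0 -1 1 -1 0 0 ∷ aff 0 1 -1 1 0 0 ∷ []) ∷
    rel -1 (quad 4 4 40 -4 -2 1) ι (aff -1 0 1 0 -1 0 ∷ aff 1 0 -1 0 1 0 ∷ []) ∷
    rel -1 (quad 4 4 40 -6 -42 12) ι (aff -1 0 1 0 -1 1 ∷ aff 1 0 -1 0 1 0 ∷ []) ∷
    rel 2 (quad 10 4 16 -3 -24 9) ι (aff 0 1 0 1 0 0 ∷ aff 0 1 -1 1 0 0 ∷ []) ∷
    rel 1 (quad 4 2 10 0 0 0) ι (aff 0 -1 0 -1 0 0 ∷ aff 0 -1 0 -1 0 0 ∷ []) ∷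
    rel 1 (quad 10 4 16 0 0 0) ι (aff 0 -1 0 -1 0 0 ∷ aff 0 -1 0 -1 0 0 ∷ []) ∷
    rel -1 (quad 4 4 40 0 0 0) ι (aff -1 0 0 0 -1 0 ∷ aff -1 0 0 0 -1 0 ∷ []) ∷
    rel -1 (quad 4 4 40 -6 -42 12) (aff 1 1 0 0 1 0) (aff -1 -1 1 0 1 0 ∷ aff -1 -1 0 0 1 0 ∷ []) ∷
    rel 1 (quad 10 4 16 -2 -16 4) ι (aff 0 -1 0 -1 0 1 ∷ aff 0 -1 0 -1 0 1 ∷ []) ∷
    rel 2 (quad 4 4 40 -6 -42 12) (aff 0 1 0 1 0 0) (aff 0 -1 1 1 1 -1 ∷ aff 0 1 -1 -1 -1 2 ∷ []) ∷
    rel 1 (quad 2 1 5 0 0 0) ι (aff 0 -1 0 -1 0 0 ∷ aff 0 -1 0 -1 0 0 ∷ []) ∷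
    rel 1 (quad 1 1 10 0 0 0) ι (aff -1 0 0 0 -1 0 ∷ aff -1 0 0 0 -1 0 ∷ []) ∷
    []

  cert₂ : List Rel
  cert₂ =
    rel -2 (quad 15 0 65 9 13 2) ι (aff 1 0 -1 0 1 -1 ∷ []) ∷
    rel -2 (quad 15 0 65 3 39 6) ι (aff 1 0 -1 0 1 -1 ∷ []) ∷
    rel 4 (quad 12 0 52 6 26 4) ι (aff 1 0 -1 0 1 -1 ∷ []) ∷
    rel -4 (quad 60 0 260 30 130 20) ι (aff 1 0 -1 0 1 -1 ∷ []) ∷
    rel 2 (quad 60 60 80 -90 -110 50) (aff 0 1 0 1 0 0) (aff 0 -1 1 1 1 -1 ∷ aff 0 1 -1 -1 -1 2 ∷ []) ∷
    rel 1 (quad 20 10 50 -25 -55 20) (aff 1 1 0 0 1 0) (aff 1 1 -1 -1 0 1 ∷ aff 1 0 -1 -1 -1 1 ∷ []) ∷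
    rel -1 (quad 15 0 65 0 0 0) (aff 1 1 0 0 1 0) (aff -1 -1 0 0 1 0 ∷ aff -1 -1 0 0 1 0 ∷ []) ∷
    rel 1 (quad 20 10 50 0 0 0) (aff 1 1 0 0 1 0) (aff 1 0 0 -1 -1 0 ∷ aff 1 0 -1 -1 -1 1 ∷ []) ∷
    rel 1 (quad 15 15 20 0 0 0) ι (aff 0 1 0 -1 -1 0 ∷ aff 0 1 -1 -1 -1 1 ∷ []) ∷
    rel 1 (quad 5 2 8 -1 -8 2) (aff 1 1 0 0 1 0) (aff 0 1 -1 -1 -2 3 ∷ aff 0 1 -1 1 -2 1 ∷ aff 0 -1 0 -1 2 0 ∷ aff 0 -1 0 -1 2 0 ∷ aff 0 -1 0 1 2 -2 ∷ []) ∷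
    rel -1 (quad 15 15 20 0 0 0) (aff 0 1 0 1 0 0) (aff 0 -1 0 -1 1 0 ∷ aff 0 -1 0 -1 1 0 ∷ []) ∷
    rel -2 (quad 12 12 16 -18 -22 10) (aff 0 1 0 1 0 0) (aff 0 -1 1 1 1 -1 ∷ aff 0 1 -1 -1 -1 2 ∷ []) ∷
    rel 1 (quad 3 0 13 0 0 0) (aff 1 1 0 0 1 0) (aff -1 -1 0 0 1 0 ∷ aff -1 -1 0 0 1 0 ∷ []) ∷
    rel -1 (quad 4 2 10 0 0 0) (aff 1 1 0 0 1 0) (aff 1 0 0 -1 -1 0 ∷ aff 1 0 -1 -1 -1 1 ∷ []) ∷
    rel -1 (quad 4 2 10 -5 -11 4) (aff 1 1 0 0 1 0) (aff 1 1 -1 -1 0 1 ∷ aff 1 0 -1 -1 -1 1 ∷ []) ∷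
    rel 1 (quad 2 1 5 0 0 0) ι (aff 0 -1 0 -1 0 0 ∷ aff 0 -1 0 -1 0 0 ∷ []) ∷
    rel -1 (quad 3 3 4 0 0 0) ι (aff 0 1 0 -1 -1 0 ∷ aff 0 1 -1 -1 -1 1 ∷ []) ∷
    []

  cert₃ₐ : List Rel
  cert₃ₐ =
    rel -2 (quad 5 0 195 4 156 32) ι (aff 1 0 -1 0 1 -1 ∷ []) ∷
    rel -2 (quad 5 0 195 2 78 8) ι (aff 1 0 -1 0 1 -1 ∷ []) ∷
    rel 1 (quad 5 2 8 0 0 0) (aff 0 1 0 1 0 0) (aff 0 -1 0 -1 1 0 ∷ aff 0 1 -1 1 -1 0 ∷ aff 0 1 -1 1 -1 0 ∷ aff 0 -1 0 -1 1 0 ∷ aff 0 -1 0 -1 1 0 ∷ []) ∷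
    []

  cert₃ᵦ : List Rel
  cert₃ᵦ =
    rel 2 (quad 15 0 65 12 26 5) ι (aff 1 0 -1 0 1 -1 ∷ []) ∷
    rel 2 (quad 15 0 65 6 52 11) ι (aff 1 0 -1 0 1 -1 ∷ []) ∷
    rel -1 (quad 5 2 8 0 0 0) (aff 1 1 0 0 1 0) (aff 0 -1 0 -1 2 0 ∷ aff 0 1 -1 1 -2 1 ∷ aff 0 1 -1 -1 -2 2 ∷ aff 0 -1 0 1 2 -2 ∷ aff 0 -1 0 -1 2 -1 ∷ []) ∷
    []

-- The certified identities between theta series

open Certificates using (f₂L; f₁L; φL; ψL; t₅; form; cert-f₂f₂₄; cert-φ²; cert-f₂f₁⁻; cert-ψ₂²; cert-EU; cert₁; cert₂; cert₃ₐ; cert₃ᵦ)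

-- The subtracted product is ψ(q)φ(-q²) rather than the equal φ(q)ψ(-q): its forms, with leading
-- part 2n² + 8m², lie over ℚ(i) like those of f₂f₂(q⁴).
Θ-f₂f₂₄+qf₁f₁₄ : ⟦ f₂L ⊗ dilL 4 f₂L ++ shL 1 f₁L ⊗ dilL 4 f₁L ++ -1ℤ ∙ (ψL ⊗ dilL 2 (negL φL)) ⟧₂ ≋ 𝟘
Θ-f₂f₂₄+qf₁f₁₄ = certify (f₂L ⊗ dilL 4 f₂L ++ shL 1 f₁L ⊗ dilL 4 f₁L ++ -1ℤ ∙ (ψL ⊗ dilL 2 (negL φL))) cert-f₂f₂₄

Θ-φ²-φ₅² : ⟦ φL ⊗ φL ++ -1ℤ ∙ (dilL 5 φL ⊗ dilL 5 φL) ++ (- + 4) ∙ (shL 1 (t₅ (+ 4)) ⊗ t₅ (+ 2)) ⟧₂ ≋ 𝟘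
Θ-φ²-φ₅² = certify (φL ⊗ φL ++ -1ℤ ∙ (dilL 5 φL ⊗ dilL 5 φL) ++ (- + 4) ∙ (shL 1 (t₅ (+ 4)) ⊗ t₅ (+ 2))) cert-φ²

-- For the same reason φ(-q²)ψ(q²) is entered as ψ(-q²)φ(-q⁴).
Θ-f₂f₁⁻+f₁f₂⁻ : ⟦ f₂L ⊗ negL f₁L ++ f₁L ⊗ negL f₂L ++ (- + 2) ∙ (dilL 2 (negL ψL) ⊗ dilL 4 (negL φL)) ⟧₂ ≋ 𝟘
Θ-f₂f₁⁻+f₁f₂⁻ = certify (f₂L ⊗ negL f₁L ++ f₁L ⊗ negL f₂L ++ (- + 2) ∙ (dilL 2 (negL ψL) ⊗ dilL 4 (negL φL))) cert-f₂f₁⁻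

Θ-ψ₂²-q²ψ₁₀² : ⟦ dilL 2 ψL ⊗ dilL 2 ψL ++ -1ℤ ∙ (shL 2 (dilL 10 ψL) ⊗ dilL 10 ψL) ++ -1ℤ ∙ (t₅ 1ℤ ⊗ t₅ (+ 3)) ⟧₂ ≋ 𝟘
Θ-ψ₂²-q²ψ₁₀² = certify (dilL 2 ψL ⊗ dilL 2 ψL ++ -1ℤ ∙ (shL 2 (dilL 10 ψL) ⊗ dilL 10 ψL) ++ -1ℤ ∙ (t₅ 1ℤ ⊗ t₅ (+ 3))) cert-ψ₂²

-- Doubled, since the certificate for the identity itself would contain coefficients ±1/2.
Θ-EU : ⟦ (+ 2) ∙ (f₂L ⊗ dilL 39 f₂L ++ shL 8 f₁L ⊗ dilL 39 f₁L ++ -1ℤ ∙ (dilL 3 f₁L ⊗ dilL 13 f₂L) ++ shL 2 (dilL 3 f₂L) ⊗ dilL 13 f₁L) ⟧₂ ≋ 𝟘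
Θ-EU = certify ((+ 2) ∙ (f₂L ⊗ dilL 39 f₂L ++ shL 8 f₁L ⊗ dilL 39 f₁L ++ -1ℤ ∙ (dilL 3 f₁L ⊗ dilL 13 f₂L) ++ shL 2 (dilL 3 f₂L) ⊗ dilL 13 f₁L)) cert-EU

-- `lhs₁` and `lhs₂` expand 2q² E₂E₇₈ U U⁻ for U(1,39) and 2q² E₆E₂₆ U U⁻ for U(3,13); `lhs₃ₐ` and
-- `lhs₃ᵦ` expand 2 E₂E₇₈ U U₄ and 2q³ E₆E₂₆ U U₄ respectively.
lhs₁ lhs₂ lhs₃ₐ lhs₃ᵦ rhs₁ rhs₂ rhs₃ₐ rhs₃ᵦ : List (ℤ × Quad)
lhs₁ = (+ 2) ∙ (shL 2 (t₅ 1ℤ) ⊗ dilL 39 (t₅ 1ℤ)) ++ (+ 2) ∙ (shL 18 (t₅ (+ 3)) ⊗ dilL 39 (t₅ (+ 3)))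
  ++ (+ 4) ∙ (shL 10 (dilL 2 ψL) ⊗ dilL 39 (dilL 2 ψL)) ++ (+ 4) ∙ (shL 11 (dilL 10 ψL) ⊗ shL 39 (dilL 39 (dilL 10 ψL)))
rhs₁ = form 1ℤ 1ℤ (+ 10) ++ form (+ 2) 1ℤ (+ 5) ++ -1ℤ ∙ form 1ℤ 0ℤ (+ 39) ++ -1ℤ ∙ form (+ 5) (+ 2) (+ 8)
lhs₂ = (+ 2) ∙ (shL 2 (dilL 3 (t₅ (+ 3))) ⊗ dilL 13 (t₅ 1ℤ)) ++ (+ 2) ∙ (shL 6 (dilL 3 (t₅ 1ℤ)) ⊗ dilL 13 (t₅ (+ 3)))
  ++ (- + 4) ∙ (shL 4 (dilL 3 (dilL 2 ψL)) ⊗ dilL 13 (dilL 2 ψL)) ++ (+ 4) ∙ (shL 7 (dilL 3 (dilL 10 ψL)) ⊗ shL 13 (dilL 13 (dilL 10 ψL)))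
rhs₂ = form (+ 3) 0ℤ (+ 13) ++ form (+ 2) 1ℤ (+ 5) ++ -1ℤ ∙ form (+ 3) (+ 3) (+ 4) ++ -1ℤ ∙ form (+ 5) (+ 2) (+ 8)
lhs₃ₐ = φL ⊗ dilL 39 φL ++ dilL 5 φL ⊗ dilL 39 (dilL 5 φL) ++ (+ 2) ∙ (shL 32 (t₅ (+ 4)) ⊗ dilL 39 (t₅ (+ 4))) ++ (+ 2) ∙ (shL 8 (t₅ (+ 2)) ⊗ dilL 39 (t₅ (+ 2)))
rhs₃ₐ = form 1ℤ 0ℤ (+ 39) ++ form (+ 5) (+ 2) (+ 8)
lhs₃ᵦ = dilL 3 φL ⊗ dilL 13 φL ++ -1ℤ ∙ (dilL 3 (dilL 5 φL) ⊗ dilL 13 (dilL 5 φL))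
  ++ (- + 2) ∙ (shL 5 (dilL 3 (t₅ (+ 4))) ⊗ dilL 13 (t₅ (+ 2))) ++ (- + 2) ∙ (shL 11 (dilL 3 (t₅ (+ 2))) ⊗ dilL 13 (t₅ (+ 4)))
rhs₃ᵦ = form (+ 3) 0ℤ (+ 13) ++ -1ℤ ∙ form (+ 5) (+ 2) (+ 8)

Θ-identity₁ : ⟦ lhs₁ ++ -1ℤ ∙ rhs₁ ⟧₂ ≋ 𝟘
Θ-identity₁ = certify (lhs₁ ++ -1ℤ ∙ rhs₁) cert₁

Θ-identity₂ : ⟦ lhs₂ ++ -1ℤ ∙ rhs₂ ⟧₂ ≋ 𝟘
Θ-identity₂ = certify (lhs₂ ++ -1ℤ ∙ rhs₂) cert₂

Θ-identity₃ₐ : ⟦ lhs₃ₐ ++ -1ℤ ∙ rhs₃ₐ ⟧₂ ≋ 𝟘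
Θ-identity₃ₐ = certify (lhs₃ₐ ++ -1ℤ ∙ rhs₃ₐ) cert₃ₐ

Θ-identity₃ᵦ : ⟦ lhs₃ᵦ ++ -1ℤ ∙ rhs₃ᵦ ⟧₂ ≋ 𝟘
Θ-identity₃ᵦ = certify (lhs₃ᵦ ++ -1ℤ ∙ rhs₃ᵦ) cert₃ᵦ

⟦⟧₁-single : ∀ c p → ⟦ (c , p) ∷ [] ⟧₁ ≋ sc c (θ₁ p)
⟦⟧₁-single c p = R.trans (⟦⟧₁-∷ c p []) (R.trans (R.+-congˡ {sc c (θ₁ p)} ⟦⟧₁-[]) (R.+-identityʳ (sc c (θ₁ p))))

⟦⟧₁-pair : ∀ c p d r → ⟦ (c , p) ∷ (d , r) ∷ [] ⟧₁ ≋ sc c (θ₁ p) ⊕ sc d (θ₁ r)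
⟦⟧₁-pair c p d r = R.trans (⟦⟧₁-∷ c p ((d , r) ∷ [])) (R.+-congˡ {sc c (θ₁ p)} (⟦⟧₁-single d r))

-- From bilateral series to theta series of quadratic polynomials

module ThetaSum (s : ℤ) (s² : s * s ≡ 1ℤ) (i j : ℕ) .{{_ : NonZero i}} .{{_ : NonZero j}} where
  open Theta s s² i j

  sign : ℤ → ℤ
  sign z = sg ∣ z ∣

  expo : ℤ → ℕ
  expo (+ n)      = ex i n
  expo ℤ.-[1+ n ] = ex j (suc n)

  full-at : ∀ L k → full L k ≋ sc (sign (k ℤ.⊖ L)) (qp (expo (k ℤ.⊖ L)))
  full-at zero    k       = half-mono i k
  full-at (suc L) zero    = half-mono j (suc L)
  full-at (suc L) (suc k) = R.trans (full-at L k) (R.reflexive (cong (λ z → sc (sign z) (qp (expo z))) (sym (ℤ.[1+m]⊖[1+n]≡m⊖n k L))))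

  -- Doubling avoids the halves in ((i + j)z² + (i - j)z)/2. One formula covers both halves of the
  -- series because z ↦ -z exchanges i and j.
  expo-quad : ∀ z → + 2 * + expo z ≡ + (i ℕ.+ j) * z * z + (+ i - + j) * z
  expo-quad z = go z
    where
    m = i ℕ.+ j
    one-sided : ∀ c n → + 2 * + ex c n ≡ + m * + n * + n + (+ 2 * + c - + m) * + n
    one-sided c zero    = sym (trans (lem₀ (+ m) (+ 2 * + c - + m)) refl)
      where
      lem₀ : ∀ a b → a * 0ℤ * 0ℤ + b * 0ℤ ≡ 0ℤ
      lem₀ = solve-∀
    one-sided c (suc n) = trans (cong (λ z → + 2 * (+ ex c n + (+ c + z))) (ℤ.pos-* n m))
      (trans (ℤ.*-distribˡ-+ (+ 2) (+ ex c n) (+ c + + n * + m)) (trans (cong (_+ + 2 * (+ c + + n * + m)) (one-sided c n)) (lem (+ m) (+ n) (+ c))))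
      where
      lem : ∀ m n c → m * n * n + (+ 2 * c - m) * n + + 2 * (c + n * m) ≡ m * (1ℤ + n) * (1ℤ + n) + (+ 2 * c - m) * (1ℤ + n)
      lem = solve-∀
    go : ∀ z → + 2 * + expo z ≡ + m * z * z + (+ i - + j) * z
    go (+ n)      = trans (one-sided i n) (lem (+ i) (+ j) (+ n))
      where
      lem : ∀ i j n → (i + j) * n * n + (+ 2 * i - (i + j)) * n ≡ (i + j) * n * n + (i - j) * n
      lem = solve-∀
    go ℤ.-[1+ n ] = trans (one-sided j (suc n)) (lem (+ i) (+ j) (+ suc n))
      where
      lem : ∀ i j n → (i + j) * n * n + (+ 2 * j - (i + j)) * n ≡ (i + j) * (- n) * (- n) + (i - j) * (- n)
      lem = solve-∀

  ∣z∣≤expo : ∀ z → ∣ z ∣ ℕ.≤ expo z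
  ∣z∣≤expo (+ n)      = n≤ex i n
  ∣z∣≤expo ℤ.-[1+ n ] = n≤ex j (suc n)

  bil-HasSum : ∀ N → HasSum (λ z → sign z * ind (+ expo z) (+ N)) (bil N)
  bil-HasSum N = subst (HasSum _) (sym total) (HasSum-ℤ N support)
    where
    total : bil N ≡ sumZ N (λ z → sign z * ind (+ expo z) (+ N))
    total = trans (adsum-sumTo (N ℕ.+ N) (full N) N) (sumTo-cong (N ℕ.+ N) (λ k → trans (at (full-at N k) N)
      (trans (cong (λ z → sign z * qp (expo z) N) (sym (ℤ.m-n≡m⊖n k N))) (cong (sign (+ k - + N) *_) (sym (ind-qp (expo (+ k - + N)) N))))))
    support : ∀ z → sign z * ind (+ expo z) (+ N) ≢ 0ℤ → ∣ z ∣ ℕ.≤ N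
    support z ne with + expo z ℤ.≟ + N
    ... | yes e = subst (∣ z ∣ ℕ.≤_) (ℤ.+-injective e) (∣z∣≤expo z)
    ... | no  _ = ⊥-elim (ne (ℤ.*-zeroʳ (sign z)))

  ind-expo : ∀ z y N → + 2 * y ≡ + (i ℕ.+ j) * z * z + (+ i - + j) * z → ind y (+ N) ≡ ind (+ expo z) (+ N)
  ind-expo z y N e = cong (λ x → ind x (+ N)) (ℤ.*-cancelˡ-≡ (+ 2) y (+ expo z) (trans e (sym (expo-quad z))))

  sg-1 : s ≡ 1ℤ → ∀ n → sg n ≡ 1ℤ
  sg-1 e zero    = refl
  sg-1 e (suc n) = cong₂ _*_ (sg-1 e n) e

  sg-σ : s ≡ -1ℤ → ∀ n → sg n ≡ sgn n
  sg-σ e zero    = refl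
  sg-σ e (suc n) = trans (cong₂ _*_ (sg-σ e n) e) (trans (ℤ.*-comm (sgn n) -1ℤ) (ℤ.-1*i≡-i (sgn n)))

  bil-plus : s ≡ 1ℤ → ∀ {p} → Valid₁ p → (∀ z → + 2 * ev₁ p z ≡ + (i ℕ.+ j) * z * z + (+ i - + j) * z) → bil ≋ ⟦ (1ℤ , p) ∷ [] ⟧₁
  bil-plus s1 {p} v e .at N = trans (HasSum-unique (bil-HasSum N) (HasSum-cong (λ z → trans (ind-expo z (ev₁ p z) N (e z))
      (sym (trans (cong (_* ind (+ expo z) (+ N)) (sg-1 s1 (∣ z ∣))) (ℤ.*-identityˡ (ind (+ expo z) (+ N)))))) (θ₁-HasSum v N)))
    (sym (at (R.trans (⟦⟧₁-single 1ℤ p) (sc1 (θ₁ p))) N))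

  -- Even and odd indices carry opposite signs. The argument n + 1 of p′ occurs because p′ describes
  -- the odd index as 2n - 1, whereas `HasSum-parity` uses 2n + 1.
  bil-minus : s ≡ -1ℤ → ∀ {p p′} → Valid₁ p → Valid₁ p′ →
    (∀ n → + 2 * ev₁ p n ≡ + (i ℕ.+ j) * (n * + 2) * (n * + 2) + (+ i - + j) * (n * + 2)) →
    (∀ n → + 2 * ev₁ p′ (n + 1ℤ) ≡ + (i ℕ.+ j) * (1ℤ + n * + 2) * (1ℤ + n * + 2) + (+ i - + j) * (1ℤ + n * + 2)) →
    bil ≋ ⟦ (1ℤ , p) ∷ (-1ℤ , p′) ∷ [] ⟧₁
  bil-minus s-1 {p} {p′} v v′ e e′ .at N = trans (HasSum-parity (bil-HasSum N)
      (HasSum-cong (λ n → cong₂ _*_ (sym (sgn₀ n)) (ind-expo (n * + 2) (ev₁ p n) N (e n))) (HasSum-*ˡ 1ℤ (θ₁-HasSum v N)))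
      (HasSum-cong (λ n → cong₂ _*_ (sym (sgn₁ n)) (ind-expo (1ℤ + n * + 2) (ev₁ p′ (n + 1ℤ)) N (e′ n))) (HasSum-pred (HasSum-*ˡ -1ℤ (θ₁-HasSum v′ N)))))
    (sym (at (⟦⟧₁-pair 1ℤ p -1ℤ p′) N))
    where
    l₀ : ∀ n → n * + 2 ≡ 0ℤ + + 2 * n
    l₀ = solve-∀
    l₁ : ∀ n → 1ℤ + n * + 2 ≡ 1ℤ + + 2 * n
    l₁ = solve-∀
    sgn₀ : ∀ n → sign (n * + 2) ≡ 1ℤ
    sgn₀ n = trans (sg-σ s-1 (∣ n * + 2 ∣)) (trans (cong σ (l₀ n)) (σ-even 0ℤ n))
    sgn₁ : ∀ n → sign (1ℤ + n * + 2) ≡ -1ℤ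
    sgn₁ n = trans (sg-σ s-1 (∣ 1ℤ + n * + 2 ∣)) (trans (cong σ (l₁ n)) (σ-even 1ℤ n))

f₂≋ : f₂.bil ≋ ⟦ f₂L ⟧₁
f₂≋ = ThetaSum.bil-minus -1ℤ refl 3 2 refl (toWitness {a? = valid₁? (q₁ (+ 10) 1ℤ 0ℤ)} _) (toWitness {a? = valid₁? (q₁ (+ 10) (- + 9) (+ 2))} _) e e′
  where
  e : ∀ n → + 2 * (+ 10 * n * n + 1ℤ * n + 0ℤ) ≡ + 5 * (n * + 2) * (n * + 2) + 1ℤ * (n * + 2)
  e = solve-∀
  e′ : ∀ n → + 2 * (+ 10 * (n + 1ℤ) * (n + 1ℤ) + (- + 9) * (n + 1ℤ) + + 2) ≡ + 5 * (1ℤ + n * + 2) * (1ℤ + n * + 2) + 1ℤ * (1ℤ + n * + 2)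
  e′ = solve-∀

f₁≋ : f₁.bil ≋ ⟦ f₁L ⟧₁
f₁≋ = ThetaSum.bil-minus -1ℤ refl 4 1 refl (toWitness {a? = valid₁? (q₁ (+ 10) (+ 3) 0ℤ)} _) (toWitness {a? = valid₁? (q₁ (+ 10) (- + 7) 1ℤ)} _) e e′
  where
  e : ∀ n → + 2 * (+ 10 * n * n + + 3 * n + 0ℤ) ≡ + 5 * (n * + 2) * (n * + 2) + + 3 * (n * + 2)
  e = solve-∀
  e′ : ∀ n → + 2 * (+ 10 * (n + 1ℤ) * (n + 1ℤ) + (- + 7) * (n + 1ℤ) + 1ℤ) ≡ + 5 * (1ℤ + n * + 2) * (1ℤ + n * + 2) + + 3 * (1ℤ + n * + 2)
  e′ = solve-∀

θ₀≋ : θ₀.bil ≋ ⟦ φL ⟧₁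
θ₀≋ = ThetaSum.bil-plus 1ℤ refl 1 1 refl (toWitness {a? = valid₁? (q₁ 1ℤ 0ℤ 0ℤ)} _) e
  where
  e : ∀ z → + 2 * (1ℤ * z * z + 0ℤ * z + 0ℤ) ≡ + 2 * z * z + 0ℤ * z
  e = solve-∀

θ₂≋ : θ₂.bil ≋ ⟦ ψL ⟧₁
θ₂≋ = ThetaSum.bil-plus 1ℤ refl 3 1 refl (toWitness {a? = valid₁? (q₁ (+ 2) 1ℤ 0ℤ)} _) e
  where
  e : ∀ z → + 2 * (+ 2 * z * z + 1ℤ * z + 0ℤ) ≡ + 4 * z * z + + 2 * z
  e = solve-∀

θ₅₁≋ : θ₅₁.bil ≋ ⟦ t₅ 1ℤ ⟧₁
θ₅₁≋ = ThetaSum.bil-plus 1ℤ refl 6 4 refl (toWitness {a? = valid₁? (q₁ (+ 5) 1ℤ 0ℤ)} _) e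
  where
  e : ∀ z → + 2 * (+ 5 * z * z + 1ℤ * z + 0ℤ) ≡ + 10 * z * z + + 2 * z
  e = solve-∀

θ₅₂≋ : θ₅₂.bil ≋ ⟦ t₅ (+ 2) ⟧₁
θ₅₂≋ = ThetaSum.bil-plus 1ℤ refl 7 3 refl (toWitness {a? = valid₁? (q₁ (+ 5) (+ 2) 0ℤ)} _) e
  where
  e : ∀ z → + 2 * (+ 5 * z * z + + 2 * z + 0ℤ) ≡ + 10 * z * z + + 4 * z
  e = solve-∀

θ₅₃≋ : θ₅₃.bil ≋ ⟦ t₅ (+ 3) ⟧₁
θ₅₃≋ = ThetaSum.bil-plus 1ℤ refl 8 2 refl (toWitness {a? = valid₁? (q₁ (+ 5) (+ 3) 0ℤ)} _) e
  where
  e : ∀ z → + 2 * (+ 5 * z * z + + 3 * z + 0ℤ) ≡ + 10 * z * z + + 6 * z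
  e = solve-∀

θ₅₄≋ : θ₅₄.bil ≋ ⟦ t₅ (+ 4) ⟧₁
θ₅₄≋ = ThetaSum.bil-plus 1ℤ refl 9 1 refl (toWitness {a? = valid₁? (q₁ (+ 5) (+ 4) 0ℤ)} _) e
  where
  e : ∀ z → + 2 * (+ 5 * z * z + + 4 * z + 0ℤ) ≡ + 10 * z * z + + 8 * z
  e = solve-∀

phi≋ : phi ≋ ⟦ φL ⟧₁
phi≋ .at N = trans (sumTo-cong (N ℕ.+ N) (λ k → cong (λ x → ind x (+ N)) (lem (+ k - + N)))) (sym (at (R.trans (⟦⟧₁-single 1ℤ (q₁ 1ℤ 0ℤ 0ℤ)) (sc1 (θ₁ (q₁ 1ℤ 0ℤ 0ℤ)))) N))
  where
  lem : ∀ n → n * n ≡ 1ℤ * n * n + 0ℤ * n + 0ℤ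
  lem = solve-∀

-- The triangular numbers n(n+1)/2, n ≥ 0, are the values 2z² + z, z ∈ ℤ, via n = 2z for z ≥ 0 and n = -2z - 1 for z < 0.
psi≋ : psi ≋ ⟦ ψL ⟧₁
psi≋ .at N = trans (HasSum-unique (HasSum-bij to back to-back to-inj onℕ) (HasSum-cong value (θ₁-HasSum {q₁ (+ 2) 1ℤ 0ℤ} (toWitness {a? = valid₁? (q₁ (+ 2) 1ℤ 0ℤ)} _) N))) (sym (at (R.trans (⟦⟧₁-single 1ℤ (q₁ (+ 2) 1ℤ 0ℤ)) (sc1 (θ₁ (q₁ (+ 2) 1ℤ 0ℤ)))) N))
  where
  f : ℕ → ℤ
  f n = ind (+ (n ℕ.* suc n)) (+ (2 ℕ.* N))
  onℕ : HasSum f (psi N)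
  onℕ = hasSum (downFrom (suc N)) (Unique.downFrom⁺ (suc N)) (λ n ne → ∈-downFrom⁺ (s≤s (small n (ℤ.+-injective (ind-≢0 ne))))) (sumL-downFrom N f)
    where
    small : ∀ n → n ℕ.* suc n ≡ 2 ℕ.* N → n ℕ.≤ N
    small zero    _ = z≤n
    small (suc n) e = ℕ.*-cancelˡ-≤ 2 (subst (2 ℕ.* suc n ℕ.≤_) e (subst (ℕ._≤ suc n ℕ.* suc (suc n)) (ℕ.*-comm (suc n) 2) (ℕ.*-monoʳ-≤ (suc n) (s≤s (s≤s z≤n)))))
  to : ℤ → ℕ
  to (+ n)      = n ℕ.* 2
  to ℤ.-[1+ n ] = suc (n ℕ.* 2)
  away : ℤ → ℤ
  away (+ n)      = + suc n
  away ℤ.-[1+ n ] = ℤ.-[1+ suc n ]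
  back : ℕ → ℤ
  back zero          = + 0
  back (suc zero)    = ℤ.-[1+ 0 ]
  back (suc (suc n)) = away (back n)
  to-away : ∀ z → to (away z) ≡ suc (suc (to z))
  to-away (+ n)      = refl
  to-away ℤ.-[1+ n ] = refl
  to-back : ∀ n → to (back n) ≡ n
  to-back zero          = refl
  to-back (suc zero)    = refl
  to-back (suc (suc n)) = trans (to-away (back n)) (cong (λ k → suc (suc k)) (to-back n))
  back-to : ∀ z → back (to z) ≡ z
  back-to (+ zero)         = refl
  back-to (+ suc n)        = cong away (back-to (+ n))
  back-to ℤ.-[1+ zero ]    = refl
  back-to ℤ.-[1+ suc n ]   = cong away (back-to ℤ.-[1+ n ])
  to-inj : ∀ {x y} → to x ≡ to y → x ≡ y
  to-inj {x} {y} e = trans (sym (back-to x)) (trans (cong back e) (back-to y))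
  twice : ∀ z → + (to z ℕ.* suc (to z)) ≡ + 2 * (+ 2 * z * z + 1ℤ * z + 0ℤ)
  twice (+ n)      = trans (ℤ.pos-* (n ℕ.* 2) (suc (n ℕ.* 2))) (trans (cong (λ x → x * (1ℤ + x)) (ℤ.pos-* n 2)) (lem (+ n)))
    where
    lem : ∀ n → n * + 2 * (1ℤ + n * + 2) ≡ + 2 * (+ 2 * n * n + 1ℤ * n + 0ℤ)
    lem = solve-∀
  twice ℤ.-[1+ n ] = trans (ℤ.pos-* (suc (n ℕ.* 2)) (suc (suc (n ℕ.* 2)))) (trans (cong (λ x → (1ℤ + x) * (1ℤ + (1ℤ + x))) (ℤ.pos-* n 2)) (lem (+ n)))
    where
    lem : ∀ n → (1ℤ + n * + 2) * (1ℤ + (1ℤ + n * + 2)) ≡ + 2 * (+ 2 * (- (1ℤ + n)) * (- (1ℤ + n)) + 1ℤ * (- (1ℤ + n)) + 0ℤ)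
    lem = solve-∀
  value : ∀ z → ind (+ 2 * z * z + 1ℤ * z + 0ℤ) (+ N) ≡ f (to z)
  value z = ind-⇔ (λ e → trans (twice z) (trans (cong (+ 2 *_) e) (sym (ℤ.pos-* 2 N))))
    (λ e → ℤ.*-cancelˡ-≡ (+ 2) (+ 2 * z * z + 1ℤ * z + 0ℤ) (+ N) (trans (sym (twice z)) (trans e (ℤ.pos-* 2 N))))

-- The identities for G, H and U

dil-dil : ∀ j k .{{_ : NonZero j}} .{{_ : NonZero k}} .{{_ : NonZero (k ℕ.* j)}} f → dil j (dil k f) ≋ dil (k ℕ.* j) f
dil-dil j k f = dil-pointwise j em eo
  where
  assoc : ∀ m → m ℕ.* (k ℕ.* j) ≡ m ℕ.* k ℕ.* j
  assoc m = sym (ℕ.*-assoc m k j)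
  em : ∀ m → dil (k ℕ.* j) f (m ℕ.* j) ≡ dil k f m
  em m with mult? k m
  ... | multiple m′ = trans (cong (dil (k ℕ.* j) f) (sym (assoc m′))) (trans (dil-mult (k ℕ.* j) f m′) (sym (dil-mult k f m′)))
  ... | other ne    = trans (dil-other (k ℕ.* j) f (m ℕ.* j) ne′) (sym (dil-other k f m ne))
    where
    ne′ : (m ℕ.* j) % (k ℕ.* j) ≢ 0
    ne′ z = ne (n∣m⇒m%n≡0 m k (*-cancelʳ-∣ {k} {m} j (m%n≡0⇒n∣m (m ℕ.* j) (k ℕ.* j) z)))
  eo : ∀ n → n % j ≢ 0 → dil (k ℕ.* j) f n ≡ 0ℤ
  eo n ne with mult? (k ℕ.* j) n
  ... | multiple m = ⊥-elim (ne (trans (cong (_% j) (assoc m)) (m*n%n≡0 (m ℕ.* k) j)))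
  ... | other ne′  = dil-other (k ℕ.* j) f n ne′

sgn-*-odd : ∀ j → sgn j ≡ -1ℤ → ∀ m → sgn (m ℕ.* j) ≡ sgn m
sgn-*-odd j o zero    = refl
sgn-*-odd j o (suc m) = trans (sgn-+ j (m ℕ.* j)) (trans (cong₂ _*_ o (sgn-*-odd j o m)) (ℤ.-1*i≡-i (sgn m)))

negq-dil : ∀ j .{{_ : NonZero j}} → sgn j ≡ -1ℤ → ∀ f → negq (dil j f) ≋ dil j (negq f)
negq-dil j o f = R.sym (dil-pointwise j
  (λ m → trans (negq≗ (dil j f) (m ℕ.* j)) (trans (cong₂ _*_ (sgn-*-odd j o m) (dil-mult j f m)) (sym (negq≗ f m))))
  (λ n ne → trans (negq≗ (dil j f) n) (trans (cong (sgn n *_) (dil-other j f n ne)) (ℤ.*-zeroʳ (sgn n)))))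

negq-dil2 : ∀ f → negq (dil 2 f) ≋ dil 2 f
negq-dil2 f = R.sym (dil-pointwise 2
  (λ m → trans (negq≗ (dil 2 f) (m ℕ.* 2)) (trans (cong₂ _*_ (sgn-even (m ℕ.* 2) (m*n%n≡0 m 2)) (dil-mult 2 f m)) (ℤ.*-identityˡ (f m))))
  (λ n ne → trans (negq≗ (dil 2 f) n) (trans (cong (sgn n *_) (dil-other 2 f n ne)) (ℤ.*-zeroʳ (sgn n)))))

negq-negq : ∀ f → negq (negq f) ≋ f
negq-negq f .at n = trans (negq≗ (negq f) n) (trans (cong (sgn n *_) (negq≗ f n))
  (trans (sym (ℤ.*-assoc (sgn n) (sgn n) (f n))) (trans (cong (_* f n) (sgn² n)) (ℤ.*-identityˡ (f n)))))
  where
  lem : ∀ x → - x * - x ≡ x * x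
  lem = solve-∀
  sgn² : ∀ n → sgn n * sgn n ≡ 1ℤ
  sgn² zero    = refl
  sgn² (suc n) = trans (lem (sgn n)) (sgn² n)

-- This and the following combinators ending in θ pair a series with its list of theta series, so
-- that the list of a compound expression is assembled along its syntax.
dilθ : ∀ k .{{_ : NonZero k}} {f L} → f ≋ ⟦ L ⟧₁ → {_ : True (valids? L)} {_ : True (valids? (dilL k L))} → dil k f ≋ ⟦ dilL k L ⟧₁
dilθ k {f} {L} e {v} {v′} = R.trans (dil-cong k e) (⟦⟧-dil k L {v} {v′})

shθ : ∀ k {f L} → f ≋ ⟦ L ⟧₁ → {_ : True (valids? L)} {_ : True (valids? (shL k L))} → sh k f ≋ ⟦ shL k L ⟧₁
shθ k {f} {L} e {v} {v′} = R.trans (sh-cong k e) (⟦⟧-sh k L {v} {v′})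

negθ : ∀ {f L} → f ≋ ⟦ L ⟧₁ → {_ : True (valids? L)} {_ : True (valids? (negL L))} → negq f ≋ ⟦ negL L ⟧₁
negθ {f} {L} e {v} {v′} = R.trans (negq-cong e) (⟦⟧-neg L {v} {v′})

infixl 7 _✶θ_
_✶θ_ : ∀ {f g L M} → f ≋ ⟦ L ⟧₁ → g ≋ ⟦ M ⟧₁ → {_ : True (valids? L)} {_ : True (valids? M)} → f ✶ g ≋ ⟦ L ⊗ M ⟧₂
_✶θ_ {L = L} {M} e e′ {v} {v′} = R.trans (✶-cong e e′) (⟦⟧-⊗ L M {v} {v′})

infixl 6 _⊕θ_
_⊕θ_ : ∀ {f g L M} → f ≋ ⟦ L ⟧₂ → g ≋ ⟦ M ⟧₂ → f ⊕ g ≋ ⟦ L ++ M ⟧₂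
_⊕θ_ {L = L} {M} e e′ = R.trans (R.+-cong e e′) (R.sym (⟦⟧₂-++ L M))

scθ : ∀ c {f L} → f ≋ ⟦ L ⟧₂ → sc c f ≋ ⟦ c ∙ L ⟧₂
scθ c {f} {L} e = R.trans (sc-cong c e) (R.sym (⟦⟧₂-scale c L))

≋-from : ∀ {f g L M} → f ≋ ⟦ L ⟧₂ → g ≋ ⟦ M ⟧₂ → ⟦ L ++ -1ℤ ∙ M ⟧₂ ≋ 𝟘 → f ≋ g
≋-from {f} {g} {L} {M} e e′ z = R.trans e (R.trans (⊖-zero (R.trans (R.+-congˡ {⟦ L ⟧₂} (R.trans (R.sym (sc-1 ⟦ M ⟧₂)) (R.sym (⟦⟧₂-scale -1ℤ M))))
  (R.trans (R.sym (⟦⟧₂-++ L (-1ℤ ∙ M))) z))) (R.sym e′))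

T₅ : ℤ → PS
T₅ b = ⟦ t₅ b ⟧₁

f₂θ : E ✶ G ≋ ⟦ f₂L ⟧₁
f₂θ = R.trans EG≋f₂ f₂≋

f₁θ : E ✶ H ≋ ⟦ f₁L ⟧₁
f₁θ = R.trans EH≋f₁ f₁≋

-- Unlike other indices, that of `φ₂` includes a sign: it is φ(-q²).
E⁻ φ₂ ψ⁻ : PS
E⁻ = negq E
φ₂ = dil 2 (negq phi)
ψ⁻ = negq psi

phi≋θ₀ : phi ≋ θ₀.bil
phi≋θ₀ = R.trans phi≋ (R.sym θ₀≋)

psi≋θ₂ : psi ≋ θ₂.bil
psi≋θ₂ = R.trans psi≋ (R.sym θ₂≋)

φ₂≋ : φ₂ ≋ φ-q²
φ₂≋ = dil-cong 2 (negq-cong phi≋θ₀)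

ψ⁻≋ : ψ⁻ ≋ ψ-q
ψ⁻≋ = negq-cong psi≋θ₂

unit-✶ : ∀ {f g} → f 0 ≡ 1ℤ → g 0 ≡ 1ℤ → (f ✶ g) 0 ≡ 1ℤ
unit-✶ {f} {g} e e′ = trans (✶-at-0 f g) (cong₂ _*_ e e′)

✶-cancel-unit : ∀ f {g h} → f 0 ≡ 1ℤ → f ✶ g ≋ f ✶ h → g ≋ h
✶-cancel-unit f u = ✶-cancelˡ f (λ z → 1≢0 (trans (sym u) z))
  where
  1≢0 : 1ℤ ≢ 0ℤ
  1≢0 ()

phi-E : negq phi ✶ dil 2 E ≋ E ✶ E
phi-E = R.trans (✶-cong (negq-cong phi≋θ₀) (R.sym (negq-dil2 E))) (R.trans (R.sym (negq-✶ θ₀.bil (dil 2 E)))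
  (R.trans (negq-cong φE₂≋E⁻²) (R.trans (negq-✶ (negq E) (negq E)) (✶-cong (negq-negq E) (negq-negq E)))))

φ₂-E : φ₂ ✶ dil 4 E ≋ dil 2 E ✶ dil 2 E
φ₂-E = R.trans (✶-cong R.refl (R.sym (dil-dil 2 2 E))) (R.trans (R.sym (dil-✶ 2 (negq phi) (dil 2 E))) (R.trans (dil-cong 2 phi-E) (dil-✶ 2 E E)))

ψ⁻-E⁻ : ψ⁻ ✶ E⁻ ≋ dil 2 E ✶ dil 2 E
ψ⁻-E⁻ = R.trans (✶-cong ψ⁻≋ R.refl) (R.trans (R.sym (negq-✶ θ₂.bil E)) (R.trans (negq-cong ψE≋E₂²) (R.trans (negq-✶ (dil 2 E) (dil 2 E)) (✶-cong (negq-dil2 E) (negq-dil2 E)))))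

psi-E : psi ✶ E ≋ dil 2 E ✶ dil 2 E
psi-E = R.trans (✶-cong psi≋θ₂ R.refl) ψE≋E₂²

EE⁻≋E₂φ₂ : E ✶ E⁻ ≋ dil 2 E ✶ φ₂
EE⁻≋E₂φ₂ = ✶-cancel-unit (dil 4 E) refl (begin
  dil 4 E ✶ (E ✶ E⁻)  ≈⟨ ×-solve 3 (λ a b c → a · (b · c) :≈ c · b · a) R.refl (dil 4 E) E E⁻ ⟩
  E⁻ ✶ E ✶ dil 4 E  ≈⟨ E⁻EE₄≋E₂³ ⟩
  dil 2 E ✶ dil 2 E ✶ dil 2 E  ≈⟨ ✶-cong (R.sym φ₂-E) R.refl ⟩
  φ₂ ✶ dil 4 E ✶ dil 2 E  ≈⟨ ×-solve 3 (λ a b c → a · b · c :≈ b · (c · a)) R.refl φ₂ (dil 4 E) (dil 2 E) ⟩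
  dil 4 E ✶ (dil 2 E ✶ φ₂)  ∎)
  where open ≋-Reasoning

EE₄≋E₂ψ⁻ : E ✶ dil 4 E ≋ dil 2 E ✶ ψ⁻
EE₄≋E₂ψ⁻ = ✶-cancel-unit E⁻ refl (begin
  E⁻ ✶ (E ✶ dil 4 E)  ≈⟨ R.sym (R.*-assoc E⁻ E (dil 4 E)) ⟩
  E⁻ ✶ E ✶ dil 4 E  ≈⟨ E⁻EE₄≋E₂³ ⟩
  dil 2 E ✶ dil 2 E ✶ dil 2 E  ≈⟨ ✶-cong (R.sym ψ⁻-E⁻) R.refl ⟩
  ψ⁻ ✶ E⁻ ✶ dil 2 E  ≈⟨ ×-solve 3 (λ a b c → a · b · c :≈ b · (c · a)) R.refl ψ⁻ E⁻ (dil 2 E) ⟩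
  E⁻ ✶ (dil 2 E ✶ ψ⁻)  ∎)
  where open ≋-Reasoning

-- Both sides are the same eta quotient. This exchange, and `φ⁻ψ≋ψ⁻φ₂` at q², carry products over
-- ℚ(√-2) to products over ℚ(i).
ψφ₂≋φψ⁻ : psi ✶ φ₂ ≋ phi ✶ ψ⁻
ψφ₂≋φψ⁻ = ✶-cancel-unit (E ✶ dil 4 E) (unit-✶ {E} {dil 4 E} refl refl) (begin
  E ✶ dil 4 E ✶ (psi ✶ φ₂)  ≈⟨ ×-solve 4 (λ e f p r → e · f · (p · r) :≈ (p · e) · (r · f)) R.refl E (dil 4 E) psi φ₂ ⟩
  psi ✶ E ✶ (φ₂ ✶ dil 4 E)  ≈⟨ ✶-cong (R.trans psi-E (R.sym ψ⁻-E⁻)) (R.trans φ₂-E (R.sym ψ⁻-E⁻)) ⟩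
  ψ⁻ ✶ E⁻ ✶ (ψ⁻ ✶ E⁻)  ≈⟨ ×-solve 2 (λ p e → p · e · (p · e) :≈ (e · e) · (p · p)) R.refl ψ⁻ E⁻ ⟩
  E⁻ ✶ E⁻ ✶ (ψ⁻ ✶ ψ⁻)  ≈⟨ ✶-cong (R.trans (R.sym φE₂≋E⁻²) (✶-cong (R.sym phi≋θ₀) R.refl)) R.refl ⟩
  phi ✶ dil 2 E ✶ (ψ⁻ ✶ ψ⁻)  ≈⟨ ×-solve 3 (λ f d p → f · d · (p · p) :≈ (d · p) · (f · p)) R.refl phi (dil 2 E) ψ⁻ ⟩
  dil 2 E ✶ ψ⁻ ✶ (phi ✶ ψ⁻)  ≈⟨ ✶-cong (R.sym EE₄≋E₂ψ⁻) R.refl ⟩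
  E ✶ dil 4 E ✶ (phi ✶ ψ⁻)  ∎)
  where open ≋-Reasoning

φ⁻ψ≋ψ⁻φ₂ : negq phi ✶ psi ≋ ψ⁻ ✶ φ₂
φ⁻ψ≋ψ⁻φ₂ = ✶-cancel-unit (dil 2 E ✶ E) (unit-✶ {dil 2 E} {E} refl refl) (begin
  dil 2 E ✶ E ✶ (negq phi ✶ psi)  ≈⟨ ×-solve 4 (λ d e f p → d · e · (f · p) :≈ (f · d) · (p · e)) R.refl (dil 2 E) E (negq phi) psi ⟩
  negq phi ✶ dil 2 E ✶ (psi ✶ E)  ≈⟨ ✶-cong phi-E (R.trans psi-E (R.sym φ₂-E)) ⟩
  E ✶ E ✶ (φ₂ ✶ dil 4 E)  ≈⟨ ×-solve 3 (λ e r f → e · e · (r · f) :≈ (e · f) · (e · r)) R.refl E φ₂ (dil 4 E) ⟩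
  E ✶ dil 4 E ✶ (E ✶ φ₂)  ≈⟨ ✶-cong EE₄≋E₂ψ⁻ R.refl ⟩
  dil 2 E ✶ ψ⁻ ✶ (E ✶ φ₂)  ≈⟨ ×-solve 4 (λ d p e r → d · p · (e · r) :≈ d · e · (p · r)) R.refl (dil 2 E) ψ⁻ E φ₂ ⟩
  dil 2 E ✶ E ✶ (ψ⁻ ✶ φ₂)  ∎)
  where open ≋-Reasoning

-- Products of G and H at q with G and H at -q and q⁴

G⁻ H⁻ G₄ H₄ : PS
G⁻ = negq G
H⁻ = negq H
G₄ = dil 4 G
H₄ = dil 4 H

-- Each factor E is attached to the G or H with the same argument, where the Rogers-Ramanujan
-- identities turn the pair into a theta function.
bar : ∀ x y → E ✶ E⁻ ✶ (dil 2 E ✶ (x ✶ negq y)) ≋ dil 2 E ✶ (E ✶ x ✶ negq (E ✶ y))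
bar x y = R.trans (×-solve 5 (λ e f d x y → e · f · (d · (x · y)) :≈ d · (e · x · (f · y))) R.refl E E⁻ (dil 2 E) x (negq y))
  (✶-cong R.refl (✶-cong R.refl (R.sym (negq-✶ E y))))

fourth : ∀ x y → E ✶ dil 4 E ✶ (dil 2 E ✶ (x ✶ dil 4 y)) ≋ dil 2 E ✶ (E ✶ x ✶ dil 4 (E ✶ y))
fourth x y = R.trans (×-solve 5 (λ e f d x y → e · f · (d · (x · y)) :≈ d · (e · x · (f · y))) R.refl E (dil 4 E) (dil 2 E) x (dil 4 y))
  (✶-cong R.refl (✶-cong R.refl (R.sym (dil-✶ 4 E y))))

EE⁻-unit : (E ✶ E⁻) 0 ≡ 1ℤ
EE⁻-unit = unit-✶ {E} {E⁻} refl refl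

EE₄-unit : (E ✶ dil 4 E) 0 ≡ 1ℤ
EE₄-unit = unit-✶ {E} {dil 4 E} refl refl

by-bar : ∀ x y {r} → E ✶ x ✶ negq (E ✶ y) ≋ φ₂ ✶ r → dil 2 E ✶ (x ✶ negq y) ≋ r
by-bar x y {r} e = ✶-cancel-unit (E ✶ E⁻) EE⁻-unit (R.trans (bar x y) (R.trans (✶-cong R.refl e)
  (R.trans (R.sym (R.*-assoc (dil 2 E) φ₂ r)) (✶-cong (R.sym EE⁻≋E₂φ₂) R.refl))))

by-fourth : ∀ x y {r} → E ✶ x ✶ dil 4 (E ✶ y) ≋ ψ⁻ ✶ r → dil 2 E ✶ (x ✶ dil 4 y) ≋ r
by-fourth x y {r} e = ✶-cancel-unit (E ✶ dil 4 E) EE₄-unit (R.trans (fourth x y) (R.trans (✶-cong R.refl e)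
  (R.trans (R.sym (R.*-assoc (dil 2 E) ψ⁻ r)) (✶-cong (R.sym EE₄≋E₂ψ⁻) R.refl))))

GG⁻ : dil 2 E ✶ (G ✶ G⁻) ≋ T₅ 1ℤ
GG⁻ = by-bar G G (R.trans (✶-cong EG≋f₂ (negq-cong EG≋f₂)) (R.trans f₂f₂⁻ (✶-cong (R.sym φ₂≋) θ₅₁≋)))

HH⁻ : dil 2 E ✶ (H ✶ H⁻) ≋ T₅ (+ 3)
HH⁻ = by-bar H H (R.trans (✶-cong EH≋f₁ (negq-cong EH≋f₁)) (R.trans f₁f₁⁻ (✶-cong (R.sym φ₂≋) θ₅₃≋)))

GH₄ : dil 2 E ✶ (G ✶ H₄) ≋ T₅ (+ 4)
GH₄ = by-fourth G H (R.trans (✶-cong EG≋f₂ (dil-cong 4 EH≋f₁)) (R.trans f₂f₁₄ (✶-cong (R.sym ψ⁻≋) θ₅₄≋)))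

HG₄ : dil 2 E ✶ (H ✶ G₄) ≋ T₅ (+ 2)
HG₄ = by-fourth H G (R.trans (✶-cong EH≋f₁ (dil-cong 4 EG≋f₂)) (R.trans f₁f₂₄ (✶-cong (R.sym ψ⁻≋) θ₅₂≋)))

φ₂θ : φ₂ ≋ ⟦ dilL 2 (negL φL) ⟧₁
φ₂θ = dilθ 2 (negθ phi≋)

f₂f₂₄+qf₁f₁₄ : E ✶ G ✶ dil 4 (E ✶ G) ⊕ sh 1 (E ✶ H) ✶ dil 4 (E ✶ H) ≋ psi ✶ φ₂
f₂f₂₄+qf₁f₁₄ = ≋-from (f₂θ ✶θ dilθ 4 f₂θ ⊕θ shθ 1 f₁θ ✶θ dilθ 4 f₁θ) (psi≋ ✶θ φ₂θ) Θ-f₂f₂₄+qf₁f₁₄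

φ²-φ₅² : phi ✶ phi ⊖ dil 5 phi ✶ dil 5 phi ≋ sc (+ 4) (sh 1 (T₅ (+ 4)) ✶ T₅ (+ 2))
φ²-φ₅² = ≋-from (R.trans (R.+-congˡ {phi ✶ phi} (R.sym (sc-1 (dil 5 phi ✶ dil 5 phi)))) (phi≋ ✶θ phi≋ ⊕θ scθ -1ℤ (dilθ 5 phi≋ ✶θ dilθ 5 phi≋)))
  (scθ (+ 4) (shθ 1 {L = t₅ (+ 4)} R.refl ✶θ R.refl {T₅ (+ 2)})) Θ-φ²-φ₅²

f₂f₁⁻+f₁f₂⁻ : E ✶ G ✶ negq (E ✶ H) ⊕ E ✶ H ✶ negq (E ✶ G) ≋ sc (+ 2) (dil 2 ψ⁻ ✶ dil 2 φ₂)
f₂f₁⁻+f₁f₂⁻ = ≋-from (f₂θ ✶θ negθ f₁θ ⊕θ f₁θ ✶θ negθ f₂θ) (scθ (+ 2) (dilθ 2 (negθ psi≋) ✶θ dilθ 2 φ₂θ)) Θ-f₂f₁⁻+f₁f₂⁻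

ψ₂²-q²ψ₁₀² : dil 2 psi ✶ dil 2 psi ⊖ sh 2 (dil 10 psi) ✶ dil 10 psi ≋ T₅ 1ℤ ✶ T₅ (+ 3)
ψ₂²-q²ψ₁₀² = ≋-from (R.trans (R.+-congˡ {dil 2 psi ✶ dil 2 psi} (R.sym (sc-1 (sh 2 (dil 10 psi) ✶ dil 10 psi))))
    (dilθ 2 psi≋ ✶θ dilθ 2 psi≋ ⊕θ scθ -1ℤ (shθ 2 (dilθ 10 psi≋) ✶θ dilθ 10 psi≋)))
  (R.refl {T₅ 1ℤ} ✶θ R.refl {T₅ (+ 3)}) Θ-ψ₂²-q²ψ₁₀²

two : PS
two = sc (+ 2) one

-- A factor of order exactly one is divided by q, which leaves a nonzero constant coefficient to
-- cancel by.
✶-zero-divisor₁ : ∀ {f g} → f 0 ≡ 0ℤ → f 1 ≢ 0ℤ → f ✶ g ≋ 𝟘 → g ≋ 𝟘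
✶-zero-divisor₁ {f} {g} f0 f1 e = ✶-cancel-0 (tl f) f1 (sh-cancel 1 (begin
  sh 1 (tl f ✶ g)  ≈⟨ sh-qp 1 (tl f ✶ g) ⟩
  qp 1 ✶ (tl f ✶ g)  ≈⟨ R.sym (R.*-assoc (qp 1) (tl f) g) ⟩
  qp 1 ✶ tl f ✶ g  ≈⟨ ✶-cong (R.trans (R.sym (sh-qp 1 (tl f))) shifted) R.refl ⟩
  f ✶ g  ≈⟨ e ⟩
  𝟘  ≈⟨ R.sym (R.zeroʳ (qp 1)) ⟩
  qp 1 ✶ 𝟘  ≈⟨ R.sym (sh-qp 1 𝟘) ⟩
  sh 1 𝟘  ∎))
  where
  open ≋-Reasoning
  shifted : sh 1 (tl f) ≋ f
  shifted .at zero    = sym f0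
  shifted .at (suc n) = sh-≤ 1 (tl f) {suc n} (s≤s z≤n)

E₂GH⁻ E₂HG⁻ E₂GG₄ E₂HH₄ : PS
E₂GH⁻ = dil 2 E ✶ (G ✶ H⁻)
E₂HG⁻ = dil 2 E ✶ (H ✶ G⁻)
E₂GG₄ = dil 2 E ✶ (G ✶ G₄)
E₂HH₄ = dil 2 E ✶ (H ✶ H₄)

Z+W : E₂GH⁻ ⊕ E₂HG⁻ ≋ two ✶ dil 2 psi
Z+W = ✶-cancel-unit (E ✶ E⁻) EE⁻-unit (begin
  E ✶ E⁻ ✶ (E₂GH⁻ ⊕ E₂HG⁻)  ≈⟨ R.distribˡ (E ✶ E⁻) E₂GH⁻ E₂HG⁻ ⟩
  E ✶ E⁻ ✶ E₂GH⁻ ⊕ E ✶ E⁻ ✶ E₂HG⁻  ≈⟨ R.+-cong (bar G H) (bar H G) ⟩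
  dil 2 E ✶ (E ✶ G ✶ negq (E ✶ H)) ⊕ dil 2 E ✶ (E ✶ H ✶ negq (E ✶ G))  ≈⟨ R.sym (R.distribˡ (dil 2 E) (E ✶ G ✶ negq (E ✶ H)) (E ✶ H ✶ negq (E ✶ G))) ⟩
  dil 2 E ✶ (E ✶ G ✶ negq (E ✶ H) ⊕ E ✶ H ✶ negq (E ✶ G))  ≈⟨ ✶-cong R.refl (R.trans f₂f₁⁻+f₁f₂⁻ (R.sym (sc≋ (+ 2) (dil 2 ψ⁻ ✶ dil 2 φ₂)))) ⟩
  -- The exchange φ(-q)ψ(q) = ψ(-q)φ(-q²), taken at q², brings out the factor φ(-q²) contained in
  -- E(q)E(-q).
  dil 2 E ✶ (two ✶ (dil 2 ψ⁻ ✶ dil 2 φ₂))  ≈⟨ ✶-cong R.refl (✶-cong R.refl (R.trans (R.sym (dil-✶ 2 ψ⁻ φ₂)) (R.trans (dil-cong 2 (R.sym φ⁻ψ≋ψ⁻φ₂)) (dil-✶ 2 (negq phi) psi)))) ⟩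
  dil 2 E ✶ (two ✶ (φ₂ ✶ dil 2 psi))  ≈⟨ ×-solve 4 (λ d t f p → d · (t · (f · p)) :≈ (d · f) · (t · p)) R.refl (dil 2 E) two φ₂ (dil 2 psi) ⟩
  dil 2 E ✶ φ₂ ✶ (two ✶ dil 2 psi)  ≈⟨ ✶-cong (R.sym EE⁻≋E₂φ₂) R.refl ⟩
  E ✶ E⁻ ✶ (two ✶ dil 2 psi)  ∎)
  where open ≋-Reasoning

ZW : E₂GH⁻ ✶ E₂HG⁻ ≋ T₅ 1ℤ ✶ T₅ (+ 3)
ZW = R.trans (×-solve 5 (λ d g h g′ h′ → d · (g · h′) · (d · (h · g′)) :≈ d · (g · g′) · (d · (h · h′))) R.refl (dil 2 E) G H G⁻ H⁻) (✶-cong GG⁻ HH⁻)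

qψ₁₀ : PS
qψ₁₀ = sh 1 (dil 10 psi)

qψ₁₀² : qψ₁₀ ✶ qψ₁₀ ≋ sh 2 (dil 10 psi) ✶ dil 10 psi
qψ₁₀² = R.trans (✶-cong (sh-qp 1 (dil 10 psi)) (sh-qp 1 (dil 10 psi))) (R.trans (×-solve 2 (λ q p → q · p · (q · p) :≈ (q · q) · p · p) R.refl (qp 1) (dil 10 psi))
  (✶-cong (R.trans (✶-cong (R.sym (qp-+ 1 1)) R.refl) (R.sym (sh-qp 2 (dil 10 psi)))) R.refl))

opaque
  unfolding _✶_
  -- Z - W and 2qψ(q¹⁰) both begin with 2q, so their sum begins with 4q and can be cancelled from
  -- the product of sum and difference.
  Z-W-at-0 : (E₂GH⁻ ⊖ E₂HG⁻ ⊕ two ✶ qψ₁₀) 0 ≡ 0ℤ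
  Z-W-at-0 = refl
  Z-W-at-1 : (E₂GH⁻ ⊖ E₂HG⁻ ⊕ two ✶ qψ₁₀) 1 ≡ + 4
  Z-W-at-1 = refl

four : two ✶ two ≋ sc (+ 4) one
four = R.trans (sc-✶-sc (+ 2) (+ 2) one one) (sc-cong (+ 4) (R.*-identityˡ one))

-- (Z - W)² = (Z + W)² - 4ZW is a known square; the root is chosen by its leading coefficient.
Z-W : E₂GH⁻ ⊖ E₂HG⁻ ≋ two ✶ qψ₁₀
Z-W = ⊖-zero (✶-zero-divisor₁ Z-W-at-0 (λ z → 4≢0 (trans (sym Z-W-at-1) z)) (begin
  (E₂GH⁻ ⊖ E₂HG⁻ ⊕ two ✶ qψ₁₀) ✶ (E₂GH⁻ ⊖ E₂HG⁻ ⊖ two ✶ qψ₁₀)  ≈⟨ solve 4 (λ z w t p → (z :- w :+ t :* p) :* (z :- w :- t :* p) := (z :+ w) :* (z :+ w) :- con (+ 4) :* (z :* w) :- (t :* t) :* (p :* p)) R.refl E₂GH⁻ E₂HG⁻ two qψ₁₀ ⟩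
  (E₂GH⁻ ⊕ E₂HG⁻) ✶ (E₂GH⁻ ⊕ E₂HG⁻) ⊖ sc (+ 4) one ✶ (E₂GH⁻ ✶ E₂HG⁻) ⊖ two ✶ two ✶ (qψ₁₀ ✶ qψ₁₀)
    ≈⟨ ⊖-cong (⊖-cong (✶-cong Z+W Z+W) (✶-cong (R.sym four) (R.trans ZW (R.sym ψ₂²-q²ψ₁₀²)))) (✶-cong R.refl qψ₁₀²) ⟩
  two ✶ dil 2 psi ✶ (two ✶ dil 2 psi) ⊖ two ✶ two ✶ (dil 2 psi ✶ dil 2 psi ⊖ sh 2 (dil 10 psi) ✶ dil 10 psi) ⊖ two ✶ two ✶ (sh 2 (dil 10 psi) ✶ dil 10 psi)
    ≈⟨ solve 3 (λ t p r → t :* p :* (t :* p) :- t :* t :* (p :* p :- r) :- t :* t :* r := con 0ℤ) R.refl two (dil 2 psi) (sh 2 (dil 10 psi) ✶ dil 10 psi) ⟩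
  𝟘  ∎))
  where
  open ≋-Reasoning
  4≢0 : + 4 ≢ 0ℤ
  4≢0 ()

two-cancel : ∀ {f g} → two ✶ f ≋ two ✶ g → f ≋ g
two-cancel {f} {g} e = sc-cancel (+ 2) {f} {g} (λ ()) (R.trans (R.sym (sc≋ (+ 2) f)) (R.trans e (sc≋ (+ 2) g)))

GH⁻ : E₂GH⁻ ≋ dil 2 psi ⊕ qψ₁₀
GH⁻ = two-cancel (R.trans (solve 2 (λ z w → con (+ 2) :* z := (z :+ w) :+ (z :- w)) R.refl E₂GH⁻ E₂HG⁻)
  (R.trans (R.+-cong Z+W Z-W) (R.sym (R.distribˡ two (dil 2 psi) qψ₁₀))))

HG⁻ : E₂HG⁻ ≋ dil 2 psi ⊖ qψ₁₀
HG⁻ = two-cancel (R.trans (solve 2 (λ z w → con (+ 2) :* w := (z :+ w) :- (z :- w)) R.refl E₂GH⁻ E₂HG⁻)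
  (R.trans (⊖-cong Z+W Z-W) (solve 3 (λ t a b → t :* a :- t :* b := t :* (a :- b)) R.refl two (dil 2 psi) qψ₁₀)))

X+qY : E₂GG₄ ⊕ qp 1 ✶ E₂HH₄ ≋ phi
X+qY = ✶-cancel-unit (E ✶ dil 4 E) EE₄-unit (begin
  E ✶ dil 4 E ✶ (E₂GG₄ ⊕ qp 1 ✶ E₂HH₄)  ≈⟨ solve 4 (λ e x q y → e :* (x :+ q :* y) := e :* x :+ q :* (e :* y)) R.refl (E ✶ dil 4 E) E₂GG₄ (qp 1) E₂HH₄ ⟩
  E ✶ dil 4 E ✶ E₂GG₄ ⊕ qp 1 ✶ (E ✶ dil 4 E ✶ E₂HH₄)  ≈⟨ R.+-cong (fourth G G) (✶-cong R.refl (fourth H H)) ⟩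
  dil 2 E ✶ (E ✶ G ✶ dil 4 (E ✶ G)) ⊕ qp 1 ✶ (dil 2 E ✶ (E ✶ H ✶ dil 4 (E ✶ H)))  ≈⟨ solve 5 (λ d a q f h → d :* a :+ q :* (d :* (f :* h)) := d :* (a :+ q :* f :* h)) R.refl
                                                                                        (dil 2 E) (E ✶ G ✶ dil 4 (E ✶ G)) (qp 1) (E ✶ H) (dil 4 (E ✶ H)) ⟩
  dil 2 E ✶ (E ✶ G ✶ dil 4 (E ✶ G) ⊕ qp 1 ✶ (E ✶ H) ✶ dil 4 (E ✶ H))  ≈⟨ ✶-cong R.refl (R.trans (R.+-congˡ {E ✶ G ✶ dil 4 (E ✶ G)} (✶-cong (R.sym (sh-qp 1 (E ✶ H))) R.refl)) (R.trans f₂f₂₄+qf₁f₁₄ ψφ₂≋φψ⁻)) ⟩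
  dil 2 E ✶ (phi ✶ ψ⁻)  ≈⟨ ×-solve 3 (λ d f p → d · (f · p) :≈ (d · p) · f) R.refl (dil 2 E) phi ψ⁻ ⟩
  dil 2 E ✶ ψ⁻ ✶ phi  ≈⟨ ✶-cong (R.sym EE₄≋E₂ψ⁻) R.refl ⟩
  E ✶ dil 4 E ✶ phi  ∎)
  where open ≋-Reasoning

XY : E₂GG₄ ✶ E₂HH₄ ≋ T₅ (+ 4) ✶ T₅ (+ 2)
XY = R.trans (×-solve 5 (λ d g h g′ h′ → d · (g · g′) · (d · (h · h′)) :≈ d · (g · h′) · (d · (h · g′))) R.refl (dil 2 E) G H G₄ H₄) (✶-cong GH₄ HG₄)

opaque
  unfolding _✶_
  X-qY-at-0 : (E₂GG₄ ⊖ qp 1 ✶ E₂HH₄ ⊕ dil 5 phi) 0 ≡ + 2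
  X-qY-at-0 = refl

-- With X and Y for the two products, (X - qY)² = (X + qY)² - 4qXY is φ(q)² - 4qXY = φ(q⁵)². Both X
-- - qY and φ(q⁵) have constant term 1, so their sum is cancellable and their difference is zero.
X-qY : E₂GG₄ ⊖ qp 1 ✶ E₂HH₄ ≋ dil 5 phi
X-qY = ⊖-zero (✶-cancel-0 (E₂GG₄ ⊖ qp 1 ✶ E₂HH₄ ⊕ dil 5 phi) (λ z → 2≢0 (trans (sym X-qY-at-0) z)) (begin
  (E₂GG₄ ⊖ qp 1 ✶ E₂HH₄ ⊕ dil 5 phi) ✶ (E₂GG₄ ⊖ qp 1 ✶ E₂HH₄ ⊖ dil 5 phi)  ≈⟨ solve 4 (λ x q y p → (x :- q :* y :+ p) :* (x :- q :* y :- p) := (x :+ q :* y) :* (x :+ q :* y) :- p :* p :- con (+ 4) :* (q :* (x :* y))) R.refl E₂GG₄ (qp 1) E₂HH₄ (dil 5 phi) ⟩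
  (E₂GG₄ ⊕ qp 1 ✶ E₂HH₄) ✶ (E₂GG₄ ⊕ qp 1 ✶ E₂HH₄) ⊖ dil 5 phi ✶ dil 5 phi ⊖ sc (+ 4) one ✶ (qp 1 ✶ (E₂GG₄ ✶ E₂HH₄))
    ≈⟨ ⊖-cong (⊖-cong (✶-cong X+qY X+qY) R.refl) (✶-cong R.refl (✶-cong R.refl XY)) ⟩
  phi ✶ phi ⊖ dil 5 phi ✶ dil 5 phi ⊖ sc (+ 4) one ✶ (qp 1 ✶ (T₅ (+ 4) ✶ T₅ (+ 2)))
    ≈⟨ ⊖-cong φ²-φ₅² (R.trans (✶-cong R.refl (R.trans (R.sym (R.*-assoc (qp 1) (T₅ (+ 4)) (T₅ (+ 2)))) (✶-cong (R.sym (sh-qp 1 (T₅ (+ 4)))) R.refl))) (sc≋ (+ 4) (sh 1 (T₅ (+ 4)) ✶ T₅ (+ 2)))) ⟩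
  sc (+ 4) (sh 1 (T₅ (+ 4)) ✶ T₅ (+ 2)) ⊖ sc (+ 4) (sh 1 (T₅ (+ 4)) ✶ T₅ (+ 2))  ≈⟨ R.-‿inverseʳ (sc (+ 4) (sh 1 (T₅ (+ 4)) ✶ T₅ (+ 2))) ⟩
  𝟘  ∎))
  where
  open ≋-Reasoning
  2≢0 : + 2 ≢ 0ℤ
  2≢0 ()

-- The product formulas at q^k, and U at -q and q⁴

module Dilated (k : ℕ) .{{_ : NonZero k}} .{{_ : NonZero (2 ℕ.* k)}} .{{_ : NonZero (4 ℕ.* k)}} (odd : sgn k ≡ -1ℤ) where
  e₂ e₁ ē₁ e₄ g h ḡ h̄ g₄ h₄ : PS
  e₁ = dil k E
  ē₁ = negq (dil k E)
  e₂ = dil (2 ℕ.* k) E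
  e₄ = dil (4 ℕ.* k) E
  g  = dil k G
  h  = dil k H
  ḡ  = negq (dil k G)
  h̄  = negq (dil k H)
  g₄ = dil (4 ℕ.* k) G
  h₄ = dil (4 ℕ.* k) H

  -- For odd k, (-q)^k = -q^k, so dilation commutes with q ↦ -q and the formula at q carries over to
  -- q^k.
  lift⁻ : ∀ {x y r} → dil 2 E ✶ (x ✶ negq y) ≋ r → e₂ ✶ (dil k x ✶ negq (dil k y)) ≋ dil k r
  lift⁻ {x} {y} {r} e = R.trans (✶-cong (R.sym (dil-dil k 2 E)) (R.trans (✶-cong R.refl (negq-dil k odd y)) (R.sym (dil-✶ k x (negq y)))))
    (R.trans (R.sym (dil-✶ k (dil 2 E) (x ✶ negq y))) (dil-cong k e))

  lift₄ : ∀ x y → e₂ ✶ (dil k x ✶ dil (4 ℕ.* k) y) ≋ dil k (dil 2 E ✶ (x ✶ dil 4 y))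
  lift₄ x y = R.trans (✶-cong (R.sym (dil-dil k 2 E)) (R.trans (✶-cong R.refl (R.sym (dil-dil k 4 y))) (R.sym (dil-✶ k x (dil 4 y)))))
    (R.sym (dil-✶ k (dil 2 E) (x ✶ dil 4 y)))

  gḡ : e₂ ✶ (g ✶ ḡ) ≋ dil k (T₅ 1ℤ)
  gḡ = lift⁻ GG⁻

  hh̄ : e₂ ✶ (h ✶ h̄) ≋ dil k (T₅ (+ 3))
  hh̄ = lift⁻ HH⁻

  dil-qψ : dil k qψ₁₀ ≋ sh k (dil k (dil 10 psi))
  dil-qψ = R.trans (dil-cong k (sh-qp 1 (dil 10 psi))) (R.trans (dil-✶ k (qp 1) (dil 10 psi)) (R.trans (✶-cong (R.trans (dil-qp k 1) (R.reflexive (cong qp (ℕ.*-identityˡ k)))) R.refl)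
    (R.sym (sh-qp k (dil k (dil 10 psi))))))

  gh̄ : e₂ ✶ (g ✶ h̄) ≋ dil k (dil 2 psi) ⊕ sh k (dil k (dil 10 psi))
  gh̄ = R.trans (lift⁻ GH⁻) (R.trans (dil-⊕ k (dil 2 psi) qψ₁₀) (R.+-congˡ {dil k (dil 2 psi)} dil-qψ))

  hḡ : e₂ ✶ (h ✶ ḡ) ≋ dil k (dil 2 psi) ⊖ sh k (dil k (dil 10 psi))
  hḡ = R.trans (lift⁻ HG⁻) (R.trans (dil-⊖ k (dil 2 psi) qψ₁₀) (⊖-cong (R.refl {dil k (dil 2 psi)}) dil-qψ))

  gh₄ : e₂ ✶ (g ✶ h₄) ≋ dil k (T₅ (+ 4))
  gh₄ = R.trans (lift₄ G H) (dil-cong k GH₄)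

  hg₄ : e₂ ✶ (h ✶ g₄) ≋ dil k (T₅ (+ 2))
  hg₄ = R.trans (lift₄ H G) (dil-cong k HG₄)

  dil-qY : qp k ✶ (e₂ ✶ (h ✶ h₄)) ≋ dil k (qp 1 ✶ E₂HH₄)
  dil-qY = R.trans (✶-cong (R.sym (R.trans (dil-qp k 1) (R.reflexive (cong qp (ℕ.*-identityˡ k))))) (lift₄ H H)) (R.sym (dil-✶ k (qp 1) E₂HH₄))

  sum₄ : e₂ ✶ (g ✶ g₄) ⊕ qp k ✶ (e₂ ✶ (h ✶ h₄)) ≋ dil k phi
  sum₄ = R.trans (R.+-cong (lift₄ G G) dil-qY) (R.trans (R.sym (dil-⊕ k E₂GG₄ (qp 1 ✶ E₂HH₄))) (dil-cong k X+qY))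

  diff₄ : e₂ ✶ (g ✶ g₄) ⊖ qp k ✶ (e₂ ✶ (h ✶ h₄)) ≋ dil k (dil 5 phi)
  diff₄ = R.trans (⊖-cong (lift₄ G G) dil-qY) (R.trans (R.sym (dil-⊖ k E₂GG₄ (qp 1 ✶ E₂HH₄))) (dil-cong k X-qY))

  eē : e₁ ✶ ē₁ ≋ e₂ ✶ dil (2 ℕ.* k) (negq phi)
  eē = R.trans (✶-cong R.refl (negq-dil k odd E)) (R.trans (R.sym (dil-✶ k E E⁻)) (R.trans (dil-cong k EE⁻≋E₂φ₂) (R.trans (dil-✶ k (dil 2 E) φ₂)
    (✶-cong (dil-dil k 2 E) (dil-dil k 2 (negq phi))))))

  ee₄ : e₁ ✶ e₄ ≋ e₂ ✶ dil k ψ⁻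
  ee₄ = R.trans (✶-cong R.refl (R.sym (dil-dil k 4 E))) (R.trans (R.sym (dil-✶ k E (dil 4 E))) (R.trans (dil-cong k EE₄≋E₂ψ⁻) (R.trans (dil-✶ k (dil 2 E) ψ⁻) (✶-cong (dil-dil k 2 E) R.refl))))

module D₁  = Dilated 1 refl
module D₃  = Dilated 3 refl
module D₁₃ = Dilated 13 refl
module D₃₉ = Dilated 39 refl

-- A bar means the value at -q, where the even powers q⁸ and q² keep their sign; V is the value at
-- q⁴, whence q³² and q⁸.
U₁ U₃ Ū₁ Ū₃ V₁ V₃ : PS
U₁ = D₁.g ✶ D₃₉.g ⊕ qp 8 ✶ (D₁.h ✶ D₃₉.h)
Ū₁ = D₁.ḡ ✶ D₃₉.ḡ ⊕ qp 8 ✶ (D₁.h̄ ✶ D₃₉.h̄)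
V₁ = D₁.g₄ ✶ D₃₉.g₄ ⊕ qp 32 ✶ (D₁.h₄ ✶ D₃₉.h₄)
U₃ = D₃.h ✶ D₁₃.g ⊖ qp 2 ✶ (D₃.g ✶ D₁₃.h)
Ū₃ = D₃.h̄ ✶ D₁₃.ḡ ⊖ qp 2 ✶ (D₃.ḡ ✶ D₁₃.h̄)
V₃ = D₃.h₄ ✶ D₁₃.g₄ ⊖ qp 8 ✶ (D₃.g₄ ✶ D₁₃.h₄)

dil-1 : ∀ f → dil 1 f ≋ f
dil-1 f = dil-pointwise 1 (λ m → cong f (ℕ.*-identityʳ m)) (λ n ne → ⊥-elim (ne (n∣m⇒m%n≡0 n 1 (1∣ n))))

EG-dil : ∀ k .{{_ : NonZero k}} → dil k E ✶ dil k G ≋ dil k (E ✶ G)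
EG-dil k = R.sym (dil-✶ k E G)

EH-dil : ∀ k .{{_ : NonZero k}} → dil k E ✶ dil k H ≋ dil k (E ✶ H)
EH-dil k = R.sym (dil-✶ k E H)

EU : D₁.e₁ ✶ D₃₉.e₁ ✶ U₁ ≋ D₃.e₁ ✶ D₁₃.e₁ ✶ U₃
EU = begin
  D₁.e₁ ✶ D₃₉.e₁ ✶ U₁
    ≈⟨ solve 7 (λ e f g g′ q h h′ → e :* f :* (g :* g′ :+ q :* (h :* h′)) := (e :* g) :* (f :* g′) :+ q :* (e :* h) :* (f :* h′)) R.refl D₁.e₁ D₃₉.e₁ D₁.g D₃₉.g (qp 8) D₁.h D₃₉.h ⟩
  D₁.e₁ ✶ D₁.g ✶ (D₃₉.e₁ ✶ D₃₉.g) ⊕ qp 8 ✶ (D₁.e₁ ✶ D₁.h) ✶ (D₃₉.e₁ ✶ D₃₉.h)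
    ≈⟨ R.+-cong (✶-cong (R.trans (EG-dil 1) (dil-1 (E ✶ G))) (EG-dil 39)) (✶-cong (R.trans (✶-cong R.refl (R.trans (EH-dil 1) (dil-1 (E ✶ H)))) (R.sym (sh-qp 8 (E ✶ H)))) (EH-dil 39)) ⟩
  E ✶ G ✶ dil 39 (E ✶ G) ⊕ sh 8 (E ✶ H) ✶ dil 39 (E ✶ H)
    ≈⟨ sc-cancel (+ 2) (λ ()) (≋-from (scθ (+ 2) (f₂θ ✶θ dilθ 39 f₂θ ⊕θ shθ 8 f₁θ ✶θ dilθ 39 f₁θ)) (scθ (+ 2) (dilθ 3 f₁θ ✶θ dilθ 13 f₂θ ⊕θ scθ -1ℤ (shθ 2 (dilθ 3 f₂θ) ✶θ dilθ 13 f₁θ))) Θ-EU) ⟩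
  dil 3 (E ✶ H) ✶ dil 13 (E ✶ G) ⊕ sc -1ℤ (sh 2 (dil 3 (E ✶ G)) ✶ dil 13 (E ✶ H))
    ≈⟨ R.+-cong (R.sym (✶-cong (EH-dil 3) (EG-dil 13))) (R.trans (sc-1 (sh 2 (dil 3 (E ✶ G)) ✶ dil 13 (E ✶ H)))
         (R.-‿cong (R.sym (✶-cong (R.trans (✶-cong R.refl (EG-dil 3)) (R.sym (sh-qp 2 (dil 3 (E ✶ G))))) (EH-dil 13))))) ⟩
  D₃.e₁ ✶ D₃.h ✶ (D₁₃.e₁ ✶ D₁₃.g) ⊖ qp 2 ✶ (D₃.e₁ ✶ D₃.g) ✶ (D₁₃.e₁ ✶ D₁₃.h)
    ≈⟨ solve 7 (λ e f g g′ q h h′ → (e :* h) :* (f :* g′) :- q :* (e :* g) :* (f :* h′) := e :* f :* (h :* g′ :- q :* (g :* h′))) R.refl D₃.e₁ D₁₃.e₁ D₃.g D₁₃.g (qp 2) D₃.h D₁₃.h ⟩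
  D₃.e₁ ✶ D₁₃.e₁ ✶ U₃ ∎
  where open ≋-Reasoning

negq-qp✶ : ∀ k f {f′} → sgn k ≡ 1ℤ → negq f ≋ f′ → negq (qp k ✶ f) ≋ qp k ✶ f′
negq-qp✶ k f s e = R.trans (negq-✶ (qp k) f) (✶-cong (R.trans (negq-qp k) (pw λ n → trans (cong (_* qp k n) s) (ℤ.*-identityˡ (qp k n)))) e)

negq-U₁ : negq U₁ ≋ Ū₁
negq-U₁ = R.trans (negq-⊕ (D₁.g ✶ D₃₉.g) (qp 8 ✶ (D₁.h ✶ D₃₉.h))) (R.+-cong (negq-✶ D₁.g D₃₉.g) (negq-qp✶ 8 (D₁.h ✶ D₃₉.h) refl (negq-✶ D₁.h D₃₉.h)))

negq-U₃ : negq U₃ ≋ Ū₃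
negq-U₃ = R.trans (negq-⊖ (D₃.h ✶ D₁₃.g) (qp 2 ✶ (D₃.g ✶ D₁₃.h))) (⊖-cong (negq-✶ D₃.h D₁₃.g) (negq-qp✶ 2 (D₃.g ✶ D₁₃.h) refl (negq-✶ D₃.g D₁₃.h)))

negq-EU : D₁.ē₁ ✶ D₃₉.ē₁ ✶ Ū₁ ≋ D₃.ē₁ ✶ D₁₃.ē₁ ✶ Ū₃
negq-EU = R.trans (R.sym (R.trans (negq-✶ (D₁.e₁ ✶ D₃₉.e₁) U₁) (✶-cong (negq-✶ D₁.e₁ D₃₉.e₁) negq-U₁)))
  (R.trans (negq-cong EU) (R.trans (negq-✶ (D₃.e₁ ✶ D₁₃.e₁) U₃) (✶-cong (negq-✶ D₃.e₁ D₁₃.e₁) negq-U₃)))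

dil4-mono : ∀ k f → dil 4 (qp k ✶ f) ≋ qp (k ℕ.* 4) ✶ dil 4 f
dil4-mono k f = R.trans (dil-✶ 4 (qp k) f) (✶-cong (dil-qp 4 k) R.refl)

dil4-EU : D₁.e₄ ✶ D₃₉.e₄ ✶ V₁ ≋ D₃.e₄ ✶ D₁₃.e₄ ✶ V₃
dil4-EU = R.trans (R.sym (R.trans (dil-✶ 4 (D₁.e₁ ✶ D₃₉.e₁) U₁) (✶-cong (d 1 39 E E) (R.trans (dil-⊕ 4 (D₁.g ✶ D₃₉.g) (qp 8 ✶ (D₁.h ✶ D₃₉.h)))
    (R.+-cong (d 1 39 G G) (R.trans (dil4-mono 8 (D₁.h ✶ D₃₉.h)) (✶-cong R.refl (d 1 39 H H))))))))
  (R.trans (dil-cong 4 EU) (R.trans (dil-✶ 4 (D₃.e₁ ✶ D₁₃.e₁) U₃) (✶-cong (d 3 13 E E) (R.trans (dil-⊖ 4 (D₃.h ✶ D₁₃.g) (qp 2 ✶ (D₃.g ✶ D₁₃.h)))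
    (⊖-cong (d 3 13 H G) (R.trans (dil4-mono 2 (D₃.g ✶ D₁₃.h)) (✶-cong R.refl (d 3 13 G H))))))))
  where
  d : ∀ j k .{{_ : NonZero j}} .{{_ : NonZero k}} .{{_ : NonZero (4 ℕ.* j)}} .{{_ : NonZero (4 ℕ.* k)}} x y → dil 4 (dil j x ✶ dil k y) ≋ dil (4 ℕ.* j) x ✶ dil (4 ℕ.* k) y
  d j k x y = R.trans (dil-✶ 4 (dil j x) (dil k y)) (✶-cong (four-dil j x) (four-dil k y))
    where
    four-dil : ∀ j .{{_ : NonZero j}} .{{_ : NonZero (4 ℕ.* j)}} x → dil 4 (dil j x) ≋ dil (4 ℕ.* j) x
    four-dil j@(suc _) x = R.trans (dil-dil 4 j x) (R.reflexive (dil-index (ℕ.*-comm j 4)))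
      where
      dil-index : ∀ {m n} .{{_ : NonZero m}} .{{_ : NonZero n}} → m ≡ n → dil m x ≡ dil n x
      dil-index refl = refl

-- Expansion of U(q)U(-q) and U(q)U(q⁴)

expand⊕ : ∀ s a b c d → s ✶ (a ⊕ b) ✶ (c ⊕ d) ≋ s ✶ (a ✶ c) ⊕ s ✶ (b ✶ d) ⊕ (s ✶ (a ✶ d) ⊕ s ✶ (b ✶ c))
expand⊕ = solve 5 (λ s a b c d → s :* (a :+ b) :* (c :+ d) := s :* (a :* c) :+ s :* (b :* d) :+ (s :* (a :* d) :+ s :* (b :* c))) R.refl

expand⊖ : ∀ s a b c d → s ✶ (a ⊖ b) ✶ (c ⊖ d) ≋ s ✶ (a ✶ c) ⊕ s ✶ (b ✶ d) ⊖ (s ✶ (a ✶ d) ⊕ s ✶ (b ✶ c))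
expand⊖ = solve 5 (λ s a b c d → s :* (a :- b) :* (c :- d) := s :* (a :* c) :+ s :* (b :* d) :- (s :* (a :* d) :+ s :* (b :* c))) R.refl

-- Factors belonging to the same dilation are brought together, with powers of q in front. The two
-- digits of the names tell which of the two terms carries such a power.
pair₀₀ : ∀ e f x y x′ y′ → e ✶ f ✶ (x ✶ y ✶ (x′ ✶ y′)) ≋ e ✶ (x ✶ x′) ✶ (f ✶ (y ✶ y′))
pair₀₀ = ×-solve 6 (λ e f x y x′ y′ → e · f · (x · y · (x′ · y′)) :≈ e · (x · x′) · (f · (y · y′))) R.refl

pair₁₁ : ∀ e f q r x y x′ y′ → e ✶ f ✶ (q ✶ (x ✶ y) ✶ (r ✶ (x′ ✶ y′))) ≋ q ✶ r ✶ (e ✶ (x ✶ x′) ✶ (f ✶ (y ✶ y′)))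
pair₁₁ = ×-solve 8 (λ e f q r x y x′ y′ → e · f · (q · (x · y) · (r · (x′ · y′))) :≈ q · r · (e · (x · x′) · (f · (y · y′)))) R.refl

pair₀₁ : ∀ e f r x y x′ y′ → e ✶ f ✶ (x ✶ y ✶ (r ✶ (x′ ✶ y′))) ≋ r ✶ (e ✶ (x ✶ x′) ✶ (f ✶ (y ✶ y′)))
pair₀₁ = ×-solve 7 (λ e f r x y x′ y′ → e · f · (x · y · (r · (x′ · y′))) :≈ r · (e · (x · x′) · (f · (y · y′)))) R.refl

pair₁₀ : ∀ e f q x y x′ y′ → e ✶ f ✶ (q ✶ (x ✶ y) ✶ (x′ ✶ y′)) ≋ q ✶ (e ✶ (x ✶ x′) ✶ (f ✶ (y ✶ y′)))
pair₁₀ = ×-solve 7 (λ e f q x y x′ y′ → e · f · (q · (x · y) · (x′ · y′)) :≈ q · (e · (x · x′) · (f · (y · y′)))) R.refl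

formθ : ∀ a b c {_ : True (1ℤ ℤ.≤? disc (quad (+ a) (+ b) (+ c) 0ℤ 0ℤ 0ℤ))} → theta a b c ≋ ⟦ form (+ a) (+ b) (+ c) ⟧₂
formθ a b c {v} = R.trans (theta≋Θ a b c (toWitness v)) (R.sym (R.trans (⟦⟧₂-∷ 1ℤ (quad (+ a) (+ b) (+ c) 0ℤ 0ℤ 0ℤ) [])
  (R.trans (R.+-cong (sc1 (Θ (quad (+ a) (+ b) (+ c) 0ℤ 0ℤ 0ℤ))) ⟦⟧₂-[]) (R.+-identityʳ (Θ (quad (+ a) (+ b) (+ c) 0ℤ 0ℤ 0ℤ))))))

⊖θ : ∀ {f g L M} → f ≋ ⟦ L ⟧₂ → g ≋ ⟦ M ⟧₂ → f ⊖ g ≋ ⟦ L ++ -1ℤ ∙ M ⟧₂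
⊖θ {f} {g} e e′ = R.trans (R.+-congˡ {f} (R.sym (sc-1 g))) (e ⊕θ scθ -1ℤ e′)

X₁ X₂ : PS
X₁ = theta 1 1 10 ⊕ theta 2 1 5 ⊖ theta 1 0 39 ⊖ theta 5 2 8
X₂ = theta 3 0 13 ⊕ theta 2 1 5 ⊖ theta 3 3 4 ⊖ theta 5 2 8

tθ : ∀ b → T₅ b ≋ ⟦ t₅ b ⟧₁
tθ b = R.refl

ψ₂θ : dil 2 psi ≋ ⟦ dilL 2 ψL ⟧₁
ψ₂θ = dilθ 2 psi≋

ψ₁₀θ : dil 10 psi ≋ ⟦ dilL 10 ψL ⟧₁
ψ₁₀θ = dilθ 10 psi≋

sh-merge : ∀ a b f g → qp a ✶ (qp b ✶ (f ✶ g)) ≋ sh (a ℕ.+ b) f ✶ g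
sh-merge a b f g = R.trans (×-solve 4 (λ a b f g → a · (b · (f · g)) :≈ (a · b) · f · g) R.refl (qp a) (qp b) f g)
  (✶-cong (R.trans (✶-cong (R.sym (qp-+ a b)) R.refl) (R.sym (sh-qp (a ℕ.+ b) f))) R.refl)

sh-one : ∀ a f g → qp a ✶ (f ✶ g) ≋ sh a f ✶ g
sh-one a f g = R.trans (R.sym (R.*-assoc (qp a) f g)) (✶-cong (R.sym (sh-qp a f)) R.refl)

identity₁ : two ✶ (qp 2 ✶ (D₁.e₂ ✶ D₃₉.e₂ ✶ U₁ ✶ Ū₁)) ≋ X₁
identity₁ = R.trans (✶-cong R.refl (✶-cong R.refl (R.trans (expand⊕ (D₁.e₂ ✶ D₃₉.e₂) (D₁.g ✶ D₃₉.g) (qp 8 ✶ (D₁.h ✶ D₃₉.h)) (D₁.ḡ ✶ D₃₉.ḡ) (qp 8 ✶ (D₁.h̄ ✶ D₃₉.h̄)))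
    (R.+-cong (R.+-cong
      (R.trans (pair₀₀ D₁.e₂ D₃₉.e₂ D₁.g D₃₉.g D₁.ḡ D₃₉.ḡ) (✶-cong (R.trans D₁.gḡ (dil-1 (T₅ 1ℤ))) D₃₉.gḡ))
      (R.trans (pair₁₁ D₁.e₂ D₃₉.e₂ (qp 8) (qp 8) D₁.h D₃₉.h D₁.h̄ D₃₉.h̄) (✶-cong (R.sym (qp-+ 8 8)) (✶-cong (R.trans D₁.hh̄ (dil-1 (T₅ (+ 3)))) D₃₉.hh̄))))
      (R.+-cong
      (R.trans (pair₀₁ D₁.e₂ D₃₉.e₂ (qp 8) D₁.g D₃₉.g D₁.h̄ D₃₉.h̄) (✶-cong R.refl (✶-cong (R.trans D₁.gh̄ (R.+-cong (dil-1 (dil 2 psi)) (sh-cong 1 (dil-1 (dil 10 psi))))) D₃₉.gh̄)))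
      (R.trans (pair₁₀ D₁.e₂ D₃₉.e₂ (qp 8) D₁.h D₃₉.h D₁.ḡ D₃₉.ḡ) (✶-cong R.refl (✶-cong (R.trans D₁.hḡ (⊖-cong (dil-1 (dil 2 psi)) (sh-cong 1 (dil-1 (dil 10 psi))))) D₃₉.hḡ)))))))) (R.trans
  -- In (a + b)(a′ + b′) + (a - b)(a′ - b′) the mixed products cancel, leaving ψ only with ψ of the
  -- same kind and doubling the factor 2 to 4.
  (solve 9 (λ q₂ A B p q₈ a b a′ b′ → con (+ 2) :* (q₂ :* (A :+ p :* B :+ (q₈ :* ((a :+ b) :* (a′ :+ b′)) :+ q₈ :* ((a :- b) :* (a′ :- b′)))))
     := con (+ 2) :* (q₂ :* A) :+ (con (+ 2) :* (q₂ :* (p :* B)) :+ (con (+ 4) :* (q₂ :* (q₈ :* (a :* a′))) :+ con (+ 4) :* (q₂ :* (q₈ :* (b :* b′)))))) R.refl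
     (qp 2) (t₁ ✶ t₁′) (t₃ ✶ t₃′) (qp 16) (qp 8) ψ₂ qψ₁₀ ψ₂′ qψ₁₀′)
  (≋-from lhs rhs Θ-identity₁))
  where
  t₁ = T₅ 1ℤ
  t₃ = T₅ (+ 3)
  t₁′ = dil 39 t₁
  t₃′ = dil 39 t₃
  ψ₂ = dil 2 psi
  ψ₂′ = dil 39 (dil 2 psi)
  qψ₁₀′ = sh 39 (dil 39 (dil 10 psi))
  lhs : two ✶ (qp 2 ✶ (t₁ ✶ t₁′)) ⊕ (two ✶ (qp 2 ✶ (qp 16 ✶ (t₃ ✶ t₃′))) ⊕ (sc (+ 4) one ✶ (qp 2 ✶ (qp 8 ✶ (ψ₂ ✶ ψ₂′))) ⊕ sc (+ 4) one ✶ (qp 2 ✶ (qp 8 ✶ (qψ₁₀ ✶ qψ₁₀′))))) ≋ ⟦ lhs₁ ⟧₂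
  lhs = R.trans (sc≋ (+ 2) _) (scθ (+ 2) (R.trans (sh-one 2 t₁ t₁′) (shθ 2 (tθ 1ℤ) ✶θ dilθ 39 (tθ 1ℤ))))
    ⊕θ (R.trans (sc≋ (+ 2) _) (scθ (+ 2) (R.trans (sh-merge 2 16 t₃ t₃′) (shθ 18 (tθ (+ 3)) ✶θ dilθ 39 (tθ (+ 3)))))
    ⊕θ (R.trans (sc≋ (+ 4) _) (scθ (+ 4) (R.trans (sh-merge 2 8 ψ₂ ψ₂′) (shθ 10 ψ₂θ ✶θ dilθ 39 ψ₂θ)))
    ⊕θ R.trans (sc≋ (+ 4) _) (scθ (+ 4) (R.trans (sh-merge 2 8 qψ₁₀ qψ₁₀′) (R.trans (✶-cong (sh-sh 10 1 (dil 10 psi)) R.refl) (shθ 11 ψ₁₀θ ✶θ shθ 39 (dilθ 39 ψ₁₀θ)))))))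
  rhs : X₁ ≋ ⟦ rhs₁ ⟧₂
  rhs = ⊖θ (⊖θ (formθ 1 1 10 ⊕θ formθ 2 1 5) (formθ 1 0 39)) (formθ 5 2 8)

identity₂ : two ✶ (qp 2 ✶ (D₃.e₂ ✶ D₁₃.e₂ ✶ U₃ ✶ Ū₃)) ≋ X₂
identity₂ = R.trans (✶-cong R.refl (✶-cong R.refl (R.trans (expand⊖ (D₃.e₂ ✶ D₁₃.e₂) (D₃.h ✶ D₁₃.g) (qp 2 ✶ (D₃.g ✶ D₁₃.h)) (D₃.h̄ ✶ D₁₃.ḡ) (qp 2 ✶ (D₃.ḡ ✶ D₁₃.h̄)))
    (⊖-cong (R.+-cong
      (R.trans (pair₀₀ D₃.e₂ D₁₃.e₂ D₃.h D₁₃.g D₃.h̄ D₁₃.ḡ) (✶-cong D₃.hh̄ D₁₃.gḡ))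
      (R.trans (pair₁₁ D₃.e₂ D₁₃.e₂ (qp 2) (qp 2) D₃.g D₁₃.h D₃.ḡ D₁₃.h̄) (✶-cong (R.sym (qp-+ 2 2)) (✶-cong D₃.gḡ D₁₃.hh̄))))
      (R.+-cong
      (R.trans (pair₀₁ D₃.e₂ D₁₃.e₂ (qp 2) D₃.h D₁₃.g D₃.ḡ D₁₃.h̄) (✶-cong R.refl (✶-cong D₃.hḡ D₁₃.gh̄)))
      (R.trans (pair₁₀ D₃.e₂ D₁₃.e₂ (qp 2) D₃.g D₁₃.h D₃.h̄ D₁₃.ḡ) (✶-cong R.refl (✶-cong D₃.gh̄ D₁₃.hḡ)))))))) (R.trans
  -- Here (a - b)(a′ + b′) + (a + b)(a′ - b′) = 2aa′ - 2bb′ is subtracted, which gives the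
  -- coefficients -4 and 4.
  (solve 8 (λ q₂ A B p a b a′ b′ → con (+ 2) :* (q₂ :* (A :+ p :* B :- (q₂ :* ((a :- b) :* (a′ :+ b′)) :+ q₂ :* ((a :+ b) :* (a′ :- b′)))))
     := con (+ 2) :* (q₂ :* A) :+ (con (+ 2) :* (q₂ :* (p :* B)) :+ (con (- + 4) :* (q₂ :* (q₂ :* (a :* a′))) :+ con (+ 4) :* (q₂ :* (q₂ :* (b :* b′)))))) R.refl
     (qp 2) (t₃ ✶ t₁) (t₁′ ✶ t₃′) (qp 4) ψ₂ r ψ₂′ r′)
  (≋-from lhs rhs Θ-identity₂))
  where
  t₃ = dil 3 (T₅ (+ 3))
  t₁ = dil 13 (T₅ 1ℤ)
  t₁′ = dil 3 (T₅ 1ℤ)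
  t₃′ = dil 13 (T₅ (+ 3))
  ψ₂ = dil 3 (dil 2 psi)
  ψ₂′ = dil 13 (dil 2 psi)
  r = sh 3 (dil 3 (dil 10 psi))
  r′ = sh 13 (dil 13 (dil 10 psi))
  lhs : two ✶ (qp 2 ✶ (t₃ ✶ t₁)) ⊕ (two ✶ (qp 2 ✶ (qp 4 ✶ (t₁′ ✶ t₃′))) ⊕ (sc (- + 4) one ✶ (qp 2 ✶ (qp 2 ✶ (ψ₂ ✶ ψ₂′))) ⊕ sc (+ 4) one ✶ (qp 2 ✶ (qp 2 ✶ (r ✶ r′))))) ≋ ⟦ lhs₂ ⟧₂
  lhs = R.trans (sc≋ (+ 2) _) (scθ (+ 2) (R.trans (sh-one 2 t₃ t₁) (shθ 2 (dilθ 3 (tθ (+ 3))) ✶θ dilθ 13 (tθ 1ℤ))))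
    ⊕θ (R.trans (sc≋ (+ 2) _) (scθ (+ 2) (R.trans (sh-merge 2 4 t₁′ t₃′) (shθ 6 (dilθ 3 (tθ 1ℤ)) ✶θ dilθ 13 (tθ (+ 3)))))
    ⊕θ (R.trans (sc≋ (- + 4) _) (scθ (- + 4) (R.trans (sh-merge 2 2 ψ₂ ψ₂′) (shθ 4 (dilθ 3 ψ₂θ) ✶θ dilθ 13 ψ₂θ)))
    ⊕θ R.trans (sc≋ (+ 4) _) (scθ (+ 4) (R.trans (sh-merge 2 2 r r′) (R.trans (✶-cong (sh-sh 4 3 (dil 3 (dil 10 psi))) R.refl) (shθ 7 (dilθ 3 ψ₁₀θ) ✶θ shθ 13 (dilθ 13 ψ₁₀θ)))))))
  rhs : X₂ ≋ ⟦ rhs₂ ⟧₂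
  rhs = ⊖θ (⊖θ (formθ 3 0 13 ⊕θ formθ 2 1 5) (formθ 3 3 4)) (formθ 5 2 8)

identity₃ₐ : two ✶ (D₁.e₂ ✶ D₃₉.e₂ ✶ U₁ ✶ V₁) ≋ theta 1 0 39 ⊕ theta 5 2 8
identity₃ₐ = begin
  two ✶ (D₁.e₂ ✶ D₃₉.e₂ ✶ U₁ ✶ V₁)
    ≈⟨ ✶-cong R.refl (R.trans (expand⊕ (D₁.e₂ ✶ D₃₉.e₂) (D₁.g ✶ D₃₉.g) (qp 8 ✶ (D₁.h ✶ D₃₉.h)) (D₁.g₄ ✶ D₃₉.g₄) (qp 32 ✶ (D₁.h₄ ✶ D₃₉.h₄)))
         (R.+-cong (R.+-cong
           (pair₀₀ D₁.e₂ D₃₉.e₂ D₁.g D₃₉.g D₁.g₄ D₃₉.g₄)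
           -- q⁴⁰ is factored as q · q³⁹, so that the sum becomes half of (X + qY)(X′ + q³⁹Y′) + (X
           -- - qY)(X′ - q³⁹Y′).
           (R.trans (pair₁₁ D₁.e₂ D₃₉.e₂ (qp 8) (qp 32) D₁.h D₃₉.h D₁.h₄ D₃₉.h₄) (✶-cong (R.trans (R.sym (qp-+ 8 32)) (qp-+ 1 39)) R.refl)))
           (R.+-cong
           (R.trans (pair₀₁ D₁.e₂ D₃₉.e₂ (qp 32) D₁.g D₃₉.g D₁.h₄ D₃₉.h₄) (✶-cong R.refl (✶-cong (R.trans D₁.gh₄ (dil-1 (T₅ (+ 4)))) D₃₉.gh₄)))
           (R.trans (pair₁₀ D₁.e₂ D₃₉.e₂ (qp 8) D₁.h D₃₉.h D₁.g₄ D₃₉.g₄) (✶-cong R.refl (✶-cong (R.trans D₁.hg₄ (dil-1 (T₅ (+ 2)))) D₃₉.hg₄)))))) ⟩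
  two ✶ (X ✶ X′ ⊕ qp 1 ✶ qp 39 ✶ (Y ✶ Y′) ⊕ (R₁ ⊕ R₂))
    ≈⟨ solve 8 (λ x y q x′ y′ q′ r s → con (+ 2) :* (x :* x′ :+ q :* q′ :* (y :* y′) :+ (r :+ s))
         := (x :+ q :* y) :* (x′ :+ q′ :* y′) :+ ((x :- q :* y) :* (x′ :- q′ :* y′) :+ (con (+ 2) :* r :+ con (+ 2) :* s))) R.refl X Y (qp 1) X′ Y′ (qp 39) R₁ R₂ ⟩
  (X ⊕ qp 1 ✶ Y) ✶ (X′ ⊕ qp 39 ✶ Y′) ⊕ ((X ⊖ qp 1 ✶ Y) ✶ (X′ ⊖ qp 39 ✶ Y′) ⊕ (two ✶ R₁ ⊕ two ✶ R₂))
    ≈⟨ R.+-cong (✶-cong (R.trans D₁.sum₄ (dil-1 phi)) D₃₉.sum₄) (R.+-cong (✶-cong (R.trans D₁.diff₄ (dil-1 (dil 5 phi))) D₃₉.diff₄) R.refl) ⟩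
  phi ✶ dil 39 phi ⊕ (dil 5 phi ✶ dil 39 (dil 5 phi) ⊕ (two ✶ R₁ ⊕ two ✶ R₂))
    ≈⟨ ≋-from lhs (formθ 1 0 39 ⊕θ formθ 5 2 8) Θ-identity₃ₐ ⟩
  theta 1 0 39 ⊕ theta 5 2 8 ∎
  where
  open ≋-Reasoning
  X = D₁.e₂ ✶ (D₁.g ✶ D₁.g₄)
  Y = D₁.e₂ ✶ (D₁.h ✶ D₁.h₄)
  X′ = D₃₉.e₂ ✶ (D₃₉.g ✶ D₃₉.g₄)
  Y′ = D₃₉.e₂ ✶ (D₃₉.h ✶ D₃₉.h₄)
  R₁ = qp 32 ✶ (T₅ (+ 4) ✶ dil 39 (T₅ (+ 4)))
  R₂ = qp 8 ✶ (T₅ (+ 2) ✶ dil 39 (T₅ (+ 2)))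
  lhs : phi ✶ dil 39 phi ⊕ (dil 5 phi ✶ dil 39 (dil 5 phi) ⊕ (two ✶ R₁ ⊕ two ✶ R₂)) ≋ ⟦ lhs₃ₐ ⟧₂
  lhs = phi≋ ✶θ dilθ 39 phi≋ ⊕θ (dilθ 5 phi≋ ✶θ dilθ 39 (dilθ 5 phi≋)
    ⊕θ (R.trans (sc≋ (+ 2) R₁) (scθ (+ 2) (R.trans (sh-one 32 (T₅ (+ 4)) (dil 39 (T₅ (+ 4)))) (shθ 32 (tθ (+ 4)) ✶θ dilθ 39 (tθ (+ 4)))))
    ⊕θ R.trans (sc≋ (+ 2) R₂) (scθ (+ 2) (R.trans (sh-one 8 (T₅ (+ 2)) (dil 39 (T₅ (+ 2)))) (shθ 8 (tθ (+ 2)) ✶θ dilθ 39 (tθ (+ 2)))))))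

-- The factor q³ completes YX′ + q¹⁰XY′ to q³YX′ + q¹³XY′, half the difference of (X + q³Y)(X′ +
-- q¹³Y′) and (X - q³Y)(X′ - q¹³Y′). It is the q³ of the quotient of theta series.
identity₃ᵦ : two ✶ (qp 3 ✶ (D₃.e₂ ✶ D₁₃.e₂ ✶ U₃ ✶ V₃)) ≋ theta 3 0 13 ⊖ theta 5 2 8
identity₃ᵦ = begin
  two ✶ (qp 3 ✶ (D₃.e₂ ✶ D₁₃.e₂ ✶ U₃ ✶ V₃))
    ≈⟨ ✶-cong R.refl (✶-cong R.refl (R.trans (expand⊖ (D₃.e₂ ✶ D₁₃.e₂) (D₃.h ✶ D₁₃.g) (qp 2 ✶ (D₃.g ✶ D₁₃.h)) (D₃.h₄ ✶ D₁₃.g₄) (qp 8 ✶ (D₃.g₄ ✶ D₁₃.h₄)))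
         (⊖-cong (R.+-cong
           (pair₀₀ D₃.e₂ D₁₃.e₂ D₃.h D₁₃.g D₃.h₄ D₁₃.g₄)
           (R.trans (pair₁₁ D₃.e₂ D₁₃.e₂ (qp 2) (qp 8) D₃.g D₁₃.h D₃.g₄ D₁₃.h₄) (✶-cong (R.sym (qp-+ 2 8)) R.refl)))
           (R.+-cong
           (R.trans (pair₀₁ D₃.e₂ D₁₃.e₂ (qp 8) D₃.h D₁₃.g D₃.g₄ D₁₃.h₄) (✶-cong R.refl (✶-cong D₃.hg₄ D₁₃.gh₄)))
           (R.trans (pair₁₀ D₃.e₂ D₁₃.e₂ (qp 2) D₃.g D₁₃.h D₃.h₄ D₁₃.g₄) (✶-cong R.refl (✶-cong D₃.gh₄ D₁₃.hg₄))))))) ⟩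
  two ✶ (qp 3 ✶ (Y ✶ X′ ⊕ qp 10 ✶ (X ✶ Y′) ⊖ (qp 8 ✶ (t₂ ✶ t₄′) ⊕ qp 2 ✶ (t₄ ✶ t₂′))))
    ≈⟨ solve 9 (λ x y x′ y′ q₃ q₁₀ q₈ q₂ r → con (+ 2) :* (q₃ :* (y :* x′ :+ q₁₀ :* (x :* y′) :- r)) := con (+ 2) :* (x′ :* (q₃ :* y) :+ (q₃ :* q₁₀) :* (x :* y′)) :- con (+ 2) :* (q₃ :* r)) R.refl
         X Y X′ Y′ (qp 3) (qp 10) (qp 8) (qp 2) (qp 8 ✶ (t₂ ✶ t₄′) ⊕ qp 2 ✶ (t₄ ✶ t₂′)) ⟩
  two ✶ (X′ ✶ (qp 3 ✶ Y) ⊕ qp 3 ✶ qp 10 ✶ (X ✶ Y′)) ⊖ two ✶ (qp 3 ✶ (qp 8 ✶ (t₂ ✶ t₄′) ⊕ qp 2 ✶ (t₄ ✶ t₂′)))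
    ≈⟨ ⊖-cong (✶-cong R.refl (R.+-congˡ {X′ ✶ (qp 3 ✶ Y)} (✶-cong (R.sym (qp-+ 3 10)) R.refl))) R.refl ⟩
  two ✶ (X′ ✶ (qp 3 ✶ Y) ⊕ qp 13 ✶ (X ✶ Y′)) ⊖ two ✶ (qp 3 ✶ (qp 8 ✶ (t₂ ✶ t₄′) ⊕ qp 2 ✶ (t₄ ✶ t₂′)))
    ≈⟨ solve 10 (λ x y q x′ y′ q′ q₈ a q₂ b → con (+ 2) :* (x′ :* (q :* y) :+ q′ :* (x :* y′)) :- con (+ 2) :* (q :* (q₈ :* a :+ q₂ :* b))
         := (x :+ q :* y) :* (x′ :+ q′ :* y′) :+ (con -1ℤ :* ((x :- q :* y) :* (x′ :- q′ :* y′)) :+ (con (- + 2) :* (q :* (q₂ :* b)) :+ con (- + 2) :* (q :* (q₈ :* a))))) R.refl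
         X Y (qp 3) X′ Y′ (qp 13) (qp 8) (t₂ ✶ t₄′) (qp 2) (t₄ ✶ t₂′) ⟩
  (X ⊕ qp 3 ✶ Y) ✶ (X′ ⊕ qp 13 ✶ Y′) ⊕ (sc -1ℤ one ✶ ((X ⊖ qp 3 ✶ Y) ✶ (X′ ⊖ qp 13 ✶ Y′)) ⊕ (S₁ ⊕ S₂))
    ≈⟨ R.+-cong (✶-cong D₃.sum₄ D₁₃.sum₄) (R.+-cong (✶-cong R.refl (✶-cong D₃.diff₄ D₁₃.diff₄)) R.refl) ⟩
  dil 3 phi ✶ dil 13 phi ⊕ (sc -1ℤ one ✶ (dil 3 (dil 5 phi) ✶ dil 13 (dil 5 phi)) ⊕ (S₁ ⊕ S₂))
    ≈⟨ ≋-from lhs (⊖θ (formθ 3 0 13) (formθ 5 2 8)) Θ-identity₃ᵦ ⟩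
  theta 3 0 13 ⊖ theta 5 2 8 ∎
  where
  open ≋-Reasoning
  X = D₃.e₂ ✶ (D₃.g ✶ D₃.g₄)
  Y = D₃.e₂ ✶ (D₃.h ✶ D₃.h₄)
  X′ = D₁₃.e₂ ✶ (D₁₃.g ✶ D₁₃.g₄)
  Y′ = D₁₃.e₂ ✶ (D₁₃.h ✶ D₁₃.h₄)
  t₂ = dil 3 (T₅ (+ 2))
  t₄ = dil 3 (T₅ (+ 4))
  t₂′ = dil 13 (T₅ (+ 2))
  t₄′ = dil 13 (T₅ (+ 4))
  S₁ = sc (- + 2) one ✶ (qp 3 ✶ (qp 2 ✶ (t₄ ✶ t₂′)))
  S₂ = sc (- + 2) one ✶ (qp 3 ✶ (qp 8 ✶ (t₂ ✶ t₄′)))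
  lhs : dil 3 phi ✶ dil 13 phi ⊕ (sc -1ℤ one ✶ (dil 3 (dil 5 phi) ✶ dil 13 (dil 5 phi)) ⊕ (S₁ ⊕ S₂)) ≋ ⟦ lhs₃ᵦ ⟧₂
  lhs = dilθ 3 phi≋ ✶θ dilθ 13 phi≋ ⊕θ (R.trans (sc≋ -1ℤ _) (scθ -1ℤ (dilθ 3 (dilθ 5 phi≋) ✶θ dilθ 13 (dilθ 5 phi≋)))
    ⊕θ (R.trans (sc≋ (- + 2) _) (scθ (- + 2) (R.trans (sh-merge 3 2 t₄ t₂′) (shθ 5 (dilθ 3 (tθ (+ 4))) ✶θ dilθ 13 (tθ (+ 2)))))
    ⊕θ R.trans (sc≋ (- + 2) _) (scθ (- + 2) (R.trans (sh-merge 3 8 t₂ t₄′) (shθ 11 (dilθ 3 (tθ (+ 2))) ✶θ dilθ 13 (tθ (+ 4)))))))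

-- Each ψ(-q^k) completes E(q^(2k)) to E(q^k)E(q^(4k)), the factors that `EU` and its dilation by 4
-- exchange.
identity₃ : (theta 3 0 13 ⊖ theta 5 2 8) ✶ (dil 3 ψ⁻ ✶ dil 13 ψ⁻) ≋ qp 3 ✶ (dil 1 ψ⁻ ✶ dil 39 ψ⁻) ✶ (theta 1 0 39 ⊕ theta 5 2 8)
identity₃ = begin
  (theta 3 0 13 ⊖ theta 5 2 8) ✶ (dil 3 ψ⁻ ✶ dil 13 ψ⁻)
    ≈⟨ ✶-cong (R.sym identity₃ᵦ) R.refl ⟩
  two ✶ (qp 3 ✶ (D₃.e₂ ✶ D₁₃.e₂ ✶ U₃ ✶ V₃)) ✶ (dil 3 ψ⁻ ✶ dil 13 ψ⁻)
    ≈⟨ ×-solve 8 (λ t q e f u v p r → t · (q · (e · f · u · v)) · (p · r) :≈ t · q · ((e · p) · (f · r) · (u · v))) R.refl two (qp 3) D₃.e₂ D₁₃.e₂ U₃ V₃ (dil 3 ψ⁻) (dil 13 ψ⁻) ⟩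
  two ✶ qp 3 ✶ ((D₃.e₂ ✶ dil 3 ψ⁻) ✶ (D₁₃.e₂ ✶ dil 13 ψ⁻) ✶ (U₃ ✶ V₃))
    ≈⟨ ✶-cong R.refl (✶-cong (R.sym (✶-cong D₃.ee₄ D₁₃.ee₄)) R.refl) ⟩
  two ✶ qp 3 ✶ ((D₃.e₁ ✶ D₃.e₄) ✶ (D₁₃.e₁ ✶ D₁₃.e₄) ✶ (U₃ ✶ V₃))
    ≈⟨ ✶-cong R.refl (regroup D₃.e₁ D₃.e₄ D₁₃.e₁ D₁₃.e₄ U₃ V₃) ⟩
  two ✶ qp 3 ✶ ((D₃.e₁ ✶ D₁₃.e₁ ✶ U₃) ✶ (D₃.e₄ ✶ D₁₃.e₄ ✶ V₃))
    ≈⟨ ✶-cong R.refl (✶-cong (R.sym EU) (R.sym dil4-EU)) ⟩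
  two ✶ qp 3 ✶ ((D₁.e₁ ✶ D₃₉.e₁ ✶ U₁) ✶ (D₁.e₄ ✶ D₃₉.e₄ ✶ V₁))
    ≈⟨ ✶-cong R.refl (R.trans (R.sym (regroup D₁.e₁ D₁.e₄ D₃₉.e₁ D₃₉.e₄ U₁ V₁)) (✶-cong (✶-cong D₁.ee₄ D₃₉.ee₄) R.refl)) ⟩
  two ✶ qp 3 ✶ ((D₁.e₂ ✶ dil 1 ψ⁻) ✶ (D₃₉.e₂ ✶ dil 39 ψ⁻) ✶ (U₁ ✶ V₁))
    ≈⟨ ×-solve 8 (λ t q e f u v p r → t · q · ((e · p) · (f · r) · (u · v)) :≈ q · (p · r) · (t · (e · f · u · v))) R.refl two (qp 3) D₁.e₂ D₃₉.e₂ U₁ V₁ (dil 1 ψ⁻) (dil 39 ψ⁻) ⟩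
  qp 3 ✶ (dil 1 ψ⁻ ✶ dil 39 ψ⁻) ✶ (two ✶ (D₁.e₂ ✶ D₃₉.e₂ ✶ U₁ ✶ V₁))
    ≈⟨ ✶-cong R.refl identity₃ₐ ⟩
  qp 3 ✶ (dil 1 ψ⁻ ✶ dil 39 ψ⁻) ✶ (theta 1 0 39 ⊕ theta 5 2 8) ∎
  where
  open ≋-Reasoning
  regroup : ∀ a b c d u v → (a ✶ b) ✶ (c ✶ d) ✶ (u ✶ v) ≋ (a ✶ c ✶ u) ✶ (b ✶ d ✶ v)
  regroup = ×-solve 6 (λ a b c d u v → (a · b) · (c · d) · (u · v) :≈ (a · c · u) · (b · d · v)) R.refl

-- Likewise φ(-q^(2k)) completes E(q^(2k)) to E(q^k)E((-q)^k), the factors exchanged by `EU` at q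
-- and at -q.
identity₄ : X₁ ✶ (dil 2 (negq phi) ✶ dil 78 (negq phi)) ≋ X₂ ✶ (dil 6 (negq phi) ✶ dil 26 (negq phi))
identity₄ = begin
  X₁ ✶ (dil 2 (negq phi) ✶ dil 78 (negq phi))
    ≈⟨ ✶-cong (R.sym identity₁) R.refl ⟩
  two ✶ (qp 2 ✶ (D₁.e₂ ✶ D₃₉.e₂ ✶ U₁ ✶ Ū₁)) ✶ (dil 2 (negq phi) ✶ dil 78 (negq phi))
    ≈⟨ absorb (dil 2 (negq phi)) (dil 78 (negq phi)) D₁.eē D₃₉.eē ⟩
  two ✶ qp 2 ✶ ((D₁.e₁ ✶ D₃₉.e₁ ✶ U₁) ✶ (D₁.ē₁ ✶ D₃₉.ē₁ ✶ Ū₁))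
    ≈⟨ ✶-cong R.refl (✶-cong EU negq-EU) ⟩
  two ✶ qp 2 ✶ ((D₃.e₁ ✶ D₁₃.e₁ ✶ U₃) ✶ (D₃.ē₁ ✶ D₁₃.ē₁ ✶ Ū₃))
    ≈⟨ R.sym (absorb (dil 6 (negq phi)) (dil 26 (negq phi)) D₃.eē D₁₃.eē) ⟩
  two ✶ (qp 2 ✶ (D₃.e₂ ✶ D₁₃.e₂ ✶ U₃ ✶ Ū₃)) ✶ (dil 6 (negq phi) ✶ dil 26 (negq phi))
    ≈⟨ ✶-cong identity₂ R.refl ⟩
  X₂ ✶ (dil 6 (negq phi) ✶ dil 26 (negq phi)) ∎
  where
  open ≋-Reasoning
  absorb : ∀ {e f u v a a′ b b′} p r → a ✶ a′ ≋ e ✶ p → b ✶ b′ ≋ f ✶ r →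
    two ✶ (qp 2 ✶ (e ✶ f ✶ u ✶ v)) ✶ (p ✶ r) ≋ two ✶ qp 2 ✶ ((a ✶ b ✶ u) ✶ (a′ ✶ b′ ✶ v))
  absorb {e} {f} {u} {v} {a} {a′} {b} {b′} p r x y = R.trans
    (×-solve 8 (λ t q e f u v p r → t · (q · (e · f · u · v)) · (p · r) :≈ t · q · ((e · p) · (f · r) · (u · v))) R.refl two (qp 2) e f u v p r)
    (✶-cong R.refl (R.trans (✶-cong (R.sym (✶-cong x y)) R.refl)
      (×-solve 6 (λ a b c d u v → (a · b) · (c · d) · (u · v) :≈ (a · c · u) · (b · d · v)) R.refl a a′ b b′ u v)))

-- Return to the convolution product of the statement

⊛-to : ∀ {f f′ g g′} → f ≋ f′ → g ≋ g′ → f ⊛ g ≋ f′ ✶ g′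
⊛-to {f} {f′} {g} e e′ = R.trans (⊛≋✶ f g) (✶-cong e e′)

U1-39≋U₁ : U1-39 ≋ U₁
U1-39≋U₁ = R.+-cong (⊛-to (R.sym (dil-1 G)) R.refl) (R.trans (sh-cong 8 (⊛-to (R.sym (dil-1 H)) R.refl)) (sh-qp 8 (D₁.h ✶ D₃₉.h)))

U3-13≋U₃ : U3-13 ≋ U₃
U3-13≋U₃ = ⊖-cong (⊛≋✶ D₃.h D₁₃.g) (R.trans (sh-cong 2 (⊛≋✶ D₃.g D₁₃.h)) (sh-qp 2 (D₃.g ✶ D₁₃.h)))

sc-sh : ∀ k {f f′} → f ≋ f′ → sc (+ 2) (sh k f) ≋ two ✶ (qp k ✶ f′)
sc-sh k {f} {f′} e = R.trans (sc-cong (+ 2) (R.trans (sh-cong k e) (sh-qp k f′))) (R.sym (sc≋ (+ 2) (qp k ✶ f′)))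

theorem4p1 : (∀ n → sc (+ 2) (sh 2 (dil 2 E ⊛ dil 78 E ⊛ U1-39 ⊛ negq U1-39)) n
    ≡ (theta 1 1 10 ⊕ theta 2 1 5 ⊖ theta 1 0 39 ⊖ theta 5 2 8) n)
    × (∀ n → sc (+ 2) (sh 2 (dil 6 E ⊛ dil 26 E ⊛ U3-13 ⊛ negq U3-13)) n
    ≡ (theta 3 0 13 ⊕ theta 2 1 5 ⊖ theta 3 3 4 ⊖ theta 5 2 8) n)
    × (∀ n → ((theta 3 0 13 ⊖ theta 5 2 8) ⊛ (dil 3 (negq psi) ⊛ dil 13 (negq psi))) n
    ≡ (sh 3 (negq psi ⊛ dil 39 (negq psi)) ⊛ (theta 1 0 39 ⊕ theta 5 2 8)) n)
    × (∀ n → ((theta 1 1 10 ⊕ theta 2 1 5 ⊖ theta 1 0 39 ⊖ theta 5 2 8)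
    ⊛ (dil 2 (negq phi) ⊛ dil 78 (negq phi))) n
    ≡ ((theta 3 0 13 ⊕ theta 2 1 5 ⊖ theta 3 3 4 ⊖ theta 5 2 8)
    ⊛ (dil 6 (negq phi) ⊛ dil 26 (negq phi))) n)
theorem4p1
  = at (R.trans (sc-sh 2 (⊛-to (⊛-to (⊛≋✶ (dil 2 E) (dil 78 E)) U1-39≋U₁) (R.trans (negq-cong U1-39≋U₁) negq-U₁))) identity₁)
  , at (R.trans (sc-sh 2 (⊛-to (⊛-to (⊛≋✶ (dil 6 E) (dil 26 E)) U3-13≋U₃) (R.trans (negq-cong U3-13≋U₃) negq-U₃))) identity₂)
  , at (R.trans (⊛-to R.refl (⊛≋✶ (dil 3 ψ⁻) (dil 13 ψ⁻))) (R.trans identity₃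
      (R.sym (⊛-to (R.trans (sh-cong 3 (⊛-to (R.sym (dil-1 ψ⁻)) R.refl)) (sh-qp 3 (dil 1 ψ⁻ ✶ dil 39 ψ⁻))) R.refl))))
  , at (R.trans (⊛-to R.refl (⊛≋✶ (dil 2 (negq phi)) (dil 78 (negq phi)))) (R.trans identity₄
      (R.sym (⊛-to R.refl (⊛≋✶ (dil 6 (negq phi)) (dil 26 (negq phi)))))))
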